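{- There is a (randomized) polynomial time algorithm that, given any feasible instance of the routing on short paths problem (a directed graph $G=(V,E)$ with $n=|V|$, edge capacities $b:E\to\mathbb{Z}_+$, source-sink pairs $\{(s_i,t_i)\}_{i=1}^k$ and a length bound $\Delta$), computes an $s_i$-$t_i$ path of length at most $\Delta$ for each $i\in\{1,\ldots,k\}$ such that for every edge $e\in E$ the number of these paths using $e$ is at most $$b_e+\min\left\{O(\sqrt{\Delta}\,\log n),\ O(\sqrt{b_e}\,\log n+\log^2 n)\right\}.$$
   Context: The routing on short paths problem: given $G$, $b$, $\{(s_i,t_i)\}_{i=1}^k$ and $\Delta$ as in the claim, find for each $i\in\{1,\ldots,k\}$ an $s_i$-$t_i$ path $P_i$ of length (number of edges) at most $\Delta$ such that the number of chosen paths using any edge $e$ is at most $b_e$. An instance is feasible if such paths exist. It is assumed that $k+|E|$ is bounded by a polynomial in $n$; the constants in $O(\cdot)$ do not otherwise depend on the instance. -}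

module Defs where

open import Data.Bool.Base using (Bool; true; false; if_then_else_)
open import Data.Fin.Base using (Fin; zero; suc; toℕ)
open import Data.Fin.Properties using (_≟_)
open import Data.List.Base
  using (List; []; _∷_; map; length; filter; foldr; allFin)
import Data.List.Membership.DecPropositional as DecMembership
open import Data.List.Relation.Unary.All using (All)
open import Data.List.Relation.Unary.Unique.Propositional using (Unique)
open import Data.Nat.Base using (ℕ; zero; suc; _+_; _*_; _^_; _⊓_; _≤_; _≤ᵇ_)
import Data.Nat.Binary.Base as Bin
open import Data.Nat.Binary.Base using (ℕᵇ; 2[1+_]; 1+[2_])
open import Data.Nat.Logarithm using (⌊log₂_⌋)
open import Data.Product.Base using (Σ-syntax; ∃-syntax; _×_; _,_)
open import Data.Vec.Base using (Vec; _∷_; lookup; replicate; _[_]≔_; toList)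
open import Relation.Binary.PropositionalEquality.Core using (_≡_)

------------------------------------------------------------------------
-- Arithmetic

-- Every polynomial in n with natural coefficients is at most poly c d n for
-- some c and d.
poly : ℕ → ℕ → ℕ → ℕ
poly c d n = c * n ^ d + c

⌊√_⌋ : ℕ → ℕ
⌊√ zero ⌋  = 0
⌊√ suc n ⌋ =
  if suc ⌊√ n ⌋ * suc ⌊√ n ⌋ ≤ᵇ suc n then suc ⌊√ n ⌋ else ⌊√ n ⌋

------------------------------------------------------------------------
-- Routing on short paths

-- Edges are indexed, so parallel edges are allowed.
record Digraph : Set where
  field
    n m       : ℕ
    tail head : Fin m → Fin n

  V E : Set
  V = Fin n
  E = Fin m

  data Walk : V → List E → V → Set where
    []  : ∀ {u} → Walk u [] u
    _∷_ : ∀ e {es v} → Walk (head e) es v → Walk (tail e) (e ∷ es) v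

  IsPath : V → List E → V → Set
  IsPath u es v = Walk u es v × Unique (u ∷ map head es)

record Instance : Set where
  field
    graph : Digraph
  open Digraph graph public
  field
    b   : E → ℕ
    k   : ℕ
    s t : Fin k → V
    Δ   : ℕ

  Routing : Set
  Routing = Fin k → List E

  IsShortRouting : Routing → Set
  IsShortRouting P = ∀ i → IsPath (s i) (P i) (t i) × length (P i) ≤ Δ

  open DecMembership (_≟_ {m}) using (_∈?_)

  load : Routing → E → ℕ
  load P e = length (filter (λ i → e ∈? P i) (allFin k))

  Feasible : Set
  Feasible = ∃[ P ] IsShortRouting P × (∀ e → load P e ≤ b e)

  -- The square roots and logarithms are rounded down, and √ Δ, √ b and log₂ n
  -- (for n ≥ 2) are at most twice their floors, so only C₁ and C₂ are affected.
  -- For n ≤ 1 every path is trivial.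
  excess : ℕ → ℕ → E → ℕ
  excess C₁ C₂ e =
      (C₁ * (⌊√ Δ ⌋ * ⌊log₂ n ⌋))
    ⊓ (C₂ * (⌊√ b e ⌋ * ⌊log₂ n ⌋ + ⌊log₂ n ⌋ ^ 2))

------------------------------------------------------------------------
-- Randomized programs

data Tree : Set where
  leaf : Tree
  node : Tree → Tree → Tree

size : Tree → ℕ
size leaf       = 1
size (node x y) = suc (size x + size y)

left right : Tree → Tree
left leaf        = leaf
left (node x _)  = x
right leaf       = leaf
right (node _ y) = y

-- The WHILE language of N. D. Jones ("Computability and Complexity from a
-- Programming Perspective"), with an instruction for tossing a fair coin.
data Expr (r : ℕ) : Set where
  nil       : Expr r
  var       : Fin r → Expr r
  cons      : Expr r → Expr r → Expr r
  hd tl     : Expr r → Expr r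

data Cmd (r : ℕ) : Set where
  skip         : Cmd r
  _:=_         : Fin r → Expr r → Cmd r
  toss         : Fin r → Cmd r
  _⨾_          : Cmd r → Cmd r → Cmd r
  ifte         : Expr r → Cmd r → Cmd r → Cmd r
  while        : Expr r → Cmd r → Cmd r

Store : ℕ → Set
Store r = Vec Tree r

eval : ∀ {r} → Store r → Expr r → Tree
eval σ nil        = leaf
eval σ (var x)    = lookup σ x
eval σ (cons e f) = node (eval σ e) (eval σ f)
eval σ (hd e)     = left (eval σ e)
eval σ (tl e)     = right (eval σ e)

fromBool : Bool → Tree
fromBool false = leaf
fromBool true  = node leaf leaf

Coins : Set
Coins = List Bool

-- Exec c (σ , ω) T (σ′ , ω′): started in store σ with upcoming coin tosses ω,
-- c halts after T steps in store σ′, with the tosses ω′ not yet made.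
--
-- Evaluating an expression counts as one step.  Storing trees as shared
-- pointers to immutable cells, each step of a fixed program allocates and
-- follows a bounded number of pointers, so this cost is polynomially related
-- to the running time of a probabilistic Turing machine.
data Exec {r} : Cmd r → Store r × Coins → ℕ → Store r × Coins → Set where
  skip  : ∀ {σ ω} → Exec skip (σ , ω) 1 (σ , ω)
  set   : ∀ {x e σ ω} → Exec (x := e) (σ , ω) 1 (σ [ x ]≔ eval σ e , ω)
  toss  : ∀ {x σ β ω} →
          Exec (toss x) (σ , β ∷ ω) 1 (σ [ x ]≔ fromBool β , ω)
  seq   : ∀ {c d ρ ρ′ ρ″ T U} →
          Exec c ρ T ρ′ → Exec d ρ′ U ρ″ → Exec (c ⨾ d) ρ (T + U) ρ″
  then  : ∀ {e c d σ ω ρ x y T} → eval σ e ≡ node x y →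
          Exec c (σ , ω) T ρ → Exec (ifte e c d) (σ , ω) (suc T) ρ
  else  : ∀ {e c d σ ω ρ T} → eval σ e ≡ leaf →
          Exec d (σ , ω) T ρ → Exec (ifte e c d) (σ , ω) (suc T) ρ
  loop  : ∀ {e c σ ω ρ ρ′ x y T U} → eval σ e ≡ node x y →
          Exec c (σ , ω) T ρ → Exec (while e c) ρ U ρ′ →
          Exec (while e c) (σ , ω) (suc (T + U)) ρ′
  done  : ∀ {e c σ ω} → eval σ e ≡ leaf →
          Exec (while e c) (σ , ω) 1 (σ , ω)

-- Variable zero holds the input at the start and the output at the end.
record Program : Set where
  field
    extra : ℕ
    body  : Cmd (suc extra)

  Outputs : Tree → Coins → ℕ → Tree → Set
  Outputs x ω B y =
    ∃[ T ] T ≤ B ×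
    (Σ[ σ ∈ Store extra ] Σ[ ω′ ∈ Coins ]
      Exec body (x ∷ replicate extra leaf , ω) T (y ∷ σ , ω′))

open Program public using (Outputs)

-- At most one coin is tossed per step, so a tape of B coins never runs out
-- within B steps.
RunsInTime : Program → (ℕ → ℕ) → Set
RunsInTime A f =
  ∀ (x : Tree) (ω : Vec Bool (f (size x))) →
  ∃[ y ] Outputs A x (toList ω) (f (size x)) y

-- Q holds with probability at least 1/2 over B independent fair coins.
AtLeastHalf : (B : ℕ) → (Vec Bool B → Set) → Set
AtLeastHalf B Q =
  Σ[ ωs ∈ List (Vec Bool B) ] Unique ωs × All Q ωs × 2 ^ B ≤ 2 * length ωs

------------------------------------------------------------------------
-- Encodings of instances and routings

encodeList : List Tree → Tree
encodeList = foldr node leaf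

encodeℕᵇ : ℕᵇ → Tree
encodeℕᵇ Bin.zero = leaf
encodeℕᵇ 2[1+ x ] = node leaf (encodeℕᵇ x)
encodeℕᵇ 1+[2 x ] = node (node leaf leaf) (encodeℕᵇ x)

encodeℕ : ℕ → Tree
encodeℕ x = encodeℕᵇ (Bin.fromℕ x)

encodeFin : ∀ {j} → Fin j → Tree
encodeFin i = encodeℕ (toℕ i)

tabulateTree : ∀ {j} → (Fin j → Tree) → Tree
tabulateTree {j} f = encodeList (map f (allFin j))

-- All numbers are in binary, but the vertices are listed, so the size of the
-- encoding is at least n.
encodeInstance : Instance → Tree
encodeInstance I = encodeList
  ( tabulateTree {n} encodeFin
  ∷ tabulateTree (λ e → encodeList
      (encodeFin (tail e) ∷ encodeFin (head e) ∷ encodeℕ (b e) ∷ []))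
  ∷ tabulateTree (λ i → encodeList (encodeFin (s i) ∷ encodeFin (t i) ∷ []))
  ∷ encodeℕ Δ
  ∷ [])
  where open Instance I

encodeRouting : (I : Instance) → Instance.Routing I → Tree
encodeRouting I P = tabulateTree (λ i → encodeList (map encodeFin (P i)))

------------------------------------------------------------------------
-- Correctness of an output

module _ (I : Instance) where
  open Instance I

  IsGoodOutput : ℕ → ℕ → Tree → Set
  IsGoodOutput C₁ C₂ y =
    Σ[ P ∈ Routing ] y ≡ encodeRouting I P
      × IsShortRouting P
      × (∀ e → load P e ≤ b e + excess C₁ C₂ e)

{-# OPTIONS --safe #-}
-- The linear relaxation is solved by approachability.  In each of T rounds every
-- commodity takes a shortest path for the edge lengths D e + 1 among the paths
-- of at most Δ′ = Δ ⊓ n edges, where D e is the overload that e has accumulated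
-- over its capacity b′ e = b e ⊓ k.  Feasibility keeps the sum of the squares of
-- D growing linearly in T, so the T routings have an average load of at most
-- b′ e + 1.
--
-- The commodities are then rounded in turn by a self-balancing walk, as in the
-- vector balancing algorithm of Alweiss, Liu and Sawhney: draw two of the T
-- paths of a commodity and choose between them by a coin that is biased against
-- the present deviation on the edges with b′ e ≥ Δ′.  A linear test of the
-- deviation, pulled back along the walk, becomes a martingale; each pullback
-- loses as much energy as the test gains variance, so the total variance is
-- bounded by the initial energy.  With (N + x) ^ N in place of the exponential,
-- to stay within the rationals, a union bound over the edges and over the events
-- that a bias leaves [−1 , 1] shows that with probability at least 1/2 every
-- deviation is O(√(b′ e ⊓ Δ′) log n + log n), which is within both bounds.
module Submission where

open import Defs

-- Biased rounding is needed only on edges with b′ ≥ Δ′: independent choices already deviate by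
-- about the root of the fractional load, which suffices elsewhere. On the other edges a divisor `c`
-- of order Δ′ log n holds the deviation near √Δ′ log n. It is squeezed from both sides: a smaller
-- `c` lets the bias leave its range too often, a larger one weakens the pull towards zero.
--
-- The analysis runs backwards in time because the steps of the walk depend on its past. A test
-- pulled back through all later steps is a fixed vector, known before the first coin, so its total
-- variance is a number and not a random variable; no bound on the random path of the deviation is
-- required beyond a trivial one.
--
-- The relaxation is solved up to an additive one on each edge. The allowed excess absorbs this unit
-- whenever n ≥ 2 and Δ ≥ 1, and otherwise every path is empty.
--
-- The logarithm of the statement is that of n, whereas the union bound needs that of n + m + k; the
-- polynomial bound on k + m makes them proportional, which is how the constants come to depend on
-- `c` and `d` of the theorem.

-- A small clocked language and its compilation to randomized WHILE programs

module Machine where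

  open import Data.Fin.Base using (zero; suc)
  open import Data.List.Base using ([]; _∷_; _++_; map; length; take; reverse)
  open import Data.List.Properties using (unfold-reverse; ++-assoc; ++-identityʳ)
  open import Data.Nat.Base
  open import Data.Nat.Properties
  open import Data.Nat.Tactic.RingSolver using (solve-∀)
  open import Data.Product.Base using (Σ-syntax; ∃-syntax; _×_; _,_)
  open import Data.Vec.Base using ([]; _∷_; _[_]≔_)
  open import Relation.Binary.PropositionalEquality

  iter : ∀ {ℓ} {A : Set ℓ} → ℕ → (A → A) → A → A
  iter zero    f x = x
  iter (suc n) f x = iter n f (f x)

  unary : ℕ → Tree
  unary zero    = leaf
  unary (suc n) = node leaf (unary n)

  -- In an expression, variable zero is the argument and variable one a constant
  -- of the whole run.
  data Prog : Set where
    ex   : Expr 2 → Prog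
    _≫_  : Prog → Prog → Prog
    fork : Prog → Prog → Prog
    cond : Prog → Prog → Prog
    rep  : Prog → Prog

  infixr 5 _≫_

  branch : Tree → Tree → Tree → Tree
  branch leaf       x y = y
  branch (node _ _) x y = x

  ⟦_⟧ : Prog → ℕ → Tree → Tree → Tree
  ⟦ ex e ⟧     z g x = eval (x ∷ g ∷ []) e
  ⟦ p ≫ q ⟧    z g x = ⟦ q ⟧ z g (⟦ p ⟧ z g x)
  ⟦ fork p q ⟧ z g x = node (⟦ p ⟧ z g x) (⟦ q ⟧ z g x)
  ⟦ cond p q ⟧ z g x = branch (left x) (⟦ p ⟧ z g (right x)) (⟦ q ⟧ z g (right x))
  ⟦ rep p ⟧    z g x = iter z (⟦ p ⟧ z g) x

  -- Both branches of `cond` are charged, so the bound depends on the clock alone and not on the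
  -- data.
  time : Prog → ℕ → ℕ
  time (ex e)     z = 1
  time (p ≫ q)    z = time p z + time q z
  time (fork p q) z = 1 + (time p z + (3 + (time q z + 2)))
  time (cond p q) z = 2 + (time p z + time q z)
  time (rep p)    z = 1 + (suc (z * (2 + time p z)) + 1)

  -- The registers: `X` carries the argument and then the result, `G` the constant of the run, `S` a
  -- stack, `C` the clock in unary; `A` and `B` are scratch space for the setup.
  pattern X = zero
  pattern G = suc zero
  pattern S = suc (suc zero)
  pattern C = suc (suc (suc zero))
  pattern A = suc (suc (suc (suc zero)))
  pattern B = suc (suc (suc (suc (suc zero))))

  rename : Expr 2 → Expr 6
  rename nil              = nil
  rename (var zero)       = var X
  rename (var (suc zero)) = var G
  rename (cons e f)       = cons (rename e) (rename f)
  rename (hd e)           = hd (rename e)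
  rename (tl e)           = tl (rename e)

  eval-rename : ∀ e {x g s c a b} →
    eval (x ∷ g ∷ s ∷ c ∷ a ∷ b ∷ []) (rename e) ≡ eval (x ∷ g ∷ []) e
  eval-rename nil              = refl
  eval-rename (var zero)       = refl
  eval-rename (var (suc zero)) = refl
  eval-rename (cons e f)       = cong₂ node (eval-rename e) (eval-rename f)
  eval-rename (hd e)           = cong left (eval-rename e)
  eval-rename (tl e)           = cong right (eval-rename e)

  infixr 5 _▸_
  _▸_ : ∀ {r} → Cmd r → Cmd r → Cmd r
  _▸_ = _⨾_

  -- `fork` and `rep` save what they need on the stack `S` and leave it as they found it, so they
  -- nest freely; every loop counts down its own copy of the clock.
  compile : Prog → Cmd 6
  compile (ex e)     = X := rename e
  compile (p ≫ q)    = compile p ▸ compile q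
  compile (fork p q) =
    (S := cons (var X) (var S)) ▸ compile p ▸
    -- The first result goes below the saved argument, which is then popped back into `X`.
    (S := cons (hd (var S)) (cons (var X) (tl (var S)))) ▸
    (X := hd (var S)) ▸ (S := tl (var S)) ▸ compile q ▸
    (X := cons (hd (var S)) (var X)) ▸ (S := tl (var S))
  compile (cond p q) =
    ifte (hd (var X)) ((X := tl (var X)) ▸ compile p) ((X := tl (var X)) ▸ compile q)
  compile (rep p)    =
    (S := cons (var C) (var S)) ▸
    while (hd (var S)) ((S := cons (tl (hd (var S))) (tl (var S))) ▸ compile p) ▸
    (S := tl (var S))

  Runs : Cmd 6 → Store 6 × Coins → ℕ → Store 6 × Coins → Set
  Runs c ρ t ρ′ = Σ[ T ∈ ℕ ] T ≤ t × Exec c ρ T ρ′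

  infixr 4 _◅_
  _◅_ : ∀ {c d ρ ρ′ ρ″ t u} → Runs c ρ t ρ′ → Runs d ρ′ u ρ″ → Runs (c ⨾ d) ρ (t + u) ρ″
  (T , T≤ , p) ◅ (U , U≤ , q) = T + U , +-mono-≤ T≤ U≤ , seq p q

  assign : ∀ {x e σ ω} → Runs (x := e) (σ , ω) 1 (σ [ x ]≔ eval σ e , ω)
  assign = 1 , ≤-refl , set

  weaken : ∀ {c ρ ρ′ t u} → t ≤ u → Runs c ρ t ρ′ → Runs c ρ u ρ′
  weaken t≤u (T , T≤ , p) = T , ≤-trans T≤ t≤u , p

  retarget : ∀ {c ρ ρ′ ρ″ t u} → ρ′ ≡ ρ″ → t ≡ u → Runs c ρ t ρ′ → Runs c ρ u ρ″
  retarget refl refl r = r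

  again : ∀ {e c σ ω ρ ρ′ x y t u} → eval σ e ≡ node x y →
          Runs c (σ , ω) t ρ → Runs (while e c) ρ u ρ′ →
          Runs (while e c) (σ , ω) (suc (t + u)) ρ′
  again eq (T , T≤ , p) (U , U≤ , q) = suc (T + U) , s≤s (+-mono-≤ T≤ U≤) , loop eq p q

  stop : ∀ {e c σ ω} → eval σ e ≡ leaf → Runs (while e c) (σ , ω) 1 (σ , ω)
  stop eq = 1 , ≤-refl , done eq

  -- The stack `s` is arbitrary and restored at the end: the induction needs this because
  -- subprograms run on top of whatever `fork` and `rep` have pushed.
  compile-correct : ∀ p {z x g s a b ω} →
    Runs (compile p) (x ∷ g ∷ s ∷ unary z ∷ a ∷ b ∷ [] , ω) (time p z)
         (⟦ p ⟧ z g x ∷ g ∷ s ∷ unary z ∷ a ∷ b ∷ [] , ω)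
  compile-correct (ex e) {z} {x} {g} {s} {a} {b} {ω} =
    subst (λ y → Runs _ _ 1 (y ∷ g ∷ s ∷ unary z ∷ a ∷ b ∷ [] , ω))
          (eval-rename e {x} {g} {s} {unary z} {a} {b}) assign
  compile-correct (p ≫ q) = compile-correct p ◅ compile-correct q
  compile-correct (fork p q) =
    assign ◅ compile-correct p ◅ assign ◅ assign ◅ assign ◅ compile-correct q ◅ assign ◅ assign
  compile-correct (cond p q) {x = leaf} with assign ◅ compile-correct q
  ... | T , T≤ , r = suc T , s≤s (≤-trans T≤ (s≤s (m≤n+m _ _))) , else refl r
  compile-correct (cond p q) {x = node leaf _} with assign ◅ compile-correct q
  ... | T , T≤ , r = suc T , s≤s (≤-trans T≤ (s≤s (m≤n+m _ _))) , else refl r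
  compile-correct (cond p q) {x = node (node _ _) _} with assign ◅ compile-correct p
  ... | T , T≤ , r = suc T , s≤s (≤-trans T≤ (s≤s (m≤m+n _ _))) , then refl r
  compile-correct (rep p) {z} {g = g} {s} {a} {b} {ω} = assign ◅ go z ◅ assign
    where
    go : ∀ n {x} →
      Runs (while (hd (var S)) ((S := cons (tl (hd (var S))) (tl (var S))) ▸ compile p))
           (x ∷ g ∷ node (unary n) s ∷ unary z ∷ a ∷ b ∷ [] , ω) (suc (n * (2 + time p z)))
           (iter n (⟦ p ⟧ z g) x ∷ g ∷ node leaf s ∷ unary z ∷ a ∷ b ∷ [] , ω)
    go zero    = stop refl
    go (suc n) = weaken
      (≤-reflexive (cong suc (trans (+-suc (1 + time p z) _) refl)))
      (again refl (assign ◅ compile-correct p) (go n))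

  unary-+ : ∀ m n → unary (m + n) ≡ iter m (node leaf) (unary n)
  unary-+ zero    n = refl
  unary-+ (suc m) n = trans (cong unary (sym (+-suc m n))) (unary-+ m (suc n))

  -- A counter: a run adds `z ^ d` to a unary number, and each `rep` multiplies the increment by the
  -- clock `z`.
  power : ℕ → Prog
  power zero    = ex (cons nil (var zero))
  power (suc d) = rep (power d)

  power-correct : ∀ d {z g} n → ⟦ power d ⟧ z g (unary n) ≡ unary (z ^ d + n)
  power-correct zero    n = refl
  power-correct (suc d) {z} {g} n = go z n
    where
    go : ∀ j n → iter j (⟦ power d ⟧ z g) (unary n) ≡ unary (j * z ^ d + n)
    go zero    n = refl
    go (suc j) n = begin
      iter j (⟦ power d ⟧ z g) (⟦ power d ⟧ z g (unary n))
        ≡⟨ cong (iter j _) (power-correct d n) ⟩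
      iter j (⟦ power d ⟧ z g) (unary (z ^ d + n)) ≡⟨ go j _ ⟩
      unary (j * z ^ d + (z ^ d + n))
        ≡⟨ cong unary (trans (sym (+-assoc (j * z ^ d) (z ^ d) n)) (cong (_+ n) (+-comm (j * z ^ d) (z ^ d)))) ⟩
      unary (z ^ d + j * z ^ d + n) ∎
      where open ≡-Reasoning

  -- `B` lists the subtrees still to be visited. Each round counts the root of the first one in `C`
  -- and replaces that tree by its children, if it has any.
  measure-body : Cmd 6
  measure-body =
    (C := cons nil (var C)) ▸
    ifte (hd (var B))
         (B := cons (hd (hd (var B))) (cons (tl (hd (var B))) (tl (var B))))
         (B := tl (var B))

  measure : Cmd 6
  measure = (B := cons (var X) nil) ▸ while (var B) measure-body

  measure-correct : ∀ {x g s a ω} →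
    Runs measure (x ∷ g ∷ s ∷ leaf ∷ a ∷ leaf ∷ [] , ω) (1 + (4 * size x + 1))
         (x ∷ g ∷ s ∷ unary (size x) ∷ a ∷ leaf ∷ [] , ω)
  measure-correct {x} {g} {s} {a} {ω} =
    retarget (cong (λ c → x ∷ g ∷ s ∷ c ∷ a ∷ leaf ∷ [] , ω) count) refl (assign ◅ go x (stop refl))
    where
    push : ℕ → Tree → Tree
    push n c = iter n (node leaf) c
    count : push (size x) leaf ≡ unary (size x)
    count = trans (sym (unary-+ (size x) 0)) (cong unary (+-identityʳ (size x)))
    push-+ : ∀ m n c → push (m + n) c ≡ push n (push m c)
    push-+ zero    n c = refl
    push-+ (suc m) n c = push-+ m n (node leaf c)
    -- The rest of the run is a premise, so that the visits of the two subtrees compose.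
    go : ∀ y {r c t ρ} →
         Runs (while (var B) measure-body) (x ∷ g ∷ s ∷ push (size y) c ∷ a ∷ r ∷ [] , ω) t ρ →
         Runs (while (var B) measure-body) (x ∷ g ∷ s ∷ c ∷ a ∷ node y r ∷ [] , ω) (4 * size y + t) ρ
    go leaf rest = again refl (assign ◅ (2 , ≤-refl , else refl set)) rest
    go (node y z) {r} {c} {t} {ρ} rest =
      weaken (≤-reflexive (eq (size y) (size z) t))
        (again refl (assign ◅ (2 , ≤-refl , then refl set))
          (go y (go z (subst (λ c → Runs _ (_ ∷ _ ∷ _ ∷ c ∷ _ , _) _ _) (push-+ (size y) (size z) (node leaf c)) rest))))
      where
      eq : ∀ m n t → 4 + (4 * m + (4 * n + t)) ≡ 4 * suc (m + n) + t
      eq = solve-∀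

  coinTree : Coins → Tree
  coinTree ω = encodeList (map fromBool ω)

  toss-body : Cmd 6
  toss-body = (A := tl (var A)) ▸ toss G ▸ (B := cons (var G) (var B))

  tossAll : Cmd 6
  tossAll = (A := var C) ▸ while (var A) toss-body

  -- The tosses are consed as they come, so `main` sees them in reverse order. This does not affect
  -- the distribution, by `∑ᶜ-reverse`.
  tossAll-correct : ∀ {z x s a ω} → z ≤ length ω → ∃[ g ] ∃[ ω′ ]
    Runs tossAll (x ∷ leaf ∷ s ∷ unary z ∷ a ∷ leaf ∷ [] , ω) (1 + (4 * z + 1))
         (x ∷ g ∷ s ∷ unary z ∷ leaf ∷ coinTree (reverse (take z ω)) ∷ [] , ω′)
  tossAll-correct {z} {x} {s} {a} {ω} z≤ with go z ω [] z≤
    where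
    go : ∀ n ω β {g} → n ≤ length ω → ∃[ g′ ] ∃[ ω′ ]
      Runs (while (var A) toss-body) (x ∷ g ∷ s ∷ unary z ∷ unary n ∷ coinTree β ∷ [] , ω) (4 * n + 1)
           (x ∷ g′ ∷ s ∷ unary z ∷ leaf ∷ coinTree (reverse (take n ω) ++ β) ∷ [] , ω′)
    go zero ω β {g} n≤ = g , ω , stop refl
    go (suc n) (h ∷ ω) β (s≤s n≤) with go n ω (h ∷ β) n≤
    ... | g′ , ω′ , r = g′ , ω′ ,
      retarget (cong (λ l → x ∷ g′ ∷ s ∷ unary z ∷ leaf ∷ coinTree l ∷ [] , ω′) eq)
               (cong (_+ 1) (sym (*-suc 4 n)))
               (again refl (assign ◅ (1 , ≤-refl , toss) ◅ assign) r)
      where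
      eq : reverse (take n ω) ++ (h ∷ β) ≡ reverse (h ∷ take n ω) ++ β
      eq = trans (sym (++-assoc (reverse (take n ω)) (h ∷ []) β)) (cong (_++ β) (sym (unfold-reverse h (take n ω))))
  ... | g , ω′ , r = g , ω′ ,
    retarget (cong (λ l → x ∷ g ∷ s ∷ unary z ∷ leaf ∷ coinTree l ∷ [] , ω′) (++-identityʳ (reverse (take z ω))))
             refl (assign ◅ r)

  -- Polynomial bounds for running times

  PolyBounded : (ℕ → ℕ) → Set
  PolyBounded f = ∃[ c ] ∃[ d ] (∀ x → 1 ≤ x → f x ≤ c * x ^ d)

  ^-growth : ∀ {x} → 1 ≤ x → ∀ {d e} → d ≤ e → x ^ d ≤ x ^ e
  ^-growth {x@(suc _)} _ d≤e = ^-monoʳ-≤ x d≤e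

  pb-const : ∀ c → PolyBounded (λ _ → c)
  pb-const c = c , 0 , λ x _ → ≤-reflexive (sym (*-identityʳ c))

  pb-id : PolyBounded (λ n → n)
  pb-id = 1 , 1 , λ x _ → ≤-reflexive (sym (trans (*-identityˡ _) (*-identityʳ x)))

  pb-+ : ∀ {f g} → PolyBounded f → PolyBounded g → PolyBounded (λ n → f n + g n)
  pb-+ {f} {g} (c , d , p) (c′ , d′ , q) = c + c′ , d + d′ , λ x x≥ → begin
    f x + g x                          ≤⟨ +-mono-≤ (p x x≥) (q x x≥) ⟩
    c * x ^ d + c′ * x ^ d′            ≤⟨ +-mono-≤ (*-monoʳ-≤ c (^-growth x≥ (m≤m+n d d′)))
                                                   (*-monoʳ-≤ c′ (^-growth x≥ (m≤n+m d′ d))) ⟩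
    c * x ^ (d + d′) + c′ * x ^ (d + d′) ≡⟨ *-distribʳ-+ (x ^ (d + d′)) c c′ ⟨
    (c + c′) * x ^ (d + d′)            ∎
    where open ≤-Reasoning

  pb-* : ∀ {f g} → PolyBounded f → PolyBounded g → PolyBounded (λ n → f n * g n)
  pb-* {f} {g} (c , d , p) (c′ , d′ , q) = c * c′ , d + d′ , λ x x≥ → begin
    f x * g x                     ≤⟨ *-mono-≤ (p x x≥) (q x x≥) ⟩
    (c * x ^ d) * (c′ * x ^ d′)   ≡⟨ eq c c′ (x ^ d) (x ^ d′) ⟩
    c * c′ * (x ^ d * x ^ d′)     ≡⟨ cong (c * c′ *_) (^-distribˡ-+-* x d d′) ⟨
    c * c′ * x ^ (d + d′)         ∎
    where
    open ≤-Reasoning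
    eq : ∀ a b u v → (a * u) * (b * v) ≡ a * b * (u * v)
    eq = solve-∀

  pb-^ : ∀ {f} → PolyBounded f → ∀ d → PolyBounded (λ n → f n ^ d)
  pb-^ p zero    = pb-const 1
  pb-^ p (suc d) = pb-* p (pb-^ p d)

  pb-time : ∀ p {f} → PolyBounded f → PolyBounded (λ n → time p (f n))
  pb-time (ex e)     b = pb-const 1
  pb-time (p ≫ q)    b = pb-+ (pb-time p b) (pb-time q b)
  pb-time (fork p q) b =
    pb-+ (pb-const 1) (pb-+ (pb-time p b) (pb-+ (pb-const 3) (pb-+ (pb-time q b) (pb-const 2))))
  pb-time (cond p q) b = pb-+ (pb-const 2) (pb-+ (pb-time p b) (pb-time q b))
  pb-time (rep p)    b =
    pb-+ (pb-const 1) (pb-+ (pb-+ (pb-const 1) (pb-* b (pb-+ (pb-const 2) (pb-time p b)))) (pb-const 1))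

  module _ (d : ℕ) (main : Prog) where

    -- The clock register first holds the size of the input, under which `power d` runs, and is then
    -- replaced by the d-th power of that size, which is the clock of `main` and the number of
    -- tosses.
    program : Program
    program = record { extra = 5 ; body =
      measure ▸ (S := cons (var X) (var S)) ▸ (X := nil) ▸ compile (power d) ▸
      (C := var X) ▸ (X := hd (var S)) ▸ tossAll ▸ (G := cons (var B) (var X)) ▸
      (X := nil) ▸ compile main }

    totalTime : ℕ → ℕ
    totalTime n = (1 + (4 * n + 1)) + (1 + (1 + (time (power d) n + (1 + (1 +
      ((1 + (4 * n ^ d + 1)) + (1 + (1 + time main (n ^ d)))))))))

    coins≤totalTime : ∀ n → n ^ d ≤ totalTime n
    coins≤totalTime n =
      m≤n⇒m≤o+n (1 + (4 * n + 1)) (m≤n⇒m≤o+n 1 (m≤n⇒m≤o+n 1 (m≤n⇒m≤o+n (time (power d) n)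
        (m≤n⇒m≤o+n 1 (m≤n⇒m≤o+n 1 (m≤n⇒m≤n+o _ (m≤n⇒m≤o+n 1 (m≤n⇒m≤n+o 1 (m≤n*m (n ^ d) 4)))))))))

    totalTime-bounded : PolyBounded totalTime
    totalTime-bounded = pb-+ (linear pb-id) (pb-+ one (pb-+ one (pb-+ (pb-time (power d) pb-id)
      (pb-+ one (pb-+ one (pb-+ (linear pow) (pb-+ one (pb-+ one (pb-time main pow)))))))))
      where
      one = pb-const 1
      pow = pb-^ pb-id d
      linear : ∀ {f} → PolyBounded f → PolyBounded (λ n → 1 + (4 * f n + 1))
      linear b = pb-+ one (pb-+ (pb-* (pb-const 4) b) one)

    result : Tree → Coins → Tree
    result x ω = ⟦ main ⟧ z (node (coinTree (reverse (take z ω))) x) leaf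
      where z = size x ^ d

    program-correct : ∀ x ω {t} → totalTime (size x) ≤ t → t ≤ length ω →
                      Outputs program x ω t (result x ω)
    program-correct x ω t≥ t≤ with tossAll-correct {size x ^ d} {x} {node x leaf} {leaf} {ω} (≤-trans (≤-trans (coins≤totalTime (size x)) t≥) t≤)
    ... | g , ω′ , r with measure-correct ◅ assign ◅ assign ◅ power-run ◅ assign ◅ assign ◅ r ◅ assign ◅ assign ◅ compile-correct main
      where
      power-run : Runs (compile (power d)) (leaf ∷ leaf ∷ node x leaf ∷ unary (size x) ∷ leaf ∷ leaf ∷ [] , ω) (time (power d) (size x))
               (unary (size x ^ d) ∷ leaf ∷ node x leaf ∷ unary (size x) ∷ leaf ∷ leaf ∷ [] , ω)
      power-run = retarget
        (cong (λ u → u ∷ leaf ∷ node x leaf ∷ unary (size x) ∷ leaf ∷ leaf ∷ [] , ω)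
              (trans (power-correct d 0) (cong unary (+-identityʳ _))))
        refl (compile-correct (power d))
    ... | T , T≤ , e = T , ≤-trans T≤ t≥ , _ , ω′ , e

-- Typed terms that carry their code and its correctness

module Typed where

  open Machine hiding (X; G; S; C; A; B)
  open import Data.Bool.Base using (Bool; true; false; if_then_else_)
  open import Data.Fin.Base using (Fin; zero; suc; toℕ)
  import Data.Fin.Properties as Fin
  open import Data.List.Base
    using (List; []; _∷_; map; length; take; drop; foldl; foldr; reverse; allFin; applyUpTo; upTo; downFrom; replicate; tabulate)
  open import Data.List.Properties
    using (reverse-foldl; reverse-map; reverse-upTo; map-∘; map-tabulate; length-tabulate; length-reverse; take-all)
  open import Data.Maybe.Base using (Maybe; just; nothing; maybe′)
  open import Data.Nat.Base
  open import Data.Nat.Properties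
  open import Data.Product.Base using (_×_; _,_; proj₁; proj₂)
  open import Data.Unit.Base using (⊤; tt)
  open import Function.Base using (_∘_; id)
  open import Relation.Binary.PropositionalEquality
  open import Relation.Nullary.Decidable.Core using (does; yes; no)

  headOr : ∀ {X : Set} → X → List X → X
  headOr d []      = d
  headOr d (x ∷ _) = x

  isPos : ℕ → Bool
  isPos zero    = false
  isPos (suc _) = true

  module Terms (Root : Set) (glob : Root → Tree) (clk : Root → ℕ) where

    record Ty : Set₁ where
      field
        El  : Root → Set
        enc : ∀ {r} → El r → Tree
    open Ty public

    infixl 5 _▷_
    _▷_ : Ty → Ty → Ty
    El  (Γ ▷ A) r       = El Γ r × El A r
    enc (Γ ▷ A) (p , a) = node (enc A a) (enc Γ p)

    infixr 6 _×ᵗ_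
    _×ᵗ_ : Ty → Ty → Ty
    El  (A ×ᵗ B) r       = El A r × El B r
    enc (A ×ᵗ B) (a , b) = node (enc A a) (enc B b)

    Raw Unit′ Bool′ Nat′ : Ty
    Raw   = record { El = λ _ → Tree ; enc = id }
    Unit′ = record { El = λ _ → ⊤ ; enc = λ _ → leaf }
    Bool′ = record { El = λ _ → Bool ; enc = fromBool }
    Nat′  = record { El = λ _ → ℕ ; enc = unary }

    Fin′ : (Root → ℕ) → Ty
    Fin′ s = record { El = λ r → Fin (s r) ; enc = unary ∘ toℕ }

    List′ Maybe′ : Ty → Ty
    List′ A  = record { El = λ r → List (El A r) ; enc = encodeList ∘ map (enc A) }
    Maybe′ A = record { El = λ r → Maybe (El A r) ; enc = maybe′ (λ a → node (enc A a) leaf) leaf }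

    Arr : (Root → ℕ) → Ty → Ty
    Arr s A = record { El = λ r → Fin (s r) → El A r ; enc = λ f → tabulateTree (enc A ∘ f) }

    -- A shallow embedding: meaning, code and correctness travel together, so a program assembled
    -- from the combinators is verified by construction. Everything is indexed by `Root` because
    -- types such as `Fin′ s` depend on the instance.
    record Tm (Γ A : Ty) : Set where
      constructor tm
      field
        fn   : ∀ r → El Γ r → El A r
        code : Prog
        ok   : ∀ r p → ⟦ code ⟧ (clk r) (glob r) (enc Γ p) ≡ enc A (fn r p)
    open Tm public

    private variable
      Γ A B D S′ : Ty

    x̂ : Expr 2
    x̂ = var zero

    -- Only the encodings have to agree, not the values. This is how a unary number becomes an
    -- index, and how a composite of combinators is identified with a function of the specification.
    cast : (t : Tm Γ A) (f : ∀ r → El Γ r → El B r) →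
           (∀ r p → enc A (fn t r p) ≡ enc B (f r p)) → Tm Γ B
    cast t f eq = tm f (code t) λ r p → trans (ok t r p) (eq r p)

    v0 : Tm (Γ ▷ A) A
    v0 = tm (λ r → proj₂) (ex (hd x̂)) λ r p → refl

    wk : Tm Γ A → Tm (Γ ▷ B) A
    wk t = tm (λ r p → fn t r (proj₁ p)) (ex (tl x̂) ≫ code t) λ r p → ok t r (proj₁ p)

    v1 : Tm (Γ ▷ A ▷ B) A
    v1 = wk v0

    v2 : Tm (Γ ▷ A ▷ B ▷ D) A
    v2 = wk v1

    skip₁ : Tm (Γ ▷ A) B → Tm (Γ ▷ S′ ▷ A) B
    skip₁ t = tm (λ r p → fn t r (proj₁ (proj₁ p) , proj₂ p))
                (ex (cons (hd x̂) (tl (tl x̂))) ≫ code t) λ r p → ok t r _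

    letT : Tm Γ A → Tm (Γ ▷ A) B → Tm Γ B
    letT {Γ = Γ} a b = tm (λ r p → fn b r (p , fn a r p)) (fork (code a) (ex x̂) ≫ code b)
      λ r p → trans (cong (λ t → ⟦ code b ⟧ (clk r) (glob r) (node t (enc Γ p))) (ok a r p)) (ok b r _)

    pairT : Tm Γ A → Tm Γ B → Tm Γ (A ×ᵗ B)
    pairT a b = tm (λ r p → fn a r p , fn b r p) (fork (code a) (code b))
      λ r p → cong₂ node (ok a r p) (ok b r p)

    fstT : Tm Γ (A ×ᵗ B) → Tm Γ A
    fstT t = tm (λ r p → proj₁ (fn t r p)) (code t ≫ ex (hd x̂)) λ r p → cong left (ok t r p)

    sndT : Tm Γ (A ×ᵗ B) → Tm Γ B
    sndT t = tm (λ r p → proj₂ (fn t r p)) (code t ≫ ex (tl x̂)) λ r p → cong right (ok t r p)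

    hdT tlT : Tm Γ Raw → Tm Γ Raw
    hdT t = tm (λ r p → left (fn t r p)) (code t ≫ ex (hd x̂)) λ r p → cong left (ok t r p)
    tlT t = tm (λ r p → right (fn t r p)) (code t ≫ ex (tl x̂)) λ r p → cong right (ok t r p)

    globT : Tm Γ Raw
    globT = tm (λ r p → glob r) (ex (var (suc zero))) λ r p → refl

    falseT trueT : Tm Γ Bool′
    falseT = tm (λ r p → false) (ex nil) λ r p → refl
    trueT  = tm (λ r p → true) (ex (cons nil nil)) λ r p → refl

    ifT : Tm Γ Bool′ → Tm Γ A → Tm Γ A → Tm Γ A
    ifT {Γ = Γ} {A = A} c t e = tm (λ r p → if fn c r p then fn t r p else fn e r p)
      (fork (code c) (ex x̂) ≫ cond (code t) (code e)) prf
      where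
      prf : ∀ r p → branch (⟦ code c ⟧ (clk r) (glob r) (enc Γ p))
          (⟦ code t ⟧ (clk r) (glob r) (enc Γ p)) (⟦ code e ⟧ (clk r) (glob r) (enc Γ p))
        ≡ enc A (if fn c r p then fn t r p else fn e r p)
      prf r p rewrite ok c r p with fn c r p
      ... | true  = ok t r p
      ... | false = ok e r p

    nothingT : Tm Γ (Maybe′ A)
    nothingT = tm (λ r p → nothing) (ex nil) λ r p → refl

    justT : Tm Γ A → Tm Γ (Maybe′ A)
    justT t = tm (λ r p → just (fn t r p)) (code t ≫ ex (cons x̂ nil)) λ r p → cong (λ x → node x leaf) (ok t r p)

    maybeT : Tm Γ (Maybe′ A) → Tm (Γ ▷ A) B → Tm Γ B → Tm Γ B
    maybeT {Γ = Γ} {A = A} {B = B} m j n = tm (λ r p → maybe′ (λ a → fn j r (p , a)) (fn n r p) (fn m r p))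
      (fork (code m) (fork (code m) (ex x̂)) ≫
       cond (ex (cons (hd (hd x̂)) (tl x̂)) ≫ code j) (ex (tl x̂) ≫ code n)) prf
      where
      prf : ∀ r p → ⟦ cond (ex (cons (hd (hd x̂)) (tl x̂)) ≫ code j) (ex (tl x̂) ≫ code n) ⟧ (clk r) (glob r)
          (⟦ fork (code m) (fork (code m) (ex x̂)) ⟧ (clk r) (glob r) (enc Γ p))
        ≡ enc B (maybe′ (λ a → fn j r (p , a)) (fn n r p) (fn m r p))
      prf r p rewrite ok m r p with fn m r p
      ... | just a  = ok j r (p , a)
      ... | nothing = ok n r p

    nilT : Tm Γ (List′ A)
    nilT = tm (λ r p → []) (ex nil) λ r p → refl

    consT : Tm Γ A → Tm Γ (List′ A) → Tm Γ (List′ A)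
    consT a l = tm (λ r p → fn a r p ∷ fn l r p) (fork (code a) (code l))
      λ r p → cong₂ node (ok a r p) (ok l r p)

    tailT : Tm Γ (List′ A) → Tm Γ (List′ A)
    tailT {A = A} t = tm (λ r p → drop 1 (fn t r p)) (code t ≫ ex (tl x̂))
      λ r p → trans (cong right (ok t r p)) (prf (fn t r p))
      where
      prf : ∀ {r} (l : List (El A r)) → right (encodeList (map (enc A) l)) ≡ encodeList (map (enc A) (drop 1 l))
      prf []      = refl
      prf (_ ∷ _) = refl

    headT : Tm Γ (List′ A) → Tm Γ A → Tm Γ A
    headT {Γ = Γ} {A = A} l d = tm (λ r p → headOr (fn d r p) (fn l r p))
      (fork (code l) (fork (code l) (code d)) ≫ cond (ex (hd (hd x̂))) (ex (tl x̂))) prf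
      where
      prf : ∀ r p → ⟦ cond (ex (hd (hd x̂))) (ex (tl x̂)) ⟧ (clk r) (glob r)
          (⟦ fork (code l) (fork (code l) (code d)) ⟧ (clk r) (glob r) (enc Γ p))
        ≡ enc A (headOr (fn d r p) (fn l r p))
      prf r p rewrite ok l r p with fn l r p
      ... | []    = ok d r p
      ... | _ ∷ _ = refl

    -- The loop runs for the full clock and idles once the list is used up; a list longer than the
    -- clock is therefore cut off by `take`.
    foldT : Tm Γ (List′ A) → Tm Γ B → Tm (Γ ▷ B ▷ A) B → Tm Γ B
    foldT {Γ = Γ} {A = A} {B = B} xs s b = tm
      (λ r p → foldl (λ s a → fn b r ((p , s) , a)) (fn s r p) (take (clk r) (fn xs r p)))
      (fork (fork (code xs) (code s)) (ex x̂) ≫ rep body ≫ ex (tl (hd x̂)))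
      λ r p → trans (cong₂ (λ l a → right (left (iter (clk r) (⟦ body ⟧ (clk r) (glob r)) (node (node l a) (enc Γ p)))))
                           (ok xs r p) (ok s r p))
                    (prf r p (clk r) (fn xs r p) (fn s r p))
      where
      step body : Prog
      step = fork (fork (ex (tl (hd (hd x̂))))
                        (ex (cons (hd (hd (hd x̂))) (cons (tl (hd x̂)) (tl x̂))) ≫ code b))
                  (ex (tl x̂))
      -- The remaining list is copied to the front because `cond` branches on the left component of
      -- its argument.
      body = ex (cons (hd (hd x̂)) x̂) ≫ cond step (ex x̂)
      prf : ∀ r p n l a →
        right (left (iter n (⟦ body ⟧ (clk r) (glob r))
          (node (node (encodeList (map (enc A) l)) (enc B a)) (enc Γ p))))
        ≡ enc B (foldl (λ s a → fn b r ((p , s) , a)) a (take n l))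
      prf r p zero    l       a = refl
      prf r p (suc n) []      a = trans (prf r p n [] a) (cong (λ l → enc B (foldl _ a l)) (take-[] n))
        where
        take-[] : ∀ {X : Set} n → take n ([] {A = X}) ≡ []
        take-[] zero    = refl
        take-[] (suc n) = refl
      prf r p (suc n) (x ∷ l) a rewrite ok b r ((p , a) , x) = prf r p n l _

    zeroT : Tm Γ Nat′
    zeroT = tm (λ r p → 0) (ex nil) λ r p → refl

    sucT predT : Tm Γ Nat′ → Tm Γ Nat′
    sucT t = tm (λ r p → suc (fn t r p)) (code t ≫ ex (cons nil x̂)) λ r p → cong (node leaf) (ok t r p)
    predT t = tm (λ r p → pred (fn t r p)) (code t ≫ ex (tl x̂)) λ r p → trans (cong right (ok t r p)) (prf (fn t r p))
      where
      prf : ∀ n → right (unary n) ≡ unary (pred n)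
      prf zero    = refl
      prf (suc n) = refl

    posT : Tm Γ Nat′ → Tm Γ Bool′
    posT {Γ = Γ} t = tm (λ r p → isPos (fn t r p)) (fork (code t) (ex x̂) ≫ cond (ex (cons nil nil)) (ex nil)) prf
      where
      prf : ∀ r p → branch (⟦ code t ⟧ (clk r) (glob r) (enc Γ p)) (node leaf leaf) leaf ≡ fromBool (isPos (fn t r p))
      prf r p rewrite ok t r p with fn t r p
      ... | zero  = refl
      ... | suc _ = refl

    -- A number in unary is a list of units.
    iterT : Tm Γ Nat′ → Tm Γ A → Tm (Γ ▷ A) A → Tm Γ A
    iterT {Γ = Γ} {A = A} n s b = cast (foldT units s (wk b))
      (λ r p → iter (fn n r p ⊓ clk r) (λ a → fn b r (p , a)) (fn s r p))
      λ r p → cong (enc A) (eq (fn n r p) (clk r) _ _)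
      where
      units : Tm Γ (List′ Unit′)
      units = cast n (λ r p → replicate (fn n r p) tt) λ r p → eq (fn n r p)
        where
        eq : ∀ n → unary n ≡ encodeList (map (λ _ → leaf) (replicate n tt))
        eq zero    = refl
        eq (suc n) = cong (node leaf) (eq n)
      eq : ∀ {X : Set} n z (f : X → X) x → foldl (λ a _ → f a) x (take z (replicate n tt)) ≡ iter (n ⊓ z) f x
      eq zero    zero    f x = refl
      eq zero    (suc z) f x = refl
      eq (suc n) zero    f x = refl
      eq (suc n) (suc z) f x = eq n z f (f x)

    -- An operand is cut at the clock where it drives a loop; the second factor of `mulT` drives the
    -- inner addition.
    addT monusT mulT : Tm Γ Nat′ → Tm Γ Nat′ → Tm Γ Nat′
    addT a b = cast (iterT a b (sucT v0)) (λ r p → (fn a r p ⊓ clk r) + fn b r p)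
      λ r p → cong unary (eq (fn a r p ⊓ clk r) (fn b r p))
      where
      eq : ∀ m n → iter m suc n ≡ m + n
      eq zero    n = refl
      eq (suc m) n = trans (eq m (suc n)) (+-suc m n)
    monusT a b = cast (iterT b a (predT v0)) (λ r p → fn a r p ∸ (fn b r p ⊓ clk r))
      λ r p → cong unary (eq (fn b r p ⊓ clk r) (fn a r p))
      where
      eq : ∀ m n → iter m pred n ≡ n ∸ m
      eq zero    n       = refl
      eq (suc m) zero    = trans (eq m 0) (0∸n≡0 m)
      eq (suc m) (suc n) = eq m n
    mulT a b = cast (iterT a zeroT (addT (wk b) v0)) (λ r p → (fn a r p ⊓ clk r) * (fn b r p ⊓ clk r))
      λ r p → cong unary (trans (eq (fn a r p ⊓ clk r) _ 0) (+-identityʳ _))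
      where
      eq : ∀ m b n → iter m (b +_) n ≡ m * b + n
      eq zero    b n = refl
      eq (suc m) b n = trans (eq m b (b + n)) (trans (sym (+-assoc (m * b) b n)) (cong (_+ n) (+-comm (m * b) b)))

    ltT : Tm Γ Nat′ → Tm Γ Nat′ → Tm Γ Bool′
    ltT a b = posT (monusT b a)

    -- The index sets over which loops may run: `card≤` keeps the clock from cutting a loop short,
    -- and `cardT` computes the size in every context.
    record Sort : Set₁ where
      field
        card   : Root → ℕ
        card≤  : ∀ r → card r ≤ clk r
        cardT  : ∀ {Γ} → Tm Γ Nat′
        cardT≡ : ∀ {Γ} r (p : El Γ r) → fn (cardT {Γ}) r p ≡ card r
    open Sort public

    natT : ∀ {s} → Tm Γ (Fin′ s) → Tm Γ Nat′
    natT t = cast t (λ r p → toℕ (fn t r p)) λ r p → refl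

    toℕ≤ : ∀ σ r (i : Fin (card σ r)) → toℕ i ≤ clk r
    toℕ≤ σ r i = ≤-trans (<⇒≤ (Fin.toℕ<n i)) (card≤ σ r)

    equalT : ∀ σ → Tm Γ (Fin′ (card σ)) → Tm Γ (Fin′ (card σ)) → Tm Γ Bool′
    equalT σ i j = cast (ifT (ltT (natT i) (natT j)) falseT (ifT (ltT (natT j) (natT i)) falseT trueT))
      (λ r p → does (fn i r p Fin.≟ fn j r p))
      λ r p → cong fromBool (trans
        (cong₂ (λ a b → if isPos (_ ∸ a) then false else if isPos (_ ∸ b) then false else true)
          (m≤n⇒m⊓n≡m (toℕ≤ σ r (fn i r p))) (m≤n⇒m⊓n≡m (toℕ≤ σ r (fn j r p))))
        (eq (fn i r p) (fn j r p)))
      where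
      eq : ∀ {n} (i j : Fin n) →
        (if isPos (toℕ j ∸ toℕ i) then false else if isPos (toℕ i ∸ toℕ j) then false else true) ≡ does (i Fin.≟ j)
      eq zero    zero    = refl
      eq zero    (suc j) = refl
      eq (suc i) zero    = refl
      eq (suc i) (suc j) = trans (eq i j) (lemma i j)
        where
        lemma : ∀ {n} (i j : Fin n) → does (i Fin.≟ j) ≡ does (suc i Fin.≟ suc j)
        lemma i j with i Fin.≟ j
        ... | yes _ = refl
        ... | no  _ = refl

    rangeT : ∀ σ → Tm Γ (List′ (Fin′ (card σ)))
    rangeT {Γ = Γ} σ = cast
      (sndT (iterT (cardT σ) (pairT zeroT nilT) (pairT (sucT (fstT v0)) (consT (fstT v0) (sndT v0)))))
      (λ r p → reverse (allFin (card σ r)))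
      λ r p → trans
        (cong (λ m → encodeList (map unary (proj₂ (iter m push (0 , [])))))
              (trans (cong (_⊓ clk r) (cardT≡ σ r p)) (m≤n⇒m⊓n≡m (card≤ σ r))))
        (trans (cong (λ l → encodeList (map unary (proj₂ l))) (full (card σ r))) (cong encodeList (eq (card σ r))))
      where
      push : ℕ × List ℕ → ℕ × List ℕ
      push (i , l) = suc i , i ∷ l
      iter-suc : ∀ {X : Set} n (f : X → X) x → iter (suc n) f x ≡ f (iter n f x)
      iter-suc zero    f x = refl
      iter-suc (suc n) f x = iter-suc n f (f x)
      full : ∀ n → iter n push (0 , []) ≡ (n , downFrom n)
      full zero    = refl
      full (suc n) = trans (iter-suc n push _) (cong push (full n))
      eq : ∀ n → map unary (downFrom n) ≡ map (unary ∘ toℕ) (reverse (allFin n))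
      eq n = begin
        map unary (downFrom n)                   ≡⟨ cong (map unary) (reverse-upTo n) ⟨
        map unary (reverse (upTo n))             ≡⟨ cong (map unary ∘ reverse) (toℕs id n) ⟨
        map unary (reverse (tabulate {n = n} toℕ)) ≡⟨ cong (map unary ∘ reverse) (map-tabulate {n = n} id toℕ) ⟨
        map unary (reverse (map toℕ (allFin n))) ≡⟨ cong (map unary) (reverse-map toℕ (allFin n)) ⟨
        map unary (map toℕ (reverse (allFin n))) ≡⟨ map-∘ (reverse (allFin n)) ⟨
        map (unary ∘ toℕ) (reverse (allFin n))   ∎
        where
        open ≡-Reasoning
        toℕs : ∀ {X : Set} (f : ℕ → X) n → tabulate {n = n} (f ∘ toℕ) ≡ applyUpTo f n
        toℕs f zero    = refl
        toℕs f (suc n) = cong (f 0 ∷_) (toℕs (f ∘ suc) n)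

    -- The range counts downwards, which turns the left fold into a right one.
    foldFinT : ∀ σ → Tm Γ B → Tm (Γ ▷ B ▷ Fin′ (card σ)) B → Tm Γ B
    foldFinT {B = B} σ s b = cast (foldT (rangeT σ) s b)
      (λ r p → foldr (λ i a → fn b r ((p , a) , i)) (fn s r p) (allFin (card σ r)))
      λ r p → cong (enc B) (trans
        (cong (foldl _ (fn s r p)) (take-all (clk r) _ (≤-trans (≤-reflexive (length-range (card σ r))) (card≤ σ r))))
        (reverse-foldl _ (fn s r p) (allFin (card σ r))))
      where
      length-range : ∀ n → length (reverse (allFin n)) ≡ n
      length-range n = trans (length-reverse (allFin n)) (length-tabulate {n = n} id)

    tabulateT : ∀ σ → Tm (Γ ▷ Fin′ (card σ)) A → Tm Γ (Arr (card σ) A)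
    tabulateT {A = A} σ t = cast (foldFinT σ nilT (consT (skip₁ t) v1)) (λ r p i → fn t r (p , i))
      λ r p → cong encodeList (eq _ (allFin (card σ r)))
      where
      eq : ∀ {X : Set} {r} (f : X → El A r) xs → map (enc A) (foldr (λ i a → f i ∷ a) [] xs) ≡ map (enc A ∘ f) xs
      eq f []       = refl
      eq f (x ∷ xs) = cong (enc A (f x) ∷_) (eq f xs)

    at : ∀ {n} (f : Fin n → Tree) i → left (iter (toℕ i) right (tabulateTree f)) ≡ f i
    at f i = trans (cong (λ l → left (iter (toℕ i) right (encodeList l))) (map-tabulate id f)) (go f i)
      where
      go : ∀ {n} (f : Fin n → Tree) i → left (iter (toℕ i) right (encodeList (tabulate f))) ≡ f i
      go f zero    = refl
      go f (suc i) = go (f ∘ suc) i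

    rawT : Tm Γ A → Tm Γ Raw
    rawT {A = A} t = cast t (λ r p → enc A (fn t r p)) λ r p → refl

    entryT : ∀ σ → (t : Tm Γ Raw) (f : ∀ r → El Γ r → Fin (card σ r) → Tree) →
             (∀ r p → fn t r p ≡ tabulateTree (f r p)) → Tm Γ (Fin′ (card σ)) → Tm Γ Raw
    entryT σ t f eq i = cast (hdT (iterT (natT i) t (tlT v0))) (λ r p → f r p (fn i r p))
      λ r p → trans (cong₂ (λ m x → left (iter m right x)) (m≤n⇒m⊓n≡m (toℕ≤ σ r (fn i r p))) (eq r p)) (at (f r p) (fn i r p))

    atT : ∀ σ → Tm Γ (Arr (card σ) A) → Tm Γ (Fin′ (card σ)) → Tm Γ A
    atT {A = A} σ t i = cast (entryT σ (rawT t) (λ r p → enc A ∘ fn t r p) (λ r p → refl) i)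
      (λ r p → fn t r p (fn i r p)) λ r p → refl

    nthT : Tm Γ (List′ A) → Tm Γ Nat′ → Tm Γ A → Tm Γ A
    nthT l n d = headT (iterT n l (tailT v0)) d

    memberT : ∀ σ → Tm Γ (Fin′ (card σ)) → Tm Γ (List′ (Fin′ (card σ))) → Tm Γ Bool′
    memberT σ i l = foldT l falseT (ifT (equalT σ (wk (wk i)) v0) trueT v1)

-- The algorithm as a function, with truncated arithmetic

module Algorithm where

  open Machine using (iter)
  open Typed using (isPos; headOr)
  open import Data.Bool.Base using (Bool; true; false; if_then_else_)
  open import Data.Fin.Base using (Fin)
  open import Data.Fin.Properties using (_≟_)
  open import Data.List.Base using (List; []; _∷_; foldl; foldr; take; drop; allFin)
  open import Data.Maybe.Base using (Maybe; just; nothing; maybe′)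
  open import Data.Nat.Base
  open import Data.Product.Base using (_×_; _,_; proj₁; proj₂)
  open import Relation.Nullary.Decidable.Core using (does)

  -- Loops of the machine are cut off after Z rounds, so that every run is short,
  -- whatever the input; Z exceeds all numbers that occur for a feasible instance.
  module Truncated (Z : ℕ) where

    infixl 6 _⊕_
    _⊕_ : ℕ → ℕ → ℕ
    a ⊕ b = (a ⊓ Z) + b

    infix 5 _≺_
    _≺_ : ℕ → ℕ → Bool
    a ≺ b = isPos (b ∸ (a ⊓ Z))

    -- The least q with x ≤ 2 ^ q, together with 2 ^ q.
    log : ℕ → ℕ × ℕ
    log x = iter (x ⊓ Z) (λ s → if proj₂ s ≺ x then (suc (proj₁ s) , proj₂ s ⊕ proj₂ s) else s) (0 , 1)

    pow : ℕ → ℕ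
    pow q = iter (q ⊓ Z) (λ x → x ⊕ x) 1

    -- Binary digits, most significant first. A missing coin reads as `false`; `enough-coins` later
    -- excludes this case.
    draw : ℕ → Coins → Coins × ℕ
    draw q ω = iter (q ⊓ Z) (λ s → drop 1 (proj₁ s) ,
        (if headOr false (proj₁ s) then suc (proj₂ s ⊕ proj₂ s) else proj₂ s ⊕ proj₂ s)) (ω , 0)

    nth : ∀ {A : Set} → A → ℕ → List A → A
    nth d n xs = headOr d (iter (n ⊓ Z) (drop 1) xs)

  module Spec (I : Instance) (Z : ℕ) where
    open Instance I
    open Truncated Z

    -- No load exceeds `k` and no path has more than `n` edges. The caps in `b′` and `Δ′` thus lose
    -- nothing, and they keep binary numbers of exponential value out of the unary arithmetic.
    b′ : E → ℕ
    b′ e = b e ⊓ k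

    Δ′ : ℕ
    Δ′ = Δ ⊓ n

    Candidate : Set
    Candidate = Maybe (ℕ × List E)

    better : Candidate → ℕ × List E → Candidate
    better o x = maybe′ (λ y → if proj₁ x ≺ proj₁ y then just x else o) (just x) o

    start : V → V → Candidate
    start t v = if does (v ≟ t) then just (0 , []) else nothing

    -- A round of Bellman-Ford. All vertices are updated from the previous round, so the walks gain
    -- at most one edge and the number of rounds limits the number of edges.
    relax : (E → ℕ) → (V → Candidate) → V → Candidate
    relax D best v = foldr
      (λ e o → if does (tail e ≟ v)
               then maybe′ (λ c → better o (D e ⊕ suc (proj₁ c) , e ∷ proj₂ c)) o (best (head e))
               else o)
      (best v) (allFin m)

    route : (E → ℕ) → Routing
    route D i = maybe′ proj₂ [] (iter (Δ′ ⊓ Z) (relax D) (start (t i)) (s i))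

    member : E → List E → Bool
    member e es = foldl (λ a x → if does (e ≟ x) then true else a) false (take Z es)

    count : Routing → E → ℕ
    count R e = foldr (λ i a → if member e (R i) then suc a else a) 0 (allFin k)

    -- `∸` is the projection to the nonnegative orthant that a strategy of approachability makes
    -- after each round.
    update : (E → ℕ) → Routing → E → ℕ
    update D R e = (count R e ⊕ D e) ∸ (b′ e ⊓ Z)

    round : (E → ℕ) × List Routing → (E → ℕ) × List Routing
    round s = update (proj₁ s) (route (proj₁ s)) , route (proj₁ s) ∷ proj₂ s

    rounds : ℕ → List Routing
    rounds T = proj₂ (iter (T ⊓ Z) round ((λ _ → 0) , []))

    high : E → Bool
    high e = if b′ e ≺ Δ′ then false else true

    -- `p` coins draw one of the `T` routings in `Rs`; `R` coins draw a number whose range is twice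
    -- `M`.
    record Sampling : Set where
      constructor sampling
      field
        p R T M : ℕ
        Rs      : List Routing

    State : Set
    State = Coins × (E → ℕ) × (E → ℕ) × Routing

    module _ (S : Sampling) where
      open Sampling S

      -- What matters is the difference of `charge x y u v` and `charge x y v u`. It is the sum of
      -- (x - y)(u - v) over the high edges, a signed quantity that `choose` compares without
      -- leaving the naturals.
      charge : List E → List E → (E → ℕ) → (E → ℕ) → ℕ
      charge x y u v = foldr (λ e a → if high e then
          (if member e x then u e else 0) ⊕ ((if member e y then v e else 0) ⊕ a) else a) 0 (allFin m)

      fractional : Fin k → E → ℕ
      fractional i e = foldl (λ a P → if member e (P i) then suc a else a) 0 (take Z Rs)

      -- For `r` uniform below 2M, the path `x` wins with probability (1 - β) / 2, where β is the
      -- difference of the charges divided by `M`; so the path that adds to the present deviation is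
      -- the less likely one.
      choose : (E → ℕ) → (E → ℕ) → List E → List E → ℕ → List E
      choose u v x y r = if r ⊕ charge x y u v ≺ M ⊕ charge x y v u then x else y

      advance : Fin k → (E → ℕ) → (E → ℕ) → Routing → Coins → List E → State
      advance i u v P ω x =
        ω ,
        (λ e → (if member e x then T else 0) ⊕ u e) ,
        (λ e → fractional i e ⊕ v e) ,
        (λ j → if does (j ≟ i) then x else P j)

      pick : Fin k → ℕ → List E
      pick i a = nth (λ _ → []) a Rs i

      step : Fin k → State → State
      step i (ω , u , v , P) =
        let ω₁ , a = draw p ω
            ω₂ , c = draw p ω₁
            ω₃ , r = draw R ω₂
        in advance i u v P ω₃ (choose u v (pick i a) (pick i c) r)

      sample : Coins → Routing
      sample ω = proj₂ (proj₂ (proj₂ (foldr step (ω , (λ _ → 0) , (λ _ → 0) , (λ _ → [])) (allFin k))))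

    lg : ℕ
    lg = proj₁ (log (n ⊕ (m ⊕ (k ⊕ 2))))

    -- `2 ^ p` has to exceed the growth of the potential, which is cubic in `m` and `k`. `2 ^ q` is
    -- the divisor of the bias, between 2^10 and 2^11 times `Δ′` times `lg` if `Δ′` is positive.
    p q : ℕ
    p = lg ⊕ (lg ⊕ lg)
    q = 10 + proj₁ (log ((Δ′ ⊓ Z) * (lg ⊓ Z)))

    parameters : Sampling
    parameters = record { p = p ; R = suc (q ⊕ p) ; T = pow p ; M = pow (q ⊕ p) ; Rs = rounds (pow p) }

    solution : Coins → Routing
    solution ω i = take Z (sample parameters ω i)

-- Terms for the algorithm, including decoding and encoding

module Realise where

  open Machine using (iter; unary; coinTree; Prog; ⟦_⟧)
  open Typed using (module Terms)
  open Algorithm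
  open import Data.Bool.Base using (Bool; true; false; if_then_else_)
  open import Data.Fin.Base using (Fin; zero; suc; toℕ)
  import Data.Fin.Properties as Fin
  open import Data.List.Base using (List; []; _∷_; map; length; foldl; foldr; take; reverse; allFin; tabulate; _++_)
  open import Data.List.Properties
  open import Data.Nat.Base
  open import Data.Nat.Properties
  import Data.Nat.Binary.Base as Bin
  open import Data.Nat.Binary.Base using (ℕᵇ; 2[1+_]; 1+[2_])
  import Data.Nat.Binary.Properties as Bin
  open import Data.Sum.Base using (inj₁; inj₂)
  open import Data.Product.Base using (∃-syntax; _×_; _,_; proj₁)
  open import Data.Unit.Base using (tt)
  open import Function.Base using (_∘_; id; flip)
  open import Relation.Binary.PropositionalEquality
  open import Relation.Nullary.Negation using (contradiction)

  length≤size : ∀ xs → length xs ≤ size (encodeList xs)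
  length≤size []       = z≤n
  length≤size (x ∷ xs) = s≤s (≤-trans (length≤size xs) (m≤n+m _ (size x)))

  table≤size : ∀ {n} (f : Fin n → Tree) → n ≤ size (tabulateTree f)
  table≤size {n} f = ≤-trans
    (≤-reflexive (sym (trans (length-map f (allFin n)) (length-tabulate {n = n} id)))) (length≤size (map f (allFin n)))

  entry≤size : ∀ {n} (f : Fin n → Tree) i → size (f i) ≤ size (tabulateTree f)
  entry≤size f i = subst (λ l → size (f i) ≤ size (encodeList l)) (sym (map-tabulate id f)) (go f i)
    where
    go : ∀ {n} (f : Fin n → Tree) i → size (f i) ≤ size (encodeList (tabulate f))
    go f zero    = m≤n⇒m≤1+n (m≤m+n _ _)
    go f (suc i) = m≤n⇒m≤1+n (≤-trans (go (f ∘ suc) i) (m≤n+m _ (size (f zero))))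

  size-left : ∀ t → size (left t) ≤ size t
  size-left leaf       = ≤-refl
  size-left (node x y) = m≤n⇒m≤1+n (m≤m+n (size x) (size y))

  size-right : ∀ t → size (right t) ≤ size t
  size-right leaf       = ≤-refl
  size-right (node x y) = m≤n⇒m≤1+n (m≤n+m (size y) (size x))

  digit : Bool → ℕ → ℕ
  digit d x = if d then suc x else suc (suc x)

  saturated : ∀ z d {a b x y} → z ≤ x → z ≤ y → digit d (a + x) ⊓ z ≡ digit d (b + y) ⊓ z
  saturated z d {a} {b} z≤x z≤y =
    trans (m≥n⇒m⊓n≡n (above d (m≤n⇒m≤o+n a z≤x))) (sym (m≥n⇒m⊓n≡n (above d (m≤n⇒m≤o+n b z≤y))))
    where
    above : ∀ d {x} → z ≤ x → z ≤ digit d x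
    above false z≤x = m≤n⇒m≤1+n (m≤n⇒m≤1+n z≤x)
    above true  z≤x = m≤n⇒m≤1+n z≤x

  -- Below `z` the truncated sum is exact, and from `z` on both results stay at least `z`; hence
  -- equality up to the cut survives every further digit.
  double : ∀ z d {a v} → a ⊓ z ≡ v ⊓ z → digit d ((a ⊓ z) + a) ⊓ z ≡ digit d (v + v) ⊓ z
  double z d {a} {v} a≡v with ≤-total z a
  ... | inj₁ z≤a = saturated z d z≤a (m⊓n≡n⇒n≤m (trans (sym a≡v) (m≥n⇒m⊓n≡n z≤a)))
  ... | inj₂ a≤z with ≤-total z v
  ...   | inj₁ z≤v = saturated z d (m⊓n≡n⇒n≤m (trans a≡v (m≥n⇒m⊓n≡n z≤v))) z≤v
  ...   | inj₂ v≤z = cong (λ x → digit d x ⊓ z) (cong₂ _+_ (trans a≡v v≡) (trans (sym (m≤n⇒m⊓n≡m a≤z)) (trans a≡v v≡)))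
    where
    v≡ : v ⊓ z ≡ v
    v≡ = m≤n⇒m⊓n≡m v≤z

  exact : ∀ {a v z} → v < z → a ⊓ z ≡ v ⊓ z → a ≡ v
  exact {a} {v} {z} v<z a≡v with ≤-total z a
  ... | inj₁ z≤a = contradiction (≤-<-trans (m⊓n≡n⇒n≤m (trans (sym a≡v) (m≥n⇒m⊓n≡n z≤a))) v<z) (n≮n z)
  ... | inj₂ a≤z = trans (sym (m≤n⇒m⊓n≡m a≤z)) (trans a≡v (m≤n⇒m⊓n≡m (<⇒≤ v<z)))

  -- Two subtractions from `c` compute a minimum with `c`, and this ignores everything above `c`, so
  -- a number known only up to `z` suffices.
  monus-monus : ∀ {x v c z} → c ≤ z → x ⊓ z ≡ v ⊓ z → c ∸ ((c ∸ (x ⊓ z)) ⊓ z) ≡ v ⊓ c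
  monus-monus {x} {v} {c} {z} c≤z x≡v = begin
    c ∸ ((c ∸ (x ⊓ z)) ⊓ z) ≡⟨ cong (c ∸_) (m≤n⇒m⊓n≡m (≤-trans (m∸n≤m c (x ⊓ z)) c≤z)) ⟩
    c ∸ (c ∸ (x ⊓ z))       ≡⟨ cong (λ y → c ∸ (c ∸ y)) x≡v ⟩
    c ∸ (c ∸ (v ⊓ z))       ≡⟨ cong (_∸ (c ∸ (v ⊓ z))) (m⊓n+n∸m≡n (v ⊓ z) c) ⟨
    v ⊓ z ⊓ c + (c ∸ (v ⊓ z)) ∸ (c ∸ (v ⊓ z)) ≡⟨ m+n∸n≡m (v ⊓ z ⊓ c) (c ∸ (v ⊓ z)) ⟩
    v ⊓ z ⊓ c               ≡⟨ ⊓-assoc v z c ⟩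
    v ⊓ (z ⊓ c)             ≡⟨ cong (v ⊓_) (m≥n⇒m⊓n≡n c≤z) ⟩
    v ⊓ c                   ∎
    where open ≡-Reasoning

  record Root : Set where
    constructor root
    field
      I    : Instance
      Z    : ℕ
      ω    : Coins
      fits : size (encodeInstance I) ≤ Z
  open Root

  glob : Root → Tree
  glob r = node (coinTree (ω r)) (encodeInstance (I r))

  open Terms Root glob Z

  private variable
    Γ A B : Ty

  -- Numbers in bijective binary, least significant digit first: the digit
  -- false stands for 2 and true for 1.
  digits : ℕᵇ → List Bool
  digits Bin.zero = []
  digits 2[1+ x ] = false ∷ digits x
  digits 1+[2 x ] = true ∷ digits x

  encode-digits : ∀ x → encodeℕᵇ x ≡ encodeList (map fromBool (digits x))
  encode-digits Bin.zero = refl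
  encode-digits 2[1+ x ] = cong (node leaf) (encode-digits x)
  encode-digits 1+[2 x ] = cong (node (node leaf leaf)) (encode-digits x)

  value : List Bool → ℕ
  value = foldr (λ d v → digit d (v + v)) 0

  value-digits : ∀ x → value (digits x) ≡ Bin.toℕ x
  value-digits Bin.zero = refl
  value-digits 2[1+ x ] rewrite value-digits x | +-identityʳ (Bin.toℕ x) = cong suc (sym (+-suc (Bin.toℕ x) (Bin.toℕ x)))
  value-digits 1+[2 x ] rewrite value-digits x | +-identityʳ (Bin.toℕ x) = refl

  -- The inner fold reverses the digits, so that the outer one can apply Horner's rule from the most
  -- significant digit on.
  decodeT : Tm Γ (List′ Bool′) → Tm Γ Nat′
  decodeT l = foldT (foldT l nilT (consT v0 v1)) zeroT
    (letT (addT v1 v1) (ifT v1 (sucT v0) (sucT (sucT v0))))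

  -- Only the minimum with Z is correct, because doubling is truncated.
  decode≡value : (t : Tm Γ (List′ Bool′)) → ∀ r p → length (fn t r p) ≤ Z r →
                 fn (decodeT t) r p ⊓ Z r ≡ value (fn t r p) ⊓ Z r
  decode≡value t r p l≤ = trans (cong (_⊓ z) eq) (go l)
    where
    open ≡-Reasoning
    z = Z r
    l = fn t r p
    next : ℕ → Bool → ℕ
    next a d = digit d ((a ⊓ z) + a)
    eq : fn (decodeT t) r p ≡ foldr (flip next) 0 l
    eq = begin
      foldl next 0 (take z (reverse (take z l))) ≡⟨ cong (λ x → foldl next 0 (take z (reverse x))) (take-all z l l≤) ⟩
      foldl next 0 (take z (reverse l))          ≡⟨ cong (foldl next 0) (take-all z (reverse l) (≤-trans (≤-reflexive (length-reverse l)) l≤)) ⟩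
      foldl next 0 (reverse l)                   ≡⟨ reverse-foldl next 0 l ⟩
      foldr (flip next) 0 l ∎
    go : ∀ l → foldr (flip next) 0 l ⊓ z ≡ value l ⊓ z
    go []      = refl
    go (d ∷ l) = double z d (go l)

  lengthT : Tm Γ (List′ A) → Tm Γ Nat′
  lengthT l = foldT l zeroT (sucT v1)

  length-correct : (t : Tm Γ (List′ A)) → ∀ r p → length (fn t r p) ≤ Z r → fn (lengthT t) r p ≡ length (fn t r p)
  length-correct t r p l≤ = trans (cong (foldl _ 0) (take-all (Z r) _ l≤)) (trans (go 0 (fn t r p)) (+-identityʳ _))
    where
    go : ∀ {X : Set} n (l : List X) → foldl (λ a _ → suc a) n l ≡ length l + n
    go n []      = refl
    go n (_ ∷ l) = trans (go (suc n) l) (+-suc (length l) n)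

  rawListT : (t : Tm Γ Raw) {c : Root → ℕ} (f : ∀ r → Fin (c r) → Tree) →
             (∀ r p → fn t r p ≡ tabulateTree (f r)) → Tm Γ (List′ Raw)
  rawListT t {c} f eq = cast t (λ r p → map (f r) (allFin (c r)))
    λ r p → trans (eq r p) (cong encodeList (sym (map-id (map (f r) (allFin (c r))))))

  tableSort : (c : Root → ℕ) → (∀ r → c r ≤ Z r) → (f : ∀ r → Fin (c r) → Tree) (t : ∀ {Γ} → Tm Γ Raw) →
              (∀ {Γ} r (p : El Γ r) → fn (t {Γ}) r p ≡ tabulateTree (f r)) → Sort
  tableSort c c≤ f t eq = record
    { card = c ; card≤ = c≤
    ; cardT = λ {Γ} → lengthT (rawListT (t {Γ}) f eq)
    ; cardT≡ = λ {Γ} r p → trans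
        (length-correct (rawListT (t {Γ}) f eq) r p (≤-trans (≤-reflexive (len r)) (c≤ r))) (len r) }
    where
    len : ∀ r → length (map (f r) (allFin (c r))) ≡ c r
    len r = trans (length-map (f r) (allFin (c r))) (length-tabulate {n = c r} id)

  verticesT edgesT commoditiesT ΔT : Tm Γ Raw
  verticesT    = hdT (tlT globT)
  edgesT       = hdT (tlT (tlT globT))
  commoditiesT = hdT (tlT (tlT (tlT globT)))
  ΔT           = hdT (tlT (tlT (tlT (tlT globT))))

  component : ∀ r → (f : Tree → Tree) → (∀ x → size (f x) ≤ size x) → size (f (encodeInstance (I r))) ≤ Z r
  component r f le = ≤-trans (le _) (fits r)

  size-edges : ∀ x → size (left (right x)) ≤ size x
  size-edges x = ≤-trans (size-left (right x)) (size-right x)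

  size-commodities : ∀ x → size (left (right (right x))) ≤ size x
  size-commodities x = ≤-trans (size-edges (right x)) (size-right x)

  open Instance using (n; m; k; tail; head; b; s; t; Δ)

  edgeTree : ∀ r → Fin (m (I r)) → Tree
  edgeTree r e = encodeList (encodeFin (tail (I r) e) ∷ encodeFin (head (I r) e) ∷ encodeℕ (b (I r) e) ∷ [])

  commodityTree : ∀ r → Fin (k (I r)) → Tree
  commodityTree r i = encodeList (encodeFin (s (I r) i) ∷ encodeFin (t (I r) i) ∷ [])

  vertex edge commodity : Sort
  vertex = tableSort (n ∘ I) (λ r → ≤-trans (table≤size {n (I r)} encodeFin) (component r left size-left))
    (λ r → encodeFin) verticesT λ r p → refl
  edge = tableSort (m ∘ I) (λ r → ≤-trans (table≤size (edgeTree r)) (component r (left ∘ right) size-edges))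
    edgeTree edgesT λ r p → refl
  commodity = tableSort (k ∘ I)
    (λ r → ≤-trans (table≤size (commodityTree r)) (component r (left ∘ right ∘ right) size-commodities))
    commodityTree commoditiesT λ r p → refl

  digitsT : (t : Tm Γ Raw) (v : ∀ r → El Γ r → ℕ) → (∀ r p → fn t r p ≡ encodeℕ (v r p)) → Tm Γ (List′ Bool′)
  digitsT t v eq = cast t (λ r p → digits (Bin.fromℕ (v r p)))
    λ r p → trans (eq r p) (encode-digits (Bin.fromℕ (v r p)))

  numberT : (t : Tm Γ Raw) (v : ∀ r → El Γ r → ℕ) → (∀ r p → fn t r p ≡ encodeℕ (v r p)) → Tm Γ Nat′
  numberT t v eq = decodeT (digitsT t v eq)

  number-correct : (t : Tm Γ Raw) (v : ∀ r → El Γ r → ℕ) (eq : ∀ r p → fn t r p ≡ encodeℕ (v r p)) →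
    ∀ r p → size (encodeℕ (v r p)) ≤ Z r → fn (numberT t v eq) r p ⊓ Z r ≡ v r p ⊓ Z r
  number-correct t v eq r p le = trans
    (decode≡value (digitsT t v eq) r p (≤-trans length≤ le))
    (cong (_⊓ Z r) (trans (value-digits (Bin.fromℕ (v r p))) (Bin.toℕ-fromℕ (v r p))))
    where
    ds : List Bool
    ds = digits (Bin.fromℕ (v r p))
    length≤ : length ds ≤ size (encodeℕ (v r p))
    length≤ = begin
      length ds                              ≡⟨ length-map fromBool ds ⟨
      length (map fromBool ds)               ≤⟨ length≤size (map fromBool ds) ⟩
      size (encodeList (map fromBool ds))    ≡⟨ cong size (encode-digits (Bin.fromℕ (v r p))) ⟨
      size (encodeℕ (v r p))                 ∎
      where open ≤-Reasoning

  -- An index is less than its cardinality, hence less than the clock, and in that range decoding is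
  -- exact.
  indexT : ∀ σ (t : Tm Γ Raw) (i : ∀ r → El Γ r → Fin (card σ r)) → (∀ r p → fn t r p ≡ encodeFin (i r p)) →
           (∀ r p → size (encodeFin (i r p)) ≤ Z r) → Tm Γ (Fin′ (card σ))
  indexT σ t i eq le = cast (numberT t (λ r p → toℕ (i r p)) eq) i
    λ r p → cong unary (exact (≤-trans (Fin.toℕ<n (i r p)) (card≤ σ r)) (number-correct t (λ r p → toℕ (i r p)) eq r p (le r p)))

  minT : ∀ σ (t : Tm Γ Nat′) (v : ∀ r → El Γ r → ℕ) → (∀ r p → fn t r p ⊓ Z r ≡ v r p ⊓ Z r) → Tm Γ Nat′
  minT σ t v eq = cast (monusT (cardT σ) (monusT (cardT σ) t)) (λ r p → v r p ⊓ card σ r)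
    λ r p → cong unary (trans (cong (λ c → c ∸ ((c ∸ (fn t r p ⊓ Z r)) ⊓ Z r)) (cardT≡ σ r p))
                              (monus-monus (card≤ σ r) (eq r p)))

  edgeRecordT : Tm Γ (Fin′ (card edge)) → Tm Γ Raw
  edgeRecordT = entryT edge edgesT (λ r p → edgeTree r) λ r p → refl

  edgeTree≤ : ∀ r e → size (edgeTree r e) ≤ Z r
  edgeTree≤ r e = ≤-trans (entry≤size (edgeTree r) e) (component r (left ∘ right) size-edges)

  commodityTree≤ : ∀ r i → size (commodityTree r i) ≤ Z r
  commodityTree≤ r i = ≤-trans (entry≤size (commodityTree r) i) (component r (left ∘ right ∘ right) size-commodities)

  tailOfT headOfT : Tm Γ (Fin′ (card edge)) → Tm Γ (Fin′ (card vertex))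
  tailOfT e = indexT vertex (hdT (edgeRecordT e)) (λ r p → tail (I r) (fn e r p)) (λ r p → refl)
    λ r p → ≤-trans (size-left (edgeTree r (fn e r p))) (edgeTree≤ r _)
  headOfT e = indexT vertex (hdT (tlT (edgeRecordT e))) (λ r p → head (I r) (fn e r p)) (λ r p → refl)
    λ r p → ≤-trans (size-edges (edgeTree r (fn e r p))) (edgeTree≤ r _)

  capacityT : Tm Γ (Fin′ (card edge)) → Tm Γ Nat′
  capacityT e = minT commodity (numberT raw (λ r p → b (I r) (fn e r p)) (λ r p → refl)) (λ r p → b (I r) (fn e r p))
    λ r p → number-correct raw (λ r p → b (I r) (fn e r p)) (λ r p → refl) r p
              (≤-trans (size-commodities (edgeTree r (fn e r p))) (edgeTree≤ r _))
    where
    raw = hdT (tlT (tlT (edgeRecordT e)))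

  sourceT sinkT : Tm Γ (Fin′ (card commodity)) → Tm Γ (Fin′ (card vertex))
  sourceT i = indexT vertex (hdT (commodityRecordT i)) (λ r p → s (I r) (fn i r p)) (λ r p → refl)
    λ r p → ≤-trans (size-left (commodityTree r (fn i r p))) (commodityTree≤ r _)
    where commodityRecordT = entryT commodity commoditiesT (λ r p → commodityTree r) λ r p → refl
  sinkT i = indexT vertex (hdT (tlT (commodityRecordT i))) (λ r p → t (I r) (fn i r p)) (λ r p → refl)
    λ r p → ≤-trans (size-edges (commodityTree r (fn i r p))) (commodityTree≤ r _)
    where commodityRecordT = entryT commodity commoditiesT (λ r p → commodityTree r) λ r p → refl

  lengthBoundT : Tm Γ Nat′
  lengthBoundT {Γ} = minT vertex (numberT ΔT (λ r p → Δ (I r)) (λ r p → refl)) (λ r p → Δ (I r))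
    λ r p → number-correct {Γ} ΔT (λ r p → Δ (I r)) (λ r p → refl) r p
      (component r (left ∘ right ∘ right ∘ right) (λ x → ≤-trans (size-commodities (right x)) (size-right x)))

  Path Weights Candidate′ Routing′ : Ty
  Path       = List′ (Fin′ (card edge))
  Weights    = Arr (card edge) Nat′
  Candidate′ = Maybe′ (Nat′ ×ᵗ Path)
  Routing′   = Arr (card commodity) Path

  betterT : Tm Γ Candidate′ → Tm Γ (Nat′ ×ᵗ Path) → Tm Γ Candidate′
  betterT o x = maybeT o (ifT (ltT (fstT (wk x)) (fstT v0)) (justT (wk x)) (wk o)) (justT x)

  relaxT : Tm Γ Weights → Tm Γ (Arr (card vertex) Candidate′) → Tm Γ (Arr (card vertex) Candidate′)
  relaxT D best = cast
    (tabulateT vertex (foldFinT edge (atT vertex (wk best) v0)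
      (ifT (equalT vertex (tailOfT v0) v2)
        (maybeT (atT vertex (wk (wk (wk best))) (headOfT v0))
          (betterT v2 (pairT (addT (atT edge (wk (wk (wk (wk D)))) v1) (sucT (fstT v0))) (consT v1 (sndT v0))))
          v1)
        v1)))
    (λ r p → Spec.relax (I r) (Z r) (fn D r p) (fn best r p)) λ r p → refl

  routeT : Tm Γ Weights → Tm Γ Routing′
  routeT D = cast
    (tabulateT commodity (maybeT
      (atT vertex
        (iterT lengthBoundT
          (tabulateT vertex (ifT (equalT vertex v0 (sinkT v1)) (justT (pairT zeroT nilT)) nothingT))
          (relaxT (wk (wk D)) v0))
        (sourceT v0))
      (sndT v0) nilT))
    (λ r p → Spec.route (I r) (Z r) (fn D r p)) λ r p → refl

  memberOfT : Tm Γ (Fin′ (card edge)) → Tm Γ Path → Tm Γ Bool′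
  memberOfT e es = cast (memberT edge e es) (λ r p → Spec.member (I r) (Z r) (fn e r p) (fn es r p)) λ r p → refl

  countT : Tm Γ Routing′ → Tm Γ (Fin′ (card edge)) → Tm Γ Nat′
  countT R e = cast
    (foldFinT commodity zeroT (ifT (memberOfT (wk (wk e)) (atT commodity (wk (wk R)) v0)) (sucT v1) v1))
    (λ r p → Spec.count (I r) (Z r) (fn R r p) (fn e r p)) λ r p → refl

  updateT : Tm Γ Weights → Tm Γ Routing′ → Tm Γ Weights
  updateT D R = cast
    (tabulateT edge (monusT (addT (countT (wk R) v0) (atT edge (wk D) v0)) (capacityT v0)))
    (λ r p → Spec.update (I r) (Z r) (fn D r p) (fn R r p)) λ r p → refl

  roundsT : Tm Γ Nat′ → Tm Γ (List′ Routing′)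
  roundsT T = cast
    (sndT (iterT T (pairT (tabulateT edge zeroT) nilT)
      (letT (routeT (fstT v0)) (pairT (updateT (fstT v1) v0) (consT v0 (sndT v1))))))
    (λ r p → Spec.rounds (I r) (Z r) (fn T r p)) λ r p → refl

  logT : Tm Γ Nat′ → Tm Γ (Nat′ ×ᵗ Nat′)
  logT x = cast
    (iterT x (pairT zeroT (sucT zeroT))
      (ifT (ltT (sndT v0) (wk x)) (pairT (sucT (fstT v0)) (addT (sndT v0) (sndT v0))) v0))
    (λ r p → Truncated.log (Z r) (fn x r p)) λ r p → refl

  powT : Tm Γ Nat′ → Tm Γ Nat′
  powT q = cast (iterT q (sucT zeroT) (addT v0 v0)) (λ r p → Truncated.pow (Z r) (fn q r p)) λ r p → refl

  drawT : Tm Γ Nat′ → Tm Γ (List′ Bool′) → Tm Γ (List′ Bool′ ×ᵗ Nat′)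
  drawT q l = cast
    (iterT q (pairT l zeroT) (pairT (tailT (fstT v0))
      (letT (addT (sndT v0) (sndT v0)) (ifT (headT (fstT v1) falseT) (sucT v0) v0))))
    (λ r p → Truncated.draw (Z r) (fn q r p) (fn l r p)) λ r p → refl

  highT : Tm Γ (Fin′ (card edge)) → Tm Γ Bool′
  highT e = cast (ifT (ltT (capacityT e) lengthBoundT) falseT trueT)
    (λ r p → Spec.high (I r) (Z r) (fn e r p)) λ r p → refl

  Sampling′ : Ty
  Sampling′ = record
    { El  = λ r → Spec.Sampling (I r) (Z r)
    ; enc = λ {r} S → let open Spec.Sampling S in enc (Nat′ ×ᵗ Nat′ ×ᵗ Nat′ ×ᵗ Nat′ ×ᵗ List′ Routing′) {r} (p , R , T , M , Rs) }

  State′ : Ty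
  State′ = List′ Bool′ ×ᵗ Weights ×ᵗ Weights ×ᵗ Routing′

  module _ (S : Tm Γ Sampling′) where
    fieldsT : Tm Γ (Nat′ ×ᵗ Nat′ ×ᵗ Nat′ ×ᵗ Nat′ ×ᵗ List′ Routing′)
    fieldsT = cast S (λ r γ → let open Spec.Sampling (fn S r γ) in p , R , T , M , Rs) λ r γ → refl

    bitsT coinsT′ roundCountT halfT : Tm Γ Nat′
    bitsT       = fstT fieldsT
    coinsT′     = fstT (sndT fieldsT)
    roundCountT = fstT (sndT (sndT fieldsT))
    halfT       = fstT (sndT (sndT (sndT fieldsT)))

    routingsT : Tm Γ (List′ Routing′)
    routingsT = sndT (sndT (sndT (sndT fieldsT)))

  chargeT : Tm Γ Path → Tm Γ Path → Tm Γ Weights → Tm Γ Weights → Tm Γ Nat′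
  chargeT x y u v =
    foldFinT edge zeroT (ifT (highT v0)
      (addT (ifT (memberOfT v0 (wk (wk x))) (atT edge (wk (wk u)) v0) zeroT)
        (addT (ifT (memberOfT v0 (wk (wk y))) (atT edge (wk (wk v)) v0) zeroT) v1))
      v1)

  chooseT : Tm Γ Sampling′ → Tm Γ Weights → Tm Γ Weights → Tm Γ Path → Tm Γ Path → Tm Γ Nat′ → Tm Γ Path
  chooseT S u v x y c = cast
    (ifT (ltT (addT c (chargeT x y u v)) (addT (halfT S) (chargeT x y v u))) x y)
    (λ r p → Spec.choose (I r) (Z r) (fn S r p) (fn u r p) (fn v r p) (fn x r p) (fn y r p) (fn c r p)) λ r p → refl

  fractionalT : Tm Γ Sampling′ → Tm Γ (Fin′ (card commodity)) → Tm Γ (Fin′ (card edge)) → Tm Γ Nat′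
  fractionalT S i e = cast
    (foldT (routingsT S) zeroT (ifT (memberOfT (wk (wk e)) (atT commodity v0 (wk (wk i)))) (sucT v1) v1))
    (λ r p → Spec.fractional (I r) (Z r) (fn S r p) (fn i r p) (fn e r p)) λ r p → refl

  advanceT : Tm Γ Sampling′ → Tm Γ (Fin′ (card commodity)) → Tm Γ Weights → Tm Γ Weights → Tm Γ Routing′ →
             Tm Γ (List′ Bool′) → Tm Γ Path → Tm Γ State′
  advanceT S i u v P l x = cast
    (pairT l (pairT
      (tabulateT edge (addT (ifT (memberOfT v0 (wk x)) (roundCountT (wk S)) zeroT) (atT edge (wk u) v0)))
      (pairT (tabulateT edge (addT (fractionalT (wk S) (wk i) v0) (atT edge (wk v) v0)))
             (tabulateT commodity (ifT (equalT commodity v0 (wk i)) (wk x) (atT commodity (wk P) v0))))))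
    (λ r p → Spec.advance (I r) (Z r) (fn S r p) (fn i r p) (fn u r p) (fn v r p) (fn P r p) (fn l r p) (fn x r p))
    λ r p → refl

  pickT : Tm Γ Sampling′ → Tm Γ (Fin′ (card commodity)) → Tm Γ Nat′ → Tm Γ Path
  pickT S i a = cast (atT {A = Path} commodity (nthT (routingsT S) a (tabulateT commodity nilT)) i)
    (λ r p → Spec.pick (I r) (Z r) (fn S r p) (fn i r p) (fn a r p)) λ r p → refl

  stepT : Tm Γ Sampling′ → Tm Γ (Fin′ (card commodity)) → Tm Γ State′ → Tm Γ State′
  stepT S i st = cast
    (letT (drawT (bitsT S) (fstT st))
    (letT (drawT (wk (bitsT S)) (fstT v0))
    (letT (drawT (wk (wk (coinsT′ S))) (fstT v0))
    (advanceT (wk (wk (wk S))) (wk (wk (wk i))) u v P (fstT v0)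
      (chooseT (wk (wk (wk S))) u v
        (pickT (wk (wk (wk S))) (wk (wk (wk i))) (sndT v2))
        (pickT (wk (wk (wk S))) (wk (wk (wk i))) (sndT v1)) (sndT v0))))))
    (λ r p → Spec.step (I r) (Z r) (fn S r p) (fn i r p) (fn st r p)) λ r p → refl
    where
    u v : ∀ {A B D} → Tm (_ ▷ A ▷ B ▷ D) Weights
    u = wk (wk (wk (fstT (sndT st))))
    v = wk (wk (wk (fstT (sndT (sndT st)))))
    P : ∀ {A B D} → Tm (_ ▷ A ▷ B ▷ D) Routing′
    P = wk (wk (wk (sndT (sndT (sndT st)))))

  coinsT : Tm Γ (List′ Bool′)
  coinsT = cast (hdT globT) (λ r p → ω r) λ r p → refl

  sampleT : Tm Γ Sampling′ → Tm Γ Routing′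
  sampleT S = cast
    (sndT (sndT (sndT (foldFinT commodity
      (pairT coinsT (pairT (tabulateT edge zeroT) (pairT (tabulateT edge zeroT) (tabulateT commodity nilT))))
      (stepT (wk (wk S)) v0 v1)))))
    (λ r p → Spec.sample (I r) (Z r) (fn S r p) (ω r)) λ r p → refl

  lgT pT qT : Tm Γ Nat′
  lgT = fstT (logT (addT (cardT vertex) (addT (cardT edge) (addT (cardT commodity) (sucT (sucT zeroT))))))
  pT  = addT lgT (addT lgT lgT)
  qT  = sucT (sucT (sucT (sucT (sucT (sucT (sucT (sucT (sucT (sucT (fstT (logT (mulT lengthBoundT lgT))))))))))))

  lgT≡ : ∀ r (p : El Γ r) → fn (lgT {Γ}) r p ≡ Spec.lg (I r) (Z r)
  lgT≡ {Γ} r p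
    rewrite cardT≡ vertex {Γ} r p | cardT≡ edge {Γ} r p | cardT≡ commodity {Γ} r p = refl

  samplingT : Tm Γ Sampling′
  samplingT {Γ} = cast (pairT pT (pairT (sucT (addT qT pT)) (pairT (powT pT) (pairT (powT (addT qT pT)) (roundsT (powT pT))))))
    (λ r γ → Spec.parameters (I r) (Z r))
    λ r γ → cong (λ (x , y) → enc Sampling′ {r} (make r x y)) (cong₂ _,_ (lgT≡ {Γ} r γ) (qT≡ r γ))
    where
    make : ∀ r → ℕ → ℕ → Spec.Sampling (I r) (Z r)
    make r l q = record { p = p ; R = suc (q ⊕ p) ; T = pow p ; M = pow (q ⊕ p) ; Rs = Spec.rounds (I r) (Z r) (pow p) }
      where
      open Truncated (Z r)
      p = l ⊕ (l ⊕ l)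
    qT≡ : ∀ r (γ : El Γ r) → fn (qT {Γ}) r γ ≡ Spec.q (I r) (Z r)
    qT≡ r γ = cong (λ l → 10 + proj₁ (Truncated.log (Z r) ((Spec.Δ′ (I r) (Z r) ⊓ Z r) * (l ⊓ Z r)))) (lgT≡ {Γ} r γ)

  reverseT : Tm Γ (List′ A) → Tm Γ (List′ A)
  reverseT l = cast (foldT l nilT (consT v0 v1)) (λ r p → reverse (take (Z r) (fn l r p))) λ r p → refl

  -- In bijective binary the digit 2 turns into 1 with a carry, since 3 = 1 + 2 · 1, and the digit 1
  -- turns into 2.
  increment : List Bool → List Bool
  increment []          = true ∷ []
  increment (false ∷ l) = true ∷ increment l
  increment (true ∷ l)  = false ∷ l

  digits-suc : ∀ x → digits (Bin.suc x) ≡ increment (digits x)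
  digits-suc Bin.zero = refl
  digits-suc 2[1+ x ] = cong (true ∷_) (digits-suc x)
  digits-suc 1+[2 x ] = refl

  length-increment : ∀ l → length (increment l) ≤ suc (length l)
  length-increment []          = ≤-refl
  length-increment (false ∷ l) = s≤s (length-increment l)
  length-increment (true ∷ l)  = m≤n⇒m≤1+n ≤-refl

  incrementT : Tm Γ (List′ Bool′) → Tm Γ (List′ Bool′)
  incrementT l = letT
    (foldT l (pairT trueT nilT)
      (ifT (fstT v1)
        (ifT v0 (pairT falseT (consT falseT (sndT v1))) (pairT trueT (consT trueT (sndT v1))))
        (pairT falseT (consT v0 (sndT v1)))))
    (reverseT (ifT (fstT v0) (consT trueT (sndT v0)) (sndT v0)))

  increment-correct : (l : Tm Γ (List′ Bool′)) → ∀ r p → length (fn l r p) < Z r →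
                      fn (incrementT l) r p ≡ increment (fn l r p)
  increment-correct t r p l< = begin
    reverse (take z (finish (foldl carry (true , []) (take z l))))
      ≡⟨ cong (λ x → reverse (take z (finish (foldl carry (true , []) x)))) (take-all z l (<⇒≤ l<)) ⟩
    reverse (take z (finish (foldl carry (true , []) l)))
      ≡⟨ cong (λ x → reverse (take z x)) (trans (sym (reverse-involutive _)) (cong reverse (go true [] l))) ⟩
    reverse (take z (reverse (increment l)))
      ≡⟨ cong reverse (take-all z _ (≤-trans (≤-reflexive (length-reverse (increment l))) (≤-trans (length-increment l) l<))) ⟩
    reverse (reverse (increment l)) ≡⟨ reverse-involutive (increment l) ⟩
    increment l ∎
    where
    open ≡-Reasoning
    z = Z r
    l = fn t r p
    finish : Bool × List Bool → List Bool
    finish (c , a) = if c then true ∷ a else a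
    shift : ∀ d a (l : List Bool) → reverse (d ∷ a) ++ l ≡ reverse a ++ (d ∷ l)
    shift d a l = trans (cong (_++ l) (unfold-reverse d a)) (++-assoc (reverse a) (d ∷ []) l)
    carry : Bool × List Bool → Bool → Bool × List Bool
    carry (c , a) d = if c then (if d then (false , false ∷ a) else (true , true ∷ a)) else (false , d ∷ a)
    go : ∀ c a l → reverse (finish (foldl carry (c , a) l)) ≡ reverse a ++ (if c then increment l else l)
    go true  a []          = unfold-reverse true a
    go false a []          = sym (++-identityʳ (reverse a))
    go true  a (false ∷ l) = trans (go true (true ∷ a) l) (shift true a (increment l))
    go true  a (true ∷ l)  = trans (go false (false ∷ a) l) (shift false a l)
    go false a (d ∷ l)     = trans (go false (d ∷ a) l) (shift d a l)

  Code OutPath Output : Ty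
  Code    = record { El = λ r → Fin (m (I r)) ; enc = encodeFin }
  OutPath = List′ Code
  Output  = record { El = λ r → Instance.Routing (I r) ; enc = λ {r} → encodeRouting (I r) }

  -- Counting up from zero converts a unary index to binary; it is affordable because indices are
  -- below the clock.
  codeT : Tm Γ (Fin′ (card edge)) → Tm Γ Code
  codeT {Γ} e = cast (iterT (natT e) nilT (incrementT v0)) (λ r p → fn e r p) prf
    where
    prf : ∀ r p → encodeList (map fromBool (iter (toℕ (fn e r p) ⊓ Z r) (λ l → fn (incrementT {Γ ▷ List′ Bool′} v0) r (p , l)) [])) ≡ encodeFin (fn e r p)
    prf r p = begin
      encodeList (map fromBool (iter (i ⊓ Z r) f [])) ≡⟨ cong (λ j → encodeList (map fromBool (iter j f []))) (m≤n⇒m⊓n≡m (<⇒≤ i<)) ⟩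
      encodeList (map fromBool (iter i f []))         ≡⟨ cong (λ l → encodeList (map fromBool l)) (proj₁ (go i i<)) ⟩
      encodeList (map fromBool (digits (Bin.fromℕ' i))) ≡⟨ encode-digits (Bin.fromℕ' i) ⟨
      encodeℕᵇ (Bin.fromℕ' i)                         ≡⟨ cong encodeℕᵇ (Bin.fromℕ≡fromℕ' i) ⟨
      encodeℕ i ∎
      where
      open ≡-Reasoning
      i = toℕ (fn e r p)
      i< : i < Z r
      i< = ≤-trans (Fin.toℕ<n (fn e r p)) (card≤ edge r)
      f : List Bool → List Bool
      f l = fn (incrementT {Γ ▷ List′ Bool′} v0) r (p , l)
      iter-suc : ∀ {X : Set} n (f : X → X) x → iter (suc n) f x ≡ f (iter n f x)
      iter-suc zero    f x = refl
      iter-suc (suc n) f x = iter-suc n f (f x)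
      go : ∀ j → j < Z r → iter j f [] ≡ digits (Bin.fromℕ' j) × length (iter j f []) ≤ j
      go zero    _  = refl , z≤n
      go (suc j) j< with go j (<-trans (n<1+n j) j<)
      ... | eq , len = trans (trans (iter-suc j f []) step) (trans (cong increment eq) (sym (digits-suc (Bin.fromℕ' j)))) ,
                       ≤-trans (≤-reflexive (cong length (trans (iter-suc j f []) step)))
                               (≤-trans (length-increment (iter j f [])) (s≤s len))
        where
        step : f (iter j f []) ≡ increment (iter j f [])
        step = increment-correct {Γ ▷ List′ Bool′} v0 r (p , iter j f []) (≤-<-trans len (<-trans (n<1+n j) j<))

  outPathT : Tm Γ Path → Tm Γ OutPath
  outPathT l = cast (reverseT (foldT l nilT (consT (codeT v0) v1))) (λ r p → take (Z r) (fn l r p))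
    λ r p → cong (enc OutPath {r}) (trans
      (cong reverse (take-all (Z r) _ (≤-trans (≤-reflexive (length-reverse (take (Z r) (fn l r p))))
                                             (≤-trans (≤-reflexive (length-take (Z r) (fn l r p))) (m⊓n≤m _ _)))))
      (reverse-involutive (take (Z r) (fn l r p))))

  solutionT : Tm Unit′ Output
  solutionT = cast
    (letT samplingT (letT (sampleT v0) (tabulateT commodity (outPathT (atT commodity v1 v0)))))
    (λ r p → Spec.solution (I r) (Z r) (ω r)) λ r p → refl

  Implements : (∀ I → ℕ → Coins → Instance.Routing I) → Prog → Set
  Implements f main = ∀ I Z ω → size (encodeInstance I) ≤ Z →
    ⟦ main ⟧ Z (node (coinTree ω) (encodeInstance I)) leaf ≡ encodeRouting I (f I Z ω)

  -- Abstracting over the term keeps the type checker from running its code.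
  implements : (t : Tm Unit′ Output) (f : ∀ I → ℕ → Coins → Instance.Routing I) →
               (∀ r → fn t r tt ≡ f (I r) (Z r) (ω r)) → ∃[ main ] Implements f main
  implements t f eq = code t , λ I Z ω fits →
    trans (ok t (root I Z ω fits) tt) (cong (encodeRouting I) (eq (root I Z ω fits)))

  -- Abstract, lest the running time of this program be evaluated.
  abstract
    realisation : ∃[ main ] Implements Spec.solution main
    realisation = implements solutionT Spec.solution λ r → refl

-- Finite sums over a commutative semiring

module Sum where

  open import Data.Bool.Base using (Bool; if_then_else_)
  open import Data.Fin.Base using (Fin; zero; suc)
  open import Data.Fin.Properties using (_≟_)
  open import Data.List.Base using (List; []; _∷_; map; foldr; allFin)
  open import Data.List.Properties using (map-tabulate)
  open import Data.Nat.Base using (ℕ)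
  open import Function.Base using (_∘_; id)
  open import Algebra.Structures using (IsCommutativeSemiring)
  open import Relation.Binary.PropositionalEquality
  open import Relation.Nullary.Decidable.Core using (does; yes; no)

  module Sums {R : Set} {_+_ _*_ : R → R → R} {0# 1# : R}
              (isCommutativeSemiring : IsCommutativeSemiring _≡_ _+_ _*_ 0# 1#) where
    open IsCommutativeSemiring isCommutativeSemiring
      using (+-assoc; +-comm; +-identityˡ; +-identityʳ; distribˡ; zeroˡ; zeroʳ; *-identityˡ)
    open ≡-Reasoning

    private variable
      A B : Set

    ∑ : List A → (A → R) → R
    ∑ xs f = foldr (λ x a → f x + a) 0# xs

    ind : Bool → R
    ind b = if b then 1# else 0#

    ∑-cong : ∀ (xs : List A) {f g} → (∀ x → f x ≡ g x) → ∑ xs f ≡ ∑ xs g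
    ∑-cong []       eq = refl
    ∑-cong (x ∷ xs) eq = cong₂ _+_ (eq x) (∑-cong xs eq)

    ∑-0 : ∀ (xs : List A) → ∑ xs (λ _ → 0#) ≡ 0#
    ∑-0 []       = refl
    ∑-0 (x ∷ xs) = trans (+-identityˡ _) (∑-0 xs)

    interchange : ∀ a b c d → (a + b) + (c + d) ≡ (a + c) + (b + d)
    interchange a b c d = begin
      (a + b) + (c + d) ≡⟨ +-assoc a b (c + d) ⟩
      a + (b + (c + d)) ≡⟨ cong (a +_) (trans (sym (+-assoc b c d)) (trans (cong (_+ d) (+-comm b c)) (+-assoc c b d))) ⟩
      a + (c + (b + d)) ≡⟨ +-assoc a c (b + d) ⟨
      (a + c) + (b + d) ∎

    ∑-+ : ∀ (xs : List A) (f g : A → R) → ∑ xs (λ x → f x + g x) ≡ ∑ xs f + ∑ xs g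
    ∑-+ []       f g = sym (+-identityˡ 0#)
    ∑-+ (x ∷ xs) f g = trans (cong ((f x + g x) +_) (∑-+ xs f g)) (interchange (f x) (g x) _ _)

    ∑-* : ∀ (xs : List A) a (f : A → R) → ∑ xs (λ x → a * f x) ≡ a * ∑ xs f
    ∑-* []       a f = sym (zeroʳ a)
    ∑-* (x ∷ xs) a f = trans (cong ((a * f x) +_) (∑-* xs a f)) (sym (distribˡ a (f x) _))

    ∑-swap : ∀ (xs : List A) (ys : List B) (f : A → B → R) → ∑ xs (λ x → ∑ ys (f x)) ≡ ∑ ys (λ y → ∑ xs (λ x → f x y))
    ∑-swap []       ys f = sym (∑-0 ys)
    ∑-swap (x ∷ xs) ys f = trans (cong (∑ ys (f x) +_) (∑-swap xs ys f)) (sym (∑-+ ys (f x) _))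

    ∑-map : ∀ (g : A → B) xs (f : B → R) → ∑ (map g xs) f ≡ ∑ xs (f ∘ g)
    ∑-map g []       f = refl
    ∑-map g (x ∷ xs) f = cong (f (g x) +_) (∑-map g xs f)

    ∑-Fin-suc : ∀ {n} (f : Fin (ℕ.suc n) → R) → ∑ (allFin (ℕ.suc n)) f ≡ f zero + ∑ (allFin n) (f ∘ suc)
    ∑-Fin-suc {n} f = cong (f zero +_) (trans (cong (λ l → ∑ l f) (sym (map-tabulate id suc))) (∑-map suc (allFin n) f))

    ∑-δ : ∀ {n} (i : Fin n) (f : Fin n → R) → ∑ (allFin n) (λ j → if does (j ≟ i) then f j else 0#) ≡ f i
    ∑-δ {ℕ.suc n} zero f = begin
      ∑ (allFin (ℕ.suc n)) (λ j → if does (j ≟ zero) then f j else 0#) ≡⟨ ∑-Fin-suc (λ j → if does (j ≟ zero) then f j else 0#) ⟩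
      f zero + ∑ (allFin n) (λ _ → 0#)                                 ≡⟨ cong (f zero +_) (∑-0 (allFin n)) ⟩
      f zero + 0#                                                      ≡⟨ +-identityʳ (f zero) ⟩
      f zero ∎
    ∑-δ {ℕ.suc n} (suc i) f = begin
      ∑ (allFin (ℕ.suc n)) (λ j → if does (j ≟ suc i) then f j else 0#)   ≡⟨ ∑-Fin-suc (λ j → if does (j ≟ suc i) then f j else 0#) ⟩
      0# + ∑ (allFin n) (λ j → if does (suc j ≟ suc i) then f (suc j) else 0#) ≡⟨ +-identityˡ _ ⟩
      ∑ (allFin n) (λ j → if does (suc j ≟ suc i) then f (suc j) else 0#) ≡⟨ ∑-cong (allFin n) lemma ⟩
      ∑ (allFin n) (λ j → if does (j ≟ i) then f (suc j) else 0#)         ≡⟨ ∑-δ i (f ∘ suc) ⟩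
      f (suc i) ∎
      where
      lemma : ∀ j → (if does (suc j ≟ suc i) then f (suc j) else 0#) ≡ (if does (j ≟ i) then f (suc j) else 0#)
      lemma j with j ≟ i
      ... | yes _ = refl
      ... | no  _ = refl

-- Natural sums, simple paths and loads

module Flow where

  open Machine using (iter)
  open Algorithm
  open Sum
  open import Data.Bool.Base using (Bool; true; false; if_then_else_; _∨_)
  open import Data.Bool.Properties using (∨-identityʳ; ∨-comm)
  open import Data.Empty using (⊥)
  open import Data.Fin.Base using (Fin; zero; suc)
  open import Data.Fin.Properties using (_≟_)
  open import Data.List.Base using (List; []; _∷_; map; foldl; foldr; allFin; length)
  open import Data.List.Properties using (take-all; length-tabulate; length-map)
  open import Data.List.Membership.Propositional using (_∈_)
  open import Data.List.Membership.Propositional.Properties using (∈-allFin)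
  open import Data.List.Relation.Unary.All using (All; []; _∷_)
  import Data.List.Relation.Unary.All as All
  open import Data.List.Relation.Unary.All.Properties using (¬Any⇒All¬)
  open import Data.List.Relation.Unary.AllPairs using ([]; _∷_)
  open import Data.List.Relation.Unary.Any using (here; there)
  open import Data.List.Relation.Unary.Unique.Propositional using (Unique)
  open import Data.Maybe.Base using (just; nothing; maybe′)
  open import Data.Nat.Base
  open import Data.Nat.Properties hiding (_≟_)
  open import Data.Nat.Tactic.RingSolver using (solve-∀)
  open import Data.Product.Base using (∃-syntax; _×_; _,_; proj₁; proj₂)
  open import Data.Sum.Base using (inj₁; inj₂)
  open import Data.Unit.Base using (⊤; tt)
  open import Function.Base using (_∘_; id)
  open import Relation.Binary.PropositionalEquality
  open import Relation.Nullary.Decidable.Core using (Dec; does; yes; no)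
  open import Relation.Nullary.Negation using (contradiction)

  open Sums +-*-isCommutativeSemiring public

  ∑-mono : ∀ {A : Set} (xs : List A) {f g : A → ℕ} → (∀ x → f x ≤ g x) → ∑ xs f ≤ ∑ xs g
  ∑-mono []       le = z≤n
  ∑-mono (x ∷ xs) le = +-mono-≤ (le x) (∑-mono xs le)

  ∑-const : ∀ {A : Set} (xs : List A) c → ∑ xs (λ _ → c) ≡ length xs * c
  ∑-const []       c = refl
  ∑-const (x ∷ xs) c = cong (c +_) (∑-const xs c)

  ∑-bound : ∀ {n} {f : Fin n → ℕ} {c} → (∀ i → f i ≤ c) → ∑ (allFin n) f ≤ n * c
  ∑-bound {n} {f} {c} le = ≤-trans (∑-mono (allFin n) le)
    (≤-reflexive (trans (∑-const (allFin n) c) (cong (_* c) (length-tabulate {n = n} id))))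

  term≤∑ : ∀ {n} (f : Fin n → ℕ) i → f i ≤ ∑ (allFin n) f
  term≤∑ {n} f i = ≤-trans (≤-reflexive (sym (∑-δ i f))) (∑-mono (allFin n) λ j → lemma j (j ≟ i))
    where
    lemma : ∀ j → (d : Dec (j ≡ i)) → (if does d then f j else 0) ≤ f j
    lemma j (yes _) = ≤-refl
    lemma j (no _)  = z≤n

  _∈ᵇ_ : ∀ {n} → Fin n → List (Fin n) → Bool
  e ∈ᵇ []       = false
  e ∈ᵇ (x ∷ es) = does (e ≟ x) ∨ (e ∈ᵇ es)

  ∈ᵇ⇒∈ : ∀ {n} (e : Fin n) es → e ∈ᵇ es ≡ true → e ∈ es
  ∈ᵇ⇒∈ e (x ∷ es) eq with e ≟ x
  ... | yes refl = here refl
  ... | no _     = there (∈ᵇ⇒∈ e es eq)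

  ∈⇒∈ᵇ : ∀ {n} {e : Fin n} {es} → e ∈ es → e ∈ᵇ es ≡ true
  ∈⇒∈ᵇ {e = e} {x ∷ es} (here refl) with e ≟ e
  ... | yes _ = refl
  ... | no ¬p = contradiction refl ¬p
  ∈⇒∈ᵇ {e = e} {x ∷ es} (there p) with e ≟ x
  ... | yes _ = refl
  ... | no  _ = ∈⇒∈ᵇ p

  ∑-unique : ∀ {n} (w : Fin n → ℕ) {es} → Unique es → ∑ es w ≡ ∑ (allFin n) (λ e → if e ∈ᵇ es then w e else 0)
  ∑-unique {n} w []             = sym (∑-0 (allFin n))
  ∑-unique {n} w {x ∷ es} (x∉ ∷ u) = begin
    w x + ∑ es w
      ≡⟨ cong₂ _+_ (sym (∑-δ x w)) (∑-unique w u) ⟩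
    ∑ (allFin n) (λ e → if does (e ≟ x) then w e else 0) + ∑ (allFin n) (λ e → if e ∈ᵇ es then w e else 0)
      ≡⟨ ∑-+ (allFin n) _ _ ⟨
    ∑ (allFin n) (λ e → (if does (e ≟ x) then w e else 0) + (if e ∈ᵇ es then w e else 0))
      ≡⟨ ∑-cong (allFin n) disjoint ⟩
    ∑ (allFin n) (λ e → if e ∈ᵇ (x ∷ es) then w e else 0) ∎
    where
    open ≡-Reasoning
    disjoint : ∀ e → (if does (e ≟ x) then w e else 0) + (if e ∈ᵇ es then w e else 0)
                   ≡ (if does (e ≟ x) ∨ (e ∈ᵇ es) then w e else 0)
    disjoint e with e ≟ x
    ... | no  _    = refl
    ... | yes refl with e ∈ᵇ es in eq
    ...   | false = +-identityʳ (w e)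
    ...   | true  = contradiction refl (All.lookup x∉ (∈ᵇ⇒∈ e es eq))

  unique-length : ∀ {n} {es : List (Fin n)} → Unique es → length es ≤ n
  unique-length {n} {es} u = begin
    length es                                           ≡⟨ *-identityʳ (length es) ⟨
    length es * 1                                       ≡⟨ ∑-const es 1 ⟨
    ∑ es (λ _ → 1)                                      ≡⟨ ∑-unique (λ _ → 1) u ⟩
    ∑ (allFin n) (λ e → if e ∈ᵇ es then 1 else 0)       ≤⟨ ∑-bound (λ e → bit (e ∈ᵇ es)) ⟩
    n * 1                                               ≡⟨ *-identityʳ n ⟩
    n ∎
    where
    open ≤-Reasoning
    bit : ∀ b → (if b then 1 else 0) ≤ 1
    bit true  = ≤-refl
    bit false = z≤n

  unique-map⁻ : ∀ {A B : Set} (f : A → B) {xs} → Unique (map f xs) → Unique xs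
  unique-map⁻ f {[]}     []       = []
  unique-map⁻ f {x ∷ xs} (p ∷ u) = apart p ∷ unique-map⁻ f u
    where
    apart : ∀ {ys} → All (f x ≢_) (map f ys) → All (x ≢_) ys
    apart {[]}     []       = []
    apart {y ∷ ys} (q ∷ qs) = (λ eq → q (cong f eq)) ∷ apart qs

  ≺-true : ∀ Z {a b} → a ≤ Z → Truncated._≺_ Z a b ≡ true → a < b
  ≺-true Z {a} {b} a≤ eq rewrite m≤n⇒m⊓n≡m a≤ with b ∸ a in d
  ... | suc _ = m∸n≢0⇒n<m λ z → contradiction (trans (sym d) z) λ ()

  ≺-false : ∀ Z {a b} → a ≤ Z → Truncated._≺_ Z a b ≡ false → b ≤ a
  ≺-false Z {a} {b} a≤ eq rewrite m≤n⇒m⊓n≡m a≤ with b ∸ a in d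
  ... | zero = m∸n≡0⇒m≤n d

  module Paths (I : Instance) where
    open Instance I

    -- Weighted lengths count each edge as one more than its weight, so that a
    -- shortest walk repeats no vertex.
    weight : (E → ℕ) → List E → ℕ
    weight D es = ∑ es (suc ∘ D)

    Minimal : (E → ℕ) → V → ℕ → V → List E → Set
    Minimal D t j u es = ∀ {es′} → Walk u es′ t → length es′ ≤ j → weight D es ≤ weight D es′

    -- Reaching `v` takes at least one edge, and every edge has positive weight; so a return to a
    -- vertex could be cut out with profit.
    suffix : ∀ {D v t es} → v ∈ map head es → ∀ {u} → Walk u es t →
             ∃[ es′ ] Walk v es′ t × length es′ < length es × weight D es′ < weight D es
    suffix {D} (here refl) (_∷_ e {es} w) = es , w , ≤-refl , s≤s (m≤n+m _ (D e))
    suffix {D} (there p) (_∷_ e w) with suffix {D} p w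
    ... | es′ , w′ , l , q = es′ , w′ , m<n⇒m<1+n l , ≤-trans q (m≤n+m _ (suc (D e)))

    -- A suffix of a minimal walk is minimal for the remaining number of edges, as the dropped edge
    -- can be put back in front of any competitor.
    minimal⇒simple : ∀ D {t j u es} → Walk u es t → length es ≤ j → Minimal D t j u es → Unique (u ∷ map head es)
    minimal⇒simple D {es = []} w l min = [] ∷ []
    minimal⇒simple D {t} {suc j} (_∷_ e {es} w) (s≤s l) min =
      ¬Any⇒All¬ _ repeated ∷ minimal⇒simple D w l λ w′ l′ → +-cancelˡ-≤ (suc (D e)) _ _ (min (e ∷ w′) (s≤s l′))
      where
      repeated : tail e ∈ map head (e ∷ es) → ⊥
      repeated p with suffix {D} p (e ∷ w)
      ... | es′ , w′ , l′ , q = <⇒≱ q (min w′ (≤-trans (<⇒≤ l′) (s≤s l)))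

    path-length : ∀ {u es v} → IsPath u es v → length es ≤ n
    path-length {es = es} (_ , u) = ≤-trans (≤-reflexive (sym (length-map head es))) (≤-trans (n≤1+n _) (unique-length u))

    path-edges-unique : ∀ {u es v} → IsPath u es v → Unique es
    path-edges-unique (_ , _ ∷ u) = unique-map⁻ head u

  -- Correctness of the shortest path search

  module ShortestPaths (I : Instance) (Z : ℕ) where
    open Instance I
    open Truncated Z
    open Spec I Z hiding (step)
    open Paths I public

    member-∈ᵇ : ∀ e es → length es ≤ Z → member e es ≡ e ∈ᵇ es
    member-∈ᵇ e es l = trans (cong (foldl _ false) (take-all Z es l)) (trans (go es false) (∨-identityʳ _))
      where
      go : ∀ es b → foldl (λ a x → if does (e ≟ x) then true else a) b es ≡ (e ∈ᵇ es) ∨ b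
      go []       b = refl
      go (x ∷ es) b with e ≟ x
      ... | yes _ = trans (go es true) (∨-comm (e ∈ᵇ es) true)
      ... | no  _ = go es b

    module _ (D : E → ℕ) (w : ℕ) (D≤ : ∀ e → suc (D e) ≤ w) (fits : suc Δ′ * w ≤ Z) (t : V) where

      Sound : ℕ → V → Candidate → Set
      Sound j v nothing         = ⊤
      Sound j v (just (c , es)) = Walk v es t × length es ≤ j × c ≡ weight D es

      Covers : Candidate → ℕ → Set
      Covers nothing        c = ⊥
      Covers (just (a , _)) c = a ≤ c

      weight-bound : ∀ es → weight D es ≤ length es * w
      weight-bound []       = z≤n
      weight-bound (e ∷ es) = +-mono-≤ (D≤ e) (weight-bound es)

      short-fits : ∀ es → length es ≤ suc Δ′ → weight D es ≤ Z
      short-fits es l = ≤-trans (weight-bound es) (≤-trans (*-monoˡ-≤ w l) fits)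

      module _ {x : ℕ × List E} (x≤ : proj₁ x ≤ Z) where

        better-sound : ∀ {j v} o → Sound j v o → Sound j v (just x) → Sound j v (better o x)
        better-sound nothing  p q = q
        better-sound (just y) p q with proj₁ x ≺ proj₁ y
        ... | true  = q
        ... | false = p

        better-covers : ∀ o {c} → Covers o c → Covers (better o x) c
        better-covers (just y) p with proj₁ x ≺ proj₁ y in eq
        ... | true  = ≤-trans (<⇒≤ (≺-true Z x≤ eq)) p
        ... | false = p

        better-new : ∀ o → Covers (better o x) (proj₁ x)
        better-new nothing  = ≤-refl
        better-new (just y) with proj₁ x ≺ proj₁ y in eq
        ... | true  = ≤-refl
        ... | false = ≺-false Z x≤ eq

      Best : ℕ → (V → Candidate) → Set
      Best j f = ∀ v → Sound j v (f v) × (∀ {es} → Walk v es t → length es ≤ j → Covers (f v) (weight D es))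

      covers-mono : ∀ o {a c} → Covers o a → a ≤ c → Covers o c
      covers-mono (just _) p q = ≤-trans p q

      start-best : Best 0 (start t)
      start-best v with v ≟ t
      ... | yes refl = ([] , z≤n , refl) , λ _ _ → z≤n
      ... | no v≢t   = tt , λ { [] z≤n → v≢t refl }

      -- A walk of at most j + 1 edges is empty or an edge followed by a walk of at most j edges,
      -- and the fold offers the best continuation when it meets that edge; other offers can only
      -- lower the cost.
      relax-best : ∀ {j} f → j < Δ′ → Best j f → Best (suc j) (relax D f)
      relax-best {j} f j< best v = proj₁ (all (allFin m)) , covers
        where
        step : E → Candidate → Candidate
        step e o = if does (tail e ≟ v)
          then maybe′ (λ c → better o (D e ⊕ suc (proj₁ c) , e ∷ proj₂ c)) o (f (head e)) else o
        new : ∀ e c → D e ⊕ suc c ≡ suc (D e) + c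
        new e c = trans (cong (_+ suc c) (m≤n⇒m⊓n≡m (≤-trans (<⇒≤ (D≤ e)) (≤-trans (m≤n*m w (suc Δ′)) fits)))) (+-suc (D e) c)
        weaken : ∀ o → Sound j v o → Sound (suc j) v o
        weaken nothing  _           = tt
        weaken (just _) (p , l , q) = p , m≤n⇒m≤1+n l , q
        step-sound : ∀ e o → Sound (suc j) v o → Sound (suc j) v (step e o)
        step-sound e o s with tail e ≟ v
        ... | no _ = s
        ... | yes refl with f (head e) | proj₁ (best (head e))
        ...   | nothing       | _           = s
        ...   | just (c , es) | p , l , refl rewrite new e (weight D es) =
          better-sound (short-fits (e ∷ es) (s≤s (≤-trans l (<⇒≤ j<)))) o s (e ∷ p , s≤s l , refl)
        step-covers : ∀ e o {c} → Covers o c → Covers (step e o) c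
        step-covers e o p with tail e ≟ v
        ... | no _ = p
        ... | yes refl with f (head e) | proj₁ (best (head e))
        ...   | nothing       | _           = p
        ...   | just (c , es) | _ , l , refl rewrite new e (weight D es) =
          better-covers (short-fits (e ∷ es) (s≤s (≤-trans l (<⇒≤ j<)))) o p
        step-new : ∀ e o {es} → tail e ≡ v → Walk (head e) es t → length es ≤ j → Covers (step e o) (weight D (e ∷ es))
        step-new e o {es} refl p l with tail e ≟ tail e
        ... | no ¬p = contradiction refl ¬p
        ... | yes _ with f (head e) | proj₁ (best (head e)) | proj₂ (best (head e)) p l
        ...   | just (c , es′) | _ , l′ , refl | le rewrite new e (weight D es′) =
          covers-mono (better o _) (better-new (short-fits (e ∷ es′) (s≤s (≤-trans l′ (<⇒≤ j<)))) o)
                      (+-monoʳ-≤ (suc (D e)) le)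
        all : ∀ xs → Sound (suc j) v (foldr step (f v) xs)
                   × (∀ {c} → Covers (f v) c → Covers (foldr step (f v) xs) c)
        all []       = weaken (f v) (proj₁ (best v)) , id
        all (e ∷ xs) with all xs
        ... | s , c = step-sound e _ s , step-covers e _ ∘ c
        reached : ∀ {e} xs → e ∈ xs → ∀ {es} → tail e ≡ v → Walk (head e) es t → length es ≤ j →
                  Covers (foldr step (f v) xs) (weight D (e ∷ es))
        reached (e ∷ xs) (here refl) eq p l = step-new e _ eq p l
        reached (x ∷ xs) (there q)   eq p l = step-covers x _ (reached xs q eq p l)
        covers : ∀ {es} → Walk v es t → length es ≤ suc j → Covers (relax D f v) (weight D es)
        covers [] _            = proj₂ (all (allFin m)) (proj₂ (best v) [] z≤n)
        covers (e ∷ p) (s≤s l) = reached (allFin m) (∈-allFin e) refl p l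

      search-best : ∀ i {j} f → i + j ≤ Δ′ → Best j f → Best (i + j) (iter i (relax D) f)
      search-best zero    f le best = best
      search-best (suc i) {j} f le best = subst (λ x → Best x (iter i (relax D) (relax D f))) (+-suc i j)
        (search-best i (relax D f) (≤-trans (≤-reflexive (+-suc i j)) le)
          (relax-best f (≤-trans (s≤s (m≤n+m j i)) le) best))

      -- The search minimises over walks, and a minimal walk within Δ′ edges turns out to be simple,
      -- so cycles never have to be removed. The competitor may be any walk, in particular a path of
      -- a feasible routing.
      route-correct : n ≤ Z → ∀ i → t ≡ Instance.t I i → ∀ {es} → Walk (s i) es t → length es ≤ Δ′ →
        IsPath (s i) (route D i) t × length (route D i) ≤ Δ′ × weight D (route D i) ≤ weight D es
      route-correct n≤Z i refl {es} p l = result (iter (Δ′ ⊓ Z) (relax D) (start t) (s i)) (best (s i))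
        where
        best : Best Δ′ (iter (Δ′ ⊓ Z) (relax D) (start t))
        best rewrite m≤n⇒m⊓n≡m (≤-trans (m⊓n≤n Δ n) n≤Z) =
          subst (λ x → Best x (iter Δ′ (relax D) (start t))) (+-identityʳ Δ′)
            (search-best Δ′ (start t) (≤-reflexive (+-identityʳ Δ′)) start-best)
        result : ∀ o → Sound Δ′ (s i) o × (∀ {es} → Walk (s i) es t → length es ≤ Δ′ → Covers o (weight D es)) →
          let r = maybe′ proj₂ [] o in IsPath (s i) r t × length r ≤ Δ′ × weight D r ≤ weight D es
        result nothing          (_ , c)              = contradiction (c p l) λ ()
        result (just (_ , es′)) ((q , l′ , refl) , c) = (q , minimal⇒simple D q l′ c) , l′ , c p l

  square-cancel : ∀ {x y} → x * x ≤ y * y → x ≤ y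
  square-cancel {x} {y} le with ≤-total x y
  ... | inj₁ x≤y = x≤y
  ... | inj₂ y≤x with m≤n⇒m<n∨m≡n y≤x
  ...   | inj₁ y<x  = contradiction le (<⇒≱ (*-mono-< y<x y<x))
  ...   | inj₂ refl = ≤-refl

  -- A positive part has at most the square of the number itself. Expanding the square of d + (l -
  -- b) and dropping -2lb gives the bound, with -2db moved to the left to stay in the naturals.
  monus-square : ∀ l d b → ((l + d) ∸ b) * ((l + d) ∸ b) + (d * b + d * b) ≤ d * d + (d * l + d * l) + (l * l + b * b)
  monus-square l d b with ≤-total (l + d) b
  ... | inj₁ le rewrite m≤n⇒m∸n≡0 le = begin
    d * b + d * b                           ≤⟨ cross d b (≤-trans (m≤n+m d l) le) ⟩
    d * d + b * b                           ≤⟨ +-mono-≤ (m≤m+n (d * d) (d * l + d * l)) (m≤n+m (b * b) (l * l)) ⟩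
    d * d + (d * l + d * l) + (l * l + b * b) ∎
    where
    open ≤-Reasoning
    cross : ∀ d b → d ≤ b → d * b + d * b ≤ d * d + b * b
    cross d b le with m≤n⇒∃[o]m+o≡n le
    ... | x , refl = ≤-trans (m≤m+n _ (x * x)) (≤-reflexive (eq d x))
      where
      eq : ∀ d x → d * (d + x) + d * (d + x) + x * x ≡ d * d + (d + x) * (d + x)
      eq = solve-∀
  ... | inj₂ b≤ with m≤n⇒∃[o]m+o≡n b≤
  ...   | x , eq = begin
    ((l + d) ∸ b) * ((l + d) ∸ b) + (d * b + d * b) ≡⟨ cong (λ y → y * y + (d * b + d * b)) (trans (cong (_∸ b) (sym eq)) (m+n∸m≡n b x)) ⟩
    x * x + (d * b + d * b)                        ≤⟨ m≤m+n _ (l * b + l * b) ⟩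
    x * x + (d * b + d * b) + (l * b + l * b)      ≡⟨ expand₁ x d b l ⟩
    x * x + ((l + d) * b + (l + d) * b)            ≡⟨ cong (λ y → x * x + (y * b + y * b)) eq ⟨
    x * x + ((b + x) * b + (b + x) * b)            ≡⟨ expand₂ x b ⟩
    (b + x) * (b + x) + b * b                      ≡⟨ cong (λ y → y * y + b * b) eq ⟩
    (l + d) * (l + d) + b * b                      ≡⟨ expand₃ l d b ⟩
    d * d + (d * l + d * l) + (l * l + b * b) ∎
    where
    open ≤-Reasoning
    expand₁ : ∀ x d b l → x * x + (d * b + d * b) + (l * b + l * b) ≡ x * x + ((l + d) * b + (l + d) * b)
    expand₁ = solve-∀
    expand₂ : ∀ x b → x * x + ((b + x) * b + (b + x) * b) ≡ (b + x) * (b + x) + b * b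
    expand₂ = solve-∀
    expand₃ : ∀ l d b → (l + d) * (l + d) + b * b ≡ d * d + (d * l + d * l) + (l * l + b * b)
    expand₃ = solve-∀

  module _ (I : Instance) where
    open Instance I

    flow : Routing → E → ℕ
    flow P e = ∑ (allFin k) (λ i → ind (e ∈ᵇ P i))

    load≡flow : ∀ P e → load P e ≡ flow P e
    load≡flow P e = go (allFin k)
      where
      open import Data.List.Membership.DecPropositional (_≟_ {m}) using (_∈?_)
      agree : ∀ es → does (e ∈? es) ≡ e ∈ᵇ es
      agree es with e ∈? es | e ∈ᵇ es in eq
      ... | yes p | true  = refl
      ... | yes p | false = trans (sym (∈⇒∈ᵇ p)) eq
      ... | no ¬p | true  = contradiction (∈ᵇ⇒∈ e es eq) ¬p
      ... | no ¬p | false = refl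
      go : ∀ is → length (Data.List.Base.filter (λ i → e ∈? P i) is) ≡ ∑ is (λ i → ind (e ∈ᵇ P i))
      go []       = refl
      go (i ∷ is) rewrite sym (agree (P i)) with does (e ∈? P i)
      ... | true  = cong suc (go is)
      ... | false = go is

    flow≤k : ∀ P e → flow P e ≤ k
    flow≤k P e = ≤-trans (∑-bound (λ i → bit (e ∈ᵇ P i))) (≤-reflexive (*-identityʳ k))
      where
      bit : ∀ b → ind b ≤ 1
      bit true  = ≤-refl
      bit false = z≤n

    -- Double counting; no edge may repeat on a path, because a load counts commodities and not
    -- visits.
    ∑-flow : ∀ P → (∀ i → Unique (P i)) → (w : E → ℕ) → ∑ (allFin k) (λ i → ∑ (P i) w) ≡ ∑ (allFin m) (λ e → w e * flow P e)
    ∑-flow P unique w = begin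
      ∑ (allFin k) (λ i → ∑ (P i) w)
        ≡⟨ ∑-cong (allFin k) (λ i → ∑-unique w (unique i)) ⟩
      ∑ (allFin k) (λ i → ∑ (allFin m) (λ e → if e ∈ᵇ P i then w e else 0))
        ≡⟨ ∑-swap (allFin k) (allFin m) _ ⟩
      ∑ (allFin m) (λ e → ∑ (allFin k) (λ i → if e ∈ᵇ P i then w e else 0))
        ≡⟨ ∑-cong (allFin m) (λ e → trans (∑-cong (allFin k) (λ i → scale (w e) (e ∈ᵇ P i))) (∑-* (allFin k) (w e) _)) ⟩
      ∑ (allFin m) (λ e → w e * flow P e) ∎
      where
      open ≡-Reasoning
      scale : ∀ x b → (if b then x else 0) ≡ x * ind b
      scale x true  = sym (*-identityʳ x)
      scale x false = sym (*-zeroʳ x)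

  -- The fractional solution by approachability

  module Approachability (I : Instance) (Z : ℕ) where
    open Instance I
    open Truncated Z
    open Spec I Z
    open ShortestPaths I Z

    Good : Routing → Set
    Good R = ∀ i → IsPath (s i) (R i) (t i) × length (R i) ≤ Δ′

    -- Twice mk for the unit added to every edge length, and twice mk² for the squares of loads and
    -- capacities.
    growth : ℕ
    growth = m * (k + k) + m * (k * k + k * k)

    potential : (E → ℕ) → ℕ
    potential D = ∑ (allFin m) (λ e → D e * D e)

    count≡flow : Δ′ ≤ Z → ∀ R → Good R → ∀ e → count R e ≡ flow I R e
    count≡flow Δ′≤Z R good e = go (allFin k)
      where
      go : ∀ is → foldr (λ i a → if member e (R i) then suc a else a) 0 is ≡ ∑ is (λ i → ind (e ∈ᵇ R i))
      go []       = refl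
      go (i ∷ is) rewrite member-∈ᵇ e (R i) (≤-trans (proj₂ (good i)) Δ′≤Z) with e ∈ᵇ R i
      ... | true  = cong suc (go is)
      ... | false = go is

    module _ {T : ℕ} (growth≤T : growth ≤ T) (n≤Z : n ≤ Z) (k≤Z : k ≤ Z) (T≤Z : T ≤ Z) (fits : suc Δ′ * suc T ≤ Z)
             {P : Routing} (feasible : IsShortRouting P) (loads : ∀ e → load P e ≤ b e) where

      flow≤b′ : ∀ e → flow I P e ≤ b′ e
      flow≤b′ e = ⊓-glb (≤-trans (≤-reflexive (sym (load≡flow I P e))) (loads e)) (flow≤k I P e)

      module _ (D : E → ℕ) (D≤T : ∀ e → D e ≤ T) where

        routed : ∀ i → IsPath (s i) (route D i) (t i) × length (route D i) ≤ Δ′ × weight D (route D i) ≤ weight D (P i)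
        routed i = route-correct D (suc T) (λ e → s≤s (D≤T e)) fits (t i) n≤Z i refl (proj₁ (proj₁ (feasible i)))
          (⊓-glb (proj₂ (feasible i)) (path-length (proj₁ (feasible i))))

        route-good : Good (route D)
        route-good i = proj₁ (routed i) , proj₁ (proj₂ (routed i))

        Δ′≤Z : Δ′ ≤ Z
        Δ′≤Z = ≤-trans (m⊓n≤n Δ n) n≤Z

        update≡ : ∀ e → update D (route D) e ≡ (flow I (route D) e + D e) ∸ b′ e
        update≡ e = trans
          (cong (λ c → ((c ⊓ Z) + D e) ∸ (b′ e ⊓ Z)) (count≡flow Δ′≤Z (route D) route-good e))
          (cong₂ (λ x y → (x + D e) ∸ y)
            (m≤n⇒m⊓n≡m (≤-trans (flow≤k I (route D) e) k≤Z))
            (m≤n⇒m⊓n≡m (≤-trans (m⊓n≤n (b e) k) k≤Z)))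

        -- The computed routing is cheapest for the lengths D + 1, hence no dearer than the feasible
        -- one, whose loads are at most b′. The unit part of these lengths costs the feasible
        -- routing at most mk.
        weighted-flow : ∑ (allFin m) (λ e → D e * flow I (route D) e) ≤ ∑ (allFin m) (λ e → D e * b′ e) + m * k
        weighted-flow = begin
          ∑ (allFin m) (λ e → D e * flow I (route D) e)
            ≤⟨ ∑-mono (allFin m) (λ e → *-monoˡ-≤ _ (n≤1+n (D e))) ⟩
          ∑ (allFin m) (λ e → suc (D e) * flow I (route D) e)
            ≡⟨ ∑-flow I (route D) (λ i → path-edges-unique (proj₁ (routed i))) (suc ∘ D) ⟨
          ∑ (allFin k) (λ i → weight D (route D i))
            ≤⟨ ∑-mono (allFin k) (λ i → proj₂ (proj₂ (routed i))) ⟩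
          ∑ (allFin k) (λ i → weight D (P i))
            ≡⟨ ∑-flow I P (λ i → path-edges-unique (proj₁ (feasible i))) (suc ∘ D) ⟩
          ∑ (allFin m) (λ e → flow I P e + D e * flow I P e)
            ≤⟨ ∑-mono (allFin m) (λ e → +-mono-≤ (flow≤k I P e) (*-monoʳ-≤ (D e) (flow≤b′ e))) ⟩
          ∑ (allFin m) (λ e → k + D e * b′ e)
            ≡⟨ ∑-+ (allFin m) _ _ ⟩
          ∑ (allFin m) (λ _ → k) + ∑ (allFin m) (λ e → D e * b′ e)
            ≤⟨ +-monoˡ-≤ _ (∑-bound {m} (λ _ → ≤-refl)) ⟩
          m * k + ∑ (allFin m) (λ e → D e * b′ e)
            ≡⟨ +-comm (m * k) _ ⟩
          ∑ (allFin m) (λ e → D e * b′ e) + m * k ∎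
          where open ≤-Reasoning

        -- The cross term in the new squares is twice the sum of D (load - b′), which
        -- `weighted-flow` bounds by 2mk; the other terms do not involve `D`.
        potential-growth : potential (update D (route D)) ≤ potential D + growth
        potential-growth = +-cancelʳ-≤ (∑ (allFin m) (λ e → D e * b′ e) + ∑ (allFin m) (λ e → D e * b′ e)) _ _ (begin
          potential (update D (route D)) + (B + B)
            ≡⟨ cong (potential (update D (route D)) +_) (sym (∑-+ (allFin m) _ _)) ⟩
          potential (update D (route D)) + ∑ (allFin m) (λ e → D e * b′ e + D e * b′ e)
            ≡⟨ ∑-+ (allFin m) _ _ ⟨
          ∑ (allFin m) (λ e → update D (route D) e * update D (route D) e + (D e * b′ e + D e * b′ e))
            ≤⟨ ∑-mono (allFin m) each ⟩
          ∑ (allFin m) (λ e → D e * D e + (D e * l e + D e * l e) + (k * k + k * k))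
            ≡⟨ trans (∑-+ (allFin m) _ _) (cong (_+ ∑ (allFin m) (λ _ → k * k + k * k)) (trans (∑-+ (allFin m) _ _) (cong (potential D +_) (∑-+ (allFin m) _ _)))) ⟩
          potential D + (F + F) + ∑ (allFin m) (λ _ → k * k + k * k)
            ≤⟨ +-mono-≤ (+-monoʳ-≤ (potential D) (+-mono-≤ weighted-flow weighted-flow)) (∑-bound {m} (λ _ → ≤-refl)) ⟩
          potential D + ((B + m * k) + (B + m * k)) + m * (k * k + k * k)
            ≡⟨ rearrange (potential D) B m k ⟩
          potential D + growth + (B + B) ∎)
          where
          open ≤-Reasoning
          l : E → ℕ
          l = flow I (route D)
          B F : ℕ
          B = ∑ (allFin m) (λ e → D e * b′ e)
          F = ∑ (allFin m) (λ e → D e * l e)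
          rearrange : ∀ p B m k → p + ((B + m * k) + (B + m * k)) + m * (k * k + k * k) ≡ p + (m * (k + k) + m * (k * k + k * k)) + (B + B)
          rearrange = solve-∀
          each : ∀ e → update D (route D) e * update D (route D) e + (D e * b′ e + D e * b′ e)
                     ≤ D e * D e + (D e * l e + D e * l e) + (k * k + k * k)
          each e rewrite update≡ e = ≤-trans (monus-square (l e) (D e) (b′ e))
            (+-monoʳ-≤ (D e * D e + (D e * l e + D e * l e)) (+-mono-≤ (*-mono-≤ (flow≤k I (route D) e) (flow≤k I (route D) e))
                                   (*-mono-≤ (m⊓n≤n (b e) k) (m⊓n≤n (b e) k))))

      record Progress (τ : ℕ) (state : (E → ℕ) × List Routing) : Set where
        field
          bounded : potential (proj₁ state) ≤ τ * growth
          good    : All Good (proj₂ state)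
          number  : length (proj₂ state) ≡ τ
          spread  : ∀ e → ∑ (proj₂ state) (λ R → flow I R e) ≤ proj₁ state e + τ * b′ e
      open Progress

      -- One square is at most the whole potential, hence at most `T * growth`. This is where `T`
      -- has to be at least `growth`.
      progress-bound : ∀ {τ state} → τ ≤ T → Progress τ state → ∀ e → proj₁ state e ≤ T
      progress-bound {τ} {D , _} τ≤T p e = square-cancel (begin
        D e * D e      ≤⟨ term≤∑ (λ e → D e * D e) e ⟩
        potential D    ≤⟨ bounded p ⟩
        τ * growth     ≤⟨ *-mono-≤ τ≤T growth≤T ⟩
        T * T          ∎)
        where open ≤-Reasoning

      progress : ∀ {τ state} → τ < T → Progress τ state → Progress (suc τ) (round state)
      progress {τ} {D , Rs} τ<T p = record
        { bounded = ≤-trans (potential-growth D D≤T) (≤-trans (+-monoˡ-≤ growth (bounded p)) (≤-reflexive (+-comm _ growth)))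
        ; good    = route-good D D≤T ∷ good p
        ; number  = cong suc (number p)
        ; spread  = λ e → begin
            flow I (route D) e + ∑ Rs (λ R → flow I R e)           ≤⟨ +-monoʳ-≤ (flow I (route D) e) (spread p e) ⟩
            flow I (route D) e + (D e + τ * b′ e)                  ≡⟨ +-assoc (flow I (route D) e) (D e) _ ⟨
            flow I (route D) e + D e + τ * b′ e                    ≤⟨ +-monoˡ-≤ (τ * b′ e) (m≤n+m∸n (flow I (route D) e + D e) (b′ e)) ⟩
            b′ e + ((flow I (route D) e + D e) ∸ b′ e) + τ * b′ e  ≡⟨ cong (λ x → b′ e + x + τ * b′ e) (update≡ D D≤T e) ⟨
            b′ e + update D (route D) e + τ * b′ e                 ≡⟨ rearrange (b′ e) _ _ ⟩
            update D (route D) e + (b′ e + τ * b′ e)               ∎ }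
        where
        open ≤-Reasoning
        D≤T : ∀ e → D e ≤ T
        D≤T = progress-bound (<⇒≤ τ<T) p
        rearrange : ∀ x y z → x + y + z ≡ y + (x + z)
        rearrange = solve-∀

      run : ∀ j {τ state} → j + τ ≤ T → Progress τ state → Progress (j + τ) (iter j round state)
      run zero    le p = p
      run (suc j) {τ} {state} le p = subst (λ x → Progress x (iter j round (round state))) (+-suc j τ)
        (run j (≤-trans (≤-reflexive (+-suc j τ)) le) (progress (≤-trans (s≤s (m≤n+m τ j)) le) p))

      -- The overload that remains after `T` rounds is at most `T`, one unit for each round.
      rounds-correct : All Good (rounds T) × length (rounds T) ≡ T ×
                       (∀ e → ∑ (rounds T) (λ R → flow I R e) ≤ T * suc (b′ e))
      rounds-correct rewrite m≤n⇒m⊓n≡m T≤Z = good final , trans (number final) (+-identityʳ T) , λ e →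
        ≤-trans (spread final e) (≤-trans (+-mono-≤ (progress-bound (≤-reflexive (+-identityʳ T)) final e)
          (≤-reflexive (cong (_* b′ e) (+-identityʳ T)))) (≤-reflexive (sym (*-suc T (b′ e)))))
        where
        final : Progress (T + 0) (iter T round ((λ _ → 0) , []))
        final = run T (≤-reflexive (+-identityʳ T)) record
          { bounded = ≤-reflexive (∑-0 (allFin m)) ; good = [] ; number = refl ; spread = λ e → z≤n }

-- Rational inequalities

module Rat where

  open Sum
  open import Algebra.Structures using (IsCommutativeRing)
  open import Data.Empty using (⊥)
  open import Data.List.Base using (List; []; _∷_; length)
  open import Data.Nat.Base as ℕ using (ℕ; zero; suc)
  import Data.Nat.Properties as ℕ
  open import Data.Product.Base using (_,_)
  open import Data.Rational.Base
  open import Data.Rational.Properties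
  open import Data.Sum.Base using (inj₁; inj₂)
  open import Relation.Binary.PropositionalEquality
  open import Relation.Nullary.Decidable.Core using (dec⇒maybe; yes; no)
  open import Relation.Nullary.Negation using (contradiction)
  import Tactic.RingSolver.Core.AlmostCommutativeRing as ACR
  open import Tactic.RingSolver using (solve-∀)

  ring : ACR.AlmostCommutativeRing _ _
  ring = ACR.fromCommutativeRing +-*-commutativeRing (λ x → dec⇒maybe (0ℚ ≟ x))

  open Sums (IsCommutativeRing.isCommutativeSemiring +-*-isCommutativeRing) public

  2ℚ : ℚ
  2ℚ = 1ℚ + 1ℚ

  0≤1 : 0ℚ ≤ 1ℚ
  0≤1 = nonNegative⁻¹ 1ℚ

  0≤2 : 0ℚ ≤ 2ℚ
  0≤2 = nonNegative⁻¹ 2ℚ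

  gap : ∀ {a b} d → 0ℚ ≤ d → b ≡ a + d → a ≤ b
  gap {a} d 0≤d refl = ≤-trans (≤-reflexive (sym (+-identityʳ a))) (+-monoʳ-≤ a 0≤d)

  0≤-gap : ∀ {a b} → a ≤ b → 0ℚ ≤ b - a
  0≤-gap {a} {b} a≤b = ≤-trans (≤-reflexive (sym (+-inverseʳ a))) (+-monoˡ-≤ (- a) a≤b)

  +-≥0 : ∀ {a b} → 0ℚ ≤ a → 0ℚ ≤ b → 0ℚ ≤ a + b
  +-≥0 p q = ≤-trans (≤-reflexive (sym (+-identityˡ 0ℚ))) (+-mono-≤ p q)

  *-mono : ∀ {a b c} → 0ℚ ≤ c → a ≤ b → c * a ≤ c * b
  *-mono {c = c} 0≤c a≤b = *-monoˡ-≤-nonNeg c {{nonNegative 0≤c}} a≤b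

  *-monoˡ : ∀ {a b c} → 0ℚ ≤ c → a ≤ b → a * c ≤ b * c
  *-monoˡ {c = c} 0≤c a≤b = *-monoʳ-≤-nonNeg c {{nonNegative 0≤c}} a≤b

  *-≥0 : ∀ {a b} → 0ℚ ≤ a → 0ℚ ≤ b → 0ℚ ≤ a * b
  *-≥0 {a} p q = ≤-trans (≤-reflexive (sym (*-zeroʳ a))) (*-mono p q)

  *-mono₂ : ∀ {a b c d} → 0ℚ ≤ a → 0ℚ ≤ d → a ≤ b → c ≤ d → a * c ≤ b * d
  *-mono₂ 0≤a 0≤d a≤b c≤d = ≤-trans (*-mono 0≤a c≤d) (*-monoˡ 0≤d a≤b)

  square≥0 : ∀ a → 0ℚ ≤ a * a
  square≥0 a with ≤-total 0ℚ a
  ... | inj₁ 0≤a = *-≥0 0≤a 0≤a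
  ... | inj₂ a≤0 = ≤-trans (*-≥0 0≤-a 0≤-a) (≤-reflexive (lemma a))
    where
    0≤-a : 0ℚ ≤ - a
    0≤-a = neg-antimono-≤ a≤0
    lemma : ∀ a → (- a) * (- a) ≡ a * a
    lemma = solve-∀ ring

  cancel : ∀ {a b r} → 0ℚ < r → r * a ≤ r * b → a ≤ b
  cancel {r = r} 0<r = *-cancelˡ-≤-pos r {{positive 0<r}}

  <⇒≱ : ∀ {a b} → a < b → b ≤ a → ⊥
  <⇒≱ p q = <-irrefl refl (<-≤-trans p q)

  square-cancel : ∀ {a b} → 0ℚ ≤ b → a * a ≤ b * b → a ≤ b
  square-cancel {a} {b} 0≤b le with a ≤? b
  ... | yes a≤b = a≤b
  ... | no  a≰b = contradiction le (<⇒≱ (≤-<-trans (*-mono 0≤b (<⇒≤ b<a)) (*-monoˡ-<-pos a {{positive (≤-<-trans 0≤b b<a)}} b<a)))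
    where
    b<a : b < a
    b<a = ≰⇒> a≰b

  ι : ℕ → ℚ
  ι zero    = 0ℚ
  ι (suc n) = 1ℚ + ι n

  ι≥0 : ∀ n → 0ℚ ≤ ι n
  ι≥0 zero    = ≤-refl
  ι≥0 (suc n) = +-≥0 0≤1 (ι≥0 n)

  ι-+ : ∀ m n → ι (m ℕ.+ n) ≡ ι m + ι n
  ι-+ zero    n = sym (+-identityˡ (ι n))
  ι-+ (suc m) n = trans (cong (1ℚ +_) (ι-+ m n)) (sym (+-assoc 1ℚ (ι m) (ι n)))

  ι-* : ∀ m n → ι (m ℕ.* n) ≡ ι m * ι n
  ι-* zero    n = sym (*-zeroˡ (ι n))
  ι-* (suc m) n = trans (ι-+ n (m ℕ.* n)) (trans (cong (ι n +_) (ι-* m n)) (lemma (ι m) (ι n)))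
    where
    lemma : ∀ a b → b + a * b ≡ (1ℚ + a) * b
    lemma = solve-∀ ring

  ι-mono : ∀ {m n} → m ℕ.≤ n → ι m ≤ ι n
  ι-mono {n = n} ℕ.z≤n   = ι≥0 n
  ι-mono (ℕ.s≤s le) = +-monoʳ-≤ 1ℚ (ι-mono le)

  ι-cancel : ∀ {m n} → ι m ≤ ι n → m ℕ.≤ n
  ι-cancel {m} {n} le with ℕ.≤-total m n
  ... | inj₁ m≤n = m≤n
  ... | inj₂ n≤m with ℕ.m≤n⇒∃[o]m+o≡n n≤m
  ...   | zero  , eq = ℕ.≤-reflexive (trans (sym eq) (ℕ.+-identityʳ n))
  ...   | suc o , eq = contradiction le (<⇒≱ (<-≤-trans n<1+n (ι-mono (ℕ.≤-trans (ℕ.≤-reflexive (ℕ.+-comm 1 n)) (ℕ.≤-trans (ℕ.+-monoʳ-≤ n (ℕ.s≤s (ℕ.z≤n {o}))) (ℕ.≤-reflexive eq))))))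
    where
    n<1+n : ι n < ι (suc n)
    n<1+n = ≤-<-trans (≤-reflexive (sym (+-identityˡ (ι n)))) (+-monoˡ-< (ι n) (positive⁻¹ 1ℚ))

  infixr 8 _^_
  _^_ : ℚ → ℕ → ℚ
  x ^ zero  = 1ℚ
  x ^ suc n = x * x ^ n

  ι-^ : ∀ m n → ι (m ℕ.^ n) ≡ ι m ^ n
  ι-^ m zero    = +-identityʳ 1ℚ
  ι-^ m (suc n) = trans (ι-* m (m ℕ.^ n)) (cong (ι m *_) (ι-^ m n))

  ^-≥0 : ∀ {x} → 0ℚ ≤ x → ∀ n → 0ℚ ≤ x ^ n
  ^-≥0 0≤x zero    = 0≤1
  ^-≥0 0≤x (suc n) = *-≥0 0≤x (^-≥0 0≤x n)

  ^-mono : ∀ {x y} → 0ℚ ≤ x → x ≤ y → ∀ n → x ^ n ≤ y ^ n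
  ^-mono 0≤x x≤y zero    = ≤-refl
  ^-mono 0≤x x≤y (suc n) = *-mono₂ 0≤x (^-≥0 (≤-trans 0≤x x≤y) n) x≤y (^-mono 0≤x x≤y n)

  ^-distrib-* : ∀ x y n → (x * y) ^ n ≡ x ^ n * y ^ n
  ^-distrib-* x y zero    = sym (*-identityˡ 1ℚ)
  ^-distrib-* x y (suc n) = trans (cong (x * y *_) (^-distrib-* x y n)) (lemma x y (x ^ n) (y ^ n))
    where
    lemma : ∀ x y a b → x * y * (a * b) ≡ x * a * (y * b)
    lemma = solve-∀ ring

  ^-+ : ∀ x m n → x ^ (m ℕ.+ n) ≡ x ^ m * x ^ n
  ^-+ x zero    n = sym (*-identityˡ (x ^ n))
  ^-+ x (suc m) n = trans (cong (x *_) (^-+ x m n)) (sym (*-assoc x (x ^ m) (x ^ n)))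

  ^-* : ∀ x m n → x ^ (m ℕ.* n) ≡ (x ^ n) ^ m
  ^-* x zero    n = refl
  ^-* x (suc m) n = trans (^-+ x n (m ℕ.* n)) (cong (x ^ n *_) (^-* x m n))

  1^ : ∀ n → 1ℚ ^ n ≡ 1ℚ
  1^ zero    = refl
  1^ (suc n) = trans (*-identityˡ (1ℚ ^ n)) (1^ n)

  bernoulli : ∀ {x} → 0ℚ ≤ x → ∀ n → 1ℚ + ι n * x ≤ (1ℚ + x) ^ n
  bernoulli {x} 0≤x zero    = ≤-reflexive (lemma x)
    where
    lemma : ∀ x → 1ℚ + 0ℚ * x ≡ 1ℚ
    lemma = solve-∀ ring
  bernoulli {x} 0≤x (suc n) = ≤-trans
    (gap (ι n * (x * x)) (*-≥0 (ι≥0 n) (square≥0 x)) (lemma x (ι n)))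
    (*-mono (+-≥0 0≤1 0≤x) (bernoulli 0≤x n))
    where
    lemma : ∀ x n → (1ℚ + x) * (1ℚ + n * x) ≡ 1ℚ + (1ℚ + n) * x + n * (x * x)
    lemma = solve-∀ ring

  -- (1 + x/r)^j ≤ 1 + jx/r + (jx/r)², with the denominators cleared.
  power-bound : ∀ {r x} n → 0ℚ ≤ r → 0ℚ ≤ r + x → ι n * x ≤ r →
                r * r * (r + x) ^ n ≤ r ^ n * (r * r + ι n * (r * x) + ι n * ι n * (x * x))
  power-bound {r} {x} n 0≤r 0≤r+x nx≤r = go n (λ j j≤n → below j j≤n)
    where
    below : ∀ j → j ℕ.≤ n → ι j * x ≤ r
    below j j≤n with ≤-total 0ℚ x
    ... | inj₁ 0≤x = ≤-trans (*-monoˡ 0≤x (ι-mono j≤n)) nx≤r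
    ... | inj₂ x≤0 = ≤-trans (≤-trans (*-mono (ι≥0 j) x≤0) (≤-reflexive (*-zeroʳ (ι j)))) 0≤r
    base : ∀ r x → r * r * 1ℚ ≡ 1ℚ * (r * r + 0ℚ * (r * x) + 0ℚ * 0ℚ * (x * x))
    base = solve-∀ ring
    regroup : ∀ r x p → r * r * ((r + x) * p) ≡ (r + x) * (r * r * p)
    regroup = solve-∀ ring
    expand : ∀ r x i p → r * p * (r * r + (1ℚ + i) * (r * x) + (1ℚ + i) * (1ℚ + i) * (x * x))
      ≡ (r + x) * (p * (r * r + i * (r * x) + i * i * (x * x))) + p * (x * x) * (i * (r - i * x) + r)
    expand = solve-∀ ring
    go : ∀ j → (∀ i → i ℕ.≤ j → ι i * x ≤ r) →
         r * r * (r + x) ^ j ≤ r ^ j * (r * r + ι j * (r * x) + ι j * ι j * (x * x))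
    go zero    h = ≤-reflexive (base r x)
    go (suc j) h = ≤-trans (≤-reflexive (regroup r x ((r + x) ^ j)))
      (≤-trans (*-mono 0≤r+x (go j (λ i i≤j → h i (ℕ.m≤n⇒m≤1+n i≤j))))
        (gap (r ^ j * (x * x) * (ι j * (r - ι j * x) + r))
          (*-≥0 (*-≥0 (^-≥0 0≤r j) (square≥0 x))
                (+-≥0 (*-≥0 (ι≥0 j) (0≤-gap (h j (ℕ.n≤1+n j)))) 0≤r))
          (expand r x (ι j) (r ^ j))))

  module _ {A : Set} where

    ∑-mono : ∀ (xs : List A) {f g : A → ℚ} → (∀ x → f x ≤ g x) → ∑ xs f ≤ ∑ xs g
    ∑-mono []       le = ≤-refl
    ∑-mono (x ∷ xs) le = +-mono-≤ (le x) (∑-mono xs le)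

    ∑-≥0 : ∀ (xs : List A) {f : A → ℚ} → (∀ x → 0ℚ ≤ f x) → 0ℚ ≤ ∑ xs f
    ∑-≥0 xs 0≤f = ≤-trans (≤-reflexive (sym (∑-0 xs))) (∑-mono xs 0≤f)

    ∑-const : ∀ (xs : List A) c → ∑ xs (λ _ → c) ≡ ι (length xs) * c
    ∑-const []       c = sym (*-zeroˡ c)
    ∑-const (x ∷ xs) c = trans (cong (c +_) (∑-const xs c)) (lemma c (ι (length xs)))
      where
      lemma : ∀ c n → c + n * c ≡ (1ℚ + n) * c
      lemma = solve-∀ ring

    -- In the induction the mixed term 2abP must be at most a²G + b²F. The squares of the two differ
    -- by (2ab)²(FG - P²) + (a²G - b²F)², which the induction hypothesis makes nonnegative.
    cauchy-schwarz : ∀ (xs : List A) (f g : A → ℚ) →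
      ∑ xs (λ x → f x * g x) * ∑ xs (λ x → f x * g x) ≤ ∑ xs (λ x → f x * f x) * ∑ xs (λ x → g x * g x)
    cauchy-schwarz []       f g = ≤-refl
    cauchy-schwarz (x ∷ xs) f g = gap
      ((F * G - P * P) + (f x * f x * G + g x * g x * F - 2ℚ * (f x * g x * P)))
      (+-≥0 (0≤-gap (cauchy-schwarz xs f g)) (0≤-gap middle)) (expand (f x) (g x) P F G)
      where
      P = ∑ xs (λ x → f x * g x)
      F = ∑ xs (λ x → f x * f x)
      G = ∑ xs (λ x → g x * g x)
      0≤F : 0ℚ ≤ F
      0≤F = ∑-≥0 xs λ x → square≥0 (f x)
      0≤G : 0ℚ ≤ G
      0≤G = ∑-≥0 xs λ x → square≥0 (g x)
      expand : ∀ a b P F G → (a * a + F) * (b * b + G)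
        ≡ (a * b + P) * (a * b + P) + ((F * G - P * P) + (a * a * G + b * b * F - 2ℚ * (a * b * P)))
      expand = solve-∀ ring
      square : ∀ a b P F G → (a * a * G + b * b * F) * (a * a * G + b * b * F)
        ≡ 2ℚ * (a * b * P) * (2ℚ * (a * b * P)) + (2ℚ * (a * b) * (2ℚ * (a * b)) * (F * G - P * P) + (a * a * G - b * b * F) * (a * a * G - b * b * F))
      square = solve-∀ ring
      middle : 2ℚ * (f x * g x * P) ≤ f x * f x * G + g x * g x * F
      middle = square-cancel (+-≥0 (*-≥0 (square≥0 (f x)) 0≤G) (*-≥0 (square≥0 (g x)) 0≤F))
        (gap _ (+-≥0 (*-≥0 (square≥0 (2ℚ * (f x * g x))) (0≤-gap (cauchy-schwarz xs f g)))
                     (square≥0 (f x * f x * G - g x * g x * F)))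
               (square (f x) (g x) P F G))

-- The self-balancing walk and its failure probability

module Rounding where

  open Rat
  open import Data.Fin.Base using (Fin)
  open import Data.Fin.Properties using (all?; ¬∀⟶∃¬)
  open import Data.List.Base using (List; []; _∷_; map; length; allFin; cartesianProductWith; _++_)
  open import Data.List.Membership.Propositional using (_∈_)
  open import Data.List.Membership.Propositional.Properties
    using (∈-allFin; ∈-map⁺; ∈-++⁺ˡ; ∈-cartesianProductWith⁺)
  open import Data.List.Relation.Unary.All.Properties using (++⁻ˡ; ++⁻ʳ; map⁻)
  open import Data.List.Relation.Unary.Any using (here; there)
  open import Data.List.Properties using (length-tabulate)
  open import Data.Nat.Base as ℕ using (ℕ; suc)
  import Data.Nat.Properties as ℕ
  open import Data.Product.Base using (_×_; _,_; proj₁; proj₂)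
  open import Data.Rational.Base hiding (_/_)
  open import Data.Rational.Properties
  open import Data.List.Relation.Unary.All using (All; []; _∷_)
  import Data.List.Relation.Unary.All as All
  open import Function.Base using (_∘_; id)
  open import Relation.Binary.Definitions using (tri<; tri≈; tri>)
  open import Relation.Nullary.Decidable.Core using (Dec; yes; no)
  open import Relation.Nullary.Negation using (contradiction)
  open import Relation.Binary.PropositionalEquality
  open import Tactic.RingSolver using (solve-∀)

  ∑-− : ∀ {A : Set} (xs : List A) (f g : A → ℚ) → ∑ xs (λ x → f x - g x) ≡ ∑ xs f - ∑ xs g
  ∑-− []       f g = refl
  ∑-− (x ∷ xs) f g = trans (cong ((f x - g x) +_) (∑-− xs f g)) (lemma (f x) (g x) (∑ xs f) (∑ xs g))
    where
    lemma : ∀ a b c d → (a - b) + (c - d) ≡ (a + c) - (b + d)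
    lemma = solve-∀ ring

  idempotent≤1 : ∀ {a} → a * a ≡ a → a ≤ 1ℚ
  idempotent≤1 {a} eq = gap ((1ℚ - a) * (1ℚ - a)) (square≥0 (1ℚ - a)) (begin
    1ℚ                                        ≡⟨ lemma a ⟩
    a + ((1ℚ - a) * (1ℚ - a) + (a - a * a))   ≡⟨ cong (λ s → a + ((1ℚ - a) * (1ℚ - a) + (a - s))) eq ⟩
    a + ((1ℚ - a) * (1ℚ - a) + (a - a))       ≡⟨ cong (λ s → a + ((1ℚ - a) * (1ℚ - a) + s)) (+-inverseʳ a) ⟩
    a + ((1ℚ - a) * (1ℚ - a) + 0ℚ)            ≡⟨ cong (a +_) (+-identityʳ _) ⟩
    a + (1ℚ - a) * (1ℚ - a) ∎)
    where
    open ≡-Reasoning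
    lemma : ∀ a → 1ℚ ≡ a + ((1ℚ - a) * (1ℚ - a) + (a - a * a))
    lemma = solve-∀ ring

  select : ∀ {P : Set} → Dec P → ℚ → ℚ → ℚ
  select (yes _) x y = x
  select (no _)  x y = y

  module _ {A : Set} where

    ∑-++ : ∀ (xs ys : List A) (f : A → ℚ) → ∑ (xs ++ ys) f ≡ ∑ xs f + ∑ ys f
    ∑-++ []       ys f = sym (+-identityˡ (∑ ys f))
    ∑-++ (x ∷ xs) ys f = trans (cong (f x +_) (∑-++ xs ys f)) (sym (+-assoc (f x) (∑ xs f) (∑ ys f)))

    ∑-mono-All : ∀ {f g : A → ℚ} {xs} → All (λ x → f x ≤ g x) xs → ∑ xs f ≤ ∑ xs g
    ∑-mono-All []       = ≤-refl
    ∑-mono-All (p ∷ ps) = +-mono-≤ p (∑-mono-All ps)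

    ∑-≥0-All : ∀ {f : A → ℚ} {xs} → All (λ x → 0ℚ ≤ f x) xs → 0ℚ ≤ ∑ xs f
    ∑-≥0-All []       = ≤-refl
    ∑-≥0-All (p ∷ ps) = +-≥0 p (∑-≥0-All ps)

    term≤∑ : ∀ {f : A → ℚ} {xs x} → All (λ x → 0ℚ ≤ f x) xs → x ∈ xs → f x ≤ ∑ xs f
    term≤∑ {f} {y ∷ xs} (p ∷ ps) (here refl) = gap (∑ xs f) (∑-≥0-All ps) refl
    term≤∑ {f} {y ∷ xs} {x} (p ∷ ps) (there q) =
      ≤-trans (term≤∑ ps q) (gap (f y) p (+-comm (f y) (∑ xs f)))

  module Mean (T : ℕ) (τ : ℚ) (0≤τ : 0ℚ ≤ τ) (τT≡1 : τ * ι T ≡ 1ℚ) where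

    X : Set
    X = Fin T

    μ : (X → ℚ) → ℚ
    μ f = τ * ∑ (allFin T) f

    μ-cong : ∀ {f g} → (∀ x → f x ≡ g x) → μ f ≡ μ g
    μ-cong eq = cong (τ *_) (∑-cong (allFin T) eq)

    μ-mono : ∀ {f g} → (∀ x → f x ≤ g x) → μ f ≤ μ g
    μ-mono le = *-mono 0≤τ (∑-mono (allFin T) le)

    μ-≥0 : ∀ {f} → (∀ x → 0ℚ ≤ f x) → 0ℚ ≤ μ f
    μ-≥0 le = *-≥0 0≤τ (∑-≥0 (allFin T) le)

    μ-+ : ∀ f g → μ (λ x → f x + g x) ≡ μ f + μ g
    μ-+ f g = trans (cong (τ *_) (∑-+ (allFin T) f g)) (*-distribˡ-+ τ _ _)

    μ-− : ∀ f g → μ (λ x → f x - g x) ≡ μ f - μ g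
    μ-− f g = trans (cong (τ *_) (∑-− (allFin T) f g)) (lemma τ _ _)
      where
      lemma : ∀ t a b → t * (a - b) ≡ t * a - t * b
      lemma = solve-∀ ring

    μ-* : ∀ a f → μ (λ x → a * f x) ≡ a * μ f
    μ-* a f = trans (cong (τ *_) (∑-* (allFin T) a f)) (lemma τ a _)
      where
      lemma : ∀ t a b → t * (a * b) ≡ a * (t * b)
      lemma = solve-∀ ring

    μ-const : ∀ a → μ (λ _ → a) ≡ a
    μ-const a = begin
      τ * ∑ (allFin T) (λ _ → a)          ≡⟨ cong (τ *_) (∑-const (allFin T) a) ⟩
      τ * (ι (length (allFin T)) * a)     ≡⟨ cong (λ n → τ * (ι n * a)) (length-tabulate {n = T} id) ⟩
      τ * (ι T * a)                       ≡⟨ *-assoc τ (ι T) a ⟨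
      τ * ι T * a                         ≡⟨ cong (_* a) τT≡1 ⟩
      1ℚ * a                              ≡⟨ *-identityˡ a ⟩
      a ∎
      where open ≡-Reasoning

    μ-∑ : ∀ {A : Set} (xs : List A) (f : A → X → ℚ) → μ (λ x → ∑ xs (λ a → f a x)) ≡ ∑ xs (λ a → μ (f a))
    μ-∑ xs f = trans (cong (τ *_) (∑-swap (allFin T) xs (λ x a → f a x))) (sym (∑-* xs τ _))

    jensen : ∀ f → μ f * μ f ≤ μ (λ x → f x * f x)
    jensen f = gap (μ (λ x → (f x - a) * (f x - a))) (μ-≥0 λ x → square≥0 (f x - a)) (begin
      μ (λ x → f x * f x)
        ≡⟨ lemma₁ (μ λ x → f x * f x) a ⟩
      a * a + (μ (λ x → f x * f x) - 2ℚ * a * a + a * a)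
        ≡⟨ cong (a * a +_) (cong₂ (λ u v → μ (λ x → f x * f x) - u + v) (sym (μ-* (2ℚ * a) f)) (sym (μ-const (a * a)))) ⟩
      a * a + (μ (λ x → f x * f x) - μ (λ x → 2ℚ * a * f x) + μ (λ _ → a * a))
        ≡⟨ cong (a * a +_) (trans (cong (_+ μ (λ _ → a * a)) (sym (μ-− (λ x → f x * f x) (λ x → 2ℚ * a * f x)))) (sym (μ-+ (λ x → f x * f x - 2ℚ * a * f x) (λ _ → a * a)))) ⟩
      a * a + μ (λ x → f x * f x - 2ℚ * a * f x + a * a)
        ≡⟨ cong (a * a +_) (μ-cong λ x → lemma₂ (f x) a) ⟩
      a * a + μ (λ x → (f x - a) * (f x - a)) ∎)
      where
      open ≡-Reasoning
      a = μ f
      lemma₁ : ∀ s a → s ≡ a * a + (s - 2ℚ * a * a + a * a)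
      lemma₁ = solve-∀ ring
      lemma₂ : ∀ f a → f * f - 2ℚ * a * f + a * a ≡ (f - a) * (f - a)
      lemma₂ = solve-∀ ring

  4ℚ 8ℚ : ℚ
  4ℚ = 2ℚ * 2ℚ
  8ℚ = 2ℚ * 4ℚ

  0≤8 : 0ℚ ≤ 8ℚ
  0≤8 = nonNegative⁻¹ 8ℚ

  3ℚ : ℚ
  3ℚ = 1ℚ + 2ℚ

  16ℚ : ℚ
  16ℚ = 8ℚ * 2ℚ

  module Walk-identities where

    identity₁ : ∀ a → a ≡ a - 2ℚ * a * a + a * a + a * a
    identity₁ = solve-∀ ring

    identity₂ : ∀ v a → (v - a) * (v - a) ≡ v * v - 2ℚ * a * v + a * a
    identity₂ = solve-∀ ring

    identity₃ : ∀ v a → v * v + a ≡ (v - a) * (v - a) + (a - a * a + 2ℚ * (v * a))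
    identity₃ = solve-∀ ring

    identity₄ : ∀ L → L + L ≡ 2ℚ * L
    identity₄ = solve-∀ ring

    identity₅ : ∀ f d y → f * (d * y) ≡ y * (d * f)
    identity₅ = solve-∀ ring

    identity₆ : ∀ h d y → h * (d * y * (d * y)) ≡ y * y * (h * (d * d))
    identity₆ = solve-∀ ring

    identity₇ : ∀ h t p i → h * ((t - i * p) * (t - i * p)) ≡ h * (t * t) - 2ℚ * i * (h * t * p) + i * i * (h * (p * p))
    identity₇ = solve-∀ ring

    identity₈ : ∀ c e P Q i → c * (e - 2ℚ * i * P + i * i * Q) ≡ c * e - (i * c) * (2ℚ * P) + (i * c) * (i * Q)
    identity₈ = solve-∀ ring

    identity₉ : ∀ e Z P Q i V → e + 2ℚ * Z ≡ (e - 2ℚ * P + i * Q + V) + ½ * (4ℚ * Z + 4ℚ * P - 3ℚ * V + (V - 2ℚ * (i * Q)))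
    identity₉ = solve-∀ ring

    identity₁₀ : ∀ a z → (a - z) * (a - z) ≡ 4ℚ * (z * z) + 4ℚ * (a * (a + z)) - 3ℚ * ((a + z) * (a + z))
    identity₁₀ = solve-∀ ring

    identity₁₁ : ∀ i L V → 2ℚ * (i * (2ℚ * L * V)) ≡ i * (4ℚ * L) * V
    identity₁₁ = solve-∀ ring

    identity₁₂ : ∀ w h t i p z → w * (h * (t - i * p) + z) ≡ w * (h * t + z) - i * (h * w * p)
    identity₁₂ = solve-∀ ring

    identity₁₃ : ∀ q → (- q) * (- q) ≡ q * q
    identity₁₃ = solve-∀ ring

    identity₁₄ : ∀ s q y → s * (q * y * (q * y)) ≡ q * q * (s * (y * y))
    identity₁₄ = solve-∀ ring

    identity₁₅ : ∀ y a → 1ℚ ≡ 2ℚ * (y + a) * (2ℚ * (y + a)) + ½ * ((1ℚ - 8ℚ * 2ℚ * (y * y)) + (1ℚ - 8ℚ * 2ℚ * (a * a)) + 8ℚ * ((y - a) * (y - a)))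
    identity₁₅ = solve-∀ ring

    identity₁₆ : ∀ u → (- (2ℚ * u)) * (- (2ℚ * u)) ≡ 2ℚ * u * (2ℚ * u)
    identity₁₆ = solve-∀ ring

    identity₁₇ : ∀ R u → (2ℚ * R - 1ℚ) + (1ℚ - - (2ℚ * u)) ≡ 2ℚ * (R + u)
    identity₁₇ = solve-∀ ring

    identity₁₈ : ∀ n u → 2ℚ * (n * u) ≡ n * (2ℚ * u)
    identity₁₈ = solve-∀ ring

    identity₁₉ : ∀ q y a → (1ℚ - q) * (y + a) ≡ y + a - q * y - a * q
    identity₁₉ = solve-∀ ring

    identity₂₀ : ∀ a → 0ℚ + a - a - a * 0ℚ ≡ 0ℚ
    identity₂₀ = solve-∀ ring

    identity₂₁ : ∀ q y a → (1ℚ - q) * ((y + a) * (y + a)) ≡ (1ℚ - q) * (y * y) + (2ℚ * a * ((1ℚ - q) * (y + a)) - a * a * (1ℚ - q))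
    identity₂₁ = solve-∀ ring

    identity₂₂ : ∀ s a → s ≡ s + (2ℚ * a * 0ℚ - a * a * 1ℚ) + a * a
    identity₂₂ = solve-∀ ring

    identity₂₃ : ∀ r p s → r * r * (p * s) ≡ p * (r * r * s)
    identity₂₃ = solve-∀ ring

    identity₂₄ : ∀ p s r n u → p * (s * (r * r + n * (r * u) + n * n * (u * u))) ≡ s * (r * r * p + n * r * (p * u) + n * n * (p * (u * u)))
    identity₂₄ = solve-∀ ring

    identity₂₅ : ∀ s r n v → s * (r * r * 1ℚ + n * r * 0ℚ + 2ℚ * r * (2ℚ * r) * (2ℚ * v)) ≡ r * (r * (s * (1ℚ + 8ℚ * v)))
    identity₂₅ = solve-∀ ring

    identity₂₆ : ∀ n s y a → n + (s + y) ≡ n + (s - a) + (y + a)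
    identity₂₆ = solve-∀ ring

    identity₂₇ : ∀ e → e + 0ℚ ≡ e + 2ℚ * 0ℚ
    identity₂₇ = solve-∀ ring

    identity₂₈ : ∀ a b c → a + b + c ≡ a + c + b
    identity₂₈ = solve-∀ ring

    identity₂₉ : ∀ a f z → a + 2ℚ * f + 2ℚ * z ≡ a + 2ℚ * (z + f)
    identity₂₉ = solve-∀ ring

    identity₃₀ : ∀ k → 1ℚ - 8ℚ * k * 0ℚ ≡ 1ℚ
    identity₃₀ = solve-∀ ring

    identity₃₁ : ∀ k K v → k * K * (8ℚ * v) ≡ K * (8ℚ * k * v)
    identity₃₁ = solve-∀ ring

    identity₃₂ : ∀ a g b → a * g * b ≡ g * (a * b)
    identity₃₂ = solve-∀ ring

    identity₃₃ : ∀ k v S → 1ℚ - 8ℚ * k * S ≡ (1ℚ + 8ℚ * k * v) * (1ℚ - 8ℚ * k * (v + S)) + (8ℚ * k * v * (8ℚ * k * S) + 8ℚ * k * v * (8ℚ * k * v))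
    identity₃₃ = solve-∀ ring

    identity₃₄ : ∀ k v S → 8ℚ * k * (v + S) ≡ 8ℚ * k * S + 8ℚ * k * v
    identity₃₄ = solve-∀ ring

    identity₃₅ : ∀ g a b → g * (a * b) ≡ a * (g * b)
    identity₃₅ = solve-∀ ring

    identity₃₆ : ∀ k v → 2ℚ * (8ℚ * k * v) ≡ k * (8ℚ * 2ℚ * v)
    identity₃₆ = solve-∀ ring

    identity₃₇ : ∀ t → 1ℚ - t ≡ ½ + ½ * (1ℚ - 2ℚ * t)
    identity₃₇ = solve-∀ ring

    identity₃₈ : ∀ t → 1ℚ ≡ t + (½ + ½ * (1ℚ - 2ℚ * t))
    identity₃₈ = solve-∀ ring

    identity₃₉ : ∀ j w → j * j ≡ w * w + (j - w) * (j - - w)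
    identity₃₉ = solve-∀ ring

    identity₄₀ : ∀ v a w j → 1ℚ + j ≡ w + (v - a) + ((1ℚ - v) + a + (j - w))
    identity₄₀ = solve-∀ ring

    identity₄₁ : ∀ v a w j → 1ℚ + j ≡ - (w + (v - a)) + ((1ℚ - a) + v + (j - - w))
    identity₄₁ = solve-∀ ring

    identity₄₂ : ∀ i a → - (i * a) ≡ i * (- a)
    identity₄₂ = solve-∀ ring

    identity₄₃ : ∀ h a b → - (h * (a - b)) ≡ h * (b - a)
    identity₄₃ = solve-∀ ring

    identity₄₄ : ∀ a → (- 1ℚ) * a ≡ - a
    identity₄₄ = solve-∀ ring

    identity₄₅ : ∀ c e → 16ℚ * (c * e) ≡ e + (16ℚ * ((c - 1ℚ) * e) + (16ℚ - 1ℚ) * e)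
    identity₄₅ = solve-∀ ring

    identity₄₆ : ∀ n x → 2ℚ * (n + x) ≡ n + (n - - (2ℚ * x))
    identity₄₆ = solve-∀ ring

    identity₄₇ : ∀ x → (- (2ℚ * x)) * (- (2ℚ * x)) ≡ 4ℚ * (x * x)
    identity₄₇ = solve-∀ ring

    identity₄₈ : ∀ M K → 4ℚ * (M * (2ℚ * (K + 1ℚ))) ≡ 8ℚ * M * (K + 1ℚ)
    identity₄₈ = solve-∀ ring

    identity₄₉ : ∀ h t z → 2ℚ * (h * (t * t)) + 2ℚ * (z * z) ≡ (h * t + z) * (h * t + z) + ((h * t - z) * (h * t - z) + 2ℚ * ((h - h * h) * (t * t)))
    identity₄₉ = solve-∀ ring

    identity₅₀ : ∀ a z → 1ℚ ≡ 16ℚ * ((a + z) * (a + z)) + ½ * ((1ℚ - 8ℚ * 8ℚ * (a * a)) + (1ℚ - 8ℚ * 8ℚ * (z * z)) + 8ℚ * 4ℚ * ((a - z) * (a - z)))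
    identity₅₀ = solve-∀ ring

    identity₅₁ : ∀ h d t → d * (h * t) ≡ h * d * (h * t) + (h - h * h) * (d * t)
    identity₅₁ = solve-∀ ring

    identity₅₂ : ∀ h d → h * d * (h * d) ≡ h * h * (d * d)
    identity₅₂ = solve-∀ ring

    identity₅₃ : ∀ L e K → K * (8ℚ * 8ℚ * (2ℚ * L * e)) ≡ 16ℚ * (8ℚ * L * K * e)
    identity₅₃ = solve-∀ ring

    identity₅₄ : ∀ w h s d → w * (h * (s * d) + 0ℚ) ≡ s * (h * w * d)
    identity₅₄ = solve-∀ ring

    identity₅₅ : ∀ t p q → t * (p * q) ≡ p * (q * t)
    identity₅₅ = solve-∀ ring

    identity₅₆ : ∀ p s g → p * (s * g) ≡ g * (p * s)
    identity₅₆ = solve-∀ ring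

    identity₅₇ : ∀ g r v → g * (r * v) ≡ r * (v * g)
    identity₅₇ = solve-∀ ring

    identity₅₈ : ∀ a → 1ℚ ≡ a * a + (1ℚ - a) * (1ℚ - - a)
    identity₅₈ = solve-∀ ring

  open Walk-identities

  -- At each step of the walk, two of T vectors are drawn and one of them is kept;
  -- h marks the edges on which the choice is biased against the deviation so
  -- far, and the bias is that deviation divided by c.
  record Setting : Set where
    field
      T       : ℕ
      τ       : ℚ
      0≤τ     : 0ℚ ≤ τ
      τT≡1    : τ * ι T ≡ 1ℚ
      m       : ℕ
      h       : Fin m → ℚ
      h²      : ∀ e → h e * h e ≡ h e
      L c c⁻¹ : ℚ
      0≤L     : 0ℚ ≤ L
      0≤c     : 0ℚ ≤ c
      0≤c⁻¹   : 0ℚ ≤ c⁻¹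
      c⁻¹c    : c⁻¹ * c ≡ 1ℚ
      4L≤c    : 4ℚ * L ≤ c

  module Walk (setting : Setting) where
    open Setting setting
    open Mean T τ 0≤τ τT≡1 public

    E : Set
    E = Fin m

    Vector : Set
    Vector = E → ℚ

    es : List E
    es = allFin m

    ⟪_,_⟫ : Vector → Vector → ℚ
    ⟪ f , g ⟫ = ∑ es (λ e → f e * g e)

    h≥0 : ∀ e → 0ℚ ≤ h e
    h≥0 e = ≤-trans (square≥0 (h e)) (≤-reflexive (h² e))

    h≤1 : ∀ e → h e ≤ 1ℚ
    h≤1 e = idempotent≤1 (h² e)

    record Block : Set where
      field
        v     : X → Vector
        v²    : ∀ x e → v x e * v x e ≡ v x e
        short : ∀ x → ∑ es (v x) ≤ L

      v≥0 : ∀ x e → 0ℚ ≤ v x e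
      v≥0 x e = ≤-trans (square≥0 (v x e)) (≤-reflexive (v² x e))

      v̄ : Vector
      v̄ e = μ (λ x → v x e)

      d : X → Vector
      d x e = v x e - v̄ e

      -- A 0-1 variable equals its square, so its variance is the mean minus the square of the mean.
      variance : ∀ e → μ (λ x → d x e * d x e) ≤ v̄ e
      variance e = gap (a * a) (square≥0 a) (trans (identity₁ a) (cong (_+ a * a) (sym (begin
        μ (λ x → d x e * d x e)                             ≡⟨ μ-cong (λ x → trans (identity₂ (v x e) a) (cong (λ s → s - 2ℚ * a * v x e + a * a) (v² x e))) ⟩
        μ (λ x → v x e - 2ℚ * a * v x e + a * a)            ≡⟨ trans (μ-+ (λ x → v x e - 2ℚ * a * v x e) (λ _ → a * a)) (cong₂ _+_ (μ-− (λ x → v x e) (λ x → 2ℚ * a * v x e)) (μ-const (a * a))) ⟩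
        a - μ (λ x → 2ℚ * a * v x e) + a * a                ≡⟨ cong (λ u → a - u + a * a) (μ-* (2ℚ * a) (λ x → v x e)) ⟩
        a - 2ℚ * a * a + a * a ∎))))
        where
        open ≡-Reasoning
        a = v̄ e

      v̄≥0 : ∀ e → 0ℚ ≤ v̄ e
      v̄≥0 e = μ-≥0 λ x → v≥0 x e

      d²≤ : ∀ x e → d x e * d x e ≤ v x e + v̄ e
      d²≤ x e = gap (v̄ e - v̄ e * v̄ e + 2ℚ * (v x e * v̄ e))
        (+-≥0 (0≤-gap (≤-trans (jensen (λ x → v x e)) (≤-reflexive (μ-cong λ x → v² x e)))) (*-≥0 0≤2 (*-≥0 (v≥0 x e) (v̄≥0 e))))
        (trans (cong (_+ v̄ e) (sym (v² x e))) (identity₃ (v x e) (v̄ e)))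

      norm : ∀ x → ∑ es (λ e → h e * (d x e * d x e)) ≤ 2ℚ * L
      norm x = begin
        ∑ es (λ e → h e * (d x e * d x e))  ≤⟨ ∑-mono es (λ e → ≤-trans (*-monoˡ (square≥0 (d x e)) (h≤1 e)) (≤-trans (≤-reflexive (*-identityˡ _)) (d²≤ x e))) ⟩
        ∑ es (λ e → v x e + v̄ e)            ≡⟨ ∑-+ es (v x) v̄ ⟩
        ∑ es (v x) + ∑ es v̄                 ≤⟨ +-mono-≤ (short x) (≤-trans (≤-reflexive (sym (μ-∑ es λ e x → v x e))) (≤-trans (μ-mono short) (≤-reflexive (μ-const L)))) ⟩
        L + L                               ≡⟨ identity₄ L ⟩
        2ℚ * L ∎
        where
        open ≤-Reasoning
    open Block public

    infixl 6 _⊹_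
    _⊹_ : Vector → Vector → Vector
    (f ⊹ g) e = f e + g e

    infixl 7 _⊙_
    _⊙_ : Vector → Vector → Vector
    (f ⊙ g) e = f e * g e

    energy : Vector → ℚ
    energy θ = ∑ es (λ e → h e * (θ e * θ e))

    -- A test measures a deviation w by ⟪ w , h ⊙ θ ⊹ ζ ⟫; θ is pulled back along
    -- the walk, and ζ is fixed.
    module Test (ζ : Vector) where

      full : Vector → Vector
      full θ = h ⊙ θ ⊹ ζ

      module _ (B : Block) (θ : Vector) where

        y a z : X → ℚ
        y x = ⟪ d B x , full θ ⟫
        a x = ⟪ d B x , h ⊙ θ ⟫
        z x = ⟪ d B x , ζ ⟫

        V : ℚ
        V = μ (λ x → y x * y x)

        -- The walk from `w` takes `x` with density 1 - c⁻¹ ⟪ d x , h ⊙ w ⟫. The drift of the test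
        -- that this causes is linear in `w`, with coefficients -c⁻¹ h e times the correlation of
        -- `d e` with `y`; `back` builds it into the test.
        pull : Vector
        pull e = μ (λ x → d B x e * y x)

        back : Vector
        back e = θ e - c⁻¹ * pull e

        y≡a+z : ∀ x → y x ≡ a x + z x
        y≡a+z x = trans (∑-cong es (λ e → *-distribˡ-+ (d B x e) (h e * θ e) (ζ e))) (∑-+ es (λ e → d B x e * (h e * θ e)) (λ e → d B x e * ζ e))

        ∑-pull : ∀ (f : Vector) → ∑ es (λ e → f e * pull e) ≡ μ (λ x → ⟪ d B x , f ⟫ * y x)
        ∑-pull f = begin
          ∑ es (λ e → f e * pull e)                       ≡⟨ ∑-cong es (λ e → μ-* (f e) _) ⟨
          ∑ es (λ e → μ (λ x → f e * (d B x e * y x)))    ≡⟨ μ-∑ es (λ e x → f e * (d B x e * y x)) ⟨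
          μ (λ x → ∑ es (λ e → f e * (d B x e * y x)))    ≡⟨ μ-cong (λ x → trans (∑-cong es λ e → identity₅ (f e) (d B x e) (y x)) (trans (∑-* es (y x) _) (*-comm (y x) _))) ⟩
          μ (λ x → ⟪ d B x , f ⟫ * y x) ∎
          where
          open ≡-Reasoning

        μ-d : ∀ e → μ (λ x → d B x e) ≡ 0ℚ
        μ-d e = trans (μ-− (λ x → v B x e) (λ _ → v̄ B e)) (trans (cong (λ s → v̄ B e - s) (μ-const (v̄ B e))) (+-inverseʳ (v̄ B e)))

        μ-⟪d⟫ : ∀ (f : Vector) → μ (λ x → ⟪ d B x , f ⟫) ≡ 0ℚ
        μ-⟪d⟫ f = begin
          μ (λ x → ⟪ d B x , f ⟫)                    ≡⟨ μ-∑ es (λ e x → d B x e * f e) ⟩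
          ∑ es (λ e → μ (λ x → d B x e * f e))       ≡⟨ ∑-cong es (λ e → trans (μ-cong λ x → *-comm (d B x e) (f e)) (trans (μ-* (f e) _) (trans (cong (f e *_) (μ-d e)) (*-zeroʳ (f e))))) ⟩
          ∑ es (λ _ → 0ℚ)                            ≡⟨ ∑-0 es ⟩
          0ℚ ∎
          where open ≡-Reasoning

        -- Jensen moves the square inside the mean, where y² factors out and leaves the norm of
        -- `d x` on the high edges, at most 2L.
        pull-norm : ∑ es (λ e → h e * (pull e * pull e)) ≤ 2ℚ * L * V
        pull-norm = begin
          ∑ es (λ e → h e * (pull e * pull e))
            ≤⟨ ∑-mono es (λ e → *-mono (h≥0 e) (jensen (λ x → d B x e * y x))) ⟩
          ∑ es (λ e → h e * μ (λ x → d B x e * y x * (d B x e * y x)))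
            ≡⟨ ∑-cong es (λ e → sym (μ-* (h e) _)) ⟩
          ∑ es (λ e → μ (λ x → h e * (d B x e * y x * (d B x e * y x))))
            ≡⟨ μ-∑ es (λ e x → h e * (d B x e * y x * (d B x e * y x))) ⟨
          μ (λ x → ∑ es (λ e → h e * (d B x e * y x * (d B x e * y x))))
            ≡⟨ μ-cong (λ x → trans (∑-cong es λ e → identity₆ (h e) (d B x e) (y x)) (∑-* es (y x * y x) _)) ⟩
          μ (λ x → y x * y x * ∑ es (λ e → h e * (d B x e * d B x e)))
            ≤⟨ μ-mono (λ x → *-mono (square≥0 (y x)) (norm B x)) ⟩
          μ (λ x → y x * y x * (2ℚ * L))
            ≡⟨ trans (μ-cong λ x → *-comm (y x * y x) (2ℚ * L)) (μ-* (2ℚ * L) _) ⟩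
          2ℚ * L * V ∎
          where
          open ≤-Reasoning

        -- Pulling back loses as much energy as the variance it produces, up to
        -- the contribution of the fixed part ζ.
        energy-back : c * energy back + V ≤ c * energy θ + 2ℚ * μ (λ x → z x * z x)
        energy-back = gap (½ * (μ (λ x → (a x - z x) * (a x - z x)) + (V - 2ℚ * (c⁻¹ * Q))))
          (*-≥0 (nonNegative⁻¹ ½) (+-≥0 (μ-≥0 λ x → square≥0 (a x - z x)) (0≤-gap Q≤)))
          (begin
            c * energy θ + 2ℚ * Z
              ≡⟨ identity₉ (c * energy θ) Z P Q c⁻¹ V ⟩
            (c * energy θ - 2ℚ * P + c⁻¹ * Q + V) + ½ * (4ℚ * Z + 4ℚ * P - 3ℚ * V + (V - 2ℚ * (c⁻¹ * Q)))
              ≡⟨ cong₂ (λ s t → s + V + ½ * (t + (V - 2ℚ * (c⁻¹ * Q)))) (sym expand) (sym squares) ⟩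
            (c * energy back + V) + ½ * (μ (λ x → (a x - z x) * (a x - z x)) + (V - 2ℚ * (c⁻¹ * Q))) ∎)
          where
          open ≡-Reasoning
          P Q Z : ℚ
          P = μ (λ x → a x * y x)
          Q = ∑ es (λ e → h e * (pull e * pull e))
          Z = μ (λ x → z x * z x)
          S : Vector
          S e = 2ℚ * c⁻¹ * (h e * θ e * pull e)
          expand : c * energy back ≡ c * energy θ - 2ℚ * P + c⁻¹ * Q
          expand = begin
            c * energy back
              ≡⟨ cong (c *_) (trans (∑-cong es λ e → identity₇ (h e) (θ e) (pull e) c⁻¹) (trans (∑-+ es (λ e → h e * (θ e * θ e) - S e) (λ e → c⁻¹ * c⁻¹ * (h e * (pull e * pull e)))) (cong₂ _+_ (trans (∑-− es (λ e → h e * (θ e * θ e)) S) (cong (λ s → energy θ - s) (trans (∑-* es (2ℚ * c⁻¹) (λ e → h e * θ e * pull e)) (cong (2ℚ * c⁻¹ *_) (∑-pull (h ⊙ θ)))))) (∑-* es (c⁻¹ * c⁻¹) (λ e → h e * (pull e * pull e)))))) ⟩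
            c * (energy θ - 2ℚ * c⁻¹ * P + c⁻¹ * c⁻¹ * Q)
              ≡⟨ identity₈ c (energy θ) P Q c⁻¹ ⟩
            c * energy θ - (c⁻¹ * c) * (2ℚ * P) + (c⁻¹ * c) * (c⁻¹ * Q)
              ≡⟨ cong (λ s → c * energy θ - s * (2ℚ * P) + s * (c⁻¹ * Q)) c⁻¹c ⟩
            c * energy θ - 1ℚ * (2ℚ * P) + 1ℚ * (c⁻¹ * Q)
              ≡⟨ cong₂ (λ s t → c * energy θ - s + t) (*-identityˡ (2ℚ * P)) (*-identityˡ (c⁻¹ * Q)) ⟩
            c * energy θ - 2ℚ * P + c⁻¹ * Q ∎
          squares : μ (λ x → (a x - z x) * (a x - z x)) ≡ 4ℚ * Z + 4ℚ * P - 3ℚ * V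
          squares = begin
            μ (λ x → (a x - z x) * (a x - z x))
              ≡⟨ μ-cong (λ x → trans (identity₁₀ (a x) (z x)) (cong (λ s → 4ℚ * (z x * z x) + 4ℚ * (a x * s) - 3ℚ * (s * s)) (sym (y≡a+z x)))) ⟩
            μ (λ x → 4ℚ * (z x * z x) + 4ℚ * (a x * y x) - 3ℚ * (y x * y x))
              ≡⟨ trans (μ-− (λ x → 4ℚ * (z x * z x) + 4ℚ * (a x * y x)) (λ x → 3ℚ * (y x * y x))) (cong₂ _-_ (trans (μ-+ (λ x → 4ℚ * (z x * z x)) (λ x → 4ℚ * (a x * y x))) (cong₂ _+_ (μ-* 4ℚ (λ x → z x * z x)) (μ-* 4ℚ (λ x → a x * y x)))) (μ-* 3ℚ (λ x → y x * y x))) ⟩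
            4ℚ * Z + 4ℚ * P - 3ℚ * V ∎
          -- The second-order term of the pullback takes at most half of the variance; this needs
          -- the divisor to be at least 4L.
          Q≤ : 2ℚ * (c⁻¹ * Q) ≤ V
          Q≤ = ≤-trans (*-mono 0≤2 (*-mono 0≤c⁻¹ pull-norm)) (≤-trans (≤-reflexive (identity₁₁ c⁻¹ L V))
            (≤-trans (*-monoˡ (μ-≥0 λ x → square≥0 (y x)) (≤-trans (*-mono 0≤c⁻¹ 4L≤c) (≤-reflexive c⁻¹c))) (≤-reflexive (*-identityˡ V))))

        module _ (w : Vector) where

          q : X → ℚ
          q x = c⁻¹ * ⟪ d B x , h ⊙ w ⟫

          ȳ : ℚ
          ȳ = μ (λ x → q x * y x)

          -- The expected value of the test after the step.
          measure-back : ⟪ w , full back ⟫ ≡ ⟪ w , full θ ⟫ - ȳ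
          measure-back = begin
            ⟪ w , full back ⟫
              ≡⟨ ∑-cong es (λ e → identity₁₂ (w e) (h e) (θ e) c⁻¹ (pull e) (ζ e)) ⟩
            ∑ es (λ e → w e * full θ e - c⁻¹ * ((h ⊙ w) e * pull e))
              ≡⟨ ∑-− es (λ e → w e * full θ e) (λ e → c⁻¹ * ((h ⊙ w) e * pull e)) ⟩
            ⟪ w , full θ ⟫ - ∑ es (λ e → c⁻¹ * ((h ⊙ w) e * pull e))
              ≡⟨ cong (λ s → ⟪ w , full θ ⟫ - s) (trans (∑-* es c⁻¹ (λ e → (h ⊙ w) e * pull e)) (cong (c⁻¹ *_) (∑-pull (h ⊙ w)))) ⟩
            ⟪ w , full θ ⟫ - c⁻¹ * μ (λ x → ⟪ d B x , h ⊙ w ⟫ * y x)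
              ≡⟨ cong (λ s → ⟪ w , full θ ⟫ - s) (trans (sym (μ-* c⁻¹ (λ x → ⟪ d B x , h ⊙ w ⟫ * y x))) (μ-cong (λ x → sym (*-assoc c⁻¹ ⟪ d B x , h ⊙ w ⟫ (y x))))) ⟩
            ⟪ w , full θ ⟫ - ȳ ∎
            where
            open ≡-Reasoning

          measure-step : ∀ x → ⟪ w ⊹ d B x , full θ ⟫ ≡ ⟪ w , full θ ⟫ + y x
          measure-step x = trans (∑-cong es λ e → *-distribʳ-+ (full θ e) (w e) (d B x e))
            (∑-+ es (λ e → w e * full θ e) (λ e → d B x e * full θ e))

          μ-y : μ y ≡ 0ℚ
          μ-y = μ-⟪d⟫ (full θ)

          μ-q : μ q ≡ 0ℚ
          μ-q = trans (μ-* c⁻¹ (λ x → ⟪ d B x , h ⊙ w ⟫)) (trans (cong (c⁻¹ *_) (μ-⟪d⟫ (h ⊙ w))) (*-zeroʳ c⁻¹))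

          μ-weights : μ (λ x → 1ℚ - q x) ≡ 1ℚ
          μ-weights = trans (μ-− (λ _ → 1ℚ) q) (trans (cong₂ _-_ (μ-const 1ℚ) μ-q) refl)

          module _ (N : ℕ) (1≤N : 1ℚ ≤ ι N) (q² : ∀ x → q x * q x ≤ 1ℚ) (y² : ∀ x → 8ℚ * 2ℚ * (y x * y x) ≤ 1ℚ)
                   (large : ι N ≤ 2ℚ * (ι N + ⟪ w , full back ⟫)) where

            q≤1 : ∀ x → q x ≤ 1ℚ
            q≤1 x = square-cancel 0≤1 (≤-trans (q² x) (≤-reflexive (sym (*-identityˡ 1ℚ))))

            -1≤q : ∀ x → - q x ≤ 1ℚ
            -1≤q x = square-cancel 0≤1 (≤-trans (≤-reflexive (identity₁₃ (q x))) (≤-trans (q² x) (≤-reflexive (sym (*-identityˡ 1ℚ)))))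

            R : ℚ
            R = ι N + ⟪ w , full back ⟫

            -- The increment centred for the tilted distribution, under which `y` has mean -`ȳ`.
            u : X → ℚ
            u x = y x + ȳ

            ȳ² : 8ℚ * 2ℚ * (ȳ * ȳ) ≤ 1ℚ
            ȳ² = begin
              8ℚ * 2ℚ * (ȳ * ȳ)                                 ≤⟨ *-mono 0≤16 (jensen (λ x → q x * y x)) ⟩
              8ℚ * 2ℚ * μ (λ x → q x * y x * (q x * y x))       ≡⟨ μ-* (8ℚ * 2ℚ) (λ x → q x * y x * (q x * y x)) ⟨
              μ (λ x → 8ℚ * 2ℚ * (q x * y x * (q x * y x)))     ≤⟨ μ-mono (λ x → ≤-trans (≤-reflexive (identity₁₄ (8ℚ * 2ℚ) (q x) (y x)))
                                                                     (≤-trans (*-mono₂ (square≥0 (q x)) 0≤1 (q² x) (y² x)) (≤-reflexive (*-identityˡ 1ℚ)))) ⟩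
              μ (λ _ → 1ℚ)                                      ≡⟨ μ-const 1ℚ ⟩
              1ℚ ∎
              where
              open ≤-Reasoning
              0≤16 : 0ℚ ≤ 8ℚ * 2ℚ
              0≤16 = nonNegative⁻¹ (8ℚ * 2ℚ)

            [2u]² : ∀ x → 2ℚ * u x * (2ℚ * u x) ≤ 1ℚ
            [2u]² x = gap (½ * ((1ℚ - 8ℚ * 2ℚ * (y x * y x)) + (1ℚ - 8ℚ * 2ℚ * (ȳ * ȳ)) + 8ℚ * ((y x - ȳ) * (y x - ȳ))))
              (*-≥0 (nonNegative⁻¹ ½) (+-≥0 (+-≥0 (0≤-gap (y² x)) (0≤-gap ȳ²)) (*-≥0 0≤8 (square≥0 (y x - ȳ)))))
              (identity₁₅ (y x) ȳ)

            2u≤1 : ∀ x → 2ℚ * u x ≤ 1ℚ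
            2u≤1 x = square-cancel 0≤1 (≤-trans ([2u]² x) (≤-reflexive (sym (*-identityˡ 1ℚ))))

            -2u≤1 : ∀ x → - (2ℚ * u x) ≤ 1ℚ
            -2u≤1 x = square-cancel 0≤1 (≤-trans (≤-reflexive (identity₁₆ (u x))) (≤-trans ([2u]² x) (≤-reflexive (sym (*-identityˡ 1ℚ)))))

            halve : ∀ {a} → 0ℚ ≤ 2ℚ * a → 0ℚ ≤ a
            halve 0≤2a = cancel (positive⁻¹ 2ℚ) (≤-trans (≤-reflexive (*-zeroʳ 2ℚ)) 0≤2a)

            0≤R : 0ℚ ≤ R
            0≤R = halve (≤-trans (ι≥0 N) large)

            0<R : 0ℚ < R
            0<R = *-cancelˡ-<-nonNeg 2ℚ {{nonNegative 0≤2}}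
              (<-≤-trans (≤-<-trans (≤-reflexive (*-zeroʳ 2ℚ)) (positive⁻¹ 1ℚ)) (≤-trans 1≤N large))

            0≤R+u : ∀ x → 0ℚ ≤ R + u x
            0≤R+u x = halve (≤-trans (+-≥0 (0≤-gap (≤-trans 1≤N large)) (0≤-gap (-2u≤1 x))) (≤-reflexive (identity₁₇ R (u x))))

            Nu≤R : ∀ x → ι N * u x ≤ R
            Nu≤R x = cancel (positive⁻¹ 2ℚ) (≤-trans (≤-reflexive (identity₁₈ (ι N) (u x)))
              (≤-trans (*-mono (ι≥0 N) (2u≤1 x)) (≤-trans (≤-reflexive (*-identityʳ (ι N))) large)))

            first-moment : μ (λ x → (1ℚ - q x) * u x) ≡ 0ℚ
            first-moment = begin
              μ (λ x → (1ℚ - q x) * (y x + ȳ))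
                ≡⟨ μ-cong (λ x → identity₁₉ (q x) (y x) ȳ) ⟩
              μ (λ x → y x + ȳ - q x * y x - ȳ * q x)
                ≡⟨ trans (μ-− (λ x → y x + ȳ - q x * y x) (λ x → ȳ * q x)) (cong₂ _-_ (trans (μ-− (λ x → y x + ȳ) (λ x → q x * y x)) (cong (_- ȳ) (trans (μ-+ y (λ _ → ȳ)) (cong₂ _+_ μ-y (μ-const ȳ))))) (trans (μ-* ȳ q) (cong (ȳ *_) μ-q))) ⟩
              0ℚ + ȳ - ȳ - ȳ * 0ℚ
                ≡⟨ identity₂₀ ȳ ⟩
              0ℚ ∎
              where
              open ≡-Reasoning

            -- Centring only lowers a second moment, and the density 1 - q is at most 2.
            second-moment : μ (λ x → (1ℚ - q x) * (u x * u x)) ≤ 2ℚ * V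
            second-moment = begin
              μ (λ x → (1ℚ - q x) * (u x * u x))
                ≡⟨ μ-cong (λ x → identity₂₁ (q x) (y x) ȳ) ⟩
              μ (λ x → (1ℚ - q x) * (y x * y x) + (2ℚ * ȳ * ((1ℚ - q x) * u x) - ȳ * ȳ * (1ℚ - q x)))
                ≡⟨ trans (μ-+ (λ x → (1ℚ - q x) * (y x * y x)) (λ x → 2ℚ * ȳ * ((1ℚ - q x) * u x) - ȳ * ȳ * (1ℚ - q x))) (cong (μ (λ x → (1ℚ - q x) * (y x * y x)) +_) (trans (μ-− (λ x → 2ℚ * ȳ * ((1ℚ - q x) * u x)) (λ x → ȳ * ȳ * (1ℚ - q x))) (cong₂ _-_ (trans (μ-* (2ℚ * ȳ) (λ x → (1ℚ - q x) * u x)) (cong (2ℚ * ȳ *_) first-moment)) (trans (μ-* (ȳ * ȳ) (λ x → 1ℚ - q x)) (cong (ȳ * ȳ *_) μ-weights))))) ⟩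
              μ (λ x → (1ℚ - q x) * (y x * y x)) + (2ℚ * ȳ * 0ℚ - ȳ * ȳ * 1ℚ)
                ≤⟨ gap (ȳ * ȳ) (square≥0 ȳ) (identity₂₂ (μ (λ x → (1ℚ - q x) * (y x * y x))) ȳ) ⟩
              μ (λ x → (1ℚ - q x) * (y x * y x))
                ≤⟨ μ-mono (λ x → *-monoˡ (square≥0 (y x)) (+-monoʳ-≤ 1ℚ (-1≤q x))) ⟩
              μ (λ x → 2ℚ * (y x * y x))
                ≡⟨ μ-* 2ℚ (λ x → y x * y x) ⟩
              2ℚ * V ∎
              where
              open ≤-Reasoning

            V≥0 : 0ℚ ≤ V
            V≥0 = μ-≥0 λ x → square≥0 (y x)

            -- The analogue of E exp u ≤ 1 + O(V). The base of the power is R + u, and `power-bound`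
            -- expands it to second order: the linear term has mean zero, and N ≤ 2R bounds the
            -- quadratic one by 4R² · 2V, whence the 8.
            step-bound : μ (λ x → (1ℚ - q x) * (ι N + ⟪ w ⊹ d B x , full θ ⟫) ^ N) ≤ R ^ N * (1ℚ + 8ℚ * V)
            step-bound = cancel 0<R (cancel 0<R (begin
              R * (R * μ (λ x → (1ℚ - q x) * (ι N + ⟪ w ⊹ d B x , full θ ⟫) ^ N))
                ≡⟨ trans (sym (*-assoc R R _)) (sym (μ-* (R * R) (λ x → (1ℚ - q x) * (ι N + ⟪ w ⊹ d B x , full θ ⟫) ^ N))) ⟩
              μ (λ x → R * R * ((1ℚ - q x) * (ι N + ⟪ w ⊹ d B x , full θ ⟫) ^ N))
                ≡⟨ μ-cong (λ x → trans (cong (λ s → R * R * ((1ℚ - q x) * s ^ N)) (shift x)) (identity₂₃ R (1ℚ - q x) ((R + u x) ^ N))) ⟩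
              μ (λ x → (1ℚ - q x) * (R * R * (R + u x) ^ N))
                ≤⟨ μ-mono (λ x → *-mono (0≤-gap (q≤1 x)) (power-bound N 0≤R (0≤R+u x) (Nu≤R x))) ⟩
              μ (λ x → (1ℚ - q x) * (R ^ N * (R * R + ι N * (R * u x) + ι N * ι N * (u x * u x))))
                ≡⟨ μ-cong (λ x → identity₂₄ (1ℚ - q x) (R ^ N) R (ι N) (u x)) ⟩
              μ (λ x → R ^ N * (R * R * (1ℚ - q x) + ι N * R * ((1ℚ - q x) * u x) + ι N * ι N * ((1ℚ - q x) * (u x * u x))))
                ≡⟨ moments ⟩
              R ^ N * (R * R * 1ℚ + ι N * R * 0ℚ + ι N * ι N * μ (λ x → (1ℚ - q x) * (u x * u x)))
                ≤⟨ *-mono (^-≥0 0≤R N) (+-monoʳ-≤ (R * R * 1ℚ + ι N * R * 0ℚ)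
                     (*-mono₂ (*-≥0 (ι≥0 N) (ι≥0 N)) (*-≥0 0≤2 V≥0) (*-mono₂ (ι≥0 N) (*-≥0 0≤2 0≤R) large large) second-moment)) ⟩
              R ^ N * (R * R * 1ℚ + ι N * R * 0ℚ + 2ℚ * R * (2ℚ * R) * (2ℚ * V))
                ≡⟨ identity₂₅ (R ^ N) R (ι N) V ⟩
              R * (R * (R ^ N * (1ℚ + 8ℚ * V))) ∎))
              where
              open ≤-Reasoning
              shift : ∀ x → ι N + ⟪ w ⊹ d B x , full θ ⟫ ≡ R + u x
              shift x = trans (cong (ι N +_) (measure-step x))
                (trans (identity₂₆ (ι N) ⟪ w , full θ ⟫ (y x) ȳ) (cong (λ s → ι N + s + u x) (sym measure-back)))
              f₀ f₁ f₂ : X → ℚ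
              f₀ x = 1ℚ - q x
              f₁ x = (1ℚ - q x) * u x
              f₂ x = (1ℚ - q x) * (u x * u x)
              moments : μ (λ x → R ^ N * (R * R * f₀ x + ι N * R * f₁ x + ι N * ι N * f₂ x))
                      ≡ R ^ N * (R * R * 1ℚ + ι N * R * 0ℚ + ι N * ι N * μ f₂)
              moments = trans (μ-* (R ^ N) (λ x → R * R * f₀ x + ι N * R * f₁ x + ι N * ι N * f₂ x)) (cong (R ^ N *_)
                (trans (μ-+ (λ x → R * R * f₀ x + ι N * R * f₁ x) (λ x → ι N * ι N * f₂ x)) (cong₂ _+_
                  (trans (μ-+ (λ x → R * R * f₀ x) (λ x → ι N * R * f₁ x)) (cong₂ _+_
                    (trans (μ-* (R * R) f₀) (cong (R * R *_) μ-weights))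
                    (trans (μ-* (ι N * R) f₁) (cong (ι N * R *_) first-moment))))
                  (μ-* (ι N * ι N) f₂))))

      -- The last block acts first: the test is carried from the end of the walk to its start. The
      -- result depends on the distributions of the blocks but not on the choices made.
      back* : List Block → Vector → Vector
      back* []       θ = θ
      back* (B ∷ bs) θ = back B (back* bs θ)

      variance* gain* : List Block → Vector → ℚ
      variance* []       θ = 0ℚ
      variance* (B ∷ bs) θ = V B (back* bs θ) + variance* bs θ
      gain* []       θ = 1ℚ
      gain* (B ∷ bs) θ = (1ℚ + 8ℚ * V B (back* bs θ)) * gain* bs θ

      fixed : Block → X → ℚ
      fixed B x = ⟪ d B x , ζ ⟫

      fixed* : List Block → ℚ
      fixed* []       = 0ℚ
      fixed* (B ∷ bs) = μ (λ x → fixed B x * fixed B x) + fixed* bs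

      variance≥0 : ∀ B θ → 0ℚ ≤ V B θ
      variance≥0 B θ = μ-≥0 λ x → square≥0 (y B θ x)

      variance*≥0 : ∀ bs θ → 0ℚ ≤ variance* bs θ
      variance*≥0 []       θ = ≤-refl
      variance*≥0 (B ∷ bs) θ = +-≥0 (variance≥0 B _) (variance*≥0 bs θ)

      gain*≥0 : ∀ bs θ → 0ℚ ≤ gain* bs θ
      gain*≥0 []       θ = 0≤1
      gain*≥0 (B ∷ bs) θ = *-≥0 (+-≥0 0≤1 (*-≥0 0≤8 (variance≥0 B _))) (gain*≥0 bs θ)

      energy* : ∀ bs θ → c * energy (back* bs θ) + variance* bs θ ≤ c * energy θ + 2ℚ * fixed* bs
      energy* []       θ = ≤-reflexive (identity₂₇ (c * energy θ))
      energy* (B ∷ bs) θ = begin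
        c * energy (back B θ′) + (V B θ′ + variance* bs θ)       ≡⟨ +-assoc (c * energy (back B θ′)) _ _ ⟨
        c * energy (back B θ′) + V B θ′ + variance* bs θ         ≤⟨ +-monoˡ-≤ (variance* bs θ) (energy-back B θ′) ⟩
        c * energy θ′ + 2ℚ * Z + variance* bs θ                  ≡⟨ identity₂₈ (c * energy θ′) (2ℚ * Z) (variance* bs θ) ⟩
        c * energy θ′ + variance* bs θ + 2ℚ * Z                  ≤⟨ +-monoˡ-≤ (2ℚ * Z) (energy* bs θ) ⟩
        c * energy θ + 2ℚ * fixed* bs + 2ℚ * Z                   ≡⟨ identity₂₉ (c * energy θ) (fixed* bs) Z ⟩
        c * energy θ + 2ℚ * (Z + fixed* bs)                      ∎
        where
        open ≤-Reasoning
        θ′ = back* bs θ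
        Z = μ (λ x → fixed B x * fixed B x)

      module _ (K : ℕ) (κ : ℚ) (0≤κ : 0ℚ ≤ κ) (κK≡1 : κ * ι K ≡ 1ℚ) where

        -- Takes the place of bounding a product by an exponential. Bernoulli gives 1 + 8V ≤ (1 +
        -- s)^K for s = 8κV, and (1 + s)(1 - t - s) ≤ 1 - t lets the second factor absorb it.
        gain-potential : ∀ bs θ → 8ℚ * κ * variance* bs θ ≤ 1ℚ → gain* bs θ * (1ℚ - 8ℚ * κ * variance* bs θ) ^ K ≤ 1ℚ
        gain-potential []       θ le = ≤-reflexive (trans (*-identityˡ _) (trans (cong (_^ K) (identity₃₀ κ)) (1^ K)))
        gain-potential (B ∷ bs) θ le = begin
          (1ℚ + 8ℚ * V₀) * gain* bs θ * (1ℚ - 8ℚ * κ * (V₀ + S)) ^ K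
            ≤⟨ *-monoˡ (^-≥0 (0≤-gap le) K) (*-monoˡ (gain*≥0 bs θ) (≤-trans (≤-reflexive scale) (bernoulli 0≤s K))) ⟩
          (1ℚ + s) ^ K * gain* bs θ * (1ℚ - 8ℚ * κ * (V₀ + S)) ^ K
            ≡⟨ trans (identity₃₂ ((1ℚ + s) ^ K) (gain* bs θ) ((1ℚ - 8ℚ * κ * (V₀ + S)) ^ K)) (cong (gain* bs θ *_) (sym (^-distrib-* (1ℚ + s) _ K))) ⟩
          gain* bs θ * ((1ℚ + s) * (1ℚ - 8ℚ * κ * (V₀ + S))) ^ K
            ≤⟨ *-mono (gain*≥0 bs θ) (^-mono (*-≥0 (+-≥0 0≤1 0≤s) (0≤-gap le)) (gap (s * t + s * s) (+-≥0 (*-≥0 0≤s 0≤t) (square≥0 s)) (identity₃₃ κ V₀ S)) K) ⟩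
          gain* bs θ * (1ℚ - t) ^ K
            ≤⟨ gain-potential bs θ (≤-trans (gap s 0≤s (identity₃₄ κ V₀ S)) le) ⟩
          1ℚ ∎
          where
          open ≤-Reasoning
          V₀ = V B (back* bs θ)
          S = variance* bs θ
          s t : ℚ
          s = 8ℚ * κ * V₀
          t = 8ℚ * κ * S
          0≤s : 0ℚ ≤ s
          0≤s = *-≥0 (*-≥0 0≤8 0≤κ) (variance≥0 B (back* bs θ))
          0≤t : 0ℚ ≤ t
          0≤t = *-≥0 (*-≥0 0≤8 0≤κ) (variance*≥0 bs θ)
          scale : 1ℚ + 8ℚ * V₀ ≡ 1ℚ + ι K * s
          scale = cong (1ℚ +_) (trans (sym (*-identityˡ (8ℚ * V₀))) (trans (cong (_* (8ℚ * V₀)) (sym κK≡1)) (identity₃₁ κ (ι K) V₀)))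

        -- Under the hypothesis the base in `gain-potential` is at least 1/2, so dividing by its
        -- K-th power costs at most 2^K.
        gain-bound : ∀ bs θ → 8ℚ * 2ℚ * variance* bs θ ≤ ι K → gain* bs θ ≤ 2ℚ ^ K
        gain-bound bs θ le = begin
          gain* bs θ                                ≡⟨ *-identityʳ (gain* bs θ) ⟨
          gain* bs θ * 1ℚ                           ≡⟨ cong (gain* bs θ *_) (trans (sym (1^ K)) (^-distrib-* 2ℚ ½ K)) ⟩
          gain* bs θ * (2ℚ ^ K * ½ ^ K)             ≡⟨ identity₃₅ (gain* bs θ) (2ℚ ^ K) (½ ^ K) ⟩
          2ℚ ^ K * (gain* bs θ * ½ ^ K)             ≤⟨ *-mono (^-≥0 0≤2 K) (*-mono (gain*≥0 bs θ) (^-mono (nonNegative⁻¹ ½) half≤ K)) ⟩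
          2ℚ ^ K * (gain* bs θ * (1ℚ - t) ^ K)      ≤⟨ *-mono (^-≥0 0≤2 K) (gain-potential bs θ t≤1) ⟩
          2ℚ ^ K * 1ℚ                               ≡⟨ *-identityʳ (2ℚ ^ K) ⟩
          2ℚ ^ K ∎
          where
          open ≤-Reasoning
          t : ℚ
          t = 8ℚ * κ * variance* bs θ
          2t≤1 : 2ℚ * t ≤ 1ℚ
          2t≤1 = ≤-trans (≤-reflexive (identity₃₆ κ (variance* bs θ))) (≤-trans (*-mono 0≤κ le) (≤-reflexive κK≡1))
          half≤ : ½ ≤ 1ℚ - t
          half≤ = gap (½ * (1ℚ - 2ℚ * t)) (*-≥0 (nonNegative⁻¹ ½) (0≤-gap 2t≤1)) (identity₃₇ t)
          t≤1 : t ≤ 1ℚ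
          t≤1 = gap (½ + ½ * (1ℚ - 2ℚ * t)) (+-≥0 (nonNegative⁻¹ ½) (*-≥0 (nonNegative⁻¹ ½) (0≤-gap 2t≤1))) (identity₃₈ t)

    -- A trivial bound after `j` steps, which serves to choose an `N` that keeps the base N +
    -- reading away from zero.
    Bounded : ℕ → Vector → Set
    Bounded j w = ∀ e → w e ≤ ι j × - w e ≤ ι j

    bounded-square : ∀ {j w} → Bounded j w → ∀ e → w e * w e ≤ ι j * ι j
    bounded-square {j} {w} b e = gap ((ι j - w e) * (ι j - - w e))
      (*-≥0 (0≤-gap (proj₁ (b e))) (0≤-gap (proj₂ (b e)))) (identity₃₉ (ι j) (w e))

    bounded-step : ∀ {j w} → Bounded j w → ∀ B x → Bounded (suc j) (w ⊹ d B x)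
    bounded-step {j} {w} b B x e =
      gap ((1ℚ - v B x e) + v̄ B e + (ι j - w e))
          (+-≥0 (+-≥0 (0≤-gap (idempotent≤1 (v² B x e))) (v̄≥0 B e)) (0≤-gap (proj₁ (b e))))
          (identity₄₀ (v B x e) (v̄ B e) (w e) (ι j)) ,
      gap ((1ℚ - v̄ B e) + v B x e + (ι j - - w e))
          (+-≥0 (+-≥0 (0≤-gap v̄≤1) (v≥0 B x e)) (0≤-gap (proj₂ (b e))))
          (identity₄₁ (v B x e) (v̄ B e) (w e) (ι j))
      where
      v̄≤1 : v̄ B e ≤ 1ℚ
      v̄≤1 = ≤-trans (μ-mono λ x → idempotent≤1 (v² B x e)) (≤-reflexive (μ-const 1ℚ))

    -- The probability that the walk is truncated or ends above its allowance.
    module Failure (allowed : Vector) where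

      difference : Block → X → X → Vector
      difference B a b e = v B a e - v B b e

      -- Stated for pairs of candidates because the coin of the sampler compares two drawn paths;
      -- averaging over the second one bounds the tilt as well.
      Alive : Block → Vector → Set
      Alive B w = ∀ a b → ⟪ h ⊙ w , difference B a b ⟫ ≤ c

      alive? : ∀ B w → Dec (Alive B w)
      alive? B w = all? λ a → all? λ b → ⟪ h ⊙ w , difference B a b ⟫ ≤? c

      accept? : (w : Vector) → Dec (∀ e → w e ≤ allowed e)
      accept? w = all? λ e → w e ≤? allowed e

      tilt : Block → Vector → X → ℚ
      tilt B w x = c⁻¹ * ⟪ d B x , h ⊙ w ⟫

      bad : List Block → Vector → ℚ
      bad []       w = select (accept? w) 0ℚ 1ℚ
      bad (B ∷ bs) w = select (alive? B w) (μ (λ x → (1ℚ - tilt B w x) * bad bs (w ⊹ d B x))) 1ℚ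

      ⟪d⟫-mean : ∀ B w a → ⟪ d B a , h ⊙ w ⟫ ≡ μ (λ b → ⟪ h ⊙ w , difference B a b ⟫)
      ⟪d⟫-mean B w a = sym (begin
        μ (λ b → ∑ es (λ e → h e * w e * (v B a e - v B b e)))      ≡⟨ μ-∑ es (λ e b → h e * w e * (v B a e - v B b e)) ⟩
        ∑ es (λ e → μ (λ b → h e * w e * (v B a e - v B b e)))      ≡⟨ ∑-cong es (λ e → trans (μ-* (h e * w e) (λ b → v B a e - v B b e)) (cong (h e * w e *_) (trans (μ-− (λ _ → v B a e) (λ b → v B b e)) (cong (_- v̄ B e) (μ-const (v B a e)))))) ⟩
        ∑ es (λ e → h e * w e * d B a e)                            ≡⟨ ∑-cong es (λ e → *-comm (h e * w e) (d B a e)) ⟩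
        ⟪ d B a , h ⊙ w ⟫ ∎)
        where open ≡-Reasoning

      alive-tilt : ∀ {B w} → Alive B w → ∀ x → tilt B w x ≤ 1ℚ × - tilt B w x ≤ 1ℚ
      alive-tilt {B} {w} al x = ≤-trans (*-mono 0≤c⁻¹ upper) (≤-reflexive c⁻¹c) ,
        ≤-trans (≤-reflexive (identity₄₂ c⁻¹ ⟪ d B x , h ⊙ w ⟫)) (≤-trans (*-mono 0≤c⁻¹ lower) (≤-reflexive c⁻¹c))
        where
        upper : ⟪ d B x , h ⊙ w ⟫ ≤ c
        upper = ≤-trans (≤-reflexive (⟪d⟫-mean B w x)) (≤-trans (μ-mono (al x)) (≤-reflexive (μ-const c)))
        swap : ∀ a b → - ⟪ h ⊙ w , difference B a b ⟫ ≡ ⟪ h ⊙ w , difference B b a ⟫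
        swap a b = trans (neg-∑ es (λ e → h e * w e * (v B a e - v B b e)))
          (∑-cong es λ e → identity₄₃ (h e * w e) (v B a e) (v B b e))
          where
          neg-∑ : ∀ (xs : List E) f → - ∑ xs f ≡ ∑ xs (λ e → - f e)
          neg-∑ []       f = refl
          neg-∑ (e ∷ xs) f = trans (neg-distrib-+ (f e) (∑ xs f)) (cong (- f e +_) (neg-∑ xs f))
        neg-μ : ∀ f → - μ f ≡ μ (λ x → - f x)
        neg-μ f = trans (sym (identity₄₄ (μ f))) (trans (sym (μ-* (- 1ℚ) f)) (μ-cong λ x → identity₄₄ (f x)))
        lower : - ⟪ d B x , h ⊙ w ⟫ ≤ c
        lower = ≤-trans (≤-reflexive (trans (cong -_ (⟪d⟫-mean B w x)) (neg-μ λ b → ⟪ h ⊙ w , difference B x b ⟫)))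
          (≤-trans (μ-mono λ b → ≤-trans (≤-reflexive (swap x b)) (al b x)) (≤-reflexive (μ-const c)))

    -- `K` is the logarithmic budget: gains stay below 2^K. `c≥` keeps the increments of a test
    -- below 1/4, and `N≥` keeps the bases of the N-th powers above N/2.
    record Regime : Set where
      field
        K     : ℕ
        κ     : ℚ
        0≤κ   : 0ℚ ≤ κ
        κK≡1  : κ * ι K ≡ 1ℚ
        c≥    : 8ℚ * L * ι K ≤ c
        1≤c   : 1ℚ ≤ c
        k N   : ℕ
        1≤N   : 1ℚ ≤ ι N
        N≥    : 8ℚ * (ι m * (ι k * ι k)) * (ι K + 1ℚ) ≤ ι N * ι N

    module Admissibility (regime : Regime) where
      open Regime regime

      -- `budget` pays for the variance along the walk, `small` bounds what the fixed part
      -- contributes to one increment, and `tame` bounds its norm for the estimate of the reading.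
      record Admissible (bs : List Block) (θ ζ : Vector) : Set where
        field
          budget : 16ℚ * (c * energy θ + 2ℚ * Test.fixed* ζ bs) ≤ ι K
          small  : All (λ B → ∀ x → 8ℚ * 8ℚ * (Test.fixed ζ B x * Test.fixed ζ B x) ≤ 1ℚ) bs
          tame   : ∑ es (λ e → ζ e * ζ e) ≤ 1ℚ
      open Admissible

      energy≥0 : ∀ θ → 0ℚ ≤ energy θ
      energy≥0 θ = ∑-≥0 es λ e → *-≥0 (h≥0 e) (square≥0 (θ e))

      module _ {ζ : Vector} where
        open Test ζ

        admissible-tail : ∀ {B bs θ} → Admissible (B ∷ bs) θ ζ → Admissible bs θ ζ
        admissible-tail {B} {bs} {θ} ad = record
          { budget = ≤-trans (*-mono (nonNegative⁻¹ 16ℚ) (+-monoʳ-≤ (c * energy θ) (*-mono 0≤2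
              (gap {fixed* bs} {fixed* (B ∷ bs)} (μ (λ x → fixed B x * fixed B x)) (μ-≥0 λ x → square≥0 (fixed B x)) (+-comm (μ (λ x → fixed B x * fixed B x)) (fixed* bs)))))) (budget ad)
          ; small = All.tail (small ad) ; tame = tame ad }

        module _ {bs : List Block} {θ : Vector} (ad : Admissible bs θ ζ) where

          total : 16ℚ * (c * energy (back* bs θ) + variance* bs θ) ≤ ι K
          total = ≤-trans (*-mono (nonNegative⁻¹ 16ℚ) (energy* bs θ)) (budget ad)

          gain≤ : gain* bs θ ≤ 2ℚ ^ K
          gain≤ = gain-bound K κ 0≤κ κK≡1 bs θ (≤-trans
            (*-mono (nonNegative⁻¹ 16ℚ) (gap {variance* bs θ} {c * energy (back* bs θ) + variance* bs θ} (c * energy (back* bs θ)) (*-≥0 0≤c (energy≥0 (back* bs θ))) (+-comm (c * energy (back* bs θ)) (variance* bs θ)))) total)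

          energy≤ : 16ℚ * (c * energy (back* bs θ)) ≤ ι K
          energy≤ = ≤-trans (*-mono (nonNegative⁻¹ 16ℚ) (gap {c * energy (back* bs θ)} (variance* bs θ) (variance*≥0 bs θ) refl)) total

          energy≤K : energy (back* bs θ) ≤ ι K
          energy≤K = ≤-trans (gap (16ℚ * ((c - 1ℚ) * ε) + (16ℚ - 1ℚ) * ε)
              (+-≥0 (*-≥0 (nonNegative⁻¹ 16ℚ) (*-≥0 (0≤-gap 1≤c) (energy≥0 (back* bs θ)))) (*-≥0 (nonNegative⁻¹ (16ℚ - 1ℚ)) (energy≥0 (back* bs θ))))
              (identity₄₅ c ε)) energy≤
            where
            ε = energy (back* bs θ)

          -- By Cauchy-Schwarz: the squared norms of the deviation and of the test are at most mk²
          -- and 2(K + 1), and `N≥` is chosen to make the reading at least -N/2.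
          large : ∀ {j w} → j ℕ.≤ k → Bounded j w → ι N ≤ 2ℚ * (ι N + ⟪ w , full (back* bs θ) ⟫)
          large {j} {w} j≤k b = gap (ι N - - (2ℚ * x)) (0≤-gap -2x≤N) (identity₄₆ (ι N) x)
            where
            open ≤-Reasoning
            f = full (back* bs θ)
            x = ⟪ w , f ⟫
            w² : ∑ es (λ e → w e * w e) ≤ ι m * (ι k * ι k)
            w² = begin
              ∑ es (λ e → w e * w e)         ≤⟨ ∑-mono es (λ e → ≤-trans (bounded-square {j} b e) (*-mono₂ (ι≥0 j) (ι≥0 k) (ι-mono j≤k) (ι-mono j≤k))) ⟩
              ∑ es (λ _ → ι k * ι k)         ≡⟨ trans (∑-const es (ι k * ι k)) (cong (λ l → ι l * (ι k * ι k)) (length-tabulate {n = m} id)) ⟩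
              ι m * (ι k * ι k) ∎
            f² : ∑ es (λ e → f e * f e) ≤ 2ℚ * (ι K + 1ℚ)
            f² = begin
              ∑ es (λ e → f e * f e)
                ≤⟨ ∑-mono es (λ e → gap {f e * f e} ((h e * back* bs θ e - ζ e) * (h e * back* bs θ e - ζ e) + 2ℚ * ((h e - h e * h e) * (back* bs θ e * back* bs θ e))) (+-≥0 (square≥0 (h e * back* bs θ e - ζ e)) (*-≥0 0≤2 (*-≥0 (0≤-gap (≤-reflexive (h² e))) (square≥0 (back* bs θ e))))) (identity₄₉ (h e) (back* bs θ e) (ζ e))) ⟩
              ∑ es (λ e → 2ℚ * (h e * (back* bs θ e * back* bs θ e)) + 2ℚ * (ζ e * ζ e))
                ≡⟨ trans (∑-+ es (λ e → 2ℚ * (h e * (back* bs θ e * back* bs θ e))) (λ e → 2ℚ * (ζ e * ζ e))) (cong₂ _+_ (∑-* es 2ℚ (λ e → h e * (back* bs θ e * back* bs θ e))) (∑-* es 2ℚ (λ e → ζ e * ζ e))) ⟩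
              2ℚ * energy (back* bs θ) + 2ℚ * ∑ es (λ e → ζ e * ζ e)
                ≤⟨ +-mono-≤ (*-mono 0≤2 energy≤K) (*-mono 0≤2 (tame ad)) ⟩
              2ℚ * ι K + 2ℚ * 1ℚ
                ≡⟨ *-distribˡ-+ 2ℚ (ι K) 1ℚ ⟨
              2ℚ * (ι K + 1ℚ) ∎
            -2x≤N : - (2ℚ * x) ≤ ι N
            -2x≤N = square-cancel (ι≥0 N) (begin
              (- (2ℚ * x)) * (- (2ℚ * x))     ≡⟨ identity₄₇ x ⟩
              4ℚ * (x * x)                    ≤⟨ *-mono (nonNegative⁻¹ 4ℚ) (cauchy-schwarz es w f) ⟩
              4ℚ * (∑ es (λ e → w e * w e) * ∑ es (λ e → f e * f e))
                                              ≤⟨ *-mono (nonNegative⁻¹ 4ℚ) (*-mono₂ (∑-≥0 es λ e → square≥0 (w e)) (*-≥0 0≤2 (+-≥0 (ι≥0 K) 0≤1)) w² f²) ⟩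
              4ℚ * (ι m * (ι k * ι k) * (2ℚ * (ι K + 1ℚ))) ≡⟨ identity₄₈ (ι m * (ι k * ι k)) (ι K) ⟩
              8ℚ * (ι m * (ι k * ι k)) * (ι K + 1ℚ) ≤⟨ N≥ ⟩
              ι N * ι N ∎)

        0<K : 0ℚ < ι K
        0<K with ι K ≟ 0ℚ
        ... | no  K≢0 = ≤∧≢⇒<′ (ι≥0 K) (K≢0 ∘ sym)
          where
          ≤∧≢⇒<′ : ∀ {a b} → a ≤ b → a ≢ b → a < b
          ≤∧≢⇒<′ {a} {b} le ne with <-cmp a b
          ... | tri< lt _ _ = lt
          ... | tri≈ _ eq _ = contradiction eq ne
          ... | tri> _ _ gt = contradiction le (<⇒≱ gt)
        ... | yes K≡0 = contradiction (trans (sym κK≡1) (trans (cong (κ *_) K≡0) (*-zeroʳ κ))) λ ()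

        -- Cauchy-Schwarz on the high edges bounds the square of the pulled-back part by 2L times
        -- the energy, and the energy is at most K / (16c); by `c≥` this is at most 1/64, like the
        -- fixed part.
        step-small : ∀ {B bs θ} → Admissible (B ∷ bs) θ ζ → ∀ x → 16ℚ * (y B (back* bs θ) x * y B (back* bs θ) x) ≤ 1ℚ
        step-small {B} {bs} {θ} ad x = gap (½ * ((1ℚ - 8ℚ * 8ℚ * (A * A)) + (1ℚ - 8ℚ * 8ℚ * (Z * Z)) + 8ℚ * 4ℚ * ((A - Z) * (A - Z))))
          (*-≥0 (nonNegative⁻¹ ½) (+-≥0 (+-≥0 (0≤-gap A²) (0≤-gap (All.head (small ad) x))) (*-≥0 (nonNegative⁻¹ (8ℚ * 4ℚ)) (square≥0 (A - Z)))))
          (trans (identity₅₀ A Z) (cong (λ s → 16ℚ * (s * s) + ½ * ((1ℚ - 8ℚ * 8ℚ * (A * A)) + (1ℚ - 8ℚ * 8ℚ * (Z * Z)) + 8ℚ * 4ℚ * ((A - Z) * (A - Z)))) (sym (y≡a+z B θ′ x))))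
          where
          open ≤-Reasoning
          θ′ = back* bs θ
          A = a B θ′ x
          Z = fixed B x
          ε = energy θ′
          drop-h : ∀ e f → (h e - h e * h e) * f ≡ 0ℚ
          drop-h e f = trans (cong (_* f) (trans (cong (λ s → h e - s) (h² e)) (+-inverseʳ (h e)))) (*-zeroˡ f)
          A² : 8ℚ * 8ℚ * (A * A) ≤ 1ℚ
          A² = cancel 0<K (begin
            ι K * (8ℚ * 8ℚ * (A * A))
              ≡⟨ cong (λ s → ι K * (8ℚ * 8ℚ * (s * s))) (∑-cong es {g = λ e → h e * d B x e * (h e * θ′ e)} λ e → trans (identity₅₁ (h e) (d B x e) (θ′ e)) (trans (cong (h e * d B x e * (h e * θ′ e) +_) (drop-h e _)) (+-identityʳ _))) ⟩
            ι K * (8ℚ * 8ℚ * (⟪ h ⊙ d B x , h ⊙ θ′ ⟫ * ⟪ h ⊙ d B x , h ⊙ θ′ ⟫))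
              ≤⟨ *-mono (ι≥0 K) (*-mono (nonNegative⁻¹ (8ℚ * 8ℚ)) (cauchy-schwarz es (h ⊙ d B x) (h ⊙ θ′))) ⟩
            ι K * (8ℚ * 8ℚ * (∑ es (λ e → h e * d B x e * (h e * d B x e)) * ∑ es (λ e → h e * θ′ e * (h e * θ′ e))))
              ≡⟨ cong₂ (λ s t → ι K * (8ℚ * 8ℚ * (s * t))) (∑-cong es {g = λ e → h e * (d B x e * d B x e)} λ e → trans (identity₅₂ (h e) (d B x e)) (cong (_* (d B x e * d B x e)) (h² e))) (∑-cong es {g = λ e → h e * (θ′ e * θ′ e)} λ e → trans (identity₅₂ (h e) (θ′ e)) (cong (_* (θ′ e * θ′ e)) (h² e))) ⟩
            ι K * (8ℚ * 8ℚ * (∑ es (λ e → h e * (d B x e * d B x e)) * ε))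
              ≤⟨ *-mono (ι≥0 K) (*-mono (nonNegative⁻¹ (8ℚ * 8ℚ)) (*-monoˡ (energy≥0 θ′) (norm B x))) ⟩
            ι K * (8ℚ * 8ℚ * (2ℚ * L * ε))
              ≡⟨ identity₅₃ L ε (ι K) ⟩
            16ℚ * (8ℚ * L * ι K * ε)
              ≤⟨ *-mono (nonNegative⁻¹ 16ℚ) (*-monoˡ (energy≥0 θ′) c≥) ⟩
            16ℚ * (c * ε)
              ≤⟨ energy≤ (admissible-tail ad) ⟩
            ι K
              ≡⟨ *-identityʳ (ι K) ⟨
            ι K * 1ℚ ∎)

      -- The list holds the blocks to be crossed before the test is read. Tests are read at
      -- different times, since the bias may leave its range before any block.
      TestPoint : Set
      TestPoint = List Block × Vector × Vector

      reading : Vector → TestPoint → ℚ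
      reading w (bs , θ , ζ) = ⟪ w , Test.full ζ (Test.back* ζ bs θ) ⟫

      -- The power stands for an exponential of the reading; `gain*` is the growth still to be
      -- granted to the blocks ahead, which turns the product into a supermartingale.
      value : Vector → TestPoint → ℚ
      value w t@(bs , θ , ζ) = (ι N + reading w t) ^ N * Test.gain* ζ bs θ

      Tested : TestPoint → Set
      Tested (bs , θ , ζ) = Admissible bs θ ζ

      nonneg-reading : ∀ {j w} → j ℕ.≤ k → Bounded j w → ∀ {t} → Tested t → 0ℚ ≤ ι N + reading w t
      nonneg-reading {j} {w} j≤ b {t} ad = cancel (positive⁻¹ 2ℚ)
        (≤-trans (≤-reflexive (*-zeroʳ 2ℚ)) (≤-trans (ι≥0 N) (large ad {j} {w} j≤ b)))

      value≥0 : ∀ {j w} → j ℕ.≤ k → Bounded j w → ∀ {t} → Tested t → 0ℚ ≤ value w t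
      value≥0 {j} {w} j≤ b {t@(bs , θ , ζ)} ad = *-≥0 (^-≥0 (nonneg-reading {j} {w} j≤ b {t} ad) N) (Test.gain*≥0 ζ bs θ)

      record Targets : Set where
        field
          Y             : ℕ
          θᶠ ζᶠ         : E → Vector
          allowed scale : E → ℚ
          0≤scale       : ∀ e → 0ℚ ≤ scale e
          scale-allowed : ∀ e → scale e * allowed e ≡ ι Y
          reading-final : ∀ w e → reading w ([] , θᶠ e , ζᶠ e) ≡ scale e * w e

      module Process (targets : Targets) where
        open Targets targets
        open Failure allowed

        threshold : ℚ
        threshold = (ι N + ι Y) ^ N

        -- Scaled so that the reading is `Y` exactly when the bias between the two candidates is at
        -- its limit `c`.
        truncation : Block → X → X → TestPoint
        truncation B a b = [] , (λ e → ι Y * c⁻¹ * difference B a b e) , (λ _ → 0ℚ)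

        tests : List Block → List TestPoint
        tests []       = map (λ e → [] , θᶠ e , ζᶠ e) es
        tests (B ∷ bs) = cartesianProductWith (truncation B) (allFin T) (allFin T) ++ map (λ (bs , t) → B ∷ bs , t) (tests bs)

        threshold≤value : ∀ {w t} → proj₁ t ≡ [] → ι Y ≤ reading w t → threshold ≤ value w t
        threshold≤value {w} {.[] , θ , ζ} refl le = ≤-trans
          (^-mono (+-≥0 (ι≥0 N) (ι≥0 Y)) (+-monoʳ-≤ (ι N) le) N) (≤-reflexive (sym (*-identityʳ _)))

        truncation-reading : ∀ B w a b → reading w (truncation B a b) ≡ ι Y * c⁻¹ * ⟪ h ⊙ w , difference B a b ⟫
        truncation-reading B w a b = trans
          (∑-cong es λ e → identity₅₄ (w e) (h e) (ι Y * c⁻¹) (difference B a b e))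
          (∑-* es (ι Y * c⁻¹) (λ e → h e * w e * difference B a b e))

        -- When the bias is out of range, or an allowance is exceeded at the end, some test read at
        -- that moment is at least `Y` and alone pays for `threshold`. Otherwise `step-bound` shows
        -- that no value grows on average. Values are nonnegative, so the remaining ones may be
        -- dropped.
        supermartingale : ∀ bs w j → j ℕ.+ length bs ℕ.≤ k → Bounded j w → All Tested (tests bs) →
                          bad bs w * threshold ≤ ∑ (tests bs) (value w)
        supermartingale [] w j le b ads = terminal (accept? w)
          where
          terminal : (dec : Dec (∀ e → w e ≤ allowed e)) → select dec 0ℚ 1ℚ * threshold ≤ ∑ (tests []) (value w)
          terminal (yes _)   = ≤-trans (≤-reflexive (*-zeroˡ threshold)) (∑-≥0-All (All.map (λ {t} → value≥0 {j} {w} (ℕ.m+n≤o⇒m≤o j le) b {t}) ads))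
          terminal (no ¬all) with ¬∀⟶∃¬ m _ (λ e → w e ≤? allowed e) ¬all
          ... | e , ¬le = ≤-trans (≤-reflexive (*-identityˡ threshold)) (≤-trans
              (threshold≤value {w} {[] , θᶠ e , ζᶠ e} refl (≤-trans (≤-reflexive (sym (scale-allowed e)))
                (≤-trans (*-mono (0≤scale e) (<⇒≤ (≰⇒> ¬le))) (≤-reflexive (sym (reading-final w e))))))
              (term≤∑ (All.map (λ {t} → value≥0 {j} {w} (ℕ.m+n≤o⇒m≤o j le) b {t}) ads) (∈-map⁺ _ (∈-allFin e))))
        supermartingale (B ∷ bs) w j le b ads = continue (alive? B w)
          where
          continue : (dec : Dec (Alive B w)) → select dec (μ (λ x → (1ℚ - tilt B w x) * bad bs (w ⊹ d B x))) 1ℚ * threshold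
                              ≤ ∑ (tests (B ∷ bs)) (value w)
          continue (yes alive) = begin
            μ (λ x → (1ℚ - tilt B w x) * bad bs (w ⊹ d B x)) * threshold
              ≡⟨ trans (*-comm _ threshold) (sym (μ-* threshold (λ x → (1ℚ - tilt B w x) * bad bs (w ⊹ d B x)))) ⟩
            μ (λ x → threshold * ((1ℚ - tilt B w x) * bad bs (w ⊹ d B x)))
              ≡⟨ μ-cong (λ x → identity₅₅ threshold (1ℚ - tilt B w x) (bad bs (w ⊹ d B x))) ⟩
            μ (λ x → (1ℚ - tilt B w x) * (bad bs (w ⊹ d B x) * threshold))
              ≤⟨ μ-mono (λ x → *-mono (0≤-gap (proj₁ (alive-tilt {B} {w} alive x))) (supermartingale bs (w ⊹ d B x) (suc j) (ℕ.≤-trans (ℕ.≤-reflexive (sym (ℕ.+-suc j (length bs)))) le) (bounded-step {j} {w} b B x) tails)) ⟩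
            μ (λ x → (1ℚ - tilt B w x) * ∑ (tests bs) (value (w ⊹ d B x)))
              ≡⟨ trans (μ-cong (λ x → sym (∑-* (tests bs) (1ℚ - tilt B w x) (value (w ⊹ d B x))))) (μ-∑ (tests bs) (λ t x → (1ℚ - tilt B w x) * value (w ⊹ d B x) t)) ⟩
            ∑ (tests bs) (λ t → μ (λ x → (1ℚ - tilt B w x) * value (w ⊹ d B x) t))
              ≤⟨ ∑-mono-All (All.map (λ {t} → advance {t}) rest) ⟩
            ∑ (tests bs) (λ (bs , t) → value w (B ∷ bs , t))
              ≡⟨ ∑-map (λ (bs , t) → B ∷ bs , t) (tests bs) (value w) ⟨
            ∑ (map (λ (bs , t) → B ∷ bs , t) (tests bs)) (value w)
              ≤⟨ gap (∑ now (value w)) (∑-≥0-All (All.map (λ {t} → value≥0 {j} {w} j≤k b {t}) (++⁻ˡ now ads))) (trans (∑-++ now _ (value w)) (+-comm (∑ now (value w)) _)) ⟩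
            ∑ (tests (B ∷ bs)) (value w) ∎
            where
            open ≤-Reasoning
            now : List TestPoint
            now = cartesianProductWith (truncation B) (allFin T) (allFin T)
            j≤k : j ℕ.≤ k
            j≤k = ℕ.m+n≤o⇒m≤o j le
            rest : All (λ (bs , t) → Tested (B ∷ bs , t)) (tests bs)
            rest = map⁻ (++⁻ʳ now ads)
            tails : All Tested (tests bs)
            tails = All.map admissible-tail rest
            square≤1 : ∀ {a} → a ≤ 1ℚ → - a ≤ 1ℚ → a * a ≤ 1ℚ
            square≤1 {a} p q = gap ((1ℚ - a) * (1ℚ - - a)) (*-≥0 (0≤-gap p) (0≤-gap q)) (identity₅₈ a)
            advance : ∀ {t} → Tested (B ∷ proj₁ t , proj₂ t) →
              μ (λ x → (1ℚ - tilt B w x) * value (w ⊹ d B x) t) ≤ value w (B ∷ proj₁ t , proj₂ t)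
            advance {pre , θ , ζ} ad = begin
              μ (λ x → (1ℚ - tilt B w x) * (P x * G))     ≡⟨ trans (μ-cong λ x → identity₅₆ (1ℚ - tilt B w x) (P x) G) (μ-* G (λ x → (1ℚ - tilt B w x) * P x)) ⟩
              G * μ (λ x → (1ℚ - tilt B w x) * P x)       ≤⟨ *-mono (Test.gain*≥0 ζ pre θ) (Test.step-bound ζ B θ′ w N 1≤N
                                                               (λ x → square≤1 (proj₁ (alive-tilt {B} {w} alive x)) (proj₂ (alive-tilt {B} {w} alive x)))
                                                               (step-small ad) (large ad {j} {w} j≤k b)) ⟩
              G * ((ι N + ⟪ w , Test.full ζ (Test.back ζ B θ′) ⟫) ^ N * (1ℚ + 8ℚ * Test.V ζ B θ′))
                                                          ≡⟨ identity₅₇ G ((ι N + ⟪ w , Test.full ζ (Test.back ζ B θ′) ⟫) ^ N) (1ℚ + 8ℚ * Test.V ζ B θ′) ⟩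
              value w (B ∷ pre , θ , ζ) ∎
              where
              θ′ = Test.back* ζ pre θ
              G = Test.gain* ζ pre θ
              P : X → ℚ
              P x = (ι N + ⟪ w ⊹ d B x , Test.full ζ θ′ ⟫) ^ N
          continue (no ¬alive) with ¬∀⟶∃¬ T _ (λ a → all? λ b → ⟪ h ⊙ w , difference B a b ⟫ ≤? c) ¬alive
          ... | a , ¬a with ¬∀⟶∃¬ T _ (λ b → ⟪ h ⊙ w , difference B a b ⟫ ≤? c) ¬a
          ...   | b′ , ¬le = ≤-trans (≤-reflexive (*-identityˡ threshold)) (≤-trans
              (threshold≤value {w} {truncation B a b′} refl (≤-trans exceeds (≤-reflexive (sym (truncation-reading B w a b′)))))
              (term≤∑ (All.map (λ {t} → value≥0 {j} {w} (ℕ.m+n≤o⇒m≤o j le) b {t}) ads)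
                      (∈-++⁺ˡ (∈-cartesianProductWith⁺ (truncation B) (∈-allFin a) (∈-allFin b′)))))
            where
            exceeds : ι Y ≤ ι Y * c⁻¹ * ⟪ h ⊙ w , difference B a b′ ⟫
            exceeds = ≤-trans (≤-reflexive (sym (trans (*-assoc (ι Y) c⁻¹ c) (trans (cong (ι Y *_) c⁻¹c) (*-identityʳ (ι Y))))))
              (*-mono (*-≥0 (ι≥0 Y) 0≤c⁻¹) (<⇒≤ (≰⇒> ¬le)))

        bad-bound : ∀ bs → length bs ℕ.≤ k → All Tested (tests bs) →
                    bad bs (λ _ → 0ℚ) * threshold ≤ ι (length (tests bs)) * (ι N ^ N * 2ℚ ^ K)
        bad-bound bs le ads = begin
          bad bs (λ _ → 0ℚ) * threshold               ≤⟨ supermartingale bs (λ _ → 0ℚ) 0 le (λ e → ≤-refl , ≤-refl) ads ⟩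
          ∑ (tests bs) (value (λ _ → 0ℚ))             ≤⟨ ∑-mono-All (All.map (λ {t} → initial {t}) ads) ⟩
          ∑ (tests bs) (λ _ → ι N ^ N * 2ℚ ^ K)       ≡⟨ ∑-const (tests bs) (ι N ^ N * 2ℚ ^ K) ⟩
          ι (length (tests bs)) * (ι N ^ N * 2ℚ ^ K) ∎
          where
          open ≤-Reasoning
          initial : ∀ {t} → Tested t → value (λ _ → 0ℚ) t ≤ ι N ^ N * 2ℚ ^ K
          initial {bs , θ , ζ} ad = ≤-trans
            (≤-reflexive (cong (λ s → (ι N + s) ^ N * Test.gain* ζ bs θ) (trans (∑-cong es λ e → *-zeroˡ (Test.full ζ (Test.back* ζ bs θ) e)) (∑-0 es))))
            (≤-trans (≤-reflexive (cong (λ s → s ^ N * Test.gain* ζ bs θ) (+-identityʳ (ι N)))) (*-mono (^-≥0 (ι≥0 N) N) (gain≤ ad)))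

-- Sums over coin strings and uniform draws

module Coins where

  open Machine using (iter)
  open Algorithm
  open Typed using (headOr)
  open Rat
  open import Data.Bool.Base using (true; false; if_then_else_)
  open import Data.Fin.Base using (zero; suc; toℕ)
  open import Data.List.Base using ([]; _∷_; allFin; _++_; drop; take; reverse)
  open import Data.List.Properties using (unfold-reverse)
  open import Data.Nat.Base as ℕ using (ℕ; zero; suc)
  import Data.Nat.Properties as ℕ
  open import Data.Nat.Tactic.RingSolver using () renaming (solve-∀ to solveℕ)
  open import Data.Product.Base using (_×_; _,_; proj₁; proj₂)
  open import Data.Rational.Base
  open import Data.Rational.Properties
  open import Function.Base using (_∘_)
  open import Relation.Binary.PropositionalEquality
  open import Tactic.RingSolver using (solve-∀)

  ∑ᶜ : ℕ → (Coins → ℚ) → ℚ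
  ∑ᶜ zero    f = f []
  ∑ᶜ (suc n) f = ∑ᶜ n (λ l → f (true ∷ l)) + ∑ᶜ n (λ l → f (false ∷ l))

  ∑ᶜ-cong : ∀ n {f g} → (∀ l → f l ≡ g l) → ∑ᶜ n f ≡ ∑ᶜ n g
  ∑ᶜ-cong zero    eq = eq []
  ∑ᶜ-cong (suc n) eq = cong₂ _+_ (∑ᶜ-cong n λ l → eq (true ∷ l)) (∑ᶜ-cong n λ l → eq (false ∷ l))

  ∑ᶜ-mono : ∀ n {f g} → (∀ l → f l ≤ g l) → ∑ᶜ n f ≤ ∑ᶜ n g
  ∑ᶜ-mono zero    le = le []
  ∑ᶜ-mono (suc n) le = +-mono-≤ (∑ᶜ-mono n λ l → le (true ∷ l)) (∑ᶜ-mono n λ l → le (false ∷ l))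

  ∑ᶜ-const : ∀ n c → ∑ᶜ n (λ _ → c) ≡ 2ℚ ^ n * c
  ∑ᶜ-const zero    c = sym (*-identityˡ c)
  ∑ᶜ-const (suc n) c = trans (cong₂ _+_ (∑ᶜ-const n c) (∑ᶜ-const n c)) (lemma (2ℚ ^ n) c)
    where
    lemma : ∀ p c → p * c + p * c ≡ 2ℚ * p * c
    lemma = solve-∀ ring

  ∑ᶜ-take : ∀ n y f → ∑ᶜ (n ℕ.+ y) (λ l → f (take n l)) ≡ 2ℚ ^ y * ∑ᶜ n f
  ∑ᶜ-take zero    y f = ∑ᶜ-const y (f [])
  ∑ᶜ-take (suc n) y f = trans (cong₂ _+_ (∑ᶜ-take n y (λ l → f (true ∷ l))) (∑ᶜ-take n y (λ l → f (false ∷ l))))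
    (sym (*-distribˡ-+ (2ℚ ^ y) _ _))

  ∑ᶜ-snoc : ∀ n f → ∑ᶜ (suc n) f ≡ ∑ᶜ n (λ l → f (l ++ true ∷ [])) + ∑ᶜ n (λ l → f (l ++ false ∷ []))
  ∑ᶜ-snoc zero    f = refl
  ∑ᶜ-snoc (suc n) f = trans (cong₂ _+_ (∑ᶜ-snoc n (λ l → f (true ∷ l))) (∑ᶜ-snoc n (λ l → f (false ∷ l))))
    (interchange (∑ᶜ n (λ l → f (true ∷ l ++ true ∷ []))) (∑ᶜ n (λ l → f (true ∷ l ++ false ∷ [])))
                 (∑ᶜ n (λ l → f (false ∷ l ++ true ∷ []))) (∑ᶜ n (λ l → f (false ∷ l ++ false ∷ []))))

  ∑ᶜ-reverse : ∀ n f → ∑ᶜ n (λ l → f (reverse l)) ≡ ∑ᶜ n f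
  ∑ᶜ-reverse zero    f = refl
  ∑ᶜ-reverse (suc n) f = trans (cong₂ _+_ (half true) (half false)) (sym (∑ᶜ-snoc n f))
    where
    half : ∀ b → ∑ᶜ n (λ l → f (reverse (b ∷ l))) ≡ ∑ᶜ n (λ l → f (l ++ b ∷ []))
    half b = trans (∑ᶜ-cong n λ l → cong f (unfold-reverse b l)) (∑ᶜ-reverse n (λ l → f (l ++ b ∷ [])))

  ∑< : ℕ → (ℕ → ℚ) → ℚ
  ∑< n f = ∑ (allFin n) (f ∘ toℕ)

  ∑<-suc : ∀ n f → ∑< (suc n) f ≡ f 0 + ∑< n (f ∘ suc)
  ∑<-suc n f = ∑-Fin-suc {n} (f ∘ toℕ)

  ∑<-+ : ∀ m n f → ∑< (m ℕ.+ n) f ≡ ∑< m f + ∑< n (λ a → f (m ℕ.+ a))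
  ∑<-+ zero    n f = sym (+-identityˡ _)
  ∑<-+ (suc m) n f = begin
    ∑< (suc (m ℕ.+ n)) f                                     ≡⟨ ∑<-suc (m ℕ.+ n) f ⟩
    f 0 + ∑< (m ℕ.+ n) (f ∘ suc)                             ≡⟨ cong (f 0 +_) (∑<-+ m n (f ∘ suc)) ⟩
    f 0 + (∑< m (f ∘ suc) + ∑< n (λ a → f (suc m ℕ.+ a)))    ≡⟨ +-assoc (f 0) _ _ ⟨
    f 0 + ∑< m (f ∘ suc) + ∑< n (λ a → f (suc m ℕ.+ a))      ≡⟨ cong (_+ ∑< n (λ a → f (suc m ℕ.+ a))) (∑<-suc m f) ⟨
    ∑< (suc m) f + ∑< n (λ a → f (suc m ℕ.+ a)) ∎
    where open ≡-Reasoning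

  ∑<-cong : ∀ n {f g} → (∀ a → a ℕ.< n → f a ≡ g a) → ∑< n f ≡ ∑< n g
  ∑<-cong zero    eq = refl
  ∑<-cong (suc n) {f} {g} eq = trans (∑<-suc n f)
    (trans (cong₂ _+_ (eq 0 (ℕ.s≤s ℕ.z≤n)) (∑<-cong n λ a a< → eq (suc a) (ℕ.s≤s a<))) (sym (∑<-suc n g)))

  module Draws (Z : ℕ) where
    open Truncated Z

    flipped : Coins × ℕ → Coins × ℕ
    flipped s = drop 1 (proj₁ s) ,
      (if headOr false (proj₁ s) then suc (proj₂ s ⊕ proj₂ s) else proj₂ s ⊕ proj₂ s)

    n<2^n : ∀ n → n ℕ.< 2 ℕ.^ n
    n<2^n zero    = ℕ.s≤s ℕ.z≤n
    n<2^n (suc n) = ℕ.≤-trans (ℕ.+-mono-≤ (ℕ.≤-trans (ℕ.s≤s ℕ.z≤n) (n<2^n n)) (n<2^n n))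
      (ℕ.≤-reflexive (cong (2 ℕ.^ n ℕ.+_) (sym (ℕ.+-identityʳ _))))

    draw≡ : ∀ q ω → 2 ℕ.^ q ℕ.≤ Z → draw q ω ≡ iter q flipped (ω , 0)
    draw≡ q ω le = cong (λ j → iter j flipped (ω , 0)) (ℕ.m≤n⇒m⊓n≡m (ℕ.≤-trans (ℕ.<⇒≤ (n<2^n q)) le))

    doubled : ∀ r q → suc r ℕ.* 2 ℕ.^ q ℕ.≤ Z → r ⊕ r ≡ r ℕ.+ r
    doubled r q le = cong (ℕ._+ r) (ℕ.m≤n⇒m⊓n≡m (ℕ.≤-trans (ℕ.<⇒≤ (ℕ.≤-trans (ℕ.≤-reflexive (sym (ℕ.*-identityʳ (suc r)))) (ℕ.*-monoʳ-≤ (suc r) (ℕ.≤-trans (ℕ.s≤s ℕ.z≤n) (n<2^n q))))) le))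

    fits-false : ∀ r q → suc r ℕ.* 2 ℕ.^ suc q ℕ.≤ Z → suc (r ℕ.+ r) ℕ.* 2 ℕ.^ q ℕ.≤ Z
    fits-false r q le = ℕ.≤-trans (ℕ.≤-trans (ℕ.m≤m+n _ (2 ℕ.^ q)) (ℕ.≤-reflexive (lemma r (2 ℕ.^ q)))) le
      where
      lemma : ∀ r x → suc (r ℕ.+ r) ℕ.* x ℕ.+ x ≡ suc r ℕ.* (2 ℕ.* x)
      lemma = solveℕ

    fits-true : ∀ r q → suc r ℕ.* 2 ℕ.^ suc q ℕ.≤ Z → suc (suc (r ℕ.+ r)) ℕ.* 2 ℕ.^ q ℕ.≤ Z
    fits-true r q le = ℕ.≤-trans (ℕ.≤-reflexive (lemma r (2 ℕ.^ q))) le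
      where
      lemma : ∀ r x → suc (suc (r ℕ.+ r)) ℕ.* x ≡ suc r ℕ.* (2 ℕ.* x)
      lemma = solveℕ

    -- Generalised over the number `r` read so far; the hypothesis keeps all later doublings within
    -- `Z`, where they are exact.
    iter-flip : ∀ q z r (f : Coins × ℕ → ℚ) → suc r ℕ.* 2 ℕ.^ q ℕ.≤ Z →
      ∑ᶜ (q ℕ.+ z) (λ ω → f (iter q flipped (ω , r))) ≡ ∑< (2 ℕ.^ q) (λ a → ∑ᶜ z (λ ω → f (ω , r ℕ.* 2 ℕ.^ q ℕ.+ a)))
    iter-flip zero z r f le = sym (trans (∑<-suc 0 (λ a → ∑ᶜ z (λ ω → f (ω , r ℕ.* 1 ℕ.+ a)))) (trans (+-identityʳ _) (∑ᶜ-cong z λ ω → cong (λ x → f (ω , x)) (lemma r))))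
      where
      lemma : ∀ r → r ℕ.* 1 ℕ.+ 0 ≡ r
      lemma = solveℕ
    iter-flip (suc q) z r f le = begin
      ∑ᶜ (q ℕ.+ z) (λ ω → f (iter q flipped (ω , suc (r ⊕ r)))) + ∑ᶜ (q ℕ.+ z) (λ ω → f (iter q flipped (ω , r ⊕ r)))
        ≡⟨ cong (λ d → ∑ᶜ (q ℕ.+ z) (λ ω → f (iter q flipped (ω , suc d))) + ∑ᶜ (q ℕ.+ z) (λ ω → f (iter q flipped (ω , d)))) (doubled r (suc q) le) ⟩
      ∑ᶜ (q ℕ.+ z) (λ ω → f (iter q flipped (ω , suc (r ℕ.+ r)))) + ∑ᶜ (q ℕ.+ z) (λ ω → f (iter q flipped (ω , r ℕ.+ r)))
        ≡⟨ cong₂ _+_ (iter-flip q z (suc (r ℕ.+ r)) f (fits-true r q le)) (iter-flip q z (r ℕ.+ r) f (fits-false r q le)) ⟩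
      ∑< (2 ℕ.^ q) (λ a → ∑ᶜ z (λ ω → f (ω , suc (r ℕ.+ r) ℕ.* 2 ℕ.^ q ℕ.+ a))) + ∑< (2 ℕ.^ q) (λ a → ∑ᶜ z (λ ω → f (ω , (r ℕ.+ r) ℕ.* 2 ℕ.^ q ℕ.+ a)))
        ≡⟨ +-comm _ (∑< (2 ℕ.^ q) (λ a → ∑ᶜ z (λ ω → f (ω , (r ℕ.+ r) ℕ.* 2 ℕ.^ q ℕ.+ a)))) ⟩
      ∑< (2 ℕ.^ q) (λ a → ∑ᶜ z (λ ω → f (ω , (r ℕ.+ r) ℕ.* 2 ℕ.^ q ℕ.+ a))) + ∑< (2 ℕ.^ q) (λ a → ∑ᶜ z (λ ω → f (ω , suc (r ℕ.+ r) ℕ.* 2 ℕ.^ q ℕ.+ a)))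
        ≡⟨ cong₂ _+_ (∑<-cong (2 ℕ.^ q) λ a _ → cong g (lemma₁ r (2 ℕ.^ q) a)) (∑<-cong (2 ℕ.^ q) λ a _ → cong g (lemma₂ r (2 ℕ.^ q) a)) ⟩
      ∑< (2 ℕ.^ q) (λ a → g (r ℕ.* 2 ℕ.^ suc q ℕ.+ a)) + ∑< (2 ℕ.^ q) (λ a → g (r ℕ.* 2 ℕ.^ suc q ℕ.+ (2 ℕ.^ q ℕ.+ a)))
        ≡⟨ ∑<-+ (2 ℕ.^ q) (2 ℕ.^ q) (λ a → g (r ℕ.* 2 ℕ.^ suc q ℕ.+ a)) ⟨
      ∑< (2 ℕ.^ q ℕ.+ 2 ℕ.^ q) (λ a → g (r ℕ.* 2 ℕ.^ suc q ℕ.+ a))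
        ≡⟨ cong (λ n → ∑< n (λ a → g (r ℕ.* 2 ℕ.^ suc q ℕ.+ a))) (cong (2 ℕ.^ q ℕ.+_) (sym (ℕ.+-identityʳ (2 ℕ.^ q)))) ⟩
      ∑< (2 ℕ.^ suc q) (λ a → g (r ℕ.* 2 ℕ.^ suc q ℕ.+ a)) ∎
      where
      open ≡-Reasoning
      g : ℕ → ℚ
      g x = ∑ᶜ z (λ ω → f (ω , x))
      lemma₁ : ∀ r x a → (r ℕ.+ r) ℕ.* x ℕ.+ a ≡ r ℕ.* (2 ℕ.* x) ℕ.+ a
      lemma₁ = solveℕ
      lemma₂ : ∀ r x a → suc (r ℕ.+ r) ℕ.* x ℕ.+ a ≡ r ℕ.* (2 ℕ.* x) ℕ.+ (x ℕ.+ a)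
      lemma₂ = solveℕ

    ∑ᶜ-draw : ∀ q z (f : Coins × ℕ → ℚ) → 2 ℕ.^ q ℕ.≤ Z → ∑ᶜ (q ℕ.+ z) (λ ω → f (draw q ω)) ≡ ∑< (2 ℕ.^ q) (λ a → ∑ᶜ z (λ ω → f (ω , a)))
    ∑ᶜ-draw q z f le = trans (∑ᶜ-cong (q ℕ.+ z) λ ω → cong f (draw≡ q ω le))
      (iter-flip q z 0 f (ℕ.≤-trans (ℕ.≤-reflexive (ℕ.+-identityʳ (2 ℕ.^ q))) le))

    iter-flip< : ∀ q r ω → suc r ℕ.* 2 ℕ.^ q ℕ.≤ Z → proj₂ (iter q flipped (ω , r)) ℕ.< suc r ℕ.* 2 ℕ.^ q
    iter-flip< zero    r ω le = ℕ.≤-reflexive (sym (ℕ.*-identityʳ (suc r)))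
    iter-flip< (suc q) r ω le with headOr false ω
    ... | true  rewrite doubled r (suc q) le = ℕ.≤-trans (iter-flip< q (suc (r ℕ.+ r)) (drop 1 ω) (fits-true r q le)) (ℕ.≤-reflexive (lemma r (2 ℕ.^ q)))
      where
      lemma : ∀ r x → suc (suc (r ℕ.+ r)) ℕ.* x ≡ suc r ℕ.* (2 ℕ.* x)
      lemma = solveℕ
    ... | false rewrite doubled r (suc q) le = ℕ.≤-trans (iter-flip< q (r ℕ.+ r) (drop 1 ω) (fits-false r q le))
      (ℕ.≤-trans (ℕ.m≤m+n _ (2 ℕ.^ q)) (ℕ.≤-reflexive (lemma r (2 ℕ.^ q))))
      where
      lemma : ∀ r x → suc (r ℕ.+ r) ℕ.* x ℕ.+ x ≡ suc r ℕ.* (2 ℕ.* x)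
      lemma = solveℕ

    draw< : ∀ q ω → 2 ℕ.^ q ℕ.≤ Z → proj₂ (draw q ω) ℕ.< 2 ℕ.^ q
    draw< q ω le rewrite draw≡ q ω le = ℕ.≤-trans (iter-flip< q 0 ω (ℕ.≤-trans (ℕ.≤-reflexive (ℕ.+-identityʳ (2 ℕ.^ q))) le))
      (ℕ.≤-reflexive (ℕ.+-identityʳ (2 ℕ.^ q)))

-- The sampler simulates the walk

module Sampler where

  open Machine using (iter)
  open Algorithm
  open Typed using (headOr)

  open Flow using (_∈ᵇ_; module Approachability; module ShortestPaths; module Paths)
  open Rat
  open Rounding
  open Coins
  open import Data.Bool.Base using (Bool; true; false; if_then_else_)
  open import Data.Fin.Base using (Fin; toℕ; fromℕ<)
  open import Data.Fin.Properties using (_≟_; all?; toℕ<n; toℕ-fromℕ<)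
  open import Data.List.Base using (List; []; _∷_; map; foldl; foldr; length; allFin; drop; reverse)
  open import Data.List.Properties using (take-all; length-tabulate; length-reverse; reverse-foldl; unfold-reverse)
  open import Data.List.Membership.Propositional using (_∈_)
  open import Data.List.Membership.Propositional.Properties using (∈-allFin)
  open import Data.List.Relation.Unary.All using (All; []; _∷_)
  import Data.List.Relation.Unary.All as All
  open import Data.List.Relation.Unary.AllPairs using ([]; _∷_)
  open import Data.List.Relation.Unary.Any using (here; there)
  open import Data.List.Relation.Unary.Unique.Propositional using (Unique)
  open import Data.List.Relation.Unary.Unique.Propositional.Properties using (allFin⁺)
  open import Data.Nat.Base as ℕ using (ℕ; zero; suc)
  import Data.Nat.Properties as ℕ
  open import Data.Nat.Tactic.RingSolver using () renaming (solve-∀ to solveℕ)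
  open import Data.Product.Base using (∃-syntax; _×_; _,_; proj₁; proj₂)
  open import Data.Rational.Base hiding (_/_)
  open import Data.Rational.Properties hiding (_≟_)
  open import Data.Sum.Base using (_⊎_; inj₁; inj₂)
  open import Function.Base using (_∘_; id)
  open import Relation.Binary.PropositionalEquality
  open import Relation.Nullary.Decidable.Core using (Dec; yes; no; does)
  open import Relation.Nullary.Negation using (contradiction)
  open import Tactic.RingSolver using (solve-∀)

  ι-∑ : ∀ {A : Set} (xs : List A) f → ι (Flow.∑ xs f) ≡ ∑ xs (ι ∘ f)
  ι-∑ []       f = refl
  ι-∑ (x ∷ xs) f = trans (ι-+ (f x) (Flow.∑ xs f)) (cong (ι (f x) +_) (ι-∑ xs f))

  ι-ind : ∀ b → ι (Flow.ind b) ≡ ind b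
  ι-ind true  = +-identityʳ 1ℚ
  ι-ind false = refl

  ind² : ∀ b → ind b * ind b ≡ ind b
  ind² true  = refl
  ind² false = refl

  ι2^ : ∀ n → ι (2 ℕ.^ n) ≡ 2ℚ ^ n
  ι2^ n = ι-^ 2 n

  ½^-inverse : ∀ n → ½ ^ n * ι (2 ℕ.^ n) ≡ 1ℚ
  ½^-inverse n = trans (cong (½ ^ n *_) (ι2^ n)) (trans (sym (^-distrib-* ½ 2ℚ n)) (1^ n))

  elem : ∀ {A : Set} → A → ℕ → List A → A
  elem d n xs = headOr d (iter n (drop 1) xs)

  ∑-elem : ∀ {A : Set} (d : A) xs (g : A → ℚ) → ∑ (allFin (length xs)) (λ x → g (elem d (toℕ x) xs)) ≡ ∑ xs g
  ∑-elem d []       g = refl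
  ∑-elem d (y ∷ xs) g = trans (∑-Fin-suc {length xs} (λ x → g (elem d (toℕ x) (y ∷ xs)))) (cong (g y +_) (∑-elem d xs g))

  elem-∈ : ∀ {A : Set} (d : A) {n} xs → n ℕ.< length xs → elem d n xs ∈ xs
  elem-∈ d {zero}  (y ∷ xs) _            = here refl
  elem-∈ d {suc n} (y ∷ xs) (ℕ.s≤s n<) = there (elem-∈ d xs n<)

  foldl-count : ∀ {A : Set} (t : A → Bool) a xs → ι (foldl (λ a x → if t x then suc a else a) a xs) ≡ ι a + ∑ xs (ind ∘ t)
  foldl-count t a []       = sym (+-identityʳ (ι a))
  foldl-count t a (x ∷ xs) with t x
  ... | true  = trans (foldl-count t (suc a) xs) (lemma (ι a) (∑ xs (ind ∘ t)))
    where
    lemma : ∀ a s → 1ℚ + a + s ≡ a + (1ℚ + s)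
    lemma = solve-∀ ring
  ... | false = trans (foldl-count t a xs) (cong (ι a +_) (sym (+-identityˡ _)))

  foldl-count≤ : ∀ {A : Set} (t : A → Bool) a xs → foldl (λ a x → if t x then suc a else a) a xs ℕ.≤ a ℕ.+ length xs
  foldl-count≤ t a []       = ℕ.≤-reflexive (sym (ℕ.+-identityʳ a))
  foldl-count≤ t a (x ∷ xs) with t x
  ... | true  = ℕ.≤-trans (foldl-count≤ t (suc a) xs) (ℕ.≤-reflexive (sym (ℕ.+-suc a (length xs))))
  ... | false = ℕ.≤-trans (foldl-count≤ t a xs) (ℕ.+-monoʳ-≤ a (ℕ.n≤1+n _))

  -- Comparing a uniform r < 2M with a threshold is a coin of the right bias.
  biased-coin : ∀ M C C′ (cond : ℕ → Bool) (f g : ℚ) → C ℕ.≤ M ℕ.+ C′ → C′ ℕ.≤ M ℕ.+ C →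
    (∀ r → r ℕ.< M ℕ.+ M → cond r ≡ true → r ℕ.+ C ℕ.< M ℕ.+ C′) →
    (∀ r → r ℕ.< M ℕ.+ M → cond r ≡ false → M ℕ.+ C′ ℕ.≤ r ℕ.+ C) →
    ∑< (M ℕ.+ M) (λ r → if cond r then f else g) ≡ (ι M + ι C′ - ι C) * f + (ι M - ι C′ + ι C) * g
  biased-coin M C C′ cond f g C≤ C′≤ true⇒ false⇒ with ℕ.m≤n⇒∃[o]m+o≡n C≤ | ℕ.m≤n⇒∃[o]m+o≡n C′≤
  ... | t , Ct≡ | s , C′s≡ = begin
    ∑< (M ℕ.+ M) (λ r → if cond r then f else g)
      ≡⟨ cong (λ n → ∑< n (λ r → if cond r then f else g)) M+M≡ ⟩
    ∑< (t ℕ.+ s) (λ r → if cond r then f else g)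
      ≡⟨ ∑<-+ t s (λ r → if cond r then f else g) ⟩
    ∑< t (λ r → if cond r then f else g) + ∑< s (λ a → if cond (t ℕ.+ a) then f else g)
      ≡⟨ cong₂ _+_ (∑<-cong t {g = λ _ → f} below) (∑<-cong s {g = λ _ → g} above) ⟩
    ∑< t (λ _ → f) + ∑< s (λ _ → g)
      ≡⟨ cong₂ _+_ (constant t f) (constant s g) ⟩
    ι t * f + ι s * g
      ≡⟨ cong₂ (λ x y → x * f + y * g) ιt ιs ⟩
    (ι M + ι C′ - ι C) * f + (ι M - ι C′ + ι C) * g ∎
    where
    open ≡-Reasoning
    constant : ∀ n x → ∑< n (λ _ → x) ≡ ι n * x
    constant n x = trans (∑-const (allFin n) x) (cong (λ l → ι l * x) (length-tabulate {n = n} id))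
    M+M≡ : M ℕ.+ M ≡ t ℕ.+ s
    M+M≡ = ℕ.+-cancelʳ-≡ (C ℕ.+ C′) _ _ (trans (lemma₁ M C C′) (trans (cong₂ ℕ._+_ (sym Ct≡) (sym C′s≡)) (lemma₂ C t C′ s)))
      where
      lemma₁ : ∀ M C C′ → M ℕ.+ M ℕ.+ (C ℕ.+ C′) ≡ (M ℕ.+ C′) ℕ.+ (M ℕ.+ C)
      lemma₁ = solveℕ
      lemma₂ : ∀ C t C′ s → (C ℕ.+ t) ℕ.+ (C′ ℕ.+ s) ≡ t ℕ.+ s ℕ.+ (C ℕ.+ C′)
      lemma₂ = solveℕ
    below : ∀ r → r ℕ.< t → (if cond r then f else g) ≡ f
    below r r<t with cond r in eq
    ... | true  = refl
    ... | false = contradiction (ℕ.+-cancelʳ-≤ C t r (ℕ.≤-trans (ℕ.≤-reflexive (trans (ℕ.+-comm t C) Ct≡)) (false⇒ r (ℕ.≤-trans r<t (ℕ.≤-trans (ℕ.m≤m+n t s) (ℕ.≤-reflexive (sym M+M≡)))) eq))) (ℕ.<⇒≱ r<t)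
    above : ∀ a → a ℕ.< s → (if cond (t ℕ.+ a) then f else g) ≡ g
    above a a<s with cond (t ℕ.+ a) in eq
    ... | false = refl
    ... | true  = contradiction (true⇒ (t ℕ.+ a) (ℕ.≤-trans (ℕ.+-monoʳ-< t a<s) (ℕ.≤-reflexive (sym M+M≡))) eq)
      (ℕ.≤⇒≯ (ℕ.≤-trans (ℕ.≤-reflexive (trans (sym Ct≡) (ℕ.+-comm C t))) (ℕ.+-monoˡ-≤ C (ℕ.m≤m+n t a))))
    ιt : ι t ≡ ι M + ι C′ - ι C
    ιt = trans (lemma (ι t) (ι C)) (cong (_- ι C) (trans (sym (ι-+ C t)) (trans (cong ι Ct≡) (ι-+ M C′))))
      where
      lemma : ∀ t C → t ≡ C + t - C
      lemma = solve-∀ ring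
    ιs : ι s ≡ ι M - ι C′ + ι C
    ιs = trans (lemma (ι s) (ι C′)) (trans (cong (_- ι C′) (trans (sym (ι-+ C′ s)) (trans (cong ι C′s≡) (ι-+ M C)))) (lemma′ (ι M) (ι C) (ι C′)))
      where
      lemma : ∀ t C → t ≡ C + t - C
      lemma = solve-∀ ring
      lemma′ : ∀ M C C′ → M + C - C′ ≡ M - C′ + C
      lemma′ = solve-∀ ring

  module Sampler-identities where

    identity₁ : ∀ T t a → T * (t * a) ≡ t * T * a
    identity₁ = solve-∀ ring

    identity₂ : ∀ h x y u v → h * (x * u + y * v) - h * (x * v + y * u) ≡ h * (u - v) * (x - y)
    identity₂ = solve-∀ ring

    identity₃ : ∀ h T w d → h * (T * w) * d ≡ T * (h * w * d)
    identity₃ = solve-∀ ring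

    identity₄ : ∀ h a b → h * (b - a) ≡ (- 1ℚ) * (h * (a - b))
    identity₄ = solve-∀ ring

    identity₅ : ∀ a → (- 1ℚ) * a ≡ - a
    identity₅ = solve-∀ ring

    identity₆ : ∀ a b → a ≡ a - b + b
    identity₆ = solve-∀ ring

    identity₇ : ∀ t a b f g → (t * a) * f + (t * b) * g ≡ t * (a * f + b * g)
    identity₇ = solve-∀ ring

    identity₈ : ∀ M C C′ → M + C′ - C ≡ M - (C - C′)
    identity₈ = solve-∀ ring

    identity₉ : ∀ M C C′ → M - C′ + C ≡ M + (C - C′)
    identity₉ = solve-∀ ring

    identity₁₀ : ∀ c t d → c * t - t * d ≡ t * (c - d)
    identity₁₀ = solve-∀ ring

    identity₁₁ : ∀ c t d → c * t + t * d ≡ t * (c + d)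
    identity₁₁ = solve-∀ ring

    identity₁₂ : ∀ M C C′ → C′ + (M - C′ + C) ≡ M + C
    identity₁₂ = solve-∀ ring

    identity₁₃ : ∀ c d → c - - d ≡ c + d
    identity₁₃ = solve-∀ ring

    identity₁₄ : ∀ t c m → t * (t * c * (t * m) + t * c * (t * m)) ≡ 2ℚ * (c * t) * t * t * m
    identity₁₄ = solve-∀ ring

    identity₁₅ : ∀ g t c d i → g * (t * (c - d)) ≡ t * c * ((1ℚ - i * d) * g) + t * g * (i * c - 1ℚ) * d
    identity₁₅ = solve-∀ ring

    identity₁₆ : ∀ a b d → a + b * (1ℚ - 1ℚ) * d ≡ a
    identity₁₆ = solve-∀ ring

    identity₁₇ : ∀ t m r → t * (t * (2ℚ * m * r)) ≡ 2ℚ * m * t * t * r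
    identity₁₇ = solve-∀ ring

    identity₁₈ : ∀ a b → a ≡ b + (a - b)
    identity₁₈ = solve-∀ ring

    identity₁₉ : ∀ t u v T x f → t * (u - v) + (t * T * x - t * f) ≡ t * ((x * T + u) - (f + v))
    identity₁₉ = solve-∀ ring

    identity₂₀ : ∀ a b c → a * (b * c) ≡ b * (a * c)
    identity₂₀ = solve-∀ ring

  open Sampler-identities

  -- `cap` leaves room below `Z` for a draw plus the largest possible charge, so that `choose`
  -- compares exact numbers.
  record Design (I : Instance) (Z : ℕ) : Set where
    open Instance I using (m; k; Routing; E)
    field
      p q  : ℕ
      Rs   : List Routing
      A    : E → ℕ
      len  : length Rs ≡ 2 ℕ.^ p
      good : All (Approachability.Good I Z) Rs
      Δ′≤Z : Spec.Δ′ I Z ℕ.≤ Z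
      cap  : 2 ℕ.^ suc (q ℕ.+ p) ℕ.+ m ℕ.* (2 ℕ.* (k ℕ.* 2 ℕ.^ p)) ℕ.≤ Z
      4L≤c : 4ℚ * ι (Spec.Δ′ I Z) ≤ ι (2 ℕ.^ q)

  module Sampler {I : Instance} {Z : ℕ} (design : Design I Z) where

    open Design design
    open Instance I using (m; k; Routing; s; t) renaming (E to Edge)
    open Spec I Z hiding (p; q)
    open Truncated Z

    T M : ℕ
    T = 2 ℕ.^ p
    M = 2 ℕ.^ (q ℕ.+ p)

    sampler : Sampling
    sampler = record { p = p ; R = suc (q ℕ.+ p) ; T = T ; M = M ; Rs = Rs }

    τ c c⁻¹ : ℚ
    τ   = ½ ^ p
    c   = ι (2 ℕ.^ q)
    c⁻¹ = ½ ^ q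

    h : Edge → ℚ
    h e = ind (high e)

    setting : Setting
    setting = record
      { T = T ; τ = τ ; 0≤τ = ^-≥0 (nonNegative⁻¹ ½) p ; τT≡1 = ½^-inverse p
      ; m = m ; h = h ; h² = λ e → ind² (high e)
      ; L = ι Δ′ ; c = c ; c⁻¹ = c⁻¹ ; 0≤L = ι≥0 Δ′ ; 0≤c = ι≥0 (2 ℕ.^ q) ; 0≤c⁻¹ = ^-≥0 (nonNegative⁻¹ ½) q
      ; c⁻¹c = ½^-inverse q ; 4L≤c = 4L≤c }

    open Walk setting public

    2M≤Z : M ℕ.+ M ℕ.≤ Z
    2M≤Z = ℕ.≤-trans (ℕ.≤-reflexive (cong (M ℕ.+_) (sym (ℕ.+-identityʳ M)))) (ℕ.≤-trans (ℕ.m≤m+n _ _) cap)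

    T≤M : T ℕ.≤ M
    T≤M = ℕ.^-monoʳ-≤ 2 (ℕ.m≤n+m p q)

    T≤Z : T ℕ.≤ Z
    T≤Z = ℕ.≤-trans T≤M (ℕ.≤-trans (ℕ.m≤m+n M M) 2M≤Z)

    path : Fin k → X → List Edge
    path i x = pick sampler i (toℕ x)

    path≡ : ∀ i x → path i x ≡ elem (λ _ → []) (toℕ x) Rs i
    path≡ i x = cong (λ n → elem (λ _ → []) n Rs i) (ℕ.m≤n⇒m⊓n≡m (ℕ.≤-trans (ℕ.<⇒≤ (toℕ<n x)) T≤Z))

    path-good : ∀ i x → Instance.IsPath I (s i) (path i x) (t i) × length (path i x) ℕ.≤ Δ′
    path-good i x = subst (λ es → Instance.IsPath I (s i) es (t i) × length es ℕ.≤ Δ′) (sym (path≡ i x))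
      (All.lookup good (elem-∈ (λ _ → []) Rs (ℕ.≤-trans (toℕ<n x) (ℕ.≤-reflexive (sym len)))) i)

    v′ : Fin k → X → Edge → ℚ
    v′ i x e = ind (member e (path i x))

    block : Fin k → Block
    block i = record
      { v = v′ i ; v² = λ x e → ind² (member e (path i x))
      ; short = λ x → ≤-trans (≤-reflexive (begin
          ∑ (allFin m) (λ e → ind (member e (path i x)))
            ≡⟨ ∑-cong (allFin m) (λ e → trans (cong ind (ShortestPaths.member-∈ᵇ I Z e (path i x) (ℕ.≤-trans (proj₂ (path-good i x)) Δ′≤Z))) (sym (ι-ind (e ∈ᵇ path i x)))) ⟩
          ∑ (allFin m) (λ e → ι (Flow.ind (e ∈ᵇ path i x)))
            ≡⟨ ι-∑ (allFin m) (λ e → Flow.ind (e ∈ᵇ path i x)) ⟨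
          ι (Flow.∑ (allFin m) (λ e → Flow.ind (e ∈ᵇ path i x)))
            ≡⟨ cong ι (Flow.∑-unique (λ _ → 1) (Paths.path-edges-unique I (proj₁ (path-good i x)))) ⟨
          ι (Flow.∑ (path i x) (λ _ → 1))
            ≡⟨ cong ι (trans (Flow.∑-const (path i x) 1) (ℕ.*-identityʳ (length (path i x)))) ⟩
          ι (length (path i x)) ∎)) (ι-mono (proj₂ (path-good i x))) }
      where open ≡-Reasoning

    fractional≡ : ∀ i e → τ * ι (fractional sampler i e) ≡ v̄ (block i) e
    fractional≡ i e = cong (τ *_) (begin
      ι (fractional sampler i e)
        ≡⟨ cong (λ l → ι (foldl (λ a P → if member e (P i) then suc a else a) 0 l)) (take-all Z Rs (ℕ.≤-trans (ℕ.≤-reflexive len) T≤Z)) ⟩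
      ι (foldl (λ a P → if member e (P i) then suc a else a) 0 Rs)
        ≡⟨ trans (foldl-count (λ P → member e (P i)) 0 Rs) (+-identityˡ _) ⟩
      ∑ Rs (λ P → ind (member e (P i)))
        ≡⟨ ∑-elem (λ _ → []) Rs (λ P → ind (member e (P i))) ⟨
      ∑ (allFin (length Rs)) (λ x → ind (member e (elem (λ _ → []) (toℕ x) Rs i)))
        ≡⟨ cong (λ n → ∑ (allFin n) (λ x → ind (member e (elem (λ _ → []) (toℕ x) Rs i)))) len ⟩
      ∑ (allFin T) (λ x → ind (member e (elem (λ _ → []) (toℕ x) Rs i)))
        ≡⟨ ∑-cong (allFin T) (λ x → cong (λ es → ind (member e es)) (sym (path≡ i x))) ⟩
      ∑ (allFin T) (λ x → v′ i x e) ∎)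
      where open ≡-Reasoning

    fractional≤T : ∀ i e → fractional sampler i e ℕ.≤ T
    fractional≤T i e = ℕ.≤-trans
      (ℕ.≤-reflexive (cong (foldl (λ a P → if member e (P i) then suc a else a) 0) (take-all Z Rs (ℕ.≤-trans (ℕ.≤-reflexive len) T≤Z))))
      (ℕ.≤-trans (foldl-count≤ (λ P → member e (P i)) 0 Rs) (ℕ.≤-reflexive len))

    kT≤Z : Edge → k ℕ.* T ℕ.≤ Z
    kT≤Z e = begin
      k ℕ.* T                     ≤⟨ ℕ.m≤m+n (k ℕ.* T) _ ⟩
      2 ℕ.* (k ℕ.* T)             ≡⟨ ℕ.*-identityˡ _ ⟨
      -- The edge `e` shows that `m` is positive.
      1 ℕ.* (2 ℕ.* (k ℕ.* T))     ≤⟨ ℕ.*-monoˡ-≤ _ (ℕ.≤-trans (ℕ.s≤s ℕ.z≤n) (toℕ<n e)) ⟩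
      m ℕ.* (2 ℕ.* (k ℕ.* T))     ≤⟨ ℕ.m≤n+m _ _ ⟩
      2 ℕ.^ suc (q ℕ.+ p) ℕ.+ m ℕ.* (2 ℕ.* (k ℕ.* T)) ≤⟨ cap ⟩
      Z ∎
      where open ℕ.≤-Reasoning

    Small : (Edge → ℕ) → Set
    Small u = ∀ e → u e ℕ.≤ k ℕ.* T

    ifℕ : Bool → ℕ → ℕ
    ifℕ b x = if b then x else 0

    ifℕ≤ : ∀ b {x y} → x ℕ.≤ y → ifℕ b x ℕ.≤ y
    ifℕ≤ true  le = le
    ifℕ≤ false le = ℕ.z≤n

    ι-ifℕ : ∀ b x → ι (ifℕ b x) ≡ ind b * ι x
    ι-ifℕ true  x = sym (*-identityˡ (ι x))
    ι-ifℕ false x = sym (*-zeroˡ (ι x))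

    module _ (x y : List Edge) {u v : Edge → ℕ} (us : Small u) (vs : Small v) where

      term : Edge → ℕ
      term e = ifℕ (high e) (ifℕ (member e x) (u e) ℕ.+ ifℕ (member e y) (v e))

      charge≡ : charge sampler x y u v ≡ Flow.∑ (allFin m) term
      charge≡ = go (allFin m)
        where
        untruncated : ∀ e b {w} → w ℕ.≤ k ℕ.* T → ifℕ b w ℕ.⊓ Z ≡ ifℕ b w
        untruncated e b le = ℕ.m≤n⇒m⊓n≡m (ifℕ≤ b (ℕ.≤-trans le (kT≤Z e)))
        go : ∀ es → foldr (λ e a → if high e then ifℕ (member e x) (u e) ⊕ (ifℕ (member e y) (v e) ⊕ a) else a) 0 es ≡ Flow.∑ es term
        go []       = refl
        go (e ∷ es) with high e
        ... | false = go es
        ... | true rewrite untruncated e (member e x) (us e) | untruncated e (member e y) (vs e) =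
          trans (sym (ℕ.+-assoc (ifℕ (member e x) (u e)) _ _)) (cong (ifℕ (member e x) (u e) ℕ.+ ifℕ (member e y) (v e) ℕ.+_) (go es))

      charge≤ : charge sampler x y u v ℕ.≤ m ℕ.* (2 ℕ.* (k ℕ.* T))
      charge≤ = ℕ.≤-trans (ℕ.≤-reflexive charge≡) (Flow.∑-bound λ e → ifℕ≤ (high e)
        (ℕ.≤-trans (ℕ.+-mono-≤ (ifℕ≤ (member e x) (us e)) (ifℕ≤ (member e y) (vs e)))
                   (ℕ.≤-reflexive (cong (k ℕ.* T ℕ.+_) (sym (ℕ.+-identityʳ (k ℕ.* T)))))))

      ι-charge : ι (charge sampler x y u v) ≡ ∑ (allFin m) (λ e → h e * (ind (member e x) * ι (u e) + ind (member e y) * ι (v e)))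
      ι-charge = trans (cong ι charge≡) (trans (ι-∑ (allFin m) term) (∑-cong (allFin m) λ e →
        trans (ι-ifℕ (high e) _) (cong (h e *_) (trans (ι-+ (ifℕ (member e x) (u e)) (ifℕ (member e y) (v e))) (cong₂ _+_ (ι-ifℕ (member e x) (u e)) (ι-ifℕ (member e y) (v e)))))))

    Deviation : (Edge → ℕ) → (Edge → ℕ) → Vector → Set
    Deviation u v w = ∀ e → w e ≡ τ * (ι (u e) - ι (v e))

    τT : ∀ a → ι T * (τ * a) ≡ a
    τT a = trans (identity₁ (ι T) τ a) (trans (cong (_* a) (½^-inverse p)) (*-identityˡ a))

    ιM : ι M ≡ c * ι T
    ιM = trans (cong ι (ℕ.^-distribˡ-+-* 2 q p)) (ι-* (2 ℕ.^ q) (2 ℕ.^ p))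

    module _ {u v : Edge → ℕ} (us : Small u) (vs : Small v) {w : Vector} (dev : Deviation u v w) (i : Fin k) where
      open Failure

      -- The terms of the two charges combine to (x - y)(u - v), and u - v is `T` times the
      -- deviation.
      gap-charge : ∀ x y → ι (charge sampler (path i x) (path i y) u v) - ι (charge sampler (path i x) (path i y) v u)
                 ≡ ι T * ⟪ h ⊙ w , (λ e → v′ i x e - v′ i y e) ⟫
      gap-charge x y = begin
        ι (charge sampler (path i x) (path i y) u v) - ι (charge sampler (path i x) (path i y) v u)
          ≡⟨ cong₂ _-_ (ι-charge (path i x) (path i y) us vs) (ι-charge (path i x) (path i y) vs us) ⟩
        ∑ es f - ∑ es g
          ≡⟨ ∑-− es f g ⟨
        ∑ es (λ e → f e - g e)
          ≡⟨ ∑-cong es (λ e → trans (identity₂ (h e) (v′ i x e) (v′ i y e) (ι (u e)) (ι (v e)))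
               (trans (cong (λ s → h e * s * (v′ i x e - v′ i y e)) (trans (sym (τT (ι (u e) - ι (v e)))) (cong (ι T *_) (sym (dev e))))) (identity₃ (h e) (ι T) (w e) (v′ i x e - v′ i y e)))) ⟩
        ∑ es (λ e → ι T * (h e * w e * (v′ i x e - v′ i y e)))
          ≡⟨ ∑-* es (ι T) (λ e → h e * w e * (v′ i x e - v′ i y e)) ⟩
        ι T * ⟪ h ⊙ w , (λ e → v′ i x e - v′ i y e) ⟫ ∎
        where
        open ≡-Reasoning
        f g : Edge → ℚ
        f e = h e * (v′ i x e * ι (u e) + v′ i y e * ι (v e))
        g e = h e * (v′ i x e * ι (v e) + v′ i y e * ι (u e))

      D : X → X → ℚ
      D x y = ⟪ h ⊙ w , (λ e → v′ i x e - v′ i y e) ⟫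

      D-swap : ∀ x y → D y x ≡ - D x y
      D-swap x y = trans (∑-cong es λ e → identity₄ (h e * w e) (v′ i x e) (v′ i y e))
        (trans (∑-* es (- 1ℚ) (λ e → h e * w e * (v′ i x e - v′ i y e))) (identity₅ (D x y)))

      module _ (allowed : Vector) (alive : Failure.Alive allowed (block i) w) where

        charge-gap≤ : ∀ x y → charge sampler (path i x) (path i y) u v ℕ.≤ M ℕ.+ charge sampler (path i x) (path i y) v u
        charge-gap≤ x y = ι-cancel (begin
          ι C                          ≡⟨ identity₆ (ι C) (ι C′) ⟩
          (ι C - ι C′) + ι C′          ≡⟨ cong (_+ ι C′) (gap-charge x y) ⟩
          ι T * D x y + ι C′           ≤⟨ +-monoˡ-≤ (ι C′) (*-mono (ι≥0 T) (alive x y)) ⟩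
          ι T * c + ι C′               ≡⟨ cong (_+ ι C′) (trans (*-comm (ι T) c) (sym ιM)) ⟩
          ι M + ι C′                   ≡⟨ ι-+ M C′ ⟨
          ι (M ℕ.+ C′) ∎)
          where
          open ≤-Reasoning
          C C′ : ℕ
          C  = charge sampler (path i x) (path i y) u v
          C′ = charge sampler (path i x) (path i y) v u

        -- Since M = cT, `gap-charge` turns the counts of `biased-coin` into T (c - D) and T (c +
        -- D); `alive` keeps both nonnegative.
        choice : ∀ x y (F : List Edge → ℚ) →
          ∑< (M ℕ.+ M) (λ r → F (choose sampler u v (path i x) (path i y) r))
          ≡ ι T * ((c - D x y) * F (path i x) + (c + D x y) * F (path i y))
        choice x y F = begin
          ∑< (M ℕ.+ M) (λ r → F (choose sampler u v (path i x) (path i y) r))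
            ≡⟨ ∑<-cong (M ℕ.+ M) (λ r _ → if-float r) ⟩
          ∑< (M ℕ.+ M) (λ r → if cond r then F (path i x) else F (path i y))
            ≡⟨ biased-coin M C C′ cond (F (path i x)) (F (path i y)) (charge-gap≤ x y) gap′ true⇒ false⇒ ⟩
          (ι M + ι C′ - ι C) * F (path i x) + (ι M - ι C′ + ι C) * F (path i y)
            ≡⟨ cong₂ (λ a b → a * F (path i x) + b * F (path i y)) eq₁ eq₂ ⟩
          (ι T * (c - D x y)) * F (path i x) + (ι T * (c + D x y)) * F (path i y)
            ≡⟨ identity₇ (ι T) (c - D x y) (c + D x y) (F (path i x)) (F (path i y)) ⟩
          ι T * ((c - D x y) * F (path i x) + (c + D x y) * F (path i y)) ∎
          where
          open ≡-Reasoning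
          C C′ : ℕ
          C  = charge sampler (path i x) (path i y) u v
          C′ = charge sampler (path i x) (path i y) v u
          cond : ℕ → Bool
          cond r = r ⊕ C ≺ M ⊕ C′
          if-float : ∀ r → F (if cond r then path i x else path i y) ≡ (if cond r then F (path i x) else F (path i y))
          if-float r with cond r
          ... | true  = refl
          ... | false = refl
          eq₁ : ι M + ι C′ - ι C ≡ ι T * (c - D x y)
          eq₁ = trans (identity₈ (ι M) (ι C) (ι C′)) (trans (cong₂ _-_ ιM (gap-charge x y)) (identity₁₀ c (ι T) (D x y)))
          eq₂ : ι M - ι C′ + ι C ≡ ι T * (c + D x y)
          eq₂ = trans (identity₉ (ι M) (ι C) (ι C′)) (trans (cong₂ _+_ ιM (gap-charge x y)) (identity₁₁ c (ι T) (D x y)))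
          gap′ : C′ ℕ.≤ M ℕ.+ C
          gap′ = ι-cancel (≤-trans (≤-trans (gap (ι T * (c + D x y)) (*-≥0 (ι≥0 T) 0≤c+D) refl) (≤-reflexive (trans (cong (ι C′ +_) (sym eq₂)) (identity₁₂ (ι M) (ι C) (ι C′))))) (≤-reflexive (sym (ι-+ M C))))
            where
            0≤c+D : 0ℚ ≤ c + D x y
            0≤c+D = ≤-trans (0≤-gap (alive y x)) (≤-reflexive (trans (cong (λ s → c - s) (D-swap x y)) (identity₁₃ c (D x y))))
          r⊕ : ∀ r → r ℕ.< M ℕ.+ M → r ⊕ C ≡ r ℕ.+ C
          r⊕ r r< = cong (ℕ._+ C) (ℕ.m≤n⇒m⊓n≡m (ℕ.≤-trans (ℕ.<⇒≤ r<) 2M≤Z))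
          M⊕ : M ⊕ C′ ≡ M ℕ.+ C′
          M⊕ = cong (ℕ._+ C′) (ℕ.m≤n⇒m⊓n≡m (ℕ.≤-trans (ℕ.m≤m+n M M) 2M≤Z))
          sum≤Z : ∀ r → r ℕ.< M ℕ.+ M → r ℕ.+ C ℕ.≤ Z
          sum≤Z r r< = ℕ.≤-trans (ℕ.+-mono-≤ (ℕ.≤-trans (ℕ.<⇒≤ r<) (ℕ.≤-reflexive (cong (M ℕ.+_) (sym (ℕ.+-identityʳ M))))) (charge≤ (path i x) (path i y) us vs)) cap
          true⇒ : ∀ r → r ℕ.< M ℕ.+ M → cond r ≡ true → r ℕ.+ C ℕ.< M ℕ.+ C′
          true⇒ r r< eq = Flow.≺-true Z (sum≤Z r r<) (trans (cong₂ _≺_ (sym (r⊕ r r<)) (sym M⊕)) eq)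
          false⇒ : ∀ r → r ℕ.< M ℕ.+ M → cond r ≡ false → M ℕ.+ C′ ℕ.≤ r ℕ.+ C
          false⇒ r r< eq = Flow.≺-false Z (sum≤Z r r<) (trans (cong₂ _≺_ (sym (r⊕ r r<)) (sym M⊕)) eq)

      ∑≡μ : ∀ (f : X → ℚ) → ∑ (allFin T) f ≡ ι T * μ f
      ∑≡μ f = sym (τT (∑ (allFin T) f))

      -- Two uniform candidates and a coin biased by their difference amount to
      -- one candidate drawn with the tilted distribution.
      tilted : ∀ (allowed : Vector) (g : X → ℚ) →
        ∑ (allFin T) (λ x → ∑ (allFin T) (λ y → ι T * ((c - D x y) * g x + (c + D x y) * g y)))
        ≡ 2ℚ * ι M * ι T * ι T * μ (λ x → (1ℚ - Failure.tilt allowed (block i) w x) * g x)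
      tilted allowed g = begin
        ∑ xs (λ x → ∑ xs (λ y → ι T * ((c - D x y) * g x + (c + D x y) * g y)))
          ≡⟨ trans (∑-cong xs λ x → ∑-* xs (ι T) _) (∑-* xs (ι T) _) ⟩
        ι T * ∑ xs (λ x → ∑ xs (λ y → (c - D x y) * g x + (c + D x y) * g y))
          ≡⟨ cong (ι T *_) (trans (∑-cong xs λ x → ∑-+ xs (λ y → (c - D x y) * g x) (λ y → (c + D x y) * g y)) (∑-+ xs (λ x → ∑ xs (λ y → (c - D x y) * g x)) (λ x → ∑ xs (λ y → (c + D x y) * g y)))) ⟩
        ι T * (A₁ + ∑ xs (λ x → ∑ xs (λ y → (c + D x y) * g y)))
          ≡⟨ cong (λ s → ι T * (A₁ + s)) (trans (∑-swap xs xs (λ x y → (c + D x y) * g y)) (∑-cong xs λ x → ∑-cong xs λ y → cong (_* g x) (cong (c +_) (D-swap x y)))) ⟩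
        ι T * (A₁ + A₁)
          ≡⟨ cong (λ s → ι T * (s + s)) (trans (∑-cong xs inner) (trans (∑-* xs (ι T * c) F) (cong (ι T * c *_) (∑≡μ F)))) ⟩
        ι T * (ι T * c * (ι T * μ F) + ι T * c * (ι T * μ F))
          ≡⟨ identity₁₄ (ι T) c (μ F) ⟩
        2ℚ * (c * ι T) * ι T * ι T * μ F
          ≡⟨ cong (λ s → 2ℚ * s * ι T * ι T * μ F) ιM ⟨
        2ℚ * ι M * ι T * ι T * μ F ∎
        where
        open ≡-Reasoning
        xs = allFin T
        A₁ : ℚ
        A₁ = ∑ xs (λ x → ∑ xs (λ y → (c - D x y) * g x))
        tilt′ F : X → ℚ
        tilt′ = Failure.tilt allowed (block i) w
        F x = (1ℚ - tilt′ x) * g x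
        inner : ∀ x → ∑ xs (λ y → (c - D x y) * g x) ≡ ι T * c * F x
        inner x = begin
          ∑ xs (λ y → (c - D x y) * g x)          ≡⟨ ∑-cong xs (λ y → *-comm (c - D x y) (g x)) ⟩
          ∑ xs (λ y → g x * (c - D x y))          ≡⟨ ∑-* xs (g x) _ ⟩
          g x * ∑ xs (λ y → c - D x y)            ≡⟨ cong (g x *_) (∑≡μ (λ y → c - D x y)) ⟩
          g x * (ι T * μ (λ y → c - D x y))       ≡⟨ cong (λ s → g x * (ι T * s)) (trans (μ-− (λ _ → c) (D x)) (cong₂ _-_ (μ-const c) (sym (Failure.⟪d⟫-mean allowed (block i) w x)))) ⟩
          g x * (ι T * (c - δ))                   ≡⟨ identity₁₅ (g x) (ι T) c δ c⁻¹ ⟩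
          ι T * c * ((1ℚ - c⁻¹ * δ) * g x) + ι T * g x * (c⁻¹ * c - 1ℚ) * δ
                                                  ≡⟨ cong (λ s → ι T * c * ((1ℚ - c⁻¹ * δ) * g x) + ι T * g x * (s - 1ℚ) * δ) (½^-inverse q) ⟩
          ι T * c * ((1ℚ - c⁻¹ * δ) * g x) + ι T * g x * (1ℚ - 1ℚ) * δ
                                                  ≡⟨ identity₁₆ (ι T * c * ((1ℚ - c⁻¹ * δ) * g x)) (ι T * g x) δ ⟩
          ι T * c * F x ∎
          where
          δ = ⟪ d (block i) x , h ⊙ w ⟫

    run : List (Fin k) → State → State
    run []       st = st
    run (i ∷ is) st = run is (step sampler i st)

    within? : (u v : Edge → ℕ) → Dec (∀ e → u e ℕ.≤ v e ℕ.+ T ℕ.* A e)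
    within? u v = all? λ e → u e ℕ.≤? v e ℕ.+ T ℕ.* A e

    failure : State → ℚ
    failure (_ , u , v , _) = select (within? u v) 0ℚ 1ℚ

    failure≤1 : ∀ st → failure st ≤ 1ℚ
    failure≤1 (_ , u , v , _) with within? u v
    ... | yes _ = 0≤1
    ... | no  _ = ≤-refl

    coins : List (Fin k) → ℕ → ℕ
    coins []       z = z
    coins (i ∷ is) z = p ℕ.+ (p ℕ.+ (suc (q ℕ.+ p) ℕ.+ coins is z))

    2^coins : ∀ i is z → 2ℚ ^ coins (i ∷ is) z ≡ 2ℚ * ι M * ι T * ι T * 2ℚ ^ coins is z
    2^coins i is z = trans (^-+ 2ℚ p _) (trans (cong (2ℚ ^ p *_) (trans (^-+ 2ℚ p _) (cong (2ℚ ^ p *_) (^-+ 2ℚ (suc (q ℕ.+ p)) (coins is z)))))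
      (trans (cong₂ (λ a b → a * (a * (2ℚ * b * 2ℚ ^ coins is z))) (sym (ι2^ p)) (sym (ι2^ (q ℕ.+ p)))) (identity₁₇ (ι T) (ι M) (2ℚ ^ coins is z))))

    open Draws Z

    step-draws : ∀ i z u v P (F : State → ℚ) →
      ∑ᶜ (p ℕ.+ (p ℕ.+ (suc (q ℕ.+ p) ℕ.+ z))) (λ ω → F (step sampler i (ω , u , v , P)))
      ≡ ∑ (allFin T) (λ x → ∑ (allFin T) (λ y → ∑< (M ℕ.+ M) (λ r →
          ∑ᶜ z (λ ω → F (advance sampler i u v P ω (choose sampler u v (path i x) (path i y) r))))))
    step-draws i z u v P F = begin
      ∑ᶜ (p ℕ.+ (p ℕ.+ (suc (q ℕ.+ p) ℕ.+ z))) (λ ω → F₁ (draw p ω))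
        ≡⟨ ∑ᶜ-draw p (p ℕ.+ (suc (q ℕ.+ p) ℕ.+ z)) F₁ T≤Z ⟩
      ∑< T (λ a → ∑ᶜ (p ℕ.+ (suc (q ℕ.+ p) ℕ.+ z)) (λ ω → F₂ a (draw p ω)))
        ≡⟨ ∑<-cong T (λ a _ → ∑ᶜ-draw p (suc (q ℕ.+ p) ℕ.+ z) (F₂ a) T≤Z) ⟩
      ∑< T (λ a → ∑< T (λ b → ∑ᶜ (suc (q ℕ.+ p) ℕ.+ z) (λ ω → F₃ a b (draw (suc (q ℕ.+ p)) ω))))
        ≡⟨ ∑<-cong T (λ a _ → ∑<-cong T (λ b _ → trans (∑ᶜ-draw (suc (q ℕ.+ p)) z (F₃ a b) (ℕ.≤-trans (ℕ.≤-reflexive 2M≡) 2M≤Z))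
             (cong (λ n → ∑< n (λ r → ∑ᶜ z (λ ω → F₃ a b (ω , r)))) 2M≡))) ⟩
      ∑< T (λ a → ∑< T (λ b → ∑< (M ℕ.+ M) (λ r → ∑ᶜ z (λ ω → F₃ a b (ω , r))))) ∎
      where
      open ≡-Reasoning
      F₃ : ℕ → ℕ → Coins × ℕ → ℚ
      F₃ a b (ω , r) = F (advance sampler i u v P ω (choose sampler u v (pick sampler i a) (pick sampler i b) r))
      F₂ : ℕ → Coins × ℕ → ℚ
      F₂ a (ω , b) = F₃ a b (draw (suc (q ℕ.+ p)) ω)
      F₁ : Coins × ℕ → ℚ
      F₁ (ω , a) = F₂ a (draw p ω)
      2M≡ : 2 ℕ.^ suc (q ℕ.+ p) ≡ M ℕ.+ M
      2M≡ = cong (M ℕ.+_) (ℕ.+-identityʳ M)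

    open Failure (ι ∘ A)

    -- By `choice` and `tilted`, the coins of one commodity average to one tilted step. The sampler
    -- goes on even when the bias is out of range; nothing is claimed about it from there on, and
    -- `bad` counts such a run as failed.
    simulate : ∀ is j z u v P w → j ℕ.+ length is ℕ.≤ k → (∀ e → u e ℕ.≤ j ℕ.* T) → (∀ e → v e ℕ.≤ j ℕ.* T) →
      Deviation u v w →
      ∑ᶜ (coins is z) (λ ω → failure (run is (ω , u , v , P))) ≤ 2ℚ ^ coins is z * bad (map block is) w
    simulate [] j z u v P w le us vs dev = ≤-trans
      (≤-reflexive (∑ᶜ-const z (select (within? u v) 0ℚ 1ℚ)))
      (*-mono (^-≥0 0≤2 z) (select≤ (within? u v) (accept? w)))
      where
      select≤ : (d₁ : Dec (∀ e → u e ℕ.≤ v e ℕ.+ T ℕ.* A e)) (d₂ : Dec (∀ e → w e ≤ ι (A e))) →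
                select d₁ 0ℚ 1ℚ ≤ select d₂ 0ℚ 1ℚ
      select≤ (yes _) (yes _) = ≤-refl
      select≤ (yes _) (no _)  = 0≤1
      select≤ (no _)  (no _)  = ≤-refl
      select≤ (no ¬p) (yes p) = contradiction (λ e → ι-cancel (begin
        ι (u e)                               ≡⟨ identity₁₈ (ι (u e)) (ι (v e)) ⟩
        ι (v e) + (ι (u e) - ι (v e))         ≡⟨ cong (ι (v e) +_) (trans (sym (τT _)) (cong (ι T *_) (sym (dev e)))) ⟩
        ι (v e) + ι T * w e                   ≤⟨ +-monoʳ-≤ (ι (v e)) (*-mono (ι≥0 T) (p e)) ⟩
        ι (v e) + ι T * ι (A e)               ≡⟨ trans (ι-+ (v e) (T ℕ.* A e)) (cong (ι (v e) +_) (ι-* T (A e))) ⟨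
        ι (v e ℕ.+ T ℕ.* A e) ∎)) ¬p
        where
        open ≤-Reasoning
    simulate (i ∷ is) j z u v P w le us vs dev = continue (alive? (block i) w)
      where
      z′ = coins is z
      F : State → ℚ
      F st = failure (run is st)
      u′ : List Edge → Edge → ℕ
      u′ x e = (if member e x then T else 0) ⊕ u e
      v″ : Edge → ℕ
      v″ e = fractional sampler i e ⊕ v e
      g : List Edge → ℚ
      g x = ∑ᶜ z′ (λ ω → F (advance sampler i u v P ω x))
      j≤k : j ℕ.≤ k
      j≤k = ℕ.m+n≤o⇒m≤o j le
      small : ∀ {f : Edge → ℕ} → (∀ e → f e ℕ.≤ j ℕ.* T) → Small f
      small le e = ℕ.≤-trans (le e) (ℕ.*-monoˡ-≤ T j≤k)
      T-if : ∀ b → (if b then T else 0) ℕ.⊓ Z ≡ (if b then T else 0)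
      T-if true  = ℕ.m≤n⇒m⊓n≡m T≤Z
      T-if false = refl
      T-if≤ : ∀ b → (if b then T else 0) ℕ.≤ T
      T-if≤ true  = ℕ.≤-refl
      T-if≤ false = ℕ.z≤n
      ι-T-if : ∀ b → ι (if b then T else 0) ≡ ind b * ι T
      ι-T-if true  = sym (*-identityˡ (ι T))
      ι-T-if false = sym (*-zeroˡ (ι T))
      u′≡ : ∀ x e → u′ x e ≡ (if member e x then T else 0) ℕ.+ u e
      u′≡ x e = cong (ℕ._+ u e) (T-if (member e x))
      v″≡ : ∀ e → v″ e ≡ fractional sampler i e ℕ.+ v e
      v″≡ e = cong (ℕ._+ v e) (ℕ.m≤n⇒m⊓n≡m (ℕ.≤-trans (fractional≤T i e) T≤Z))
      next : ∀ x → g (path i x) ≤ 2ℚ ^ z′ * bad (map block is) (w ⊹ d (block i) x)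
      next x = simulate is (suc j) z (u′ (path i x)) v″ (λ j′ → if does (j′ ≟ i) then path i x else P j′) (w ⊹ d (block i) x)
        (ℕ.≤-trans (ℕ.≤-reflexive (sym (ℕ.+-suc j (length is)))) le)
        (λ e → ℕ.≤-trans (ℕ.≤-reflexive (u′≡ (path i x) e)) (ℕ.+-mono-≤ (T-if≤ (member e (path i x))) (us e)))
        (λ e → ℕ.≤-trans (ℕ.≤-reflexive (v″≡ e)) (ℕ.+-mono-≤ (fractional≤T i e) (vs e)))
        λ e → begin
          w e + (v′ i x e - v̄ (block i) e)
            ≡⟨ cong₂ (λ a b → a + (v′ i x e - b)) (dev e) (sym (fractional≡ i e)) ⟩
          τ * (ι (u e) - ι (v e)) + (v′ i x e - τ * ι (fractional sampler i e))
            ≡⟨ cong (λ a → τ * (ι (u e) - ι (v e)) + (a - τ * ι (fractional sampler i e))) (trans (sym (*-identityˡ (v′ i x e))) (cong (_* v′ i x e) (sym (½^-inverse p)))) ⟩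
          τ * (ι (u e) - ι (v e)) + (τ * ι T * v′ i x e - τ * ι (fractional sampler i e))
            ≡⟨ identity₁₉ τ (ι (u e)) (ι (v e)) (ι T) (v′ i x e) (ι (fractional sampler i e)) ⟩
          τ * ((v′ i x e * ι T + ι (u e)) - (ι (fractional sampler i e) + ι (v e)))
            ≡⟨ cong₂ (λ a b → τ * (a - b)) (trans (cong (_+ ι (u e)) (sym (ι-T-if (member e (path i x))))) (trans (sym (ι-+ (if member e (path i x) then T else 0) (u e))) (cong ι (sym (u′≡ (path i x) e)))))
                                          (trans (sym (ι-+ (fractional sampler i e) (v e))) (cong ι (sym (v″≡ e)))) ⟩
          τ * (ι (u′ (path i x) e) - ι (v″ e)) ∎
        where
        open ≡-Reasoning
      continue : (dec : Dec (Alive (block i) w)) →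
        ∑ᶜ (coins (i ∷ is) z) (λ ω → F (step sampler i (ω , u , v , P)))
        ≤ 2ℚ ^ coins (i ∷ is) z * select dec (μ (λ x → (1ℚ - tilt (block i) w x) * bad (map block is) (w ⊹ d (block i) x))) 1ℚ
      continue (no _) = ≤-trans (∑ᶜ-mono (coins (i ∷ is) z) (λ ω → failure≤1 (run is (step sampler i (ω , u , v , P)))))
        (≤-reflexive (∑ᶜ-const (coins (i ∷ is) z) 1ℚ))
      continue (yes alive) = begin
        ∑ᶜ (coins (i ∷ is) z) (λ ω → F (step sampler i (ω , u , v , P)))
          ≡⟨ step-draws i z′ u v P F ⟩
        ∑ (allFin T) (λ x → ∑ (allFin T) (λ y → ∑< (M ℕ.+ M) (λ r → g (choose sampler u v (path i x) (path i y) r))))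
          ≡⟨ ∑-cong (allFin T) (λ x → ∑-cong (allFin T) λ y → choice (small us) (small vs) {w} dev i (ι ∘ A) alive x y g) ⟩
        ∑ (allFin T) (λ x → ∑ (allFin T) (λ y → ι T * ((c - D′ x y) * g (path i x) + (c + D′ x y) * g (path i y))))
          ≡⟨ tilted (small us) (small vs) {w} dev i (ι ∘ A) (λ x → g (path i x)) ⟩
        2ℚ * ι M * ι T * ι T * μ (λ x → (1ℚ - tilt (block i) w x) * g (path i x))
          ≤⟨ *-mono scale≥0 (μ-mono λ x → *-mono (0≤-gap (proj₁ (alive-tilt {block i} {w} alive x))) (next x)) ⟩
        2ℚ * ι M * ι T * ι T * μ (λ x → (1ℚ - tilt (block i) w x) * (2ℚ ^ z′ * bad (map block is) (w ⊹ d (block i) x)))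
          ≡⟨ cong (2ℚ * ι M * ι T * ι T *_) (trans (μ-cong λ x → identity₂₀ (1ℚ - tilt (block i) w x) (2ℚ ^ z′) (bad (map block is) (w ⊹ d (block i) x))) (μ-* (2ℚ ^ z′) (λ x → (1ℚ - tilt (block i) w x) * bad (map block is) (w ⊹ d (block i) x)))) ⟩
        2ℚ * ι M * ι T * ι T * (2ℚ ^ z′ * μ (λ x → (1ℚ - tilt (block i) w x) * bad (map block is) (w ⊹ d (block i) x)))
          ≡⟨ trans (sym (*-assoc (2ℚ * ι M * ι T * ι T) (2ℚ ^ z′) (μ (λ x → (1ℚ - tilt (block i) w x) * bad (map block is) (w ⊹ d (block i) x))))) (cong (_* μ (λ x → (1ℚ - tilt (block i) w x) * bad (map block is) (w ⊹ d (block i) x))) (sym (2^coins i is z))) ⟩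
        2ℚ ^ coins (i ∷ is) z * μ (λ x → (1ℚ - tilt (block i) w x) * bad (map block is) (w ⊹ d (block i) x)) ∎
        where
        open ≤-Reasoning
        D′ : X → X → ℚ
        D′ = D (small us) (small vs) {w} dev i
        scale≥0 : 0ℚ ≤ 2ℚ * ι M * ι T * ι T
        scale≥0 = *-≥0 (*-≥0 (*-≥0 0≤2 (ι≥0 M)) (ι≥0 T)) (ι≥0 T)

    choose-either : ∀ u v x y r → choose sampler u v x y r ≡ x ⊎ choose sampler u v x y r ≡ y
    choose-either u v x y r with r ⊕ charge sampler x y u v ≺ M ⊕ charge sampler x y v u
    ... | true  = inj₁ refl
    ... | false = inj₂ refl

    pick-path : ∀ i a → a ℕ.< T → ∃[ x ] pick sampler i a ≡ path i x
    pick-path i a a< = fromℕ< a< , cong (pick sampler i) (sym (toℕ-fromℕ< a<))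

    initial : Coins → State
    initial ω = ω , (λ _ → 0) , (λ _ → 0) , (λ _ → [])

    taken expected : State → Edge → ℕ
    taken    (_ , u , _ , _) = u
    expected (_ , _ , v , _) = v

    routed : State → Routing
    routed (_ , _ , _ , P) = P

    -- What holds for every coin string, once the commodities in `xs` have been routed.
    record Outcome (xs : List (Fin k)) (st : State) : Set where
      field
        paths : All (λ i → ∃[ x ] routed st i ≡ path i x) xs
        u≡    : ∀ e → taken st e ≡ T ℕ.* Flow.∑ xs (λ i → Flow.ind (member e (routed st i)))
        v≡    : ∀ e → expected st e ≡ Flow.∑ xs (λ i → fractional sampler i e)
    open Outcome

    ∑-cong-All : ∀ {xs : List (Fin k)} {f g : Fin k → ℕ} → All (λ i → f i ≡ g i) xs → Flow.∑ xs f ≡ Flow.∑ xs g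
    ∑-cong-All []       = refl
    ∑-cong-All (p ∷ ps) = cong₂ ℕ._+_ p (∑-cong-All ps)

    outcome-step : ∀ {i xs st} → Unique (i ∷ xs) → Outcome xs st → Outcome (i ∷ xs) (step sampler i st)
    outcome-step {i} {xs} {st@(ω , u₀ , v₀ , P₀)} (i∉ ∷ _) o = record
      { paths = chosen ∷ All.zipWith (λ {j} (i≢j , x , eq) → x , trans (other (i≢j ∘ sym)) eq) (i∉ , paths o)
      ; u≡ = λ e → begin
          ((if member e y then T else 0) ℕ.⊓ Z) ℕ.+ u₀ e
            ≡⟨ cong₂ ℕ._+_ (T-if (member e y)) (u≡ o e) ⟩
          T ℕ.* Flow.ind (member e y) ℕ.+ T ℕ.* Flow.∑ xs (λ j → Flow.ind (member e (P₀ j)))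
            ≡⟨ ℕ.*-distribˡ-+ T (Flow.ind (member e y)) _ ⟨
          T ℕ.* (Flow.ind (member e y) ℕ.+ Flow.∑ xs (λ j → Flow.ind (member e (P₀ j))))
            ≡⟨ cong (T ℕ.*_) (cong₂ ℕ._+_ (cong (λ es → Flow.ind (member e es)) (sym self))
                 (∑-cong-All (All.map (λ {j} i≢j → cong (λ es → Flow.ind (member e es)) (sym (other (i≢j ∘ sym)))) i∉))) ⟩
          T ℕ.* Flow.∑ (i ∷ xs) (λ j → Flow.ind (member e (P′ j))) ∎
      ; v≡ = λ e → cong₂ ℕ._+_ (ℕ.m≤n⇒m⊓n≡m (ℕ.≤-trans (fractional≤T i e) T≤Z)) (v≡ o e) }
      where
      open ≡-Reasoning
      d₁ = draw p ω
      d₂ = draw p (proj₁ d₁)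
      d₃ = draw (suc (q ℕ.+ p)) (proj₁ d₂)
      x₁ x₂ y : List Edge
      x₁ = pick sampler i (proj₂ d₁)
      x₂ = pick sampler i (proj₂ d₂)
      y = choose sampler u₀ v₀ x₁ x₂ (proj₂ d₃)
      P′ : Routing
      P′ j = if does (j ≟ i) then y else P₀ j
      self : P′ i ≡ y
      self with i ≟ i
      ... | yes _ = refl
      ... | no ¬p = contradiction refl ¬p
      other : ∀ {j} → j ≢ i → P′ j ≡ P₀ j
      other {j} j≢i with j ≟ i
      ... | yes p = contradiction p j≢i
      ... | no _  = refl
      chosen : ∃[ x ] P′ i ≡ path i x
      chosen with choose-either u₀ v₀ x₁ x₂ (proj₂ d₃)
      ... | inj₁ eq = proj₁ r , trans self (trans eq (proj₂ r))
        where r = pick-path i (proj₂ d₁) (draw< p ω T≤Z)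
      ... | inj₂ eq = proj₁ r , trans self (trans eq (proj₂ r))
        where r = pick-path i (proj₂ d₂) (draw< p (proj₁ d₁) T≤Z)
      T-if : ∀ b → (if b then T else 0) ℕ.⊓ Z ≡ T ℕ.* Flow.ind b
      T-if true  = trans (ℕ.m≤n⇒m⊓n≡m T≤Z) (sym (ℕ.*-identityʳ T))
      T-if false = sym (ℕ.*-zeroʳ T)

    outcome : ∀ ω {xs} → Unique xs → Outcome xs (foldr (step sampler) (initial ω) xs)
    outcome ω []            = record { paths = [] ; u≡ = λ e → sym (ℕ.*-zeroʳ T) ; v≡ = λ e → refl }
    outcome ω (x∉ ∷ unique) = outcome-step (x∉ ∷ unique) (outcome ω unique)

    final : Coins → State
    final ω = foldr (step sampler) (initial ω) (allFin k)

    final-outcome : ∀ ω → Outcome (allFin k) (final ω)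
    final-outcome ω = outcome ω (allFin⁺ k)

    sample-path : ∀ ω i → ∃[ x ] sample sampler ω i ≡ path i x
    sample-path ω i = All.lookup (paths (final-outcome ω)) (∈-allFin i)

    sample-good : ∀ ω i → Instance.IsPath I (s i) (sample sampler ω i) (t i) × length (sample sampler ω i) ℕ.≤ Δ′
    sample-good ω i with sample-path ω i
    ... | x , eq = subst (λ es → Instance.IsPath I (s i) es (t i) × length es ℕ.≤ Δ′) (sym eq) (path-good i x)

    member-flow : ∀ {P} → Approachability.Good I Z P → ∀ e →
                  Flow.∑ (allFin k) (λ i → Flow.ind (member e (P i))) ≡ Flow.flow I P e
    member-flow {P} good e = Flow.∑-cong (allFin k) λ i →
      cong Flow.ind (ShortestPaths.member-∈ᵇ I Z e (P i) (ℕ.≤-trans (proj₂ (good i)) Δ′≤Z))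

    fractional-∑ : ∀ i e → fractional sampler i e ≡ Flow.∑ Rs (λ R → Flow.ind (member e (R i)))
    fractional-∑ i e = trans
      (cong (foldl (λ a P → if member e (P i) then suc a else a) 0) (take-all Z Rs (ℕ.≤-trans (ℕ.≤-reflexive len) T≤Z)))
      (go 0 Rs)
      where
      go : ∀ a (xs : List Routing) → foldl (λ a P → if member e (P i) then suc a else a) a xs ≡ a ℕ.+ Flow.∑ xs (λ R → Flow.ind (member e (R i)))
      go a []       = sym (ℕ.+-identityʳ a)
      go a (R ∷ xs) with member e (R i)
      ... | true  = trans (go (suc a) xs) (sym (ℕ.+-suc a _))
      ... | false = go a xs

    module _ (spread : ∀ e → Flow.∑ Rs (λ R → Flow.flow I R e) ℕ.≤ T ℕ.* suc (b′ e)) where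

      total-fractional : ∀ e → Flow.∑ (allFin k) (λ i → fractional sampler i e) ℕ.≤ T ℕ.* suc (b′ e)
      total-fractional e = begin
        Flow.∑ (allFin k) (λ i → fractional sampler i e)
          ≡⟨ Flow.∑-cong (allFin k) (λ i → fractional-∑ i e) ⟩
        Flow.∑ (allFin k) (λ i → Flow.∑ Rs (λ R → Flow.ind (member e (R i))))
          ≡⟨ Flow.∑-swap (allFin k) Rs (λ i R → Flow.ind (member e (R i))) ⟩
        Flow.∑ Rs (λ R → Flow.∑ (allFin k) (λ i → Flow.ind (member e (R i))))
          ≡⟨ congAll good ⟩
        Flow.∑ Rs (λ R → Flow.flow I R e)
          ≤⟨ spread e ⟩
        T ℕ.* suc (b′ e) ∎
        where
        open ℕ.≤-Reasoning
        congAll : ∀ {xs} → All (Approachability.Good I Z) xs →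
          Flow.∑ xs (λ R → Flow.∑ (allFin k) (λ i → Flow.ind (member e (R i)))) ≡ Flow.∑ xs (λ R → Flow.flow I R e)
        congAll []       = refl
        congAll (g ∷ gs) = cong₂ ℕ._+_ (member-flow g e) (congAll gs)

      -- The accumulators hold `T` times the load and `T` times the fractional load; `spread` bounds
      -- the latter, and `T` cancels.
      load-bound : ∀ ω → (∀ e → taken (final ω) e ℕ.≤ expected (final ω) e ℕ.+ T ℕ.* A e) →
                   ∀ e → Instance.load I (sample sampler ω) e ℕ.≤ suc (b′ e) ℕ.+ A e
      load-bound ω within e = ℕ.*-cancelˡ-≤ T {{ℕ.>-nonZero (ℕ.≤-trans (ℕ.s≤s ℕ.z≤n) (n<2^n p))}} (begin
        T ℕ.* Instance.load I P₁ e
          ≡⟨ cong (T ℕ.*_) (trans (Flow.load≡flow I P₁ e) (sym (member-flow (sample-good ω) e))) ⟩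
        T ℕ.* Flow.∑ (allFin k) (λ i → Flow.ind (member e (P₁ i)))
          ≡⟨ u≡ (final-outcome ω) e ⟨
        taken (final ω) e
          ≤⟨ within e ⟩
        expected (final ω) e ℕ.+ T ℕ.* A e
          ≡⟨ cong (ℕ._+ T ℕ.* A e) (v≡ (final-outcome ω) e) ⟩
        Flow.∑ (allFin k) (λ i → fractional sampler i e) ℕ.+ T ℕ.* A e
          ≤⟨ ℕ.+-monoˡ-≤ (T ℕ.* A e) (total-fractional e) ⟩
        T ℕ.* suc (b′ e) ℕ.+ T ℕ.* A e
          ≡⟨ ℕ.*-distribˡ-+ T (suc (b′ e)) (A e) ⟨
        T ℕ.* (suc (b′ e) ℕ.+ A e) ∎)
        where
        open ℕ.≤-Reasoning
        P₁ = sample sampler ω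

    -- The algorithm folds from the right, so it routes the commodities in descending order, and the
    -- walk has to follow that order.
    final≡run : ∀ ω → final ω ≡ run (reverse (allFin k)) (initial ω)
    final≡run ω = trans (sym (reverse-foldl (λ st i → step sampler i st) (initial ω) (allFin k))) (sym (run-foldl (reverse (allFin k)) (initial ω)))
      where
      run-foldl : ∀ is st → run is st ≡ foldl (λ st i → step sampler i st) st is
      run-foldl []       st = refl
      run-foldl (i ∷ is) st = run-foldl is (step sampler i st)

    order : List (Fin k)
    order = reverse (allFin k)

    length-order : length order ≡ k
    length-order = trans (length-reverse (allFin k)) (length-tabulate {n = k} id)

    failures : ∀ z → ∑ᶜ (coins order z) (λ ω → failure (final ω)) ≤ 2ℚ ^ coins order z * bad (map block order) (λ _ → 0ℚ)
    failures z = ≤-trans (≤-reflexive (∑ᶜ-cong (coins order z) λ ω → cong failure (final≡run ω)))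
      (simulate order 0 z (λ _ → 0) (λ _ → 0) (λ _ → []) (λ _ → 0ℚ) (ℕ.≤-reflexive length-order)
        (λ e → ℕ.z≤n) (λ e → ℕ.z≤n) λ e → sym (*-zeroʳ τ))

    Σv̄ : ∀ e → ∑ order (λ i → v̄ (block i) e) ≡ τ * ι (Flow.∑ (allFin k) (λ i → fractional sampler i e))
    Σv̄ e = begin
      ∑ order (λ i → v̄ (block i) e)                       ≡⟨ reverse-∑ (allFin k) (λ i → v̄ (block i) e) ⟩
      ∑ (allFin k) (λ i → v̄ (block i) e)                  ≡⟨ ∑-cong (allFin k) (λ i → fractional≡ i e) ⟨
      ∑ (allFin k) (λ i → τ * ι (fractional sampler i e)) ≡⟨ ∑-* (allFin k) τ _ ⟩
      τ * ∑ (allFin k) (λ i → ι (fractional sampler i e)) ≡⟨ cong (τ *_) (ι-∑ (allFin k) (λ i → fractional sampler i e)) ⟨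
      τ * ι (Flow.∑ (allFin k) (λ i → fractional sampler i e)) ∎
      where
      open ≡-Reasoning
      reverse-∑ : ∀ (xs : List (Fin k)) f → ∑ (reverse xs) f ≡ ∑ xs f
      reverse-∑ []       f = refl
      reverse-∑ (x ∷ xs) f = trans (cong (λ l → ∑ l f) (unfold-reverse x xs)) (trans (∑-++ (reverse xs) (x ∷ []) f)
        (trans (cong₂ _+_ (reverse-∑ xs f) (+-identityʳ (f x))) (+-comm (∑ xs f) (f x))))

-- Choice of the constants and the union bound

module Tail where

  open Algorithm

  open Flow using (module Approachability)
  open Rat
  open Rounding
  open Coins
  open Sampler
  open import Data.Bool.Base using (Bool; true; false; if_then_else_)
  open import Data.Fin.Properties using (_≟_)
  open import Data.List.Base using (List; []; _∷_; map; length; allFin; cartesianProductWith; _++_)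
  open import Data.List.Properties using (length-map; length-++; length-tabulate)
  open import Data.List.Relation.Unary.All using (All; []; _∷_)
  import Data.List.Relation.Unary.All as All
  import Data.List.Relation.Unary.All.Properties as All
  open import Data.Nat.Base as ℕ using (ℕ; zero; suc)
  import Data.Nat.Properties as ℕ
  open import Data.Nat.Tactic.RingSolver using () renaming (solve-∀ to solveℕ)
  open import Data.Product.Base using (∃-syntax; _×_; _,_; proj₁; proj₂)
  open import Data.Rational.Base hiding (_/_)
  open import Data.Rational.Properties hiding (_≟_)
  open import Data.Sum.Base using (_⊎_; inj₁; inj₂)
  open import Function.Base using (_∘_; id)
  open import Relation.Binary.PropositionalEquality
  open import Relation.Nullary.Decidable.Core using (Dec; yes; no; does)
  open import Relation.Nullary.Negation using (contradiction)
  open import Tactic.RingSolver using (solve-∀)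

  √-upper : ∀ n → n ℕ.< suc ⌊√ n ⌋ ℕ.* suc ⌊√ n ⌋
  √-upper zero    = ℕ.s≤s ℕ.z≤n
  √-upper (suc n) with suc ⌊√ n ⌋ ℕ.* suc ⌊√ n ⌋ ℕ.≤ᵇ suc n in eq
  ... | false = ℕ.≰⇒> λ le → contradiction (trans (sym eq) (true! (ℕ.≤⇒≤ᵇ le))) λ ()
    where
    true! : ∀ {b} → Data.Bool.Base.T b → b ≡ true
    true! {true} _ = refl
  ... | true  = ℕ.≤-trans (ℕ.s≤s (√-upper n)) (ℕ.≤-trans (ℕ.m≤m+n _ (suc (suc (⌊√ n ⌋ ℕ.+ ⌊√ n ⌋)))) (ℕ.≤-reflexive (lemma ⌊√ n ⌋)))
    where
    lemma : ∀ s → suc (suc s ℕ.* suc s) ℕ.+ suc (suc (s ℕ.+ s)) ≡ suc (suc s) ℕ.* suc (suc s)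
    lemma = solveℕ

  reciprocal : ∀ n → ∃[ ρ ] 0ℚ ≤ ρ × ρ * ι (suc n) ≡ 1ℚ
  reciprocal n = (1/ ι (suc n)) {{pos⇒nonZero (ι (suc n)) {{positive 0<}}}} ,
    <⇒≤ (positive⁻¹ _ {{1/pos⇒pos (ι (suc n)) {{positive 0<}}}}) , *-inverseˡ (ι (suc n)) {{pos⇒nonZero (ι (suc n)) {{positive 0<}}}}
    where
    0< : 0ℚ < ι (suc n)
    0< = <-≤-trans (positive⁻¹ 1ℚ) (gap (ι n) (ι≥0 n) refl)

  length-product : ∀ {A B C : Set} (f : A → B → C) xs ys → length (cartesianProductWith f xs ys) ≡ length xs ℕ.* length ys
  length-product f []       ys = refl
  length-product f (x ∷ xs) ys = trans (length-++ (map (f x) ys)) (cong₂ ℕ._+_ (length-map (f x) ys) (length-product f xs ys))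

  module Tail-identities where

    identity₁ : ∀ r p → r * r * (p * p) ≡ (p * r) * (p * r)
    identity₁ = solve-∀ ring

    identity₂ : ∀ p → (½ ^ 6 * p) * (½ ^ 6 * p) ≡ ½ ^ 12 * (p * p)
    identity₂ = solve-∀ ring

    identity₃ : ∀ p K r → ½ ^ 6 * p * (2ℚ ^ 7 * (K * r)) ≡ 2ℚ * K * (p * r)
    identity₃ = solve-∀ ring

    identity₄ : ∀ w h → w * (h * 0ℚ + 0ℚ) ≡ 0ℚ
    identity₄ = solve-∀ ring

    identity₅ : ∀ w h s → w * (h * s + (1ℚ - h) * s) ≡ s * w
    identity₅ = solve-∀ ring

    identity₆ : ∀ a → a + a ≡ 2ℚ * a
    identity₆ = solve-∀ ring

    identity₇ : ∀ x y → x * x + y * y ≡ (x - y) * (x - y) + 2ℚ * (x * y)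
    identity₇ = solve-∀ ring

    identity₈ : ∀ h s d → h * (s * d * (s * d)) ≡ s * s * (h * (d * d))
    identity₈ = solve-∀ ring

    identity₉ : ∀ c i y e → 16ℚ * (c * (y * i * (y * i) * e) + 2ℚ * 0ℚ) ≡ 16ℚ * (i * c * (y * y * (i * e)))
    identity₉ = solve-∀ ring

    identity₁₀ : ∀ K i L → 16ℚ * (1ℚ * (2ℚ * K * (2ℚ * K) * (i * (2ℚ * L)))) ≡ K * (i * (2ℚ ^ 7 * (L * K)))
    identity₁₀ = solve-∀ ring

    identity₁₁ : ∀ h → h * (0ℚ * 0ℚ) ≡ 0ℚ
    identity₁₁ = solve-∀ ring

    identity₁₂ : ∀ d s → d * s * (d * s) ≡ s * s * (d * d)
    identity₁₂ = solve-∀ ring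

    identity₁₃ : ∀ h s → s * s ≡ (1ℚ - h) * s * ((1ℚ - h) * s) + (h * (s * s) + (h - h * h) * (s * s))
    identity₁₃ = solve-∀ ring

    identity₁₄ : ∀ c s S → 16ℚ * (c * (1ℚ * (s * s)) + 2ℚ * ((1ℚ - 1ℚ) * s * ((1ℚ - 1ℚ) * s) * S)) ≡ 16ℚ * (c * (s * s))
    identity₁₄ = solve-∀ ring

    identity₁₅ : ∀ L K r → 16ℚ * (2ℚ ^ 8 * (L * K) * (½ ^ 12 * r)) ≡ K * (L * r)
    identity₁₅ = solve-∀ ring

    identity₁₆ : ∀ c s S → 16ℚ * (c * (0ℚ * (s * s)) + 2ℚ * ((1ℚ - 0ℚ) * s * ((1ℚ - 0ℚ) * s) * S)) ≡ 16ℚ * (2ℚ * (s * s * S))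
    identity₁₆ = solve-∀ ring

    identity₁₇ : ∀ b r → 16ℚ * (2ℚ * (½ ^ 12 * r * b)) ≡ ½ ^ 7 * (b * r)
    identity₁₇ = solve-∀ ring

    identity₁₈ : ∀ d s → 8ℚ * 8ℚ * (d * s * (d * s)) ≡ 8ℚ * 8ℚ * (d * d * (s * s))
    identity₁₈ = solve-∀ ring

    identity₁₉ : ∀ n y v → n * y * v ≡ v * n * y
    identity₁₉ = solve-∀ ring

    identity₂₀ : ∀ n y b → n * (y * (2ℚ * b)) ≡ 2ℚ * (b * (n * y))
    identity₂₀ = solve-∀ ring

    identity₂₁ : ∀ k n → k * (n * k) ≡ n * (k * k * 1ℚ)
    identity₂₁ = solve-∀ ring

    identity₂₂ : ∀ a b → 2ℚ * (a * b) ≡ a * (2ℚ * b)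
    identity₂₂ = solve-∀ ring

  open Tail-identities

  -- `lower` makes the truncation tests admissible and `upper` the final tests of the high edges.
  -- `few` says that twice the number of tests is at most 2^K.
  record Regimen (I : Instance) (Z : ℕ) : Set where
    open Instance I using (m; k; Routing)
    open Spec I Z using (Δ′; b′)
    field
      p q K′ : ℕ
      Rs     : List Routing
      len    : length Rs ≡ 2 ℕ.^ p
      good   : All (Approachability.Good I Z) Rs
      Δ′≤Z   : Δ′ ℕ.≤ Z
      k≤Z    : k ℕ.≤ Z
      cap    : 2 ℕ.^ suc (q ℕ.+ p) ℕ.+ m ℕ.* (2 ℕ.* (k ℕ.* 2 ℕ.^ p)) ℕ.≤ Z
      spread : ∀ e → Flow.∑ Rs (λ R → Flow.flow I R e) ℕ.≤ 2 ℕ.^ p ℕ.* suc (b′ e)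
      lower  : 2 ℕ.^ 7 ℕ.* (Δ′ ℕ.* suc K′) ℕ.≤ 2 ℕ.^ q
      upper  : 2 ℕ.^ q ℕ.≤ 2 ℕ.^ 8 ℕ.* (Δ′ ℕ.* suc K′)
      few    : 2 ℕ.* (k ℕ.* (2 ℕ.^ p ℕ.* 2 ℕ.^ p) ℕ.+ m) ℕ.≤ 2 ℕ.^ suc K′

  module Tail {I : Instance} {Z : ℕ} (regimen : Regimen I Z) where

    open Regimen regimen
    open Instance I using (m; k) renaming (E to Edge)
    open Spec I Z using (Δ′; b′; high; fractional)

    K : ℕ
    K = suc K′

    root : Edge → ℕ
    root e = ⌊√ b′ e ℕ.⊓ Δ′ ⌋

    -- The final test of an edge is scaled by 2^-6 / (1 + root) and compared with Y = 2K; the factor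
    -- 2^7 (1 + root) undoes this.
    A : Edge → ℕ
    A e = 2 ℕ.^ 7 ℕ.* (K ℕ.* suc (root e))

    lowerℚ : 2ℚ ^ 7 * (ι Δ′ * ι K) ≤ ι (2 ℕ.^ q)
    lowerℚ = ≤-trans (≤-reflexive (sym (trans (ι-* (2 ℕ.^ 7) (Δ′ ℕ.* K)) (cong₂ _*_ (ι2^ 7) (ι-* Δ′ K))))) (ι-mono lower)

    upperℚ : ι (2 ℕ.^ q) ≤ 2ℚ ^ 8 * (ι Δ′ * ι K)
    upperℚ = ≤-trans (ι-mono upper) (≤-reflexive (trans (ι-* (2 ℕ.^ 8) (Δ′ ℕ.* K)) (cong₂ _*_ (ι2^ 8) (ι-* Δ′ K))))

    1≤K : 1ℚ ≤ ι K
    1≤K = gap (ι K′) (ι≥0 K′) refl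

    Δ′K≥0 : 0ℚ ≤ ι Δ′ * ι K
    Δ′K≥0 = *-≥0 (ι≥0 Δ′) (ι≥0 K)

    4L≤c : 4ℚ * ι Δ′ ≤ ι (2 ℕ.^ q)
    4L≤c = ≤-trans (≤-trans (*-mono (nonNegative⁻¹ 4ℚ) (≤-trans (≤-reflexive (sym (*-identityʳ (ι Δ′)))) (*-mono (ι≥0 Δ′) 1≤K)))
      (*-monoˡ Δ′K≥0 4≤)) lowerℚ
      where
      4≤ : 4ℚ ≤ 2ℚ ^ 7
      4≤ = gap {4ℚ} {2ℚ ^ 7} (2ℚ ^ 7 - 4ℚ) (nonNegative⁻¹ (2ℚ ^ 7 - 4ℚ)) refl

    design : Design I Z
    design = record { p = p ; q = q ; Rs = Rs ; A = A ; len = len ; good = good ; Δ′≤Z = Δ′≤Z ; cap = cap ; 4L≤c = 4L≤c }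

    open Sampler.Sampler design

    c≥ : 8ℚ * ι Δ′ * ι K ≤ c
    c≥ = ≤-trans (≤-trans (≤-reflexive (*-assoc 8ℚ (ι Δ′) (ι K)))
      (*-monoˡ Δ′K≥0 (gap {8ℚ} {2ℚ ^ 7} (2ℚ ^ 7 - 8ℚ) (nonNegative⁻¹ (2ℚ ^ 7 - 8ℚ)) refl))) lowerℚ

    1≤c : 1ℚ ≤ c
    1≤c = ≤-trans (≤-reflexive (sym (+-identityʳ 1ℚ))) (ι-mono (ℕ.≤-trans (ℕ.s≤s ℕ.z≤n) (Draws.n<2^n Z q)))

    κ : ℚ
    κ = proj₁ (reciprocal K′)

    -- Y = 2K yields a threshold of 2^2K times N^N: one factor 2^K pays for the gain, the other for
    -- the number of tests. `N` is a multiple of `Y` for the sake of `threshold≥`, and `N₁` is large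
    -- for the sake of `N≥`.
    Y N₁ N : ℕ
    Y  = 2 ℕ.* K
    N₁ = suc (8 ℕ.* (m ℕ.* (k ℕ.* k)) ℕ.* suc K)
    N  = N₁ ℕ.* Y

    1≤N : 1ℚ ≤ ι N
    1≤N = ≤-trans (≤-reflexive (sym (+-identityʳ 1ℚ))) (ι-mono {1} {N} (ℕ.s≤s ℕ.z≤n))

    N≥ : 8ℚ * (ι m * (ι k * ι k)) * (ι K + 1ℚ) ≤ ι N * ι N
    N≥ = begin
      8ℚ * (ι m * (ι k * ι k)) * (ι K + 1ℚ)
        ≡⟨ cong₂ _*_ (trans (ι-* 8 (m ℕ.* (k ℕ.* k))) (cong (8ℚ *_) (trans (ι-* m (k ℕ.* k)) (cong (ι m *_) (ι-* k k))))) (+-comm 1ℚ (ι K)) ⟨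
      ι (8 ℕ.* (m ℕ.* (k ℕ.* k))) * ι (suc K)
        ≡⟨ ι-* (8 ℕ.* (m ℕ.* (k ℕ.* k))) (suc K) ⟨
      ι (8 ℕ.* (m ℕ.* (k ℕ.* k)) ℕ.* suc K)
        ≤⟨ ι-mono (ℕ.≤-trans (ℕ.n≤1+n _) (ℕ.m≤m*n N₁ Y)) ⟩
      ι N
        ≡⟨ *-identityˡ (ι N) ⟨
      1ℚ * ι N
        ≤⟨ *-monoˡ (ι≥0 N) 1≤N ⟩
      ι N * ι N ∎
      where open ≤-Reasoning

    regime : Regime
    regime = record
      { K = K ; κ = κ ; 0≤κ = proj₁ (proj₂ (reciprocal K′)) ; κK≡1 = proj₂ (proj₂ (reciprocal K′))
      ; c≥ = c≥ ; 1≤c = 1≤c ; k = k ; N = N ; 1≤N = 1≤N ; N≥ = N≥ }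

    open Admissibility regime

    ρ : Edge → ℚ
    ρ e = proj₁ (reciprocal (root e))

    ρ≥0 : ∀ e → 0ℚ ≤ ρ e
    ρ≥0 e = proj₁ (proj₂ (reciprocal (root e)))

    ρr≡1 : ∀ e → ρ e * ι (suc (root e)) ≡ 1ℚ
    ρr≡1 e = proj₂ (proj₂ (reciprocal (root e)))

    square-root : ∀ e {x} → ι x ≤ ι (suc (root e)) * ι (suc (root e)) → ι x * (ρ e * ρ e) ≤ 1ℚ
    square-root e {x} le = ≤-trans (*-monoˡ (square≥0 (ρ e)) le)
      (≤-reflexive (trans (identity₁ (ι (suc (root e))) (ρ e)) (trans (cong₂ _*_ (ρr≡1 e) (ρr≡1 e)) (*-identityˡ 1ℚ))))

    -- By `upper`, the budget of a high edge is at most 16 · 2^8 Δ′ K times the square of the scale;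
    -- the factor 2^-6 cancels these powers of two.
    scale : Edge → ℚ
    scale e = ½ ^ 6 * ρ e

    scale² : ∀ e → scale e * scale e ≡ ½ ^ 12 * (ρ e * ρ e)
    scale² e = identity₂ (ρ e)

    scale-allowed : ∀ e → scale e * ι (A e) ≡ ι Y
    scale-allowed e = begin
      ½ ^ 6 * ρ e * ι (2 ℕ.^ 7 ℕ.* (K ℕ.* suc (root e)))    ≡⟨ cong (½ ^ 6 * ρ e *_) (trans (ι-* (2 ℕ.^ 7) (K ℕ.* suc (root e))) (cong (2ℚ ^ 7 *_) (ι-* K (suc (root e))))) ⟩
      ½ ^ 6 * ρ e * (2ℚ ^ 7 * (ι K * ι (suc (root e))))     ≡⟨ identity₃ (ρ e) (ι K) (ι (suc (root e))) ⟩
      2ℚ * ι K * (ρ e * ι (suc (root e)))                   ≡⟨ cong (2ℚ * ι K *_) (ρr≡1 e) ⟩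
      2ℚ * ι K * 1ℚ                                         ≡⟨ *-identityʳ (2ℚ * ι K) ⟩
      2ℚ * ι K                                              ≡⟨ ι-* 2 K ⟨
      ι Y ∎
      where
      open ≡-Reasoning

    -- Together they read the coordinate `e`. As `full` multiplies θ by `h`, a high edge is carried
    -- by `θᶠ` and decays under the pullback, while a low edge stays in `ζᶠ`; the drift that the
    -- bias causes on a low edge then appears in θ on the high ones.
    θᶠ ζᶠ : Edge → Vector
    θᶠ e e′ = if does (e′ ≟ e) then scale e else 0ℚ
    ζᶠ e e′ = if does (e′ ≟ e) then (1ℚ - h e) * scale e else 0ℚ

    ∑-single : ∀ e (f : Edge → ℚ → ℚ → ℚ) → (∀ e′ → f e′ 0ℚ 0ℚ ≡ 0ℚ) →
      ∑ es (λ e′ → f e′ (θᶠ e e′) (ζᶠ e e′)) ≡ f e (scale e) ((1ℚ - h e) * scale e)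
    ∑-single e f f0 = trans (∑-cong es pointwise) (∑-δ e (λ e′ → f e′ (scale e) ((1ℚ - h e) * scale e)))
      where
      pointwise : ∀ e′ → f e′ (θᶠ e e′) (ζᶠ e e′) ≡ (if does (e′ ≟ e) then f e′ (scale e) ((1ℚ - h e) * scale e) else 0ℚ)
      pointwise e′ with does (e′ ≟ e)
      ... | true  = refl
      ... | false = f0 e′

    reading-final : ∀ w e → reading w ([] , θᶠ e , ζᶠ e) ≡ scale e * w e
    reading-final w e = trans (∑-single e (λ e′ t z → w e′ * (h e′ * t + z)) (λ e′ → identity₄ (w e′) (h e′)))
      (identity₅ (w e) (h e) (scale e))

    open Failure (ι ∘ A)

    targets : Targets
    targets = record
      { Y = Y ; θᶠ = θᶠ ; ζᶠ = ζᶠ ; allowed = ι ∘ A ; scale = scale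
      ; 0≤scale = λ e → *-≥0 (^-≥0 (nonNegative⁻¹ ½) 6) (ρ≥0 e)
      ; scale-allowed = scale-allowed ; reading-final = reading-final }

    open Process targets

    bs : List Block
    bs = map block order

    Truncating : TestPoint → Set
    Truncating (_ , t) = ∃[ B ] ∃[ a ] ∃[ b ] t ≡ proj₂ (truncation B a b)

    Finishing : List Block → TestPoint → Set
    Finishing bs (pre , t) = pre ≡ bs × ∃[ e ] t ≡ (θᶠ e , ζᶠ e)

    kinds : ∀ bs → All (λ t → Truncating t ⊎ Finishing bs t) (tests bs)
    kinds []       = All.map⁺ (All.universal (λ e → inj₂ (refl , e , refl)) es)
    kinds (B ∷ bs) = All.++⁺ (products (allFin T))
      (All.map⁺ (All.map (λ {t} → later {t}) (kinds bs)))
      where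
      later : ∀ {t} → Truncating t ⊎ Finishing bs t →
              Truncating (B ∷ proj₁ t , proj₂ t) ⊎ Finishing (B ∷ bs) (B ∷ proj₁ t , proj₂ t)
      later (inj₁ p)             = inj₁ p
      later (inj₂ (refl , final)) = inj₂ (refl , final)
      products : ∀ xs → All (λ t → Truncating t ⊎ Finishing (B ∷ bs) t) (cartesianProductWith (truncation B) xs (allFin T))
      products []       = []
      products (x ∷ xs) = All.++⁺ (All.map⁺ (All.universal (λ y → inj₁ (B , x , y , refl)) (allFin T))) (products xs)

    module _ (pre : List Block) (B : Block) (a b : X) where

      ζ₀ θ₀ : Vector
      ζ₀ _ = 0ℚ
      θ₀ e = ι Y * c⁻¹ * difference B a b e

      fixed-0 : ∀ B x → Test.fixed ζ₀ B x ≡ 0ℚ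
      fixed-0 B x = trans (∑-cong es λ e → *-zeroʳ (d B x e)) (∑-0 es)

      fixed*-0 : ∀ pre → Test.fixed* ζ₀ pre ≡ 0ℚ
      fixed*-0 []        = refl
      fixed*-0 (B ∷ pre) = trans (cong₂ _+_
        (trans (μ-cong λ x → trans (cong₂ _*_ (fixed-0 B x) (fixed-0 B x)) (*-zeroˡ 0ℚ)) (μ-const 0ℚ)) (fixed*-0 pre)) (+-identityˡ 0ℚ)

      difference-energy : energy (difference B a b) ≤ 2ℚ * ι Δ′
      difference-energy = begin
        ∑ es (λ e → h e * (difference B a b e * difference B a b e))
          ≤⟨ ∑-mono es (λ e → ≤-trans (*-monoˡ (square≥0 (difference B a b e)) (h≤1 e)) (≤-trans (≤-reflexive (*-identityˡ _)) (pointwise e))) ⟩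
        ∑ es (λ e → v B a e + v B b e)
          ≡⟨ ∑-+ es (v B a) (v B b) ⟩
        ∑ es (v B a) + ∑ es (v B b)
          ≤⟨ +-mono-≤ (short B a) (short B b) ⟩
        ι Δ′ + ι Δ′
          ≡⟨ identity₆ (ι Δ′) ⟩
        2ℚ * ι Δ′ ∎
        where
        open ≤-Reasoning
        pointwise : ∀ e → difference B a b e * difference B a b e ≤ v B a e + v B b e
        pointwise e = gap (2ℚ * (v B a e * v B b e)) (*-≥0 0≤2 (*-≥0 (v≥0 B a e) (v≥0 B b e)))
          (trans (cong₂ _+_ (sym (v² B a e)) (sym (v² B b e))) (identity₇ (v B a e) (v B b e)))

      -- The energy is at most (Y / c)² · 2Δ′, so the budget asks for 2^7 Δ′ K² / c ≤ K. This is the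
      -- origin of the constant in `lower`.
      truncation-admissible : Admissible pre θ₀ ζ₀
      truncation-admissible = record
        { budget = begin
            16ℚ * (c * energy θ₀ + 2ℚ * Test.fixed* ζ₀ pre)
              ≡⟨ cong₂ (λ x y → 16ℚ * (c * x + 2ℚ * y)) (trans (∑-cong es λ e → identity₈ (h e) (ι Y * c⁻¹) (difference B a b e)) (∑-* es (ι Y * c⁻¹ * (ι Y * c⁻¹)) (λ e → h e * (difference B a b e * difference B a b e)))) (fixed*-0 pre) ⟩
            16ℚ * (c * (ι Y * c⁻¹ * (ι Y * c⁻¹) * energy (difference B a b)) + 2ℚ * 0ℚ)
              ≡⟨ identity₉ c c⁻¹ (ι Y) (energy (difference B a b)) ⟩
            16ℚ * (c⁻¹ * c * (ι Y * ι Y * (c⁻¹ * energy (difference B a b))))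
              ≡⟨ cong (λ s → 16ℚ * (s * (ι Y * ι Y * (c⁻¹ * energy (difference B a b))))) (½^-inverse q) ⟩
            16ℚ * (1ℚ * (ι Y * ι Y * (c⁻¹ * energy (difference B a b))))
              ≤⟨ *-mono (nonNegative⁻¹ 16ℚ) (*-mono 0≤1 (*-mono (square≥0 (ι Y)) (*-mono 0≤c⁻¹ difference-energy))) ⟩
            16ℚ * (1ℚ * (ι Y * ι Y * (c⁻¹ * (2ℚ * ι Δ′))))
              ≡⟨ trans (cong (λ y → 16ℚ * (1ℚ * (y * y * (c⁻¹ * (2ℚ * ι Δ′))))) (ι-* 2 K)) (identity₁₀ (ι K) c⁻¹ (ι Δ′)) ⟩
            ι K * (c⁻¹ * (2ℚ ^ 7 * (ι Δ′ * ι K)))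
              ≤⟨ *-mono (ι≥0 K) (*-mono 0≤c⁻¹ lowerℚ) ⟩
            ι K * (c⁻¹ * c)
              ≡⟨ trans (cong (ι K *_) (½^-inverse q)) (*-identityʳ (ι K)) ⟩
            ι K ∎
        ; small = All.universal (λ B x → ≤-trans (≤-reflexive (cong (λ s → 8ℚ * 8ℚ * (s * s)) (fixed-0 B x))) 0≤1) pre
        ; tame  = ≤-trans (≤-reflexive (trans (∑-cong es λ e → *-zeroˡ 0ℚ) (∑-0 es))) 0≤1 }
        where
        open ≤-Reasoning
        0≤c⁻¹ : 0ℚ ≤ c⁻¹
        0≤c⁻¹ = ^-≥0 (nonNegative⁻¹ ½) q

    Δ′≤r² : ∀ e → Δ′ ℕ.≤ b′ e → ι Δ′ ≤ ι (suc (root e)) * ι (suc (root e))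
    Δ′≤r² e le = ≤-trans (ι-mono (ℕ.≤-trans (ℕ.≤-reflexive (sym (ℕ.m≥n⇒m⊓n≡n le))) (ℕ.<⇒≤ (√-upper (b′ e ℕ.⊓ Δ′)))))
      (≤-reflexive (ι-* (suc (root e)) (suc (root e))))

    b′≤r² : ∀ e → b′ e ℕ.≤ Δ′ → ι (suc (b′ e)) ≤ ι (suc (root e)) * ι (suc (root e))
    b′≤r² e le = ≤-trans (ι-mono (ℕ.≤-trans (ℕ.s≤s (ℕ.≤-reflexive (sym (ℕ.m≤n⇒m⊓n≡m le)))) (√-upper (b′ e ℕ.⊓ Δ′))))
      (≤-reflexive (ι-* (suc (root e)) (suc (root e))))

    high-true : ∀ e → high e ≡ true → Δ′ ℕ.≤ b′ e
    high-true e eq with Truncated._≺_ Z (b′ e) Δ′ in lt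
    ... | false = Flow.≺-false Z (ℕ.≤-trans (ℕ.m⊓n≤n (Instance.b I e) k) k≤Z) lt

    high-false : ∀ e → high e ≡ false → b′ e ℕ.≤ Δ′
    high-false e eq with Truncated._≺_ Z (b′ e) Δ′ in lt
    ... | true = ℕ.<⇒≤ (Flow.≺-true Z (ℕ.≤-trans (ℕ.m⊓n≤n (Instance.b I e) k) k≤Z) lt)

    module _ (e : Edge) where

      σ S s² : ℚ
      σ  = (1ℚ - h e) * scale e
      S  = ∑ order (λ i → v̄ (block i) e)
      s² = scale e * scale e

      S≤ : S ≤ ι (suc (b′ e))
      S≤ = begin
        S                                                               ≡⟨ Σv̄ e ⟩
        τ * ι (Flow.∑ (allFin k) (λ i → fractional sampler i e))        ≤⟨ *-mono 0≤τ (ι-mono (total-fractional spread e)) ⟩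
        τ * ι (2 ℕ.^ p ℕ.* suc (b′ e))                                  ≡⟨ cong (τ *_) (ι-* (2 ℕ.^ p) (suc (b′ e))) ⟩
        τ * (ι (2 ℕ.^ p) * ι (suc (b′ e)))                              ≡⟨ *-assoc τ (ι (2 ℕ.^ p)) (ι (suc (b′ e))) ⟨
        τ * ι (2 ℕ.^ p) * ι (suc (b′ e))                                ≡⟨ trans (cong (_* ι (suc (b′ e))) (½^-inverse p)) (*-identityˡ (ι (suc (b′ e)))) ⟩
        ι (suc (b′ e)) ∎
        where
        open ≤-Reasoning
        0≤τ : 0ℚ ≤ τ
        0≤τ = ^-≥0 (nonNegative⁻¹ ½) p

      fixed≡ : ∀ B x → Test.fixed (ζᶠ e) B x ≡ d B x e * σ
      fixed≡ B x = ∑-single e (λ e′ _ z → d B x e′ * z) (λ e′ → *-zeroʳ (d B x e′))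

      energy≡ : energy (θᶠ e) ≡ h e * s²
      energy≡ = ∑-single e (λ e′ t _ → h e′ * (t * t)) (λ e′ → identity₁₁ (h e′))

      -- The fixed part reads a single coordinate of each block, whose variance is at most its mean.
      fixed*≤ : ∀ is → Test.fixed* (ζᶠ e) (map block is) ≤ σ * σ * ∑ is (λ i → v̄ (block i) e)
      fixed*≤ []       = ≤-reflexive (sym (*-zeroʳ (σ * σ)))
      fixed*≤ (i ∷ is) = begin
        μ (λ x → Test.fixed (ζᶠ e) (block i) x * Test.fixed (ζᶠ e) (block i) x) + Test.fixed* (ζᶠ e) (map block is)
          ≤⟨ +-mono-≤ head (fixed*≤ is) ⟩
        σ * σ * v̄ (block i) e + σ * σ * ∑ is (λ i → v̄ (block i) e)
          ≡⟨ *-distribˡ-+ (σ * σ) (v̄ (block i) e) _ ⟨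
        σ * σ * (v̄ (block i) e + ∑ is (λ i → v̄ (block i) e)) ∎
        where
        open ≤-Reasoning
        head : μ (λ x → Test.fixed (ζᶠ e) (block i) x * Test.fixed (ζᶠ e) (block i) x) ≤ σ * σ * v̄ (block i) e
        head = ≤-trans (≤-reflexive (trans
          (μ-cong λ x → trans (cong₂ _*_ (fixed≡ (block i) x) (fixed≡ (block i) x)) (identity₁₂ (d (block i) x e) σ))
          (μ-* (σ * σ) (λ x → d (block i) x e * d (block i) x e)))) (*-mono (square≥0 σ) (variance (block i) e))

      ρ²≤1 : ρ e * ρ e ≤ 1ℚ
      ρ²≤1 = ≤-trans (≤-reflexive (sym (*-identityˡ (ρ e * ρ e)))) (≤-trans (*-monoˡ (square≥0 (ρ e)) (≤-reflexive (sym (+-identityʳ 1ℚ))))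
        (square-root e {1} (≤-trans (ι-mono {1} {suc (root e) ℕ.* suc (root e)} (ℕ.s≤s ℕ.z≤n)) (≤-reflexive (ι-* (suc (root e)) (suc (root e)))))))

      s²≤ : s² ≤ ½ ^ 12
      s²≤ = ≤-trans (≤-reflexive (scale² e)) (≤-trans (*-mono (nonNegative⁻¹ (½ ^ 12)) ρ²≤1) (≤-reflexive (*-identityʳ (½ ^ 12))))

      σ²≤s² : σ * σ ≤ s²
      σ²≤s² = gap (h e * s² + (h e - h e * h e) * s²)
        (+-≥0 (*-≥0 (h≥0 e) (square≥0 (scale e))) (*-≥0 (0≤-gap (≤-reflexive (h² e))) (square≥0 (scale e))))
        (identity₁₃ (h e) (scale e))
        where
        h² : ∀ e → h e * h e ≡ h e
        h² e = ind² (high e)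

      -- On a high edge the fixed part vanishes and Δ′ ρ² ≤ 1. On a low edge the energy vanishes,
      -- and the variance is governed by the fractional load, at most b′ + 1, with (b′ + 1) ρ² ≤ 1.
      budget-cases : ∀ b → high e ≡ b → 16ℚ * (c * (h e * s²) + 2ℚ * (σ * σ * S)) ≤ ι K
      budget-cases true eq = begin
        16ℚ * (c * (h e * s²) + 2ℚ * (σ * σ * S))
          ≡⟨ cong (λ x → 16ℚ * (c * (x * s²) + 2ℚ * ((1ℚ - x) * scale e * ((1ℚ - x) * scale e) * S))) (cong ind eq) ⟩
        16ℚ * (c * (1ℚ * s²) + 2ℚ * ((1ℚ - 1ℚ) * scale e * ((1ℚ - 1ℚ) * scale e) * S))
          ≡⟨ identity₁₄ c (scale e) S ⟩
        16ℚ * (c * s²)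
          ≤⟨ *-mono (nonNegative⁻¹ 16ℚ) (*-monoˡ (square≥0 (scale e)) upperℚ) ⟩
        16ℚ * (2ℚ ^ 8 * (ι Δ′ * ι K) * s²)
          ≡⟨ trans (cong (λ x → 16ℚ * (2ℚ ^ 8 * (ι Δ′ * ι K) * x)) (scale² e)) (identity₁₅ (ι Δ′) (ι K) (ρ e * ρ e)) ⟩
        ι K * (ι Δ′ * (ρ e * ρ e))
          ≤⟨ *-mono (ι≥0 K) (square-root e {Δ′} (Δ′≤r² e (high-true e eq))) ⟩
        ι K * 1ℚ
          ≡⟨ *-identityʳ (ι K) ⟩
        ι K ∎
        where
        open ≤-Reasoning
      budget-cases false eq = begin
        16ℚ * (c * (h e * s²) + 2ℚ * (σ * σ * S))
          ≡⟨ cong (λ x → 16ℚ * (c * (x * s²) + 2ℚ * ((1ℚ - x) * scale e * ((1ℚ - x) * scale e) * S))) (cong ind eq) ⟩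
        16ℚ * (c * (0ℚ * s²) + 2ℚ * ((1ℚ - 0ℚ) * scale e * ((1ℚ - 0ℚ) * scale e) * S))
          ≡⟨ identity₁₆ c (scale e) S ⟩
        16ℚ * (2ℚ * (s² * S))
          ≤⟨ *-mono (nonNegative⁻¹ 16ℚ) (*-mono 0≤2 (*-mono (square≥0 (scale e)) S≤)) ⟩
        16ℚ * (2ℚ * (s² * ι (suc (b′ e))))
          ≡⟨ trans (cong (λ x → 16ℚ * (2ℚ * (x * ι (suc (b′ e))))) (scale² e)) (identity₁₇ (ι (suc (b′ e))) (ρ e * ρ e)) ⟩
        ½ ^ 7 * (ι (suc (b′ e)) * (ρ e * ρ e))
          ≤⟨ *-mono (nonNegative⁻¹ (½ ^ 7)) (square-root e {suc (b′ e)} (b′≤r² e (high-false e eq))) ⟩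
        ½ ^ 7 * 1ℚ
          ≤⟨ gap {½ ^ 7 * 1ℚ} {1ℚ} (1ℚ - ½ ^ 7) (nonNegative⁻¹ (1ℚ - ½ ^ 7)) refl ⟩
        1ℚ
          ≤⟨ 1≤K ⟩
        ι K ∎
        where
        open ≤-Reasoning

      finishing-admissible : Admissible bs (θᶠ e) (ζᶠ e)
      finishing-admissible = record
        { budget = ≤-trans
            (*-mono (nonNegative⁻¹ 16ℚ) (+-mono-≤ (≤-reflexive (cong (c *_) energy≡)) (*-mono 0≤2 (fixed*≤ order))))
            (budget-cases (high e) refl)
        ; small = All.universal (λ B x → small B x) bs
        ; tame  = begin
            ∑ es (λ e′ → ζᶠ e e′ * ζᶠ e e′)  ≡⟨ ∑-single e (λ _ _ z → z * z) (λ _ → *-zeroˡ 0ℚ) ⟩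
            σ * σ                            ≤⟨ σ²≤s² ⟩
            s²                               ≤⟨ s²≤ ⟩
            ½ ^ 12                           ≤⟨ gap {½ ^ 12} {1ℚ} (1ℚ - ½ ^ 12) (nonNegative⁻¹ (1ℚ - ½ ^ 12)) refl ⟩
            1ℚ ∎ }
        where
        open ≤-Reasoning
        small : ∀ B x → 8ℚ * 8ℚ * (Test.fixed (ζᶠ e) B x * Test.fixed (ζᶠ e) B x) ≤ 1ℚ
        small B x = begin
          8ℚ * 8ℚ * (Test.fixed (ζᶠ e) B x * Test.fixed (ζᶠ e) B x)
            ≡⟨ trans (cong (λ s → 8ℚ * 8ℚ * (s * s)) (fixed≡ B x)) (identity₁₈ (d B x e) σ) ⟩
          8ℚ * 8ℚ * (d B x e * d B x e * (σ * σ))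
            ≤⟨ *-mono (nonNegative⁻¹ (8ℚ * 8ℚ)) (*-mono₂ (square≥0 (d B x e)) (nonNegative⁻¹ (½ ^ 12)) d²≤2 (≤-trans σ²≤s² s²≤)) ⟩
          8ℚ * 8ℚ * (2ℚ * ½ ^ 12)
            ≤⟨ gap {8ℚ * 8ℚ * (2ℚ * ½ ^ 12)} {1ℚ} (1ℚ - 8ℚ * 8ℚ * (2ℚ * ½ ^ 12)) (nonNegative⁻¹ (1ℚ - 8ℚ * 8ℚ * (2ℚ * ½ ^ 12))) refl ⟩
          1ℚ ∎
          where
          d²≤2 : d B x e * d B x e ≤ 2ℚ
          d²≤2 = ≤-trans (d²≤ B x e) (+-mono-≤ (idempotent≤1 (v² B x e))
            (≤-trans (μ-mono λ x → idempotent≤1 (v² B x e)) (≤-reflexive (μ-const 1ℚ))))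

    tested : All Tested (tests bs)
    tested = All.map (λ {t} → admissible {t}) (kinds bs)
      where
      admissible : ∀ {t} → Truncating t ⊎ Finishing bs t → Tested t
      admissible {pre , _} (inj₁ (B , a , b , refl)) = truncation-admissible pre B a b
      admissible (inj₂ (refl , e , refl))            = finishing-admissible e

    length-tests : ∀ is → length (tests (map block is)) ≡ length is ℕ.* (T ℕ.* T) ℕ.+ m
    length-tests []       = trans (length-map _ es) (length-tabulate {n = m} id)
    length-tests (i ∷ is) = begin
      length (cartesianProductWith (truncation (block i)) (allFin T) (allFin T) ++ map _ (tests (map block is)))
        ≡⟨ length-++ (cartesianProductWith (truncation (block i)) (allFin T) (allFin T)) ⟩
      length (cartesianProductWith (truncation (block i)) (allFin T) (allFin T)) ℕ.+ length (map _ (tests (map block is)))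
        ≡⟨ cong₂ ℕ._+_ (trans (length-product (truncation (block i)) (allFin T) (allFin T)) (cong₂ ℕ._*_ (length-tabulate {n = T} id) (length-tabulate {n = T} id)))
                       (trans (length-map _ (tests (map block is))) (length-tests is)) ⟩
      T ℕ.* T ℕ.+ (length is ℕ.* (T ℕ.* T) ℕ.+ m)
        ≡⟨ ℕ.+-assoc (T ℕ.* T) _ m ⟨
      T ℕ.* T ℕ.+ length is ℕ.* (T ℕ.* T) ℕ.+ m ∎
      where open ≡-Reasoning

    bad≥0 : ∀ bs w → 0ℚ ≤ bad bs w
    bad≥0 [] w with accept? w
    ... | yes _ = ≤-refl
    ... | no _  = 0≤1
    bad≥0 (B ∷ bs) w = go (alive? B w)
      where
      go : (dec : Dec (Alive B w)) → 0ℚ ≤ select dec (μ (λ x → (1ℚ - tilt B w x) * bad bs (w ⊹ d B x))) 1ℚ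
      go (yes alive) = μ-≥0 λ x → *-≥0 (0≤-gap (proj₁ (alive-tilt {B} {w} alive x))) (bad≥0 bs (w ⊹ d B x))
      go (no _)      = 0≤1

    -- N = N₁ Y, and (1 + 1/N₁)^N₁ ≥ 2 by Bernoulli.
    threshold≥ : ι N ^ N * 2ℚ ^ Y ≤ threshold
    threshold≥ = begin
      ι N ^ N * 2ℚ ^ Y                  ≤⟨ *-mono (^-≥0 (ι≥0 N) N) (^-mono 0≤2 two≤ Y) ⟩
      ι N ^ N * ((1ℚ + ν) ^ N₁) ^ Y     ≡⟨ cong (ι N ^ N *_) (trans (sym (^-* (1ℚ + ν) Y N₁)) (cong ((1ℚ + ν) ^_) (ℕ.*-comm Y N₁))) ⟩
      ι N ^ N * (1ℚ + ν) ^ N            ≡⟨ ^-distrib-* (ι N) (1ℚ + ν) N ⟨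
      (ι N * (1ℚ + ν)) ^ N              ≡⟨ cong (_^ N) expand ⟩
      (ι N + ι Y) ^ N ∎
      where
      open ≤-Reasoning
      ν : ℚ
      ν = proj₁ (reciprocal (8 ℕ.* (m ℕ.* (k ℕ.* k)) ℕ.* suc K))
      νN₁ : ν * ι N₁ ≡ 1ℚ
      νN₁ = proj₂ (proj₂ (reciprocal (8 ℕ.* (m ℕ.* (k ℕ.* k)) ℕ.* suc K)))
      two≤ : 2ℚ ≤ (1ℚ + ν) ^ N₁
      two≤ = ≤-trans (≤-reflexive (cong (1ℚ +_) (sym (trans (*-comm (ι N₁) ν) νN₁))))
        (bernoulli (proj₁ (proj₂ (reciprocal (8 ℕ.* (m ℕ.* (k ℕ.* k)) ℕ.* suc K)))) N₁)
      expand : ι N * (1ℚ + ν) ≡ ι N + ι Y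
      expand = trans (*-distribˡ-+ (ι N) 1ℚ ν) (cong₂ _+_ (*-identityʳ (ι N))
        (trans (cong (_* ν) (ι-* N₁ Y)) (trans (identity₁₉ (ι N₁) (ι Y) ν) (trans (cong (_* ι Y) νN₁) (*-identityˡ (ι Y))))))

    1≤x⇒0<x^ : ∀ {x} → 1ℚ ≤ x → ∀ n → 1ℚ ≤ x ^ n
    1≤x⇒0<x^ le zero    = ≤-refl
    1≤x⇒0<x^ le (suc n) = ≤-trans (≤-reflexive (sym (*-identityˡ 1ℚ))) (*-mono₂ 0≤1 (^-≥0 (≤-trans 0≤1 le) n) le (1≤x⇒0<x^ le n))

    -- Each test starts with value at most N^N 2^K, and twice their number is at most 2^K, so the
    -- sum stays below half of the threshold N^N 2^2K.
    bad≤½ : 2ℚ * bad bs (λ _ → 0ℚ) ≤ 1ℚ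
    bad≤½ = cancel (positive-power 2ℚ (gap {1ℚ} {2ℚ} 1ℚ 0≤1 refl) Y) (cancel (positive-power (ι N) 1≤N N) (begin
      ι N ^ N * (2ℚ ^ Y * (2ℚ * bad₀))          ≡⟨ identity₂₀ (ι N ^ N) (2ℚ ^ Y) bad₀ ⟩
      2ℚ * (bad₀ * (ι N ^ N * 2ℚ ^ Y))          ≤⟨ *-mono 0≤2 (*-mono (bad≥0 bs (λ _ → 0ℚ)) threshold≥) ⟩
      2ℚ * (bad₀ * threshold)                   ≤⟨ *-mono 0≤2 (bad-bound bs (ℕ.≤-reflexive (trans (length-map block order) length-order)) tested) ⟩
      2ℚ * (ι (length (tests bs)) * (ι N ^ N * 2ℚ ^ K))
                                                ≡⟨ *-assoc 2ℚ (ι (length (tests bs))) (ι N ^ N * 2ℚ ^ K) ⟨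
      2ℚ * ι (length (tests bs)) * (ι N ^ N * 2ℚ ^ K)
                                                ≤⟨ *-monoˡ (*-≥0 (^-≥0 (ι≥0 N) N) (^-≥0 0≤2 K)) tests≤ ⟩
      2ℚ ^ K * (ι N ^ N * 2ℚ ^ K)               ≡⟨ identity₂₁ (2ℚ ^ K) (ι N ^ N) ⟩
      ι N ^ N * (2ℚ ^ K * 2ℚ ^ K * 1ℚ)          ≡⟨ cong (λ s → ι N ^ N * (s * 1ℚ)) (trans (sym (^-+ 2ℚ K K)) (cong (λ n → 2ℚ ^ (K ℕ.+ n)) (sym (ℕ.+-identityʳ K)))) ⟩
      ι N ^ N * (2ℚ ^ Y * 1ℚ) ∎))
      where
      open ≤-Reasoning
      bad₀ = bad bs (λ _ → 0ℚ)
      positive-power : ∀ x → 1ℚ ≤ x → ∀ n → 0ℚ < x ^ n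
      positive-power x le n = <-≤-trans (positive⁻¹ 1ℚ) (1≤x⇒0<x^ le n)
      tests≤ : 2ℚ * ι (length (tests bs)) ≤ 2ℚ ^ K
      tests≤ = ≤-trans (≤-reflexive (trans (cong (λ l → 2ℚ * ι l) (trans (length-tests order) (cong (λ n → n ℕ.* (T ℕ.* T) ℕ.+ m) length-order)))
          (sym (ι-* 2 (k ℕ.* (T ℕ.* T) ℕ.+ m)))))
        (≤-trans (ι-mono few) (≤-reflexive (ι2^ K)))

    failures≤½ : ∀ z → 2ℚ * ∑ᶜ (coins order z) (λ ω → failure (final ω)) ≤ 2ℚ ^ coins order z
    failures≤½ z = begin
      2ℚ * ∑ᶜ (coins order z) (λ ω → failure (final ω))      ≤⟨ *-mono 0≤2 (failures z) ⟩
      2ℚ * (2ℚ ^ coins order z * bad bs (λ _ → 0ℚ))          ≡⟨ identity₂₂ (2ℚ ^ coins order z) (bad bs (λ _ → 0ℚ)) ⟩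
      2ℚ ^ coins order z * (2ℚ * bad bs (λ _ → 0ℚ))          ≤⟨ *-mono (^-≥0 0≤2 (coins order z)) bad≤½ ⟩
      2ℚ ^ coins order z * 1ℚ                                ≡⟨ *-identityʳ (2ℚ ^ coins order z) ⟩
      2ℚ ^ coins order z ∎
      where
      open ≤-Reasoning

-- Size of the parameters and the final estimate of the excess

module Bounds where

  open Machine using (iter)
  open Algorithm
  open Realise using (table≤size)

  open Coins using (module Draws)
  open import Data.Bool.Base using (true; false; if_then_else_)
  open import Data.List.Base using ([]; _∷_)
  open import Data.Nat.Base
  open import Data.Nat.Properties
  open import Data.Nat.Logarithm
  open import Data.Nat.Tactic.RingSolver using (solve-∀)
  open import Data.Product.Base using (∃-syntax; _×_; _,_; proj₁; proj₂)
  open import Data.Sum.Base using (_⊎_; inj₁; inj₂)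
  open import Function.Base using (_∘_)
  open import Relation.Binary.PropositionalEquality

  double : ∀ q → 2 ^ q + 2 ^ q ≡ 2 ^ suc q
  double q = cong (2 ^ q +_) (sym (+-identityʳ (2 ^ q)))

  2^-cancel : ∀ {a b} → 2 ^ a ≤ 2 ^ b → a ≤ b
  2^-cancel {a} {b} le = ≮⇒≥ λ b<a → <⇒≱ (^-monoʳ-< 2 (s≤s (s≤s z≤n)) b<a) le

  module Exact (Z : ℕ) where
    open Truncated Z
    open Draws Z using (n<2^n) public

    ⊕-exact : ∀ {a} b → a ≤ Z → a ⊕ b ≡ a + b
    ⊕-exact b a≤Z = cong (_+ b) (m≤n⇒m⊓n≡m a≤Z)

    log-step : ℕ → ℕ × ℕ → ℕ × ℕ
    log-step x s = if proj₂ s ≺ x then (suc (proj₁ s) , proj₂ s ⊕ proj₂ s) else s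

    -- The second alternative means that the loop never stalled, so its exponent is at least the
    -- number of rounds; after `x` rounds this suffices as x < 2^x. A doubling starts only below
    -- `x`, hence the bound 2x on the powers.
    log-loop : ∀ {x B} → 2 * x ≤ B → B ≤ Z → ∀ j q → 2 ^ q ≤ B →
      ∃[ q′ ] iter j (log-step x) (q , 2 ^ q) ≡ (q′ , 2 ^ q′) × 2 ^ q′ ≤ B × q ≤ q′ × (x ≤ 2 ^ q′ ⊎ j + q ≤ q′)
    log-loop {x} {B} 2x≤B B≤Z zero    q le = q , refl , le , ≤-refl , inj₂ ≤-refl
    log-loop {x} {B} 2x≤B B≤Z (suc j) q le with 2 ^ q ≺ x in eq
    ... | false with log-loop {x} 2x≤B B≤Z j q le
    ...   | q′ , e , le′ , q≤ , _ = q′ , e , le′ , q≤ ,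
      inj₁ (≤-trans (Flow.≺-false Z (≤-trans le B≤Z) eq) (^-monoʳ-≤ 2 q≤))
    log-loop {x} {B} 2x≤B B≤Z (suc j) q le | true
      rewrite ⊕-exact {2 ^ q} (2 ^ q) (≤-trans le B≤Z) | double q
      with log-loop {x} 2x≤B B≤Z j (suc q) (≤-trans (*-monoʳ-≤ 2 (<⇒≤ (Flow.≺-true Z (≤-trans le B≤Z) eq))) 2x≤B)
    ... | q′ , e , le′ , q≤ , large = q′ , e , le′ , ≤-trans (n≤1+n q) q≤ , shift large
      where
      shift : x ≤ 2 ^ q′ ⊎ j + suc q ≤ q′ → x ≤ 2 ^ q′ ⊎ suc j + q ≤ q′
      shift (inj₁ p) = inj₁ p
      shift (inj₂ p) = inj₂ (≤-trans (≤-reflexive (sym (+-suc j q))) p)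

    log-exact : ∀ x → 2 * x ⊔ 1 ≤ Z → ∃[ q ] log x ≡ (q , 2 ^ q) × x ≤ 2 ^ q × 2 ^ q ≤ 2 * x ⊔ 1
    log-exact x le with log-loop {x} (m≤m⊔n (2 * x) 1) le x 0 (m≤n⊔m (2 * x) 1)
    ... | q , e , upper , _ , large = q , trans (cong (λ j → iter j (log-step x) (0 , 1)) (m≤n⇒m⊓n≡m x≤Z)) e , lower large , upper
      where
      x≤Z : x ≤ Z
      x≤Z = ≤-trans (≤-trans (m≤n*m x 2) (m≤m⊔n (2 * x) 1)) le
      lower : x ≤ 2 ^ q ⊎ x + 0 ≤ q → x ≤ 2 ^ q
      lower (inj₁ p) = p
      lower (inj₂ p) = ≤-trans (≤-reflexive (sym (+-identityʳ x))) (≤-trans p (<⇒≤ (n<2^n q)))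

    pow-exact : ∀ q → 2 ^ q ≤ Z → pow q ≡ 2 ^ q
    pow-exact q le = trans (cong (λ j → iter j (λ x → x ⊕ x) 1) (m≤n⇒m⊓n≡m (≤-trans (<⇒≤ (n<2^n q)) le)))
      (trans (go q 0 (≤-trans (≤-reflexive (cong (2 ^_) (+-identityʳ q))) le)) (cong (2 ^_) (+-identityʳ q)))
      where
      go : ∀ j q → 2 ^ (j + q) ≤ Z → iter j (λ x → x ⊕ x) (2 ^ q) ≡ 2 ^ (j + q)
      go zero    q le = refl
      go (suc j) q le = trans (cong (iter j (λ x → x ⊕ x)) (trans (⊕-exact (2 ^ q) (≤-trans (^-monoʳ-≤ 2 (m≤n+m q (suc j))) le)) (double q)))
        (trans (go j (suc q) (≤-trans (≤-reflexive (cong (2 ^_) (+-suc j q))) le)) (cong (2 ^_) (+-suc j q)))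

  -- Bounds by powers of the input size

  module Powers {N : ℕ} (2≤N : 2 ≤ N) where

    1≤N : 1 ≤ N
    1≤N = ≤-trans (s≤s z≤n) 2≤N

    raise : ∀ {x a b} → a ≤ b → x ≤ N ^ a → x ≤ N ^ b
    raise {a = a} {b} a≤b le = ≤-trans le (^-monoʳ-≤ N {{>-nonZero 1≤N}} a≤b)

    prod : ∀ {x y} a b → x ≤ N ^ a → y ≤ N ^ b → x * y ≤ N ^ (a + b)
    prod a b p q = ≤-trans (*-mono-≤ p q) (≤-reflexive (sym (^-distribˡ-+-* N a b)))

    sum : ∀ {x y} a → x ≤ N ^ a → y ≤ N ^ a → x + y ≤ N ^ suc a
    sum a p q = ≤-trans (+-mono-≤ p q) (≤-trans (≤-reflexive (cong (N ^ a +_) (sym (+-identityʳ (N ^ a))))) (*-monoˡ-≤ (N ^ a) 2≤N))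

    one : ∀ a → 1 ≤ N ^ a
    one a = ^-monoʳ-≤ N {{>-nonZero 1≤N}} {0} {a} z≤n

    2^≤ : ∀ a → 2 ^ a ≤ N ^ a
    2^≤ a = ^-monoˡ-≤ a 2≤N

  vertices+edges+commodities≤size : ∀ I → let open Instance I in n + (m + (k + 2)) ≤ size (encodeInstance I)
  vertices+edges+commodities≤size I = ≤-trans (≤-trans
        (+-mono-≤ (table≤size {n} encodeFin) (+-mono-≤
          (table≤size λ e → encodeList (encodeFin (tail e) ∷ encodeFin (head e) ∷ encodeℕ (b e) ∷ []))
          (+-monoˡ-≤ 2 (table≤size λ i → encodeList (encodeFin (s i) ∷ encodeFin (t i) ∷ [])))))
        (m≤m+n _ (size (encodeℕ Δ) + 3)))
      (≤-reflexive (lemma _ _ _ (size (encodeℕ Δ))))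
    where
    open Instance I
    lemma : ∀ a b c d → a + (b + (c + 2)) + (d + 3) ≡ suc (a + suc (b + suc (c + suc (d + 1))))
    lemma = solve-∀

  module Parameters (I : Instance) (N : ℕ) (s₀≤N : Instance.n I + (Instance.m I + (Instance.k I + 2)) ≤ N) where
    open Instance I

    -- The exponent is dictated by `cap`: 2^q ≤ N^14 and T ≤ N^6 give 2^(q + p + 1) ≤ N^21, and
    -- adding the charges costs one more power.
    s₀ Z : ℕ
    s₀ = n + (m + (k + 2))
    Z  = N ^ 22

    open Spec I Z using (Δ′; lg) renaming (p to p̂; q to q̂)
    open Truncated Z
    open Exact Z

    2≤s₀ : 2 ≤ s₀
    2≤s₀ = ≤-trans (m≤n+m 2 k) (≤-trans (m≤n+m (k + 2) m) (m≤n+m (m + (k + 2)) n))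

    open Powers (≤-trans 2≤s₀ s₀≤N) public hiding (1≤N)

    s₀≤N¹ : s₀ ≤ N ^ 1
    s₀≤N¹ = ≤-trans s₀≤N (≤-reflexive (sym (*-identityʳ N)))

    n≤s₀ : n ≤ s₀
    n≤s₀ = m≤m+n n _

    m≤s₀ : m ≤ s₀
    m≤s₀ = ≤-trans (m≤m+n m (k + 2)) (m≤n+m (m + (k + 2)) n)

    k≤s₀ : k ≤ s₀
    k≤s₀ = ≤-trans (m≤m+n k 2) (≤-trans (m≤n+m (k + 2) m) (m≤n+m (m + (k + 2)) n))

    ≤Z : ∀ {x} a → a ≤ 22 → x ≤ N ^ a → x ≤ Z
    ≤Z a = raise

    to-Z : ∀ {x} → x ≤ s₀ → x ≤ Z
    to-Z le = ≤Z 1 (s≤s z≤n) (≤-trans le s₀≤N¹)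

    n≤Z : n ≤ Z
    n≤Z = to-Z n≤s₀

    m≤Z : m ≤ Z
    m≤Z = to-Z m≤s₀

    k≤Z : k ≤ Z
    k≤Z = to-Z k≤s₀

    Δ′≤s₀ : Δ′ ≤ s₀
    Δ′≤s₀ = ≤-trans (m⊓n≤n Δ n) n≤s₀

    Δ′≤Z : Δ′ ≤ Z
    Δ′≤Z = to-Z Δ′≤s₀

    total≡ : n ⊕ (m ⊕ (k ⊕ 2)) ≡ s₀
    total≡ = trans (⊕-exact _ n≤Z) (cong (n +_) (trans (⊕-exact _ m≤Z) (cong (m +_) (⊕-exact 2 k≤Z))))

    2s₀≤ : 2 * s₀ ⊔ 1 ≤ N ^ 2
    2s₀≤ = ⊔-lub (prod 1 1 (2^≤ 1) s₀≤N¹) (one 2)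

    l : ℕ
    l = proj₁ (log-exact s₀ (≤Z 2 (s≤s (s≤s z≤n)) 2s₀≤))

    lg≡ : lg ≡ l
    lg≡ = trans (cong (proj₁ ∘ log) total≡) (cong proj₁ (proj₁ (proj₂ (log-exact s₀ (≤Z 2 (s≤s (s≤s z≤n)) 2s₀≤)))))

    s₀≤2^l : s₀ ≤ 2 ^ l
    s₀≤2^l = proj₁ (proj₂ (proj₂ (log-exact s₀ (≤Z 2 (s≤s (s≤s z≤n)) 2s₀≤))))

    2^l≤2s₀ : 2 ^ l ≤ 2 * s₀
    2^l≤2s₀ = ≤-trans (proj₂ (proj₂ (proj₂ (log-exact s₀ (≤Z 2 (s≤s (s≤s z≤n)) 2s₀≤)))))
      (≤-reflexive (m≥n⇒m⊔n≡m (≤-trans (s≤s z≤n) (≤-trans 2≤s₀ (m≤n*m s₀ 2)))))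

    1≤l : 1 ≤ l
    1≤l = 2^-cancel (≤-trans 2≤s₀ s₀≤2^l)

    2^l≤N² : 2 ^ l ≤ N ^ 2
    2^l≤N² = ≤-trans 2^l≤2s₀ (prod 1 1 (2^≤ 1) s₀≤N¹)

    l≤N² : l ≤ N ^ 2
    l≤N² = ≤-trans (<⇒≤ (n<2^n l)) 2^l≤N²

    l≤Z : l ≤ Z
    l≤Z = ≤Z 2 (s≤s (s≤s z≤n)) l≤N²

    p q₀ T : ℕ
    p = l + (l + l)
    T = 2 ^ p

    p≡ : p̂ ≡ p
    p≡ = trans (cong (λ x → x ⊕ (x ⊕ x)) lg≡) (trans (⊕-exact (l ⊕ l) l≤Z) (cong (l +_) (⊕-exact l l≤Z)))

    T≡ : T ≡ 2 ^ l * (2 ^ l * 2 ^ l)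
    T≡ = trans (^-distribˡ-+-* 2 l (l + l)) (cong (2 ^ l *_) (^-distribˡ-+-* 2 l l))

    T≤N⁶ : T ≤ N ^ 6
    T≤N⁶ = ≤-trans (≤-reflexive T≡) (prod 2 4 2^l≤N² (prod 2 2 2^l≤N² 2^l≤N²))

    T≤Z : T ≤ Z
    T≤Z = ≤Z 6 (s≤s (s≤s (s≤s (s≤s (s≤s (s≤s z≤n)))))) T≤N⁶

    2Δ′l≤ : 2 * (Δ′ * l) ⊔ 1 ≤ N ^ 4
    2Δ′l≤ = ⊔-lub (prod 1 3 (2^≤ 1) (prod 1 2 (≤-trans Δ′≤s₀ s₀≤N¹) l≤N²)) (one 4)

    private
      log-Δ′l = log-exact (Δ′ * l) (≤Z 4 (s≤s (s≤s (s≤s (s≤s z≤n)))) 2Δ′l≤)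

    q₀ = proj₁ log-Δ′l

    -- Abstract, lest `2 ^ (10 + q₀)` unfold into ten doublings.
    abstract
      q : ℕ
      q = 10 + q₀

      2^q : 2 ^ q ≡ 2 ^ 10 * 2 ^ q₀
      2^q = ^-distribˡ-+-* 2 10 q₀

      q≡ : q̂ ≡ q
      q≡ = cong (10 +_) (trans (cong (proj₁ ∘ log) (trans (cong (λ x → (Δ′ ⊓ Z) * (x ⊓ Z)) lg≡) (cong₂ _*_ (m≤n⇒m⊓n≡m Δ′≤Z) (m≤n⇒m⊓n≡m l≤Z))))
        (cong proj₁ (proj₁ (proj₂ log-Δ′l))))

    Δ′l≤2^q₀ : Δ′ * l ≤ 2 ^ q₀
    Δ′l≤2^q₀ = proj₁ (proj₂ (proj₂ log-Δ′l))

    2^q₀≤ : 2 ^ q₀ ≤ 2 * (Δ′ * l) ⊔ 1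
    2^q₀≤ = proj₂ (proj₂ (proj₂ log-Δ′l))

    2^q≤N¹⁴ : 2 ^ q ≤ N ^ 14
    2^q≤N¹⁴ = ≤-trans (≤-reflexive 2^q) (prod 10 4 (2^≤ 10) (≤-trans 2^q₀≤ 2Δ′l≤))

    2^[q+p]≤N²⁰ : 2 ^ (q + p) ≤ N ^ 20
    2^[q+p]≤N²⁰ = ≤-trans (≤-reflexive (^-distribˡ-+-* 2 q p)) (prod 14 6 2^q≤N¹⁴ T≤N⁶)

    cap : 2 ^ suc (q + p) + m * (2 * (k * T)) ≤ Z
    cap = sum 21 (prod 1 20 (2^≤ 1) 2^[q+p]≤N²⁰)
      (raise {a = 9} (≤ᵇ⇒≤ 9 21 _) (prod 1 8 (≤-trans m≤s₀ s₀≤N¹) (prod 1 7 (2^≤ 1) (prod 1 6 (≤-trans k≤s₀ s₀≤N¹) T≤N⁶))))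

    routing-fits : suc Δ′ * suc T ≤ Z
    routing-fits = ≤Z 9 (≤ᵇ⇒≤ 9 22 _) (prod 2 7 (sum 1 (one 1) (≤-trans Δ′≤s₀ s₀≤N¹)) (sum 6 (one 6) T≤N⁶))

    enough-coins : k * (p + (p + suc (q + p))) ≤ Z
    enough-coins = ≤Z 19 (≤ᵇ⇒≤ 19 22 _) (prod 1 18 (≤-trans k≤s₀ s₀≤N¹)
      (sum 17 (raise (≤ᵇ⇒≤ 6 17 _) p≤) (sum 16 (raise (≤ᵇ⇒≤ 6 16 _) p≤) (sum 15 (one 15)
        (sum 14 (≤-trans (<⇒≤ (n<2^n q)) 2^q≤N¹⁴) (raise (≤ᵇ⇒≤ 6 14 _) p≤))))))
      where
      p≤ : p ≤ N ^ 6
      p≤ = ≤-trans (<⇒≤ (n<2^n p)) T≤N⁶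

    -- With T = 2^3l there are at most 2^l T² = 2^7l tests, and a last factor 2^l covers the
    -- doubling in `few`; so K is 8l.
    K′ : ℕ
    K′ = pred (8 * l)

    K≡ : suc K′ ≡ 8 * l
    K≡ = suc-pred (8 * l) {{>-nonZero (≤-trans 1≤l (m≤n*m l 8))}}

    lower : 2 ^ 7 * (Δ′ * suc K′) ≤ 2 ^ q
    lower = begin
      2 ^ 7 * (Δ′ * suc K′)    ≡⟨ cong (λ x → 2 ^ 7 * (Δ′ * x)) K≡ ⟩
      2 ^ 7 * (Δ′ * (8 * l))   ≡⟨ lemma Δ′ l ⟩
      2 ^ 10 * (Δ′ * l)        ≤⟨ *-monoʳ-≤ (2 ^ 10) Δ′l≤2^q₀ ⟩
      2 ^ 10 * 2 ^ q₀          ≡⟨ 2^q ⟨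
      2 ^ q ∎
      where
      open ≤-Reasoning
      lemma : ∀ x y → 128 * (x * (8 * y)) ≡ 1024 * (x * y)
      lemma = solve-∀

    upper : 1 ≤ Δ′ → 2 ^ q ≤ 2 ^ 8 * (Δ′ * suc K′)
    upper 1≤Δ′ = begin
      2 ^ q                        ≡⟨ 2^q ⟩
      2 ^ 10 * 2 ^ q₀              ≤⟨ *-monoʳ-≤ (2 ^ 10) 2^q₀≤ ⟩
      2 ^ 10 * (2 * (Δ′ * l) ⊔ 1)  ≡⟨ cong (2 ^ 10 *_) (m≥n⇒m⊔n≡m (≤-trans (*-mono-≤ 1≤Δ′ 1≤l) (m≤n*m (Δ′ * l) 2))) ⟩
      2 ^ 10 * (2 * (Δ′ * l))      ≡⟨ lemma Δ′ l ⟩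
      2 ^ 8 * (Δ′ * (8 * l))       ≡⟨ cong (λ x → 2 ^ 8 * (Δ′ * x)) K≡ ⟨
      2 ^ 8 * (Δ′ * suc K′) ∎
      where
      open ≤-Reasoning
      lemma : ∀ x y → 1024 * (2 * (x * y)) ≡ 256 * (x * (8 * y))
      lemma = solve-∀

    few : 2 * (k * (T * T) + m) ≤ 2 ^ suc K′
    few = begin
      2 * (k * (T * T) + m)               ≤⟨ *-mono-≤ (^-monoʳ-≤ 2 {1} {l} 1≤l) inner ⟩
      2 ^ l * (2 ^ l * (T * T))           ≡⟨ exponents ⟨
      2 ^ suc K′ ∎
      where
      open ≤-Reasoning
      1≤T : 1 ≤ T
      1≤T = ^-monoʳ-≤ 2 {0} {p} z≤n
      inner : k * (T * T) + m ≤ 2 ^ l * (T * T)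
      inner = begin
        k * (T * T) + m             ≤⟨ +-monoʳ-≤ (k * (T * T)) (≤-trans (≤-reflexive (sym (*-identityʳ m))) (*-monoʳ-≤ m (*-mono-≤ 1≤T 1≤T))) ⟩
        k * (T * T) + m * (T * T)   ≡⟨ *-distribʳ-+ (T * T) k m ⟨
        (k + m) * (T * T)           ≤⟨ *-monoˡ-≤ (T * T) (≤-trans (≤-trans (≤-reflexive (+-comm k m)) (≤-trans (+-monoʳ-≤ m (m≤m+n k 2)) (m≤n+m (m + (k + 2)) n))) s₀≤2^l) ⟩
        2 ^ l * (T * T) ∎
      exponents : 2 ^ suc K′ ≡ 2 ^ l * (2 ^ l * (T * T))
      exponents = trans (cong (2 ^_) (trans K≡ (lemma l)))
        (trans (^-distribˡ-+-* 2 l (l + (p + p))) (cong (2 ^ l *_) (trans (^-distribˡ-+-* 2 l (p + p)) (cong (2 ^ l *_) (^-distribˡ-+-* 2 p p)))))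
        where
        lemma : ∀ l → 8 * l ≡ l + (l + ((l + (l + l)) + (l + (l + l))))
        lemma = solve-∀

    -- `T` is the cube of a power of two that is at least m + k + 2, and this cube contains all
    -- terms of `growth`.
    growth≤T : m * (k + k) + m * (k * k + k * k) ≤ T
    growth≤T = begin
      m * (k + k) + m * (k * k + k * k)            ≤⟨ m≤m+n _ _ ⟩
      m * (k + k) + m * (k * k + k * k) + rest m k ≡⟨ lemma m k ⟩
      y * (y * y)                                  ≤⟨ *-mono-≤ y≤ (*-mono-≤ y≤ y≤) ⟩
      2 ^ l * (2 ^ l * 2 ^ l)                      ≡⟨ T≡ ⟨
      T ∎
      where
      open ≤-Reasoning
      y = m + (k + 2)
      y≤ : y ≤ 2 ^ l
      y≤ = ≤-trans (m≤n+m y n) s₀≤2^l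
      rest : ℕ → ℕ → ℕ
      rest m k = m * m * m + k * k * k + 8 + 3 * (m * m * k) + 6 * (m * m) + m * (k * k) + 6 * (k * k) + 12 * m + 12 * k + 10 * (m * k)
      lemma : ∀ m k → m * (k + k) + m * (k * k + k * k) + (m * m * m + k * k * k + 8 + 3 * (m * m * k) + 6 * (m * m) + m * (k * k) + 6 * (k * k) + 12 * m + 12 * k + 10 * (m * k)) ≡ (m + (k + 2)) * ((m + (k + 2)) * (m + (k + 2)))
      lemma = solve-∀

    4Δ′≤2^q : 4 * Δ′ ≤ 2 ^ q
    4Δ′≤2^q = begin
      4 * Δ′             ≤⟨ *-mono-≤ (≤ᵇ⇒≤ 4 1024 _) (≤-trans (≤-reflexive (sym (*-identityʳ Δ′))) (≤-trans (*-monoʳ-≤ Δ′ 1≤l) Δ′l≤2^q₀)) ⟩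
      2 ^ 10 * 2 ^ q₀    ≡⟨ 2^q ⟨
      2 ^ q ∎
      where open ≤-Reasoning

  √-mono : ∀ {m n} → m ≤ n → ⌊√ m ⌋ ≤ ⌊√ n ⌋
  √-mono {m} {n} m≤n with m≤n⇒∃[o]m+o≡n m≤n
  ... | o , refl = go o
    where
    √-suc : ∀ n → ⌊√ n ⌋ ≤ ⌊√ suc n ⌋
    √-suc n with suc ⌊√ n ⌋ * suc ⌊√ n ⌋ ≤ᵇ suc n
    ... | true  = n≤1+n _
    ... | false = ≤-refl
    go : ∀ o → ⌊√ m ⌋ ≤ ⌊√ m + o ⌋
    go zero    = ≤-reflexive (cong ⌊√_⌋ (sym (+-identityʳ m)))
    go (suc o) = ≤-trans (go o) (≤-trans (√-suc (m + o)) (≤-reflexive (cong ⌊√_⌋ (sym (+-suc m o)))))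

  -- As n ≥ 2, the floor ℓ of its logarithm is at least 1, and n ≤ 2^2ℓ. Multiples of ℓ then absorb
  -- everything: 3 for the constant factor 8, 2 for n, and c + 2d for the polynomial.
  log-poly : ∀ c d {n x l} → 2 ≤ n → x ≤ poly c d n → 2 ^ l ≤ 2 * (n + (x + 2)) → l ≤ (5 + (c + 2 * d)) * ⌊log₂ n ⌋
  log-poly c d {n} {x} {l} 2≤n x≤ le = 2^-cancel (begin
    2 ^ l                              ≤⟨ le ⟩
    2 * (n + (x + 2))                  ≤⟨ *-monoʳ-≤ 2 (+-mono-≤ n≤ (+-mono-≤ x≤′ 2≤)) ⟩
    2 * (P + ((P + P) + P))            ≡⟨ lemma P ⟩
    2 ^ 3 * P                          ≤⟨ *-monoˡ-≤ P (^-monoʳ-≤ 2 (≤-trans (≤-reflexive (sym (*-identityʳ 3))) (*-monoʳ-≤ 3 1≤ℓ))) ⟩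
    2 ^ (3 * ℓ) * 2 ^ (2 * ℓ + (c * ℓ + 2 * d * ℓ)) ≡⟨ ^-distribˡ-+-* 2 (3 * ℓ) _ ⟨
    2 ^ (3 * ℓ + (2 * ℓ + (c * ℓ + 2 * d * ℓ)))     ≡⟨ cong (2 ^_) (lemma′ ℓ c d) ⟩
    2 ^ ((5 + (c + 2 * d)) * ℓ) ∎)
    where
    open ≤-Reasoning
    ℓ = ⌊log₂ n ⌋
    P = 2 ^ (2 * ℓ + (c * ℓ + 2 * d * ℓ))
    lemma : ∀ P → 2 * (P + ((P + P) + P)) ≡ 8 * P
    lemma = solve-∀
    lemma′ : ∀ l c d → 3 * l + (2 * l + (c * l + 2 * d * l)) ≡ (5 + (c + 2 * d)) * l
    lemma′ = solve-∀
    1≤ℓ : 1 ≤ ℓ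
    1≤ℓ = ≤-trans (≤-reflexive (sym (⌊log₂[2^n]⌋≡n 1))) (⌊log₂⌋-mono-≤ 2≤n)
    n≤2ℓ : n ≤ 2 ^ (2 * ℓ)
    n≤2ℓ = ≤-trans (<⇒≤ (≰⇒> λ big → <⇒≱ (n<1+n ℓ) (≤-trans (≤-reflexive (sym (⌊log₂[2^n]⌋≡n (suc ℓ)))) (⌊log₂⌋-mono-≤ big))))
      (^-monoʳ-≤ 2 (≤-trans (+-monoˡ-≤ ℓ 1≤ℓ) (≤-reflexive (cong (ℓ +_) (sym (+-identityʳ ℓ))))))
    n≤ : n ≤ P
    n≤ = ≤-trans n≤2ℓ (^-monoʳ-≤ 2 (m≤m+n (2 * ℓ) _))
    2≤ : 2 ≤ P
    2≤ = ≤-trans 2≤n n≤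
    c≤ : c ≤ 2 ^ (c * ℓ)
    c≤ = ≤-trans (<⇒≤ (Exact.n<2^n 0 c)) (^-monoʳ-≤ 2 (≤-trans (≤-reflexive (sym (*-identityʳ c))) (*-monoʳ-≤ c 1≤ℓ)))
    n^d≤ : n ^ d ≤ 2 ^ (2 * d * ℓ)
    n^d≤ = ≤-trans (^-monoˡ-≤ d n≤2ℓ) (≤-reflexive (trans (^-*-assoc 2 (2 * ℓ) d) (cong (2 ^_) (lemma″ ℓ d))))
      where
      lemma″ : ∀ l d → 2 * l * d ≡ 2 * d * l
      lemma″ = solve-∀
    x≤′ : x ≤ P + P
    x≤′ = ≤-trans x≤ (+-mono-≤
      (≤-trans (*-mono-≤ c≤ n^d≤) (≤-trans (≤-reflexive (sym (^-distribˡ-+-* 2 (c * ℓ) (2 * d * ℓ)))) (^-monoʳ-≤ 2 (m≤n+m _ (2 * ℓ)))))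
      (≤-trans c≤ (^-monoʳ-≤ 2 (≤-trans (m≤m+n (c * ℓ) _) (m≤n+m _ (2 * ℓ))))))

  -- The leading `suc` is the unit lost by the fractional solution; it turns 2^7 · 8 = 1024 into
  -- 1025. The factor 2 in 2050 comes from r + 1 ≤ 2√Δ.
  excess-bound : ∀ C l ℓ r √Δ √b → l ≤ C * ℓ → 1 ≤ C → 1 ≤ ℓ → r ≤ √Δ → r ≤ √b → 1 ≤ √Δ →
    suc (2 ^ 7 * (8 * l * suc r)) ≤ (2050 * C * (√Δ * ℓ)) ⊓ (2050 * C * (√b * ℓ + ℓ ^ 2))
  excess-bound C l ℓ r √Δ √b l≤ 1≤C 1≤ℓ r≤Δ r≤b 1≤Δ = ⊓-glb
    (begin
      suc (2 ^ 7 * (8 * l * suc r))   ≤⟨ main ⟩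
      1025 * (C * ℓ * suc r)          ≤⟨ *-monoʳ-≤ 1025 (*-monoʳ-≤ (C * ℓ) (+-mono-≤ 1≤Δ r≤Δ)) ⟩
      1025 * (C * ℓ * (√Δ + √Δ))      ≡⟨ lemma₁ C ℓ √Δ ⟩
      2050 * C * (√Δ * ℓ)             ∎)
    (begin
      suc (2 ^ 7 * (8 * l * suc r))   ≤⟨ main ⟩
      1025 * (C * ℓ * suc r)          ≤⟨ *-monoʳ-≤ 1025 (*-monoʳ-≤ (C * ℓ) (s≤s r≤b)) ⟩
      1025 * (C * ℓ * suc √b)         ≡⟨ lemma₂ C ℓ √b ⟩
      1025 * C * (√b * ℓ + ℓ * 1)     ≤⟨ *-mono-≤ (*-monoˡ-≤ C (≤ᵇ⇒≤ 1025 2050 _)) (+-monoʳ-≤ (√b * ℓ) (*-monoʳ-≤ ℓ (≤-trans 1≤ℓ (≤-reflexive (sym (*-identityʳ ℓ)))))) ⟩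
      2050 * C * (√b * ℓ + ℓ ^ 2)     ∎)
    where
    open ≤-Reasoning
    lemma₀ : ∀ c l r → c * l * r + 128 * (8 * (c * l) * r) ≡ 1025 * (c * l * r)
    lemma₀ = solve-∀
    lemma₁ : ∀ c l s → 1025 * (c * l * (s + s)) ≡ 2050 * c * (s * l)
    lemma₁ = solve-∀
    lemma₂ : ∀ c l s → 1025 * (c * l * suc s) ≡ 1025 * c * (s * l + l * 1)
    lemma₂ = solve-∀
    main : suc (2 ^ 7 * (8 * l * suc r)) ≤ 1025 * (C * ℓ * suc r)
    main = ≤-trans
      (+-mono-≤ (*-mono-≤ (*-mono-≤ 1≤C 1≤ℓ) (s≤s (z≤n {r}))) (*-monoʳ-≤ (2 ^ 7) (*-monoˡ-≤ (suc r) (*-monoʳ-≤ 8 l≤))))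
      (≤-reflexive (lemma₀ C ℓ (suc r)))

-- Success probability and assembly of the algorithm

module Final where

  open Machine using (Prog; program; program-correct; totalTime; totalTime-bounded; coins≤totalTime; result)
  open Algorithm
  open Realise using (Implements; realisation)

  open Flow using (module Approachability)
  open Rat
  open Rounding using (select)
  open Coins


  open Bounds
  open import Data.Bool.Base using (Bool; true; false)
  open import Data.List.Base using (List; []; _∷_; map; length; allFin; filter; take; reverse; _++_)
  open import Data.List.Properties using (length-map; take-all)
  open import Data.List.Relation.Unary.All using (All; []; _∷_)
  import Data.List.Relation.Unary.All as All
  open import Data.List.Relation.Unary.All.Properties using (all-filter)
  open import Data.List.Relation.Unary.AllPairs using ([]; _∷_)
  open import Data.List.Membership.Propositional using (_∈_)
  open import Data.List.Membership.Propositional.Properties using (∈-map⁻)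
  open import Data.List.Relation.Unary.Unique.Propositional using (Unique)
  import Data.List.Relation.Unary.Unique.Propositional.Properties as Unique
  open import Data.Nat.Base as ℕ using (ℕ; zero; suc)
  import Data.Nat.Properties as ℕ
  open import Data.Nat.Logarithm using (⌊log₂_⌋; ⌊log₂⌋-mono-≤; ⌊log₂[2^n]⌋≡n)
  open import Data.Nat.Tactic.RingSolver using () renaming (solve-∀ to solveℕ)
  open import Data.Product.Base using (∃-syntax; _×_; _,_; proj₁; proj₂)
  open import Data.Rational.Base using (0ℚ; 1ℚ; _+_; _*_; _-_; -_; _≤_)
  open import Data.Rational.Properties
  open import Data.Vec.Base using (Vec; []; _∷_; toList)
  open import Data.Vec.Properties using (length-toList; ∷-injective)
  open import Function.Base using (_∘_)
  open import Relation.Binary.PropositionalEquality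
  open import Relation.Nullary.Decidable.Core using (Dec; yes; no; _×-dec_)
  open import Relation.Nullary.Negation using (¬_)
  open import Tactic.RingSolver using (solve-∀)

  allVecs : ∀ n → List (Vec Bool n)
  allVecs zero    = [] ∷ []
  allVecs (suc n) = map (true ∷_) (allVecs n) ++ map (false ∷_) (allVecs n)

  allVecs-unique : ∀ n → Unique (allVecs n)
  allVecs-unique zero    = [] ∷ []
  allVecs-unique (suc n) = Unique.++⁺
    (Unique.map⁺ (proj₂ ∘ ∷-injective) (allVecs-unique n))
    (Unique.map⁺ (proj₂ ∘ ∷-injective) (allVecs-unique n))
    λ { (p , q) → disjoint (∈-map⁻ (true ∷_) p) (∈-map⁻ (false ∷_) q) }
    where
    disjoint : ∀ {v : Vec Bool (suc n)} → (∃[ x ] x ∈ allVecs n × v ≡ true ∷ x) → ¬ (∃[ x ] x ∈ allVecs n × v ≡ false ∷ x)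
    disjoint (_ , _ , refl) (_ , _ , ())

  ∑-allVecs : ∀ n f → ∑ (allVecs n) (f ∘ toList) ≡ ∑ᶜ n f
  ∑-allVecs zero    f = +-identityʳ (f [])
  ∑-allVecs (suc n) f = trans (Rounding.∑-++ (map (true ∷_) (allVecs n)) (map (false ∷_) (allVecs n)) (f ∘ toList))
    (cong₂ _+_ (trans (∑-map (true ∷_) (allVecs n) (f ∘ toList)) (∑-allVecs n (f ∘ (true ∷_))))
               (trans (∑-map (false ∷_) (allVecs n) (f ∘ toList)) (∑-allVecs n (f ∘ (false ∷_)))))

  module _ {B : ℕ} {G : Coins → Set} (G? : ∀ l → Dec (G l)) where

    successes : List (Vec Bool B) → List (Vec Bool B)
    successes = filter (λ ω → G? (toList ω))

    count-successes : ∀ vs → ι (length (successes vs)) + ∑ vs (λ ω → select (G? (toList ω)) 0ℚ 1ℚ) ≡ ι (length vs)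
    count-successes []       = refl
    count-successes (ω ∷ vs) with G? (toList ω)
    ... | yes _ = trans (lemma (ι (length (successes vs))) _) (cong (1ℚ +_) (count-successes vs))
      where
      lemma : ∀ a b → (1ℚ + a) + (0ℚ + b) ≡ 1ℚ + (a + b)
      lemma = solve-∀ ring
    ... | no _  = trans (lemma (ι (length (successes vs))) _) (cong (1ℚ +_) (count-successes vs))
      where
      lemma : ∀ a b → a + (1ℚ + b) ≡ 1ℚ + (a + b)
      lemma = solve-∀ ring

    atLeastHalf : 2ℚ * ∑ᶜ B (λ l → select (G? l) 0ℚ 1ℚ) ≤ 2ℚ ^ B → AtLeastHalf B (λ ω → G (toList ω))
    atLeastHalf le = successes (allVecs B) , Unique.filter⁺ (λ ω → G? (toList ω)) (allVecs-unique B) ,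
      all-filter (λ ω → G? (toList ω)) (allVecs B) , ι-cancel (begin
        ι (2 ℕ.^ B)                           ≡⟨ Sampler.ι2^ B ⟩
        2ℚ ^ B                                ≡⟨ lemma (2ℚ ^ B) ⟩
        2ℚ * 2ℚ ^ B - 2ℚ ^ B                  ≤⟨ +-monoʳ-≤ (2ℚ * 2ℚ ^ B) (neg-antimono-≤ le) ⟩
        2ℚ * 2ℚ ^ B - 2ℚ * bad                ≡⟨ cong (λ s → 2ℚ * s - 2ℚ * bad) (sym total) ⟩
        2ℚ * (ι good + bad) - 2ℚ * bad        ≡⟨ lemma′ (ι good) bad ⟩
        2ℚ * ι good                           ≡⟨ ι-* 2 good ⟨
        ι (2 ℕ.* good) ∎)
      where
      open ≤-Reasoning
      bad = ∑ᶜ B (λ l → select (G? l) 0ℚ 1ℚ)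
      good = length (successes (allVecs B))
      lemma : ∀ x → x ≡ 2ℚ * x - x
      lemma = solve-∀ ring
      lemma′ : ∀ a b → 2ℚ * (a + b) - 2ℚ * b ≡ 2ℚ * a
      lemma′ = solve-∀ ring
      size-all : ι (length (allVecs B)) ≡ 2ℚ ^ B
      size-all = trans (sym (trans (∑-const (allVecs B) 1ℚ) (*-identityʳ _)))
        (trans (∑-allVecs B (λ _ → 1ℚ)) (trans (∑ᶜ-const B 1ℚ) (*-identityʳ (2ℚ ^ B))))
      total : ι good + bad ≡ 2ℚ ^ B
      total = trans (cong (ι good +_) (sym (∑-allVecs B (λ l → select (G? l) 0ℚ 1ℚ)))) (trans (count-successes (allVecs B)) size-all)

  AtLeastHalf-map : ∀ {B} {P Q : Vec Bool B → Set} → (∀ ω → P ω → Q ω) → AtLeastHalf B P → AtLeastHalf B Q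
  AtLeastHalf-map imp (ωs , unique , all , large) = ωs , unique , All.map (imp _) all , large

  GoodRouting : (I : Instance) → ℕ → ℕ → Instance.Routing I → Set
  GoodRouting I C₁ C₂ P = IsShortRouting P × (∀ e → load P e ℕ.≤ b e ℕ.+ excess C₁ C₂ e)
    where open Instance I

  module Success (c d : ℕ) (I : Instance) (N : ℕ) (s₀≤N : Instance.n I ℕ.+ (Instance.m I ℕ.+ (Instance.k I ℕ.+ 2)) ℕ.≤ N)
      (k+m≤ : Instance.k I ℕ.+ Instance.m I ℕ.≤ poly c d (Instance.n I)) (feasible : Instance.Feasible I)
      {C₀ C : ℕ} (C₀≡ : C₀ ≡ 5 ℕ.+ (c ℕ.+ 2 ℕ.* d)) (C≡ : C ≡ 2050 ℕ.* C₀) where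

    open Instance I using (n; m; k; b; s; t; Δ; Routing; load; IsPath; IsShortRouting; excess) renaming (E to Edge)
    open Parameters I N s₀≤N
    open Spec I Z using (Δ′; b′; sample; parameters; solution; rounds; Sampling)
    open Truncated Z

    Rs : List Routing
    Rs = rounds T

    private
      flow-facts = Approachability.rounds-correct I Z growth≤T n≤Z k≤Z T≤Z routing-fits
        (proj₁ (proj₂ feasible)) (proj₂ (proj₂ feasible))

    good : All (Approachability.Good I Z) Rs
    good = proj₁ flow-facts

    len : length Rs ≡ T
    len = proj₁ (proj₂ flow-facts)

    spread : ∀ e → Flow.∑ Rs (λ R → Flow.flow I R e) ℕ.≤ T ℕ.* suc (b′ e)
    spread = proj₂ (proj₂ flow-facts)

    4L≤c : Rounding.4ℚ * ι Δ′ ≤ ι (2 ℕ.^ q)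
    4L≤c = ≤-trans (≤-reflexive (sym (ι-* 4 Δ′))) (ι-mono 4Δ′≤2^q)

    -- Serves for the facts that hold for every coin string, also when Δ′ = 0 and `upper` fails;
    -- they do not involve the allowances, which are set to zero.
    design : Sampler.Design I Z
    design = record { p = p ; q = q ; Rs = Rs ; A = λ _ → 0 ; len = len ; good = good ; Δ′≤Z = Δ′≤Z ; cap = cap ; 4L≤c = 4L≤c }

    sampler : Sampling
    sampler = record { p = p ; R = suc (q ℕ.+ p) ; T = T ; M = 2 ℕ.^ (q ℕ.+ p) ; Rs = Rs }

    parameters≡ : parameters ≡ sampler
    parameters≡ = trans (cong₂ make p≡ q≡) (trans
      (cong (λ x → record { p = p ; R = suc x ; T = pow p ; M = pow x ; Rs = rounds (pow p) }) q⊕p≡)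
      (cong₂ (λ x y → record { p = p ; R = suc (q ℕ.+ p) ; T = x ; M = y ; Rs = rounds x }) (pow-exact p T≤Z) (pow-exact (q ℕ.+ p) M≤Z)))
      where
      open Exact Z
      make : ℕ → ℕ → Sampling
      make p q = record { p = p ; R = suc (q ⊕ p) ; T = pow p ; M = pow (q ⊕ p) ; Rs = rounds (pow p) }
      M≤Z : 2 ℕ.^ (q ℕ.+ p) ℕ.≤ Z
      M≤Z = ℕ.≤-trans (ℕ.^-monoʳ-≤ 2 (ℕ.n≤1+n (q ℕ.+ p))) (ℕ.≤-trans (ℕ.m≤m+n _ _) cap)
      q⊕p≡ : q ⊕ p ≡ q ℕ.+ p
      q⊕p≡ = ⊕-exact p (ℕ.≤-trans (ℕ.≤-trans (ℕ.<⇒≤ (n<2^n q)) (ℕ.^-monoʳ-≤ 2 (ℕ.m≤m+n q p))) M≤Z)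

    sample-good : ∀ ω i → IsPath (s i) (sample sampler ω i) (t i) × length (sample sampler ω i) ℕ.≤ Δ′
    sample-good = Sampler.Sampler.sample-good design

    solution≡ : ∀ ω i → solution ω i ≡ sample sampler ω i
    solution≡ ω i = trans (cong (λ S → take Z (sample S ω i)) parameters≡)
      (take-all Z _ (ℕ.≤-trans (proj₂ (sample-good ω i)) Δ′≤Z))

    short : ∀ ω → IsShortRouting (solution ω)
    short ω i = subst (λ es → IsPath (s i) es (t i) × length es ℕ.≤ Δ) (sym (solution≡ ω i))
      (proj₁ (sample-good ω i) , ℕ.≤-trans (proj₂ (sample-good ω i)) (ℕ.m⊓n≤m Δ n))

    load-solution : ∀ ω e → load (solution ω) e ≡ load (sample sampler ω) e
    load-solution ω e = trans (Flow.load≡flow I (solution ω) e) (trans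
      (Flow.∑-cong (allFin k) λ i → cong (λ es → Flow.ind (e Flow.∈ᵇ es)) (solution≡ ω i))
      (sym (Flow.load≡flow I (sample sampler ω) e)))

    unloaded : ∀ P → (∀ i → P i ≡ []) → ∀ e → load P e ≡ 0
    unloaded P empty e = trans (Flow.load≡flow I P e)
      (trans (Flow.∑-cong (allFin k) λ i → cong (λ es → Flow.ind (e Flow.∈ᵇ es)) (empty i)) (Flow.∑-0 (allFin k)))

    -- With no edges to use, or no second vertex, all paths are trivial.
    degenerate : ¬ (2 ℕ.≤ n × 1 ℕ.≤ Δ) → ∀ ω → GoodRouting I C C (solution ω)
    degenerate ¬both ω = short ω , λ e → ℕ.≤-trans (ℕ.≤-reflexive (unloaded (solution ω) empty e)) ℕ.z≤n
      where
      no-edges : ∀ {es : List Edge} → length es ℕ.≤ 0 → es ≡ []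
      no-edges {[]} _ = refl
      empty : ∀ i → solution ω i ≡ []
      empty i = no-edges (case (2 ℕ.≤? n))
        where
        case : Dec (2 ℕ.≤ n) → length (solution ω i) ℕ.≤ 0
        case (yes 2≤n) = ℕ.≤-trans (proj₂ (short ω i)) (ℕ.≮⇒≥ λ 1≤Δ → ¬both (2≤n , 1≤Δ))
        -- A simple path visits one vertex more than it has edges.
        case (no  n<2) = ℕ.s≤s⁻¹ (ℕ.≤-trans
          (ℕ.≤-trans (ℕ.≤-reflexive (cong suc (sym (length-map (Instance.head I) (solution ω i))))) (Flow.unique-length (proj₂ (proj₁ (short ω i)))))
          (ℕ.s≤s⁻¹ (ℕ.≰⇒> n<2)))

    module Proper (2≤n : 2 ℕ.≤ n) (1≤Δ : 1 ℕ.≤ Δ) where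

      1≤Δ′ : 1 ℕ.≤ Δ′
      1≤Δ′ = ℕ.⊓-glb 1≤Δ (ℕ.≤-trans (ℕ.s≤s ℕ.z≤n) 2≤n)

      regimen : Tail.Regimen I Z
      regimen = record
        { p = p ; q = q ; K′ = K′ ; Rs = Rs ; len = len ; good = good ; Δ′≤Z = Δ′≤Z ; k≤Z = k≤Z ; cap = cap
        ; spread = spread ; lower = lower ; upper = upper 1≤Δ′ ; few = few }

      open Tail.Tail regimen using (A; root; failures≤½)
      open Sampler.Sampler (Tail.Tail.design regimen) using (final; failure; taken; expected; within?; order; length-order; coins; load-bound)

      Q : ℕ
      Q = p ℕ.+ (p ℕ.+ suc (q ℕ.+ p))

      coins≡ : ∀ is z → coins is z ≡ length is ℕ.* Q ℕ.+ z
      coins≡ []       z = refl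
      coins≡ (i ∷ is) z = trans (cong (λ x → p ℕ.+ (p ℕ.+ (suc (q ℕ.+ p) ℕ.+ x))) (coins≡ is z)) (lemma p (suc (q ℕ.+ p)) (length is ℕ.* Q) z)
        where
        lemma : ∀ p r x z → p ℕ.+ (p ℕ.+ (r ℕ.+ (x ℕ.+ z))) ≡ (p ℕ.+ (p ℕ.+ r)) ℕ.+ x ℕ.+ z
        lemma = solveℕ

      -- The sampler consumes `k * Q` coins, and the rest of the `Z` tosses is averaged out.
      coins-Z : coins order (Z ℕ.∸ k ℕ.* Q) ≡ Z
      coins-Z = trans (coins≡ order (Z ℕ.∸ k ℕ.* Q)) (trans (cong (λ j → j ℕ.* Q ℕ.+ (Z ℕ.∸ k ℕ.* Q)) length-order) (ℕ.m+[n∸m]≡n enough-coins))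

      half : 2ℚ * ∑ᶜ Z (λ ω → failure (final ω)) ≤ 2ℚ ^ Z
      half = subst (λ z → 2ℚ * ∑ᶜ z (λ ω → failure (final ω)) ≤ 2ℚ ^ z) coins-Z (failures≤½ (Z ℕ.∸ k ℕ.* Q))

      -- `reverse (take Z l)` is the list of coins that the compiled program hands over when the
      -- tape is `l`.
      Success : Coins → Set
      Success l = ∀ e → taken (final (reverse (take Z l))) e ℕ.≤ expected (final (reverse (take Z l))) e ℕ.+ T ℕ.* A e

      success? : ∀ l → Dec (Success l)
      success? l = within? (taken (final (reverse (take Z l)))) (expected (final (reverse (take Z l))))

      half-B : ∀ y → 2ℚ * ∑ᶜ (Z ℕ.+ y) (λ l → failure (final (reverse (take Z l)))) ≤ 2ℚ ^ (Z ℕ.+ y)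
      half-B y = begin
        2ℚ * ∑ᶜ (Z ℕ.+ y) (λ l → failure (final (reverse (take Z l))))
          ≡⟨ cong (2ℚ *_) (∑ᶜ-take Z y (λ l → failure (final (reverse l)))) ⟩
        2ℚ * (2ℚ ^ y * ∑ᶜ Z (λ l → failure (final (reverse l))))
          ≡⟨ cong (λ s → 2ℚ * (2ℚ ^ y * s)) (∑ᶜ-reverse Z (λ l → failure (final l))) ⟩
        2ℚ * (2ℚ ^ y * ∑ᶜ Z (λ l → failure (final l)))
          ≡⟨ lemma (2ℚ ^ y) (∑ᶜ Z (λ l → failure (final l))) ⟩
        2ℚ ^ y * (2ℚ * ∑ᶜ Z (λ l → failure (final l)))
          ≤⟨ *-mono (^-≥0 0≤2 y) half ⟩
        2ℚ ^ y * 2ℚ ^ Z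
          ≡⟨ trans (*-comm (2ℚ ^ y) (2ℚ ^ Z)) (sym (^-+ 2ℚ Z y)) ⟩
        2ℚ ^ (Z ℕ.+ y) ∎
        where
        open ≤-Reasoning
        lemma : ∀ a b → 2ℚ * (a * b) ≡ a * (2ℚ * b)
        lemma = solve-∀ ring

      logarithm : l ℕ.≤ C₀ ℕ.* ⌊log₂ n ⌋
      logarithm = subst (λ x → l ℕ.≤ x ℕ.* ⌊log₂ n ⌋) (sym C₀≡)
        (log-poly c d {n} {k ℕ.+ m} 2≤n k+m≤ (ℕ.≤-trans 2^l≤2s₀ (ℕ.≤-reflexive (cong (2 ℕ.*_) (lemma n m k)))))
        where
        lemma : ∀ n m k → n ℕ.+ (m ℕ.+ (k ℕ.+ 2)) ≡ n ℕ.+ ((k ℕ.+ m) ℕ.+ 2)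
        lemma = solveℕ

      allowance : ∀ e → suc (A e) ℕ.≤ excess C C e
      allowance e = allow K≡ C≡ (excess-bound C₀ l ⌊log₂ n ⌋ (root e) ⌊√ Δ ⌋ ⌊√ b e ⌋ logarithm
          (subst (1 ℕ.≤_) (sym C₀≡) (ℕ.s≤s ℕ.z≤n))
          (ℕ.≤-trans (ℕ.≤-reflexive (sym (⌊log₂[2^n]⌋≡n 1))) (⌊log₂⌋-mono-≤ 2≤n))
          (√-mono (ℕ.≤-trans (ℕ.m⊓n≤n (b′ e) Δ′) (ℕ.m⊓n≤m Δ n)))
          (√-mono (ℕ.≤-trans (ℕ.m⊓n≤m (b′ e) Δ′) (ℕ.m⊓n≤m (b e) k)))
          (√-mono {1} 1≤Δ))
        where
        allow : ∀ {K L C C′ r x y} → K ≡ L → C ≡ C′ → suc (2 ℕ.^ 7 ℕ.* (L ℕ.* r)) ℕ.≤ (C′ ℕ.* x) ℕ.⊓ (C′ ℕ.* y) →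
                suc (2 ℕ.^ 7 ℕ.* (K ℕ.* r)) ℕ.≤ (C ℕ.* x) ℕ.⊓ (C ℕ.* y)
        allow refl refl le = le

      success-good : ∀ l → Success l → GoodRouting I C C (solution (reverse (take Z l)))
      success-good l succ = short ω , λ e → begin
        load (solution ω) e           ≡⟨ load-solution ω e ⟩
        load (sample sampler ω) e     ≤⟨ load-bound spread ω succ e ⟩
        suc (b′ e) ℕ.+ A e            ≡⟨ ℕ.+-suc (b′ e) (A e) ⟨
        b′ e ℕ.+ suc (A e)            ≤⟨ ℕ.+-mono-≤ (ℕ.m⊓n≤m (b e) k) (allowance e) ⟩
        b e ℕ.+ excess C C e ∎
        where
        open ℕ.≤-Reasoning
        ω = reverse (take Z l)

      often-good : ∀ B → Z ℕ.≤ B → AtLeastHalf B (λ ω → GoodRouting I C C (solution (reverse (take Z (toList ω)))))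
      often-good B Z≤B = AtLeastHalf-map (λ ω → success-good (toList ω))
        (atLeastHalf success? (subst (λ B → 2ℚ * ∑ᶜ B (λ l → failure (final (reverse (take Z l)))) ≤ 2ℚ ^ B) (ℕ.m+[n∸m]≡n Z≤B) (half-B (B ℕ.∸ Z))))

    success : ∀ B → Z ℕ.≤ B → AtLeastHalf B (λ ω → GoodRouting I C C (solution (reverse (take Z (toList ω)))))
    success B Z≤B = case ((2 ℕ.≤? n) ×-dec (1 ℕ.≤? Δ))
      where
      open import Data.Unit.Base using (⊤; tt)
      case : Dec (2 ℕ.≤ n × 1 ℕ.≤ Δ) → AtLeastHalf B (λ ω → GoodRouting I C C (solution (reverse (take Z (toList ω)))))
      case (yes (2≤n , 1≤Δ)) = Proper.often-good 2≤n 1≤Δ B Z≤B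
      case (no ¬both) = AtLeastHalf-map (λ ω _ → degenerate ¬both (reverse (take Z (toList ω))))
        (atLeastHalf {G = λ _ → ⊤} (λ _ → yes tt) (≤-trans (≤-reflexive (trans (cong (2ℚ *_) (trans (∑ᶜ-const B 0ℚ) (*-zeroʳ (2ℚ ^ B)))) (*-zeroʳ 2ℚ))) (^-≥0 0≤2 B)))

  1≤size : ∀ x → 1 ℕ.≤ size x
  1≤size leaf       = ℕ.≤-refl
  1≤size (node _ _) = ℕ.s≤s ℕ.z≤n

  -- The exponent and the program are kept variable to prevent their unfolding.
  module Assembly {D : ℕ} (D≡22 : D ≡ 22) {main : Prog} (implements : Implements Spec.solution main) (c d : ℕ) {C : ℕ} (C≡ : C ≡ 2050 ℕ.* (5 ℕ.+ (c ℕ.+ 2 ℕ.* d))) where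

    abstract
      c′ d′ : ℕ
      c′ = proj₁ (totalTime-bounded D main)
      d′ = proj₁ (proj₂ (totalTime-bounded D main))

      totalTime≤ : ∀ {x} → 1 ℕ.≤ x → totalTime D main x ℕ.≤ poly c′ d′ x
      totalTime≤ 1≤x = ℕ.≤-trans (proj₂ (proj₂ (totalTime-bounded D main)) _ 1≤x) (ℕ.m≤m+n _ c′)

    time : ℕ → ℕ
    time = poly c′ d′

    outputs : ∀ x (ω : Vec Bool (time (size x))) → Outputs (program D main) x (toList ω) (time (size x)) (result D main x (toList ω))
    outputs x ω = program-correct D main x (toList ω) (totalTime≤ (1≤size x)) (ℕ.≤-reflexive (sym (length-toList ω)))

    fits : ∀ N → 1 ℕ.≤ N → N ℕ.≤ N ℕ.^ D
    fits N 1≤N = ℕ.≤-trans (ℕ.≤-reflexive (sym (ℕ.*-identityʳ N)))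
      (ℕ.^-monoʳ-≤ N {{ℕ.>-nonZero 1≤N}} {1} (ℕ.≤-trans (ℕ.s≤s ℕ.z≤n) (ℕ.≤-reflexive (sym D≡22))))

    result≡ : ∀ I ω → result D main (encodeInstance I) ω ≡
      encodeRouting I (Spec.solution I (size (encodeInstance I) ℕ.^ D) (reverse (take (size (encodeInstance I) ℕ.^ D) ω)))
    result≡ I ω = implements I (size (encodeInstance I) ℕ.^ D) (reverse (take (size (encodeInstance I) ℕ.^ D) ω)) (fits _ (1≤size (encodeInstance I)))

    success : ∀ I N → Instance.n I ℕ.+ (Instance.m I ℕ.+ (Instance.k I ℕ.+ 2)) ℕ.≤ N →
      Instance.k I ℕ.+ Instance.m I ℕ.≤ poly c d (Instance.n I) → Instance.Feasible I → ∀ B → N ℕ.^ D ℕ.≤ B →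
      AtLeastHalf B (λ ω → GoodRouting I C C (Spec.solution I (N ℕ.^ D) (reverse (take (N ℕ.^ D) (toList ω)))))
    success I N s₀≤N k+m≤ feasible = subst
      (λ D → ∀ B → N ℕ.^ D ℕ.≤ B → AtLeastHalf B (λ ω → GoodRouting I C C (Spec.solution I (N ℕ.^ D) (reverse (take (N ℕ.^ D) (toList ω))))))
      (sym D≡22) (Success.success c d I N s₀≤N k+m≤ feasible refl C≡)

    algorithm : Program
    algorithm = program D main

    runsInTime : RunsInTime algorithm time
    runsInTime x ω = _ , outputs x ω

    reliable : (I : Instance) → let open Instance I in
      k ℕ.+ m ℕ.≤ poly c d n → Feasible →
      AtLeastHalf (time (size (encodeInstance I))) λ ω →
        ∃[ y ] Outputs algorithm (encodeInstance I) (toList ω) (time (size (encodeInstance I))) y × IsGoodOutput I C C y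
    reliable I k+m≤ feasible = AtLeastHalf-map
      (λ ω good → _ , outputs (encodeInstance I) ω , _ , result≡ I (toList ω) , good)
      (success I (size (encodeInstance I)) (vertices+edges+commodities≤size I) k+m≤ feasible _
        (ℕ.≤-trans (coins≤totalTime D main (size (encodeInstance I))) (totalTime≤ (1≤size (encodeInstance I)))))

  abstract
    constant : ℕ → ℕ → ℕ
    constant c d = 2050 ℕ.* (5 ℕ.+ (c ℕ.+ 2 ℕ.* d))

    constant≡ : ∀ c d → constant c d ≡ 2050 ℕ.* (5 ℕ.+ (c ℕ.+ 2 ℕ.* d))
    constant≡ c d = refl

  module Randomized (c d : ℕ) = Assembly refl {proj₁ realisation} (proj₂ realisation) c d (constant≡ c d)

open import Data.Nat.Base using (ℕ; _+_; _≤_)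
open import Data.Product.Base using (Σ-syntax; ∃-syntax; _×_; _,_)
open import Data.Vec.Base using (toList)

corollary2 :
  (c d : ℕ) →
  Σ[ A ∈ Program ] ∃[ c′ ] ∃[ d′ ] ∃[ C₁ ] ∃[ C₂ ]
    ( RunsInTime A (poly c′ d′)
    × ( (I : Instance) → let open Instance I in
        k + m ≤ poly c d n →
        Feasible →
        let x = encodeInstance I
            B = poly c′ d′ (size x)
        in  AtLeastHalf B (λ ω →
              ∃[ y ] Outputs A x (toList ω) B y × IsGoodOutput I C₁ C₂ y) ) )
corollary2 c d = algorithm , c′ , d′ , Final.constant c d , Final.constant c d , runsInTime , reliable
  where open Final.Randomized c d
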